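{- Let $S$ be a cut-free net that is atomically testable by a sequent $A_1,\dots,A_n$. Then $S\vdash_{\mathsf{MLL}^\maltese}A_1,\dots,A_n$ if and only if $S$ is orthogonal to $\mathsf{tests}(A_1)\parallel\cdots\parallel\mathsf{tests}(A_n)$.
   Context: **Nets.** Fix a countable set of positions. A hypergraph has a finite set $V$ of positions and a finite set $E$ of labelled links; each link has a source and a target, which are finite sequences of pairwise distinct positions, the source and the target being disjoint. The only links used are: tensor links $\langle p_1,p_2\rhd_\otimes p\rangle$ and par links $\langle p_1,p_2\rhd_\wp p\rangle$ (two inputs, one output), cut links $\langle p_1,p_2\rhd_{\mathsf{cut}}\rangle$ (two inputs, no output), and daimon links $\langle\rhd_\maltese p_1,\dots,p_n\rangle$, $n\ge 0$ (no input). ($\wp$ denotes the par connective.) The sum $H_1+H_2$ takes the union of positions and the disjoint union of links. A conclusion is a position that is in the source of no link. A (multiplicative) net $S$ is a finite sum of such links in which every position is in the target of exactly one link and in the source of at most one link, together with a total order on its conclusions; $S(i)$ is the $i$-th conclusion and $\#S$ the number of conclusions. A net is cut-free if it has no cut link. Nets are considered up to isomorphism. $S\parallel T$ is the disjoint union (after renaming positions), with the conclusions of $S$ ordered before those of $T$. $\maltese_n$ is the net made of one daimon link with $n$ outputs. Initial positions are the outputs of daimon links. **Cut elimination** $\to$ is the closure under sum with a context of the following rules (insensitive to the order of the inputs of cut links; conclusions and their order are unchanged): (i) $\langle p_1,p_2\rhd_\wp p\rangle+\langle p,q\rhd_{\mathsf{cut}}\rangle+\langle q_1,q_2\rhd_\otimes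 q\rangle\to\langle p_1,q_1\rhd_{\mathsf{cut}}\rangle+\langle p_2,q_2\rhd_{\mathsf{cut}}\rangle$; (ii) for two distinct daimon links, $\langle\rhd_\maltese\bar p\rangle+\langle p_i,q_j\rhd_{\mathsf{cut}}\rangle+\langle\rhd_\maltese\bar q\rangle\to\langle\rhd_\maltese\bar p\setminus p_i,\bar q\setminus q_j\rangle$; (iii) $\langle p_1,p_2\rhd_\otimes p\rangle+\langle p,q\rhd_{\mathsf{cut}}\rangle+\langle\rhd_\maltese\bar a,q,\bar b\rangle\to\langle p_1,q^1\rhd_{\mathsf{cut}}\rangle+\langle p_2,q^2\rhd_{\mathsf{cut}}\rangle+\langle\rhd_\maltese\bar a,q^1,q^2,\bar b\rangle$ with $q^1,q^2$ fresh; (iv) $\langle q_1,q_2\rhd_\wp q\rangle+\langle q,p\rhd_{\mathsf{cut}}\rangle+\langle\rhd_\maltese\bar a,p,\bar b\rangle\to\langle q_1,p^1\rhd_{\mathsf{cut}}\rangle+\langle q_2,p^2\rhd_{\mathsf{cut}}\rangle+\langle\rhd_\maltese\bar a',p^1,\bar b'\rangle+\langle\rhd_\maltese\bar a'',p^2,\bar b''\rangle$ with $p^1,p^2$ fresh, for any choice of sequences such that $\bar a',\bar a''$ enumerate a splitting of $\bar a$ into two (possibly empty) parts and $\bar b',\bar b''$ one of $\bar b$. In (iii) and (iv) the inputs of the connective link may themselves be outputs of the daimon link involved. Other cuts are not reducible. $\to^*$ is the reflexive transitive closure. **Orthogonality.** For nets $S,T$ with $k=\min(\#S,\#T)$, the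 interaction $S::T$ is $S+T+\sum_{1\le i\le k}\langle S(i),T(i)\rhd_{\mathsf{cut}}\rangle$ ($S,T$ made disjoint), the remaining conclusions keeping their order. $S\perp T$ iff there exists a reduction $S::T\to^*\maltese_0$. A net is orthogonal to a set of nets if it is orthogonal to each of its elements. For a set $A$ of nets, $A^\bot=\{P\mid\forall R\in A,\ P\perp R\}$. For sets of nets $\mathbf A,\mathbf B$: $\mathbf A\parallel\mathbf B=\{S\parallel T\mid S\in\mathbf A,T\in\mathbf B\}^{\bot\bot}$. **Logic.** Propositional variables form a countable set with an involution $X\mapsto X^\bot$. Formulas: $A,B::=X\mid A\wp B\mid A\otimes B$, with $(A\wp B)^\bot=A^\bot\otimes B^\bot$, $(A\otimes B)^\bot=A^\bot\wp B^\bot$. Sequents are finite sequences of formulas. $\mathsf{MLL}^\maltese$ proofs are trees built with the rules: ($\maltese$) infer any $\Gamma$ with no premise; ($\wp$) from $\Gamma,A,B$ infer $\Gamma,A\wp B$; ($\otimes$) from $\Gamma,A$ and $\Delta,B$ infer $\Gamma,\Delta,A\otimes B$; (cut) from $\Gamma,A$ and $\Delta,A^\bot$ infer $\Gamma,\Delta$; (ex) exchange of two consecutive formulas. A net $S$ represents a proof $\pi$ of $A_1,\dots,A_n$ (the $i$-th conclusion of $S$ corresponding to $A_i$), inductively: a $\maltese$-rule is represented by a single daimon link $\langle\rhd_\maltese p_1,\dots,p_n\rangle$ with conclusions ordered $p_1,\dots,p_n$; a $\wp$-rule by adding a par link with fresh output to the conclusions for $A,B$ of a net representing the premise; a $\otimes$-rule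 (resp. cut-rule) by the disjoint sum of nets representing the premises plus a tensor link with fresh output (resp. a cut link) on the conclusions for the two active formulas; exchange by exchanging the two conclusions in the order. $S\vdash_{\mathsf{MLL}^\maltese}\Gamma$ means that $S$ represents some $\mathsf{MLL}^\maltese$ proof of $\Gamma$. **Atomic testability.** A formula labelling of a cut-free net $S$ is a function $\tau$ from its positions to formulas such that $\tau(p)=\tau(p_1)\wp\tau(p_2)$ for each par link $\langle p_1,p_2\rhd_\wp p\rangle$ and $\tau(p)=\tau(p_1)\otimes\tau(p_2)$ for each tensor link $\langle p_1,p_2\rhd_\otimes p\rangle$ of $S$. It is atomic if every output of every daimon link is labelled by a propositional variable. A cut-free net $S$ with $n$ conclusions is atomically testable by $A_1,\dots,A_n$ if it has an atomic formula labelling $\tau$ with $\tau(S(i))=A_i$ for all $i$. **Natural partitions.** In such a net $S$ there is a binary tree of connective links above each conclusion; each initial position $p$ is determined by the index $i$ of the conclusion $S(i)$ below it and its address, the left/right word leading from $S(i)$ up to $p$. Order the $n$ initial positions lexicographically by (index, address), left before right. For a partition $P$ of the initial positions of $S$, $\mathbf{Nat}_S(P)$ is the corresponding partition of $\{1,\dots,n\}$. $\mathsf P_\maltese(S)$ is the partition $\{\mathrm t(d)\mid d\text{ a daimon link of }S\}$, $\mathrm t(d)$ being the set of outputs of $d$. **Switchings.** For a par link $\langle p_1,p_2\rhd_\wp p\rangle$ of a net, a left (resp. right) switching step deletes this link and replaces $p_1$ (resp. $p_2$) by $p$ in the target of the link having it as an output; $p_2$ (resp. $p_1$) becomes a new (last)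 conclusion. A switching $\sigma S$ of $S$ is a normal form of $S$ for these steps (so it has no par link). Its initial positions are identified with those of $S$ via the replacements. For cut-free $S$, $\uparrow^i\sigma S$ is the partition of the initial positions having one class for each conclusion $q$ of $\sigma S$, namely the set of initial positions above $q$ in $\sigma S$ (those from which $q$ is reached by going repeatedly from an input to an output of a link). **Tests.** A cut-free net $T$ is a test of a formula $A$ if $T$ is atomically testable by $A^\bot$ and there exist a (cut-free) net $S$ atomically testable by $A$ and a switching $\sigma S$ of $S$ such that $\mathbf{Nat}_T(\mathsf P_\maltese(T))=\mathbf{Nat}_S(\uparrow^i\sigma S)$. $\mathsf{tests}(A)$ is the set of tests of $A$. -}

module Defs where

open import Data.Fin.Base using (Fin; toℕ)
import Data.Fin.Base as Fin
open import Data.List.Base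
  using (List; []; _∷_; _++_; map; concatMap; zipWith; drop; length; lookup)
open import Data.List.Properties using (concatMap-map; map-concatMap; concatMap-cong; concatMap-++)
open import Data.List.Membership.Propositional using (_∈_; _∉_)
open import Data.List.Membership.Propositional.Properties using (∈-map⁺; ∈-map⁻; ∈-++⁺ˡ; ∈-++⁺ʳ; ∈-++⁻)
open import Data.List.Relation.Binary.Disjoint.Propositional using (Disjoint)
open import Data.List.Relation.Binary.Lex.Strict using (Lex-<)
open import Data.List.Relation.Binary.Permutation.Propositional using (_↭_)
open import Data.List.Relation.Binary.Subset.Propositional using (_⊆_)
open import Data.List.Relation.Unary.All as All using (All)
import Data.List.Relation.Unary.All.Properties as All
open import Data.List.Relation.Unary.AllPairs using (AllPairs)
open import Data.List.Relation.Unary.Unique.Propositional using (Unique)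
import Data.List.Relation.Unary.Unique.Propositional.Properties as Unique
open import Data.Nat.Base using (ℕ; suc; _*_)
open import Data.Nat.Properties using (_≟_; *-cancelˡ-≡; suc-injective; even≢odd)
open import Data.Product.Base using (Σ-syntax; ∃-syntax; _×_; _,_; proj₁; proj₂)
open import Data.Product.Relation.Binary.Lex.Strict using (×-Lex)
open import Data.Sum.Base using (_⊎_; inj₁; inj₂)
open import Function.Base using (id; _∘_)
open import Function.Bundles using (_⇔_; mk⇔; Equivalence; _↣_)
open import Level using (0ℓ)
open import Relation.Binary.Construct.Closure.ReflexiveTransitive using (Star)
open import Relation.Binary.PropositionalEquality
  using (_≡_; _≢_; refl; sym; trans; subst)
open import Relation.Nullary using (¬_; yes; no)
open import Relation.Unary using (Pred; _≐_)

Pos : Set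
Pos = ℕ

data Link : Set where
  ten : (p₁ p₂ p : Pos) → Link
  par : (p₁ p₂ p : Pos) → Link
  cut : (p₁ p₂ : Pos) → Link
  dai : (ps : List Pos) → Link

source : Link → List Pos
source (ten p₁ p₂ p) = p₁ ∷ p₂ ∷ []
source (par p₁ p₂ p) = p₁ ∷ p₂ ∷ []
source (cut p₁ p₂)   = p₁ ∷ p₂ ∷ []
source (dai ps)      = []

target : Link → List Pos
target (ten p₁ p₂ p) = p ∷ []
target (par p₁ p₂ p) = p ∷ []
target (cut p₁ p₂)   = []
target (dai ps)      = ps

-- A finite sum of links together with an ordering of its conclusions.
-- `links` is only ever used up to permutation (`_↭_`), so it stands for the
-- finite set of labelled links.  In a net every position is in some target,
-- so the set of positions need not be recorded separately.
record Graph : Set where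
  constructor graph
  field
    links : List Link
    concl : List Pos

open Graph public

sources targets positions : List Link → List Pos
sources     = concatMap source
targets     = concatMap target
positions E = sources E ++ targets E

record IsNet (G : Graph) : Set where
  field
    source#target   : All (λ l → Disjoint (source l) (target l)) (links G)
    -- Uniqueness in the concatenated list covers both the distinctness of the
    -- positions within one link and the disjointness of different links.
    targets-unique  : Unique (targets (links G))
    sources-unique  : Unique (sources (links G))
    sources⊆targets : sources (links G) ⊆ targets (links G)
    concl-unique    : Unique (concl G)
    concl-spec      : ∀ p → p ∈ concl G ⇔ (p ∈ targets (links G) × p ∉ sources (links G))

record Net : Set where
  constructor net
  field
    body  : Graph
    isNet : IsNet body
  open Graph body public renaming (links to linksₙ; concl to conclₙ)

open Net public

CutFree : Net → Set
CutFree S = ∀ p q → cut p q ∉ linksₙ S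

daimon₀ : Graph
daimon₀ = graph (dai [] ∷ []) []

renameLink : (Pos → Pos) → Link → Link
renameLink f (ten p₁ p₂ p) = ten (f p₁) (f p₂) (f p)
renameLink f (par p₁ p₂ p) = par (f p₁) (f p₂) (f p)
renameLink f (cut p₁ p₂)   = cut (f p₁) (f p₂)
renameLink f (dai ps)      = dai (map f ps)

rename : (Pos → Pos) → Graph → Graph
rename f (graph E ps) = graph (map (renameLink f) E) (map f ps)

-- The two summands are made disjoint by moving the first one to the even and
-- the second one to the odd positions.
evens odds : Graph → Graph
evens = rename (2 *_)
odds  = rename (λ p → suc (2 * p))

_∥ᴳ_ : Graph → Graph → Graph
G ∥ᴳ H = graph (links (evens G) ++ links (odds H)) (concl (evens G) ++ concl (odds H))

module NetLemmas where

  source-rename : ∀ f l → source (renameLink f l) ≡ map f (source l)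
  source-rename f (ten p₁ p₂ p) = refl
  source-rename f (par p₁ p₂ p) = refl
  source-rename f (cut p₁ p₂)   = refl
  source-rename f (dai ps)      = refl

  target-rename : ∀ f l → target (renameLink f l) ≡ map f (target l)
  target-rename f (ten p₁ p₂ p) = refl
  target-rename f (par p₁ p₂ p) = refl
  target-rename f (cut p₁ p₂)   = refl
  target-rename f (dai ps)      = refl

  concatMap-rename : (h : Link → List Pos) → ∀ f → (∀ l → h (renameLink f l) ≡ map f (h l)) →
                     ∀ E → concatMap h (map (renameLink f) E) ≡ map f (concatMap h E)
  concatMap-rename h f eq E =
    trans (concatMap-map h (renameLink f) E)
      (trans (concatMap-cong eq E) (sym (map-concatMap f h E)))

  sources-rename : ∀ f E → sources (map (renameLink f) E) ≡ map f (sources E)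
  sources-rename f = concatMap-rename source f (source-rename f)

  targets-rename : ∀ f E → targets (map (renameLink f) E) ≡ map f (targets E)
  targets-rename f = concatMap-rename target f (target-rename f)

  Injective : (Pos → Pos) → Set
  Injective f = ∀ {p q} → f p ≡ f q → p ≡ q

  ∈-map-injective : ∀ {f} → Injective f → ∀ {p ps} → f p ∈ map f ps → p ∈ ps
  ∈-map-injective {f} inj {ps = ps} m with ∈-map⁻ f m
  ... | _ , q∈ , eq = subst (_∈ ps) (sym (inj eq)) q∈

  rename-isNet : ∀ {f} → Injective f → ∀ {G} → IsNet G → IsNet (rename f G)
  rename-isNet {f} inj {G} N = record
    { source#target   = All.map⁺ (All.map (λ {l} → disjoint l) source#target)
    ; targets-unique  = subst Unique (sym T≡) (Unique.map⁺ inj targets-unique)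
    ; sources-unique  = subst Unique (sym S≡) (Unique.map⁺ inj sources-unique)
    ; sources⊆targets = λ {p} p∈ → subst (p ∈_) (sym T≡) (map-⊆ (subst (p ∈_) S≡ p∈))
    ; concl-unique    = Unique.map⁺ inj concl-unique
    ; concl-spec      = λ p → mk⇔ (to p) (from p)
    }
    where
    open IsNet N
    T≡ = targets-rename f (links G)
    S≡ = sources-rename f (links G)

    disjoint : ∀ l → Disjoint (source l) (target l) →
               Disjoint (source (renameLink f l)) (target (renameLink f l))
    disjoint l d {p} (p∈s , p∈t) with ∈-map⁻ f (subst (p ∈_) (source-rename f l) p∈s)
    ... | q , q∈ , refl =
      d (q∈ , ∈-map-injective inj (subst (f q ∈_) (target-rename f l) p∈t))

    map-⊆ : map f (sources (links G)) ⊆ map f (targets (links G))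
    map-⊆ p∈ with ∈-map⁻ f p∈
    ... | q , q∈ , refl = ∈-map⁺ f (sources⊆targets q∈)

    to : ∀ p → p ∈ map f (concl G) →
         p ∈ targets (map (renameLink f) (links G)) × p ∉ sources (map (renameLink f) (links G))
    to p p∈ with ∈-map⁻ f p∈
    ... | q , q∈ , refl with Equivalence.to (concl-spec q) q∈
    ... | q∈t , q∉s =
        subst (f q ∈_) (sym T≡) (∈-map⁺ f q∈t)
      , λ m → q∉s (∈-map-injective inj (subst (f q ∈_) S≡ m))

    from : ∀ p → p ∈ targets (map (renameLink f) (links G)) ×
                 p ∉ sources (map (renameLink f) (links G)) → p ∈ map f (concl G)
    from p (p∈t , p∉s) with ∈-map⁻ f (subst (p ∈_) T≡ p∈t)
    ... | q , q∈ , refl = ∈-map⁺ f (Equivalence.from (concl-spec q)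
            (q∈ , λ m → p∉s (subst (f q ∈_) (sym S≡) (∈-map⁺ f m))))

  sum-isNet : ∀ {G H} → IsNet G → IsNet H → Disjoint (targets (links G)) (targets (links H)) →
              IsNet (graph (links G ++ links H) (concl G ++ concl H))
  sum-isNet {G} {H} N M d = record
    { source#target   = All.++⁺ N.source#target M.source#target
    ; targets-unique  = subst Unique (sym T≡) (Unique.++⁺ N.targets-unique M.targets-unique d)
    ; sources-unique  = subst Unique (sym S≡) (Unique.++⁺ N.sources-unique M.sources-unique
                          (λ (a , b) → d (N.sources⊆targets a , M.sources⊆targets b)))
    ; sources⊆targets = λ {p} p∈ → subst (p ∈_) (sym T≡) (⊆ (subst (p ∈_) S≡ p∈))
    ; concl-unique    = Unique.++⁺ N.concl-unique M.concl-unique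
                          (λ (a , b) → d (proj₁ (N.to a) , proj₁ (M.to b)))
    ; concl-spec      = λ p → mk⇔
        (λ m → let (a , b) = to (∈-++⁻ (concl G) m) in
               subst (p ∈_) (sym T≡) a , λ c → b (subst (p ∈_) S≡ c))
        (λ (a , b) → from (∈-++⁻ (targets (links G)) (subst (p ∈_) T≡ a))
                          (λ c → b (subst (p ∈_) (sym S≡) c)))
    }
    where
    module N where
      open IsNet N public
      to : ∀ {p} → p ∈ concl G → p ∈ targets (links G) × p ∉ sources (links G)
      to {p} = Equivalence.to (concl-spec p)
    module M where
      open IsNet M public
      to : ∀ {p} → p ∈ concl H → p ∈ targets (links H) × p ∉ sources (links H)
      to {p} = Equivalence.to (concl-spec p)
    T≡ = concatMap-++ target (links G) (links H)
    S≡ = concatMap-++ source (links G) (links H)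

    ⊆ : sources (links G) ++ sources (links H) ⊆ targets (links G) ++ targets (links H)
    ⊆ p∈ with ∈-++⁻ (sources (links G)) p∈
    ... | inj₁ m = ∈-++⁺ˡ (N.sources⊆targets m)
    ... | inj₂ m = ∈-++⁺ʳ (targets (links G)) (M.sources⊆targets m)

    to : ∀ {p} → p ∈ concl G ⊎ p ∈ concl H →
         p ∈ targets (links G) ++ targets (links H) × p ∉ sources (links G) ++ sources (links H)
    to {p} (inj₁ m) = ∈-++⁺ˡ (proj₁ (N.to m)) , λ c → no-source (∈-++⁻ (sources (links G)) c)
      where
      no-source : ¬ (p ∈ sources (links G) ⊎ p ∈ sources (links H))
      no-source (inj₁ c) = proj₂ (N.to m) c
      no-source (inj₂ c) = d (proj₁ (N.to m) , M.sources⊆targets c)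
    to {p} (inj₂ m) = ∈-++⁺ʳ (targets (links G)) (proj₁ (M.to m))
                    , λ c → no-source (∈-++⁻ (sources (links G)) c)
      where
      no-source : ¬ (p ∈ sources (links G) ⊎ p ∈ sources (links H))
      no-source (inj₁ c) = d (N.sources⊆targets c , proj₁ (M.to m))
      no-source (inj₂ c) = proj₂ (M.to m) c

    from : ∀ {p} → p ∈ targets (links G) ⊎ p ∈ targets (links H) →
           p ∉ sources (links G) ++ sources (links H) → p ∈ concl G ++ concl H
    from {p} (inj₁ m) n =
      ∈-++⁺ˡ (Equivalence.from (N.concl-spec p) (m , λ c → n (∈-++⁺ˡ c)))
    from {p} (inj₂ m) n =
      ∈-++⁺ʳ (concl G) (Equivalence.from (M.concl-spec p)
        (m , λ c → n (∈-++⁺ʳ (sources (links G)) c)))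

  ∥ᴳ-isNet : ∀ {G H} → IsNet G → IsNet H → IsNet (G ∥ᴳ H)
  ∥ᴳ-isNet {G} {H} N M = sum-isNet
    (rename-isNet (λ {p} {q} → *-cancelˡ-≡ p q 2) N)
    (rename-isNet (λ {p} {q} eq → *-cancelˡ-≡ p q 2 (suc-injective eq)) M)
    disjoint
    where
    disjoint : Disjoint (targets (links (evens G))) (targets (links (odds H)))
    disjoint {p} (a , b)
      with ∈-map⁻ (2 *_) (subst (p ∈_) (targets-rename (2 *_) (links G)) a)
         | ∈-map⁻ (λ n → suc (2 * n))
             (subst (p ∈_) (targets-rename (λ n → suc (2 * n)) (links H)) b)
    ... | m , _ , eq | n , _ , eq′ = even≢odd m n (trans (sym eq) eq′)

open NetLemmas using (∥ᴳ-isNet)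

_∥ₙ_ : Net → Net → Net
S ∥ₙ T = net (body S ∥ᴳ body T) (∥ᴳ-isNet (isNet S) (isNet T))

emptyNet : Net
emptyNet = net (graph [] []) record
  { source#target   = All.[]
  ; targets-unique  = AllPairs.[]
  ; sources-unique  = AllPairs.[]
  ; sources⊆targets = λ ()
  ; concl-unique    = AllPairs.[]
  ; concl-spec      = λ _ → mk⇔ (λ ()) (λ ())
  }

-- Reduction is insensitive to the order of the inputs of a cut link.
data CutOn (p q : Pos) : Link → Set where
  direct  : CutOn p q (cut p q)
  swapped : CutOn p q (cut q p)

data Rule (Fresh : Pred Pos 0ℓ) : List Link → List Link → Set where
  par/ten : ∀ {p₁ p₂ p q₁ q₂ q c} → CutOn p q c →
    Rule Fresh (par p₁ p₂ p ∷ c ∷ ten q₁ q₂ q ∷ [])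
               (cut p₁ q₁ ∷ cut p₂ q₂ ∷ [])
  dai/dai : ∀ {as p as′ bs q bs′ c} → CutOn p q c →
    Rule Fresh (dai (as ++ p ∷ as′) ∷ c ∷ dai (bs ++ q ∷ bs′) ∷ [])
               (dai ((as ++ as′) ++ (bs ++ bs′)) ∷ [])
  ten/dai : ∀ {p₁ p₂ p as q bs c q¹ q²} → CutOn p q c →
    Fresh q¹ → Fresh q² → q¹ ≢ q² →
    Rule Fresh (ten p₁ p₂ p ∷ c ∷ dai (as ++ q ∷ bs) ∷ [])
               (cut p₁ q¹ ∷ cut p₂ q² ∷ dai (as ++ q¹ ∷ q² ∷ bs) ∷ [])
  par/dai : ∀ {q₁ q₂ q as p bs c p¹ p² as′ as″ bs′ bs″} → CutOn q p c →
    Fresh p¹ → Fresh p² → p¹ ≢ p² →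
    as′ ++ as″ ↭ as → bs′ ++ bs″ ↭ bs →
    Rule Fresh (par q₁ q₂ q ∷ c ∷ dai (as ++ p ∷ bs) ∷ [])
               (cut q₁ p¹ ∷ cut q₂ p² ∷ dai (as′ ++ p¹ ∷ bs′) ∷ dai (as″ ++ p² ∷ bs″) ∷ [])

data _⟶_ (G H : Graph) : Set where
  reduce : ∀ {redex reduct context} →
    Rule (_∉ positions (links G)) redex reduct →
    links G ↭ redex ++ context →
    links H ↭ reduct ++ context →
    concl H ≡ concl G →
    G ⟶ H

_⟶*_ : Graph → Graph → Set
_⟶*_ = Star _⟶_

-- `zipWith` stops at the shorter list of conclusions; at most one of the two
-- `drop`s is non-empty.
interaction : Net → Net → Graph
interaction S T = graph
  (links S′ ++ links T′ ++ zipWith cut (concl S′) (concl T′))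
  (drop (length (concl T′)) (concl S′) ++ drop (length (concl S′)) (concl T′))
  where
  S′ = evens (body S)
  T′ = odds (body T)

_⟂_ : Net → Net → Set
S ⟂ T = interaction S T ⟶* daimon₀

NetSet : Set₁
NetSet = Pred Net 0ℓ

_⟂ˢ_ : Net → NetSet → Set
S ⟂ˢ 𝐀 = ∀ R → 𝐀 R → S ⟂ R

_ᗮ : NetSet → NetSet
(𝐀 ᗮ) P = P ⟂ˢ 𝐀

-- The generating set is not closed under isomorphism of nets.  Orthogonality is
-- invariant under isomorphism, so this does not affect the bi-orthogonal.
data Juxtaposition (𝐀 𝐁 : NetSet) : NetSet where
  juxtapose : ∀ {S T} → 𝐀 S → 𝐁 T → Juxtaposition 𝐀 𝐁 (S ∥ₙ T)

_∥_ : NetSet → NetSet → NetSet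
𝐀 ∥ 𝐁 = (Juxtaposition 𝐀 𝐁 ᗮ) ᗮ

-- The empty family gives the bi-orthogonal of the empty net, the unit of `_∥ₙ_`.
parallel : List NetSet → NetSet
parallel []              = ((_≡ emptyNet) ᗮ) ᗮ
parallel (𝐀 ∷ [])        = 𝐀
parallel (𝐀 ∷ 𝐁 ∷ 𝐂s)    = 𝐀 ∥ parallel (𝐁 ∷ 𝐂s)

record Family (X : Set) : Set₁ where
  field
    Index : Set
    class : Index → Pred X 0ℓ

open Family public

-- Equality of the sets { class i ∣ i : Index }.  An empty class counts: a
-- partition with an empty class differs from one without.
_≋_ : ∀ {X} → Family X → Family X → Set
P ≋ Q = (∀ i → ∃[ j ] class P i ≐ class Q j) × (∀ j → ∃[ i ] class P i ≐ class Q j)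

daimonPartition : Net → Family Pos
daimonPartition S = record
  { Index = Σ[ ps ∈ List Pos ] dai ps ∈ linksₙ S
  ; class = λ (ps , _) p → p ∈ ps
  }

daimonOutputs : Link → List Pos
daimonOutputs (dai ps) = ps
daimonOutputs _        = []

initials : Net → List Pos
initials S = concatMap daimonOutputs (linksₙ S)

data Side : Set where
  left right : Side

data _<ˢ_ : Side → Side → Set where
  left<right : left <ˢ right

Address : Set
Address = List Side

data Connective (p₁ p₂ p : Pos) : Link → Set where
  isTen : Connective p₁ p₂ p (ten p₁ p₂ p)
  isPar : Connective p₁ p₂ p (par p₁ p₂ p)

-- Path G q w p: following the word w upwards from q leads to p.
data Path (G : Graph) : Pos → Address → Pos → Set where
  here    : ∀ {p} → Path G p [] p
  goLeft  : ∀ {l p₁ p₂ q w p} → l ∈ links G → Connective p₁ p₂ q l →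
            Path G p₁ w p → Path G q (left ∷ w) p
  goRight : ∀ {l p₁ p₂ q w p} → l ∈ links G → Connective p₁ p₂ q l →
            Path G p₂ w p → Path G q (right ∷ w) p

_<ᵃ_ : ∀ {n} → Fin n × Address → Fin n × Address → Set
_<ᵃ_ = ×-Lex _≡_ Fin._<_ (Lex-< _≡_ _<ˢ_)

HasAddress : (S : Net) → Pos → Fin (length (conclₙ S)) × Address → Set
HasAddress S p (i , w) = Path (body S) (lookup (conclₙ S) i) w p

Before : Net → Pos → Pos → Set
Before S p q = ∃[ a ] ∃[ b ] HasAddress S p a × HasAddress S q b × a <ᵃ b

NaturalOrder : Net → List Pos → Set
NaturalOrder S ps = ps ↭ initials S × AllPairs (Before S) ps

-- p is the k-th initial position, counting from 1.
Rank : Net → Pos → ℕ → Set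
Rank S p k = ∃[ ps ] NaturalOrder S ps ×
  Σ[ j ∈ Fin (length ps) ] lookup ps j ≡ p × suc (toℕ j) ≡ k

Nat : Net → Family Pos → Family ℕ
Nat S P = record
  { Index = Index P
  ; class = λ i k → ∃[ p ] class P i p × Rank S p k
  }

replace : Pos → Pos → Pos → Pos
replace p q r with r ≟ p
... | yes _ = q
... | no  _ = r

retarget : (Pos → Pos) → Link → Link
retarget f (ten p₁ p₂ p) = ten p₁ p₂ (f p)
retarget f (par p₁ p₂ p) = par p₁ p₂ (f p)
retarget f (cut p₁ p₂)   = cut p₁ p₂
retarget f (dai ps)      = dai (map f ps)

-- The function is the replacement performed by the step.
data SwitchingStep (G : Graph) : (Pos → Pos) → Graph → Set where
  leftStep  : ∀ {p₁ p₂ p E} → links G ↭ par p₁ p₂ p ∷ E →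
    SwitchingStep G (replace p₁ p)
      (graph (map (retarget (replace p₁ p)) E) (concl G ++ p₂ ∷ []))
  rightStep : ∀ {p₁ p₂ p E} → links G ↭ par p₁ p₂ p ∷ E →
    SwitchingStep G (replace p₂ p)
      (graph (map (retarget (replace p₂ p)) E) (concl G ++ p₁ ∷ []))

-- Switching G ι H: H is a switching of G, and ι sends each initial position of G
-- to the initial position of H with which it is identified.
data Switching : Graph → (Pos → Pos) → Graph → Set where
  normal : ∀ {G} → (∀ p₁ p₂ p → par p₁ p₂ p ∉ links G) → Switching G id G
  step   : ∀ {G f G′ ι H} → SwitchingStep G f G′ → Switching G′ ι H → Switching G (ι ∘ f) H

switchingPartition : Net → (Pos → Pos) → Graph → Family Pos
switchingPartition S ι H = record
  { Index = Σ[ q ∈ Pos ] q ∈ concl H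
  ; class = λ (q , _) p → p ∈ initials S × ∃[ w ] Path H q w (ι p)
  }

record PropositionalVariables : Set₁ where
  field
    Var        : Set
    countable  : Var ↣ ℕ
    dual       : Var → Var
    involutive : ∀ X → dual (dual X) ≡ X

module MLL (𝒱 : PropositionalVariables) where

  open PropositionalVariables 𝒱

  infixr 6 _⅋_ _⊗_

  data Formula : Set where
    var : Var → Formula
    _⅋_ : Formula → Formula → Formula
    _⊗_ : Formula → Formula → Formula

  _^⊥ : Formula → Formula
  var X   ^⊥ = var (dual X)
  (A ⅋ B) ^⊥ = (A ^⊥) ⊗ (B ^⊥)
  (A ⊗ B) ^⊥ = (A ^⊥) ⅋ (B ^⊥)

  Sequent : Set
  Sequent = List Formula

  data Proof : Sequent → Set where
    ✠-rule   : ∀ Γ → Proof Γ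
    ⅋-rule   : ∀ Γ A B → Proof (Γ ++ A ∷ B ∷ []) → Proof (Γ ++ (A ⅋ B) ∷ [])
    ⊗-rule   : ∀ Γ Δ A B → Proof (Γ ++ A ∷ []) → Proof (Δ ++ B ∷ []) →
               Proof (Γ ++ Δ ++ (A ⊗ B) ∷ [])
    cut-rule : ∀ Γ Δ A → Proof (Γ ++ A ∷ []) → Proof (Δ ++ (A ^⊥) ∷ []) → Proof (Γ ++ Δ)
    ex-rule  : ∀ Γ Δ A B → Proof (Γ ++ A ∷ B ∷ Δ) → Proof (Γ ++ B ∷ A ∷ Δ)

  -- Since S is itself a net, the output of an added link is fresh and the nets
  -- representing the premises are disjoint.
  data Represents (S : Net) : ∀ {Γ} → Proof Γ → Set where
    ✠-rep : ∀ {Γ ps} →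
      linksₙ S ≡ dai ps ∷ [] → conclₙ S ≡ ps → length ps ≡ length Γ →
      Represents S (✠-rule Γ)
    ⅋-rep : ∀ {Γ A B π S₀ ps p₁ p₂ p} → Represents S₀ π →
      conclₙ S₀ ≡ ps ++ p₁ ∷ p₂ ∷ [] →
      linksₙ S ↭ par p₁ p₂ p ∷ linksₙ S₀ →
      conclₙ S ≡ ps ++ p ∷ [] →
      Represents S (⅋-rule Γ A B π)
    ⊗-rep : ∀ {Γ Δ A B π₁ π₂ S₁ S₂ ps₁ ps₂ p₁ p₂ p} → Represents S₁ π₁ → Represents S₂ π₂ →
      conclₙ S₁ ≡ ps₁ ++ p₁ ∷ [] → conclₙ S₂ ≡ ps₂ ++ p₂ ∷ [] →
      linksₙ S ↭ ten p₁ p₂ p ∷ linksₙ S₁ ++ linksₙ S₂ →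
      conclₙ S ≡ ps₁ ++ ps₂ ++ p ∷ [] →
      Represents S (⊗-rule Γ Δ A B π₁ π₂)
    cut-rep : ∀ {Γ Δ A π₁ π₂ S₁ S₂ ps₁ ps₂ p₁ p₂} → Represents S₁ π₁ → Represents S₂ π₂ →
      conclₙ S₁ ≡ ps₁ ++ p₁ ∷ [] → conclₙ S₂ ≡ ps₂ ++ p₂ ∷ [] →
      linksₙ S ↭ cut p₁ p₂ ∷ linksₙ S₁ ++ linksₙ S₂ →
      conclₙ S ≡ ps₁ ++ ps₂ →
      Represents S (cut-rule Γ Δ A π₁ π₂)
    ex-rep : ∀ {Γ Δ A B π S₀ ps p q qs} → Represents S₀ π →
      conclₙ S₀ ≡ ps ++ p ∷ q ∷ qs → length ps ≡ length Γ →
      linksₙ S ↭ linksₙ S₀ →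
      conclₙ S ≡ ps ++ q ∷ p ∷ qs →
      Represents S (ex-rule Γ Δ A B π)

  _⊢_ : Net → Sequent → Set
  S ⊢ Γ = Σ[ π ∈ Proof Γ ] Represents S π

  -- Only the values of τ at positions of S matter.
  record IsAtomicLabelling (S : Net) (τ : Pos → Formula) : Set where
    field
      label-⅋ : ∀ {p₁ p₂ p} → par p₁ p₂ p ∈ linksₙ S → τ p ≡ τ p₁ ⅋ τ p₂
      label-⊗ : ∀ {p₁ p₂ p} → ten p₁ p₂ p ∈ linksₙ S → τ p ≡ τ p₁ ⊗ τ p₂
      atomic  : ∀ {ps p} → dai ps ∈ linksₙ S → p ∈ ps → ∃[ X ] τ p ≡ var X

  record AtomicallyTestable (S : Net) (Γ : Sequent) : Set where
    field
      cutFree     : CutFree S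
      τ           : Pos → Formula
      isLabelling : IsAtomicLabelling S τ
      labels      : map τ (conclₙ S) ≡ Γ

  record IsTest (A : Formula) (T : Net) : Set where
    field
      testable   : AtomicallyTestable T ((A ^⊥) ∷ [])
      S          : Net
      S-testable : AtomicallyTestable S (A ∷ [])
      ι          : Pos → Pos
      σS         : Graph
      switching  : Switching (body S) ι σS
      partitions : Nat T (daimonPartition T) ≋ Nat S (switchingPartition S ι σS)

  tests : Formula → NetSet
  tests A = IsTest A

{-# OPTIONS --safe #-}

-- A cut-free net S labelled by Γ is a forest of the syntax trees of Γ whose leaves are
-- partitioned by the daimons.  Orthogonality to a bi-orthogonal of juxtapositions
-- reduces to orthogonality to each T = T₁ ∥ … ∥ Tₙ with Tᵢ a test, because S ⟂ (T ∥ U)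
-- iff (S cut against T) ⟂ U.  In the interaction of S with T the trees match dually, so
-- reduction leaves the bipartite multigraph with the daimons of S and of T as nodes and
-- the leaves as edges, and S ⟂ T iff this multigraph is a tree.  Since the daimons of T
-- are the components of a switching of the trees of Γ, S is orthogonal to all T iff it
-- satisfies the Danos–Regnier criterion.  Connectedness is stated throughout as: every
-- two-colouring compatible with some switching is constant; acyclicity is an equality
-- between the numbers of daimons and of tensors.
--
-- A correct net is sequentialized by contracting, from the leaves downwards, a tensor
-- between two parts already built or a par inside one part.  If nothing can be
-- contracted, every topmost connective is a par between two different parts.  For each
-- switching and each par, deleting the selected edge of the par cuts off a component
-- containing both of its premises; a smallest such component gives a contradiction.

module Submission where

open import Defs
open import Algebra.Solver.CommutativeMonoid as CommutativeMonoidSolver using ()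
open import Data.Bool.Base using (Bool; true; false; not; _∧_; _∨_; _xor_; if_then_else_)
import Data.Bool.Properties as Bool
open import Data.Empty using (⊥; ⊥-elim)
open import Data.Fin.Base using (Fin; zero; suc; toℕ)
import Data.Fin.Properties as Fin
open import Data.List.Base
  using (List; []; _∷_; _++_; map; concat; concatMap; zipWith; drop; length; lookup; filter)
open import Data.List.Properties
  using (concatMap-++; map-++; map-∘; map-cong; map-id; ++-assoc; ++-identityʳ;
         length-map; length-++; ++-conicalʳ; filter-accept; filter-reject; filter-all; zipWith-zeroʳ; ∷-injectiveˡ; ∷-injectiveʳ)
open import Data.List.Membership.Propositional using (_∈_; _∉_)
open import Data.List.Membership.Propositional.Properties
  using (∈-map⁺; ∈-map⁻; ∈-++⁺ˡ; ∈-++⁺ʳ; ∈-++⁻; ∈-∃++; ∈-lookup; ∈-concat⁻′; ∈-concat⁺′; ∈-filter⁻)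
open import Data.Nat.Properties using (_≟_)
open import Data.List.Membership.DecPropositional _≟_ using (_∈?_)
open import Data.List.Relation.Binary.Disjoint.Propositional using (Disjoint)
open import Data.List.Relation.Binary.Lex.Strict using (Lex-<)
import Data.List.Relation.Binary.Lex.Core as Lex
open import Data.List.Relation.Binary.Permutation.Propositional
  using (_↭_; ↭-refl; ↭-sym; ↭-trans; ↭-reflexive; prep; swap; ↭⇒↭ₛ)
open import Data.List.Relation.Binary.Permutation.Propositional.Properties
  using (∈-resp-↭; All-resp-↭; map⁺; ++⁺; ++⁺ˡ; ++⁺ʳ; ++-comm; shift; shifts; drop-∷; ↭-length;
         ↭-empty-inv; ↭-singleton-inv; ¬x∷xs↭[]; ↭-map-inv; ++-commutativeMonoid)
import Data.List.Relation.Binary.Permutation.Setoid.Properties as Permutationₛ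
open import Data.List.Relation.Binary.Pointwise.Base using (Pointwise; []; _∷_)
open import Data.List.Relation.Binary.Subset.Propositional using (_⊆_)
open import Data.List.Relation.Unary.All as All using (All; []; _∷_)
import Data.List.Relation.Unary.All.Properties as All
open import Data.List.Relation.Unary.AllPairs as AllPairs using (AllPairs; []; _∷_)
import Data.List.Relation.Unary.AllPairs.Properties as AllPairs
open import Data.List.Relation.Unary.Any using (here; there)
open import Data.List.Relation.Unary.Unique.Propositional using (Unique)
import Data.List.Relation.Unary.Unique.Propositional.Properties as Unique
open import Data.Nat.Base using (ℕ; zero; suc; _+_; _*_; _≤_; _<_; z≤n; s≤s)
import Data.Nat.Properties as ℕ
open import Data.Nat.Solver using (module +-*-Solver)
open import Data.Nat.ListAction using (sum)
import Data.Nat.ListAction.Properties as ℕ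
open import Data.Product.Base using (Σ; Σ-syntax; ∃-syntax; _×_; _,_; proj₁; proj₂)
open import Data.Product.Properties using (≡-dec)
open import Data.Sum.Base using (_⊎_; inj₁; inj₂; [_,_]′)
open import Data.Unit.Base using (⊤; tt)
open import Function.Base using (id; _∘_; case_of_)
open import Function.Bundles using (_⇔_; mk⇔; Equivalence)
open import Relation.Binary.Construct.Closure.ReflexiveTransitive using (ε; _◅_)
open import Relation.Binary.PropositionalEquality
  using (_≡_; _≢_; refl; sym; trans; cong; cong₂; subst; subst₂; setoid)
open import Relation.Nullary using (¬_; yes; no; does; contradiction)
open import Relation.Nullary.Decidable using (¬?; dec-true; dec-false)
open import Relation.Unary using (_≐_)

-- Permutations and nets

-- Orthogonality asserts only that some reduction exists, and the rule that splits a daimon against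
-- a par is non-deterministic. What is extracted from `S ⟂ T` must therefore survive every step: a
-- count of links, and a relational experiment in which each position carries the tree of colours of
-- the leaves above it. Since atoms face atoms, the experiment itself excludes the steps in which a
-- connective meets a daimon. In the other direction a reduction is exhibited.
--
-- Colourings stand for paths because they compose with renamings, restrict to subnets and extend
-- from leaves to inner positions. Taking the side of a removed edge that avoids a point, and
-- uniting or subtracting such sides, become Boolean operations on functions.
--
-- Colours do not see a daimon without outputs. This is why correctness has a separate clause about
-- empty daimons, and why the empty sequent, where a correct net is a single empty daimon, is
-- treated apart.

module PermutationSolver {A : Set} = CommutativeMonoidSolver (++-commutativeMonoid {A = A})
open PermutationSolver using (solve; _⊕_; _⊜_)

module _ {A : Set} where

  Unique-resp-↭ : {xs ys : List A} → xs ↭ ys → Unique xs → Unique ys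
  Unique-resp-↭ σ = Permutationₛ.Unique-resp-↭ (setoid A) (↭⇒↭ₛ σ)

  ∈⇒↭ : {x : A} {xs : List A} → x ∈ xs → ∃[ ys ] xs ↭ x ∷ ys
  ∈⇒↭ x∈ with as , bs , refl ← ∈-∃++ x∈ = as ++ bs , shift _ as bs

  Unique-++⁻ : (xs : List A) {ys : List A} → Unique (xs ++ ys) → Unique xs × Unique ys × Disjoint xs ys
  Unique-++⁻ [] u = [] , u , λ ()
  Unique-++⁻ (x ∷ xs) (x∉ ∷ u) with uˡ , uʳ , d ← Unique-++⁻ xs u =
    All.++⁻ˡ xs x∉ ∷ uˡ , uʳ , λ
      { (here refl , m) → All.lookup (All.++⁻ʳ xs x∉) m refl
      ; (there m , m′) → d (m , m′) }

  Unique-head : {x : A} {xs : List A} → Unique (x ∷ xs) → x ∉ xs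
  Unique-head (x∉ ∷ _) m = All.lookup x∉ m refl

  Unique-⊆⇒↭ : {xs ys : List A} → Unique xs → Unique ys → xs ⊆ ys → ys ⊆ xs → xs ↭ ys
  Unique-⊆⇒↭ {[]} {[]} _ _ _ _ = ↭-refl
  Unique-⊆⇒↭ {[]} {y ∷ ys} _ _ _ g = case g (here refl) of λ ()
  Unique-⊆⇒↭ {x ∷ xs} {ys} (x∉ ∷ u) v f g with ys′ , σ ← ∈⇒↭ (f (here refl)) =
    ↭-trans (prep x (Unique-⊆⇒↭ u (AllPairs.tail w) f′ g′)) (↭-sym σ)
    where
    w = Unique-resp-↭ σ v
    f′ : xs ⊆ ys′
    f′ m with ∈-resp-↭ σ (f (there m))
    ... | here refl = contradiction refl (All.lookup x∉ m)
    ... | there m′  = m′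
    g′ : ys′ ⊆ xs
    g′ m with g (∈-resp-↭ (↭-sym σ) (there m))
    ... | here refl = contradiction m (Unique-head w)
    ... | there m′  = m′

  concatMap⁺ : {B : Set} (f : A → List B) {xs ys : List A} → xs ↭ ys → concatMap f xs ↭ concatMap f ys
  concatMap⁺ f _↭_.refl = ↭-refl
  concatMap⁺ f (prep x σ) = ++⁺ˡ (f x) (concatMap⁺ f σ)
  concatMap⁺ f (swap x y σ) = ↭-trans (shifts (f x) (f y)) (++⁺ˡ (f y) (++⁺ˡ (f x) (concatMap⁺ f σ)))
  concatMap⁺ f (_↭_.trans σ τ) = ↭-trans (concatMap⁺ f σ) (concatMap⁺ f τ)

  Pointwise-↭ : {B : Set} {R : A → B → Set} {xs ys : List A} {zs : List B} →
                xs ↭ ys → Pointwise R xs zs → ∃[ ws ] Pointwise R ys ws × zs ↭ ws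
  Pointwise-↭ _↭_.refl rs = _ , rs , ↭-refl
  Pointwise-↭ (prep x σ) (r ∷ rs) with _ , rs′ , τ ← Pointwise-↭ σ rs = _ , r ∷ rs′ , prep _ τ
  Pointwise-↭ (swap x y σ) (r ∷ r′ ∷ rs) with _ , rs′ , τ ← Pointwise-↭ σ rs = _ , r′ ∷ r ∷ rs′ , swap _ _ τ
  Pointwise-↭ (_↭_.trans σ σ′) rs with _ , rs′ , τ ← Pointwise-↭ σ rs with _ , rs″ , τ′ ← Pointwise-↭ σ′ rs′ =
    _ , rs″ , ↭-trans τ τ′

  Pointwise-++⁻ : {B : Set} {R : A → B → Set} (xs : List A) {ys : List A} {zs : List B} →
                  Pointwise R (xs ++ ys) zs →
                  ∃[ as ] ∃[ bs ] zs ≡ as ++ bs × Pointwise R xs as × Pointwise R ys bs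
  Pointwise-++⁻ [] rs = _ , _ , refl , [] , rs
  Pointwise-++⁻ (x ∷ xs) (r ∷ rs) with as , bs , refl , ps , qs ← Pointwise-++⁻ xs rs =
    _ ∷ as , bs , refl , r ∷ ps , qs

  Pointwise-++⁺ : {B : Set} {R : A → B → Set} {xs ys : List A} {as bs : List B} →
                  Pointwise R xs as → Pointwise R ys bs → Pointwise R (xs ++ ys) (as ++ bs)
  Pointwise-++⁺ [] qs = qs
  Pointwise-++⁺ (p ∷ ps) qs = p ∷ Pointwise-++⁺ ps qs

-- Every position is an output exactly once, and is then either an input exactly once or a
-- conclusion. With the converse `balance⇒isNet`, the incidence conditions on a net become one
-- permutation, which the monoid solver can rearrange.
balance : ∀ {G} → IsNet G → targets (links G) ↭ sources (links G) ++ concl G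
balance {G} N = Unique-⊆⇒↭ targets-unique
    (Unique.++⁺ sources-unique concl-unique λ (s , c) → proj₂ (Equivalence.to (concl-spec _) c) s)
    f g
  where
  open IsNet N
  f : targets (links G) ⊆ sources (links G) ++ concl G
  f {p} m with p ∈? sources (links G)
  ... | yes s = ∈-++⁺ˡ s
  ... | no s  = ∈-++⁺ʳ (sources (links G)) (Equivalence.from (concl-spec p) (m , s))
  g : sources (links G) ++ concl G ⊆ targets (links G)
  g {p} m with ∈-++⁻ (sources (links G)) m
  ... | inj₁ s = sources⊆targets s
  ... | inj₂ c = proj₁ (Equivalence.to (concl-spec p) c)

balance⇒isNet : ∀ {E ps} → All (λ l → Disjoint (source l) (target l)) E → Unique (targets E) →
                targets E ↭ sources E ++ ps → IsNet (graph E ps)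
balance⇒isNet {E} {ps} d u σ with us , up , s#p ← Unique-++⁻ (sources E) (Unique-resp-↭ σ u) = record
  { source#target   = d
  ; targets-unique  = u
  ; sources-unique  = us
  ; sources⊆targets = λ s → ∈-resp-↭ (↭-sym σ) (∈-++⁺ˡ s)
  ; concl-unique    = up
  ; concl-spec      = λ p → mk⇔
      (λ c → ∈-resp-↭ (↭-sym σ) (∈-++⁺ʳ (sources E) c) , λ s → s#p (s , c))
      (λ (t , s∉) → [ (λ s → contradiction s s∉) , id ]′ (∈-++⁻ (sources E) (∈-resp-↭ σ t)))
  }

∈-targets : ∀ {l E p} → l ∈ E → p ∈ target l → p ∈ targets E
∈-targets (here refl) m = ∈-++⁺ˡ m
∈-targets {E = l′ ∷ _} (there l∈) m = ∈-++⁺ʳ (target l′) (∈-targets l∈ m)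

∈-targets⁻ : ∀ E {p} → p ∈ targets E → ∃[ l ] l ∈ E × p ∈ target l
∈-targets⁻ (l ∷ E) m with ∈-++⁻ (target l) m
... | inj₁ m′ = l , here refl , m′
... | inj₂ m′ with l′ , l∈ , m″ ← ∈-targets⁻ E m′ = l′ , there l∈ , m″

target-injective : ∀ {E l l′ p} → Unique (targets E) → l ∈ E → l′ ∈ E → p ∈ target l → p ∈ target l′ → l ≡ l′
target-injective u (here refl) (here refl) m m′ = refl
target-injective {l ∷ E} u (here refl) (there l′∈) m m′ =
  ⊥-elim (proj₂ (proj₂ (Unique-++⁻ (target l) u)) (m , ∈-targets l′∈ m′))
target-injective {l ∷ E} u (there l∈) (here refl) m m′ =
  ⊥-elim (proj₂ (proj₂ (Unique-++⁻ (target l) u)) (m′ , ∈-targets l∈ m))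
target-injective {l ∷ E} u (there l∈) (there l′∈) m m′ =
  target-injective (proj₁ (proj₂ (Unique-++⁻ (target l) u))) l∈ l′∈ m m′

targets-↭ : ∀ {E F} → E ↭ F → targets E ↭ targets F
targets-↭ = concatMap⁺ target

sources-↭ : ∀ {E F} → E ↭ F → sources E ↭ sources F
sources-↭ = concatMap⁺ source

-- Renaming, symmetry and associativity of interaction

data Parity : ℕ → Set where
  even : ∀ m → Parity (2 * m)
  odd  : ∀ m → Parity (suc (2 * m))

parity : ∀ n → Parity n
parity zero = even 0
parity (suc n) with parity n
... | even m = odd m
... | odd m  = subst Parity (ℕ.*-distribˡ-+ 2 1 m) (even (suc m))

module _ {A : Set} where

  -- Summands are separated by parity, so a renaming or a colouring of a juxtaposition or of an
  -- interaction is given by its two restrictions, glued along parity.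
  join : (ℕ → A) → (ℕ → A) → ℕ → A
  join g h zero          = g 0
  join g h (suc zero)    = h 0
  join g h (suc (suc n)) = join (g ∘ suc) (h ∘ suc) n

  join-even : ∀ g h m → join g h (2 * m) ≡ g m
  join-even g h zero = refl
  join-even g h (suc m) = trans (cong (join g h) (ℕ.*-distribˡ-+ 2 1 m)) (join-even (g ∘ suc) (h ∘ suc) m)

  join-odd : ∀ g h m → join g h (suc (2 * m)) ≡ h m
  join-odd g h zero = refl
  join-odd g h (suc m) = trans (cong (join g h ∘ suc) (ℕ.*-distribˡ-+ 2 1 m)) (join-odd (g ∘ suc) (h ∘ suc) m)

open NetLemmas

evenly oddly : Pos → Pos
evenly p = 2 * p
oddly p  = suc (2 * p)

join-injective : ∀ {g h} → Injective g → Injective h → (∀ p q → g p ≢ h q) → Injective (join g h)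
join-injective {g} {h} gi hi d {p} {q} eq with parity p | parity q
... | even m | even n = cong evenly (gi (trans (sym (join-even g h m)) (trans eq (join-even g h n))))
... | even m | odd n  = ⊥-elim (d m n (trans (sym (join-even g h m)) (trans eq (join-odd g h n))))
... | odd m  | even n = ⊥-elim (d n m (sym (trans (sym (join-odd g h m)) (trans eq (join-even g h n)))))
... | odd m  | odd n  = cong oddly (hi (trans (sym (join-odd g h m)) (trans eq (join-odd g h n))))

evenly-injective : Injective evenly
evenly-injective {p} {q} = ℕ.*-cancelˡ-≡ p q 2

oddly-injective : Injective oddly
oddly-injective {p} {q} eq = ℕ.*-cancelˡ-≡ p q 2 (ℕ.suc-injective eq)

evenly≢oddly : ∀ p q → evenly p ≢ oddly q
evenly≢oddly = ℕ.even≢odd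

-- The constructor `cut′` reverses a cut. The symmetry of orthogonality produces such reversals, and
-- reduction ignores the order of the inputs of a cut.
data LinkIso (f : Pos → Pos) : Link → Link → Set where
  ten  : ∀ {p₁ p₂ p} → LinkIso f (ten p₁ p₂ p) (ten (f p₁) (f p₂) (f p))
  par  : ∀ {p₁ p₂ p} → LinkIso f (par p₁ p₂ p) (par (f p₁) (f p₂) (f p))
  cut  : ∀ {p q} → LinkIso f (cut p q) (cut (f p) (f q))
  cut′ : ∀ {p q} → LinkIso f (cut p q) (cut (f q) (f p))
  dai  : ∀ {ps} → LinkIso f (dai ps) (dai (map f ps))

LinksIso : (Pos → Pos) → List Link → List Link → Set
LinksIso f = Pointwise (LinkIso f)

ends : Link → List Pos
ends l = source l ++ target l

∈-positions⁻ : ∀ E {p} → p ∈ positions E → ∃[ l ] l ∈ E × p ∈ ends l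
∈-positions⁻ E m with ∈-++⁻ (sources E) m
... | inj₂ t with l , l∈ , m′ ← ∈-targets⁻ E t = l , l∈ , ∈-++⁺ʳ (source l) m′
... | inj₁ s = go E s
  where
  go : ∀ E {p} → p ∈ sources E → ∃[ l ] l ∈ E × p ∈ ends l
  go (l ∷ E) m with ∈-++⁻ (source l) m
  ... | inj₁ m′ = l , here refl , ∈-++⁺ˡ m′
  ... | inj₂ m′ with l′ , l∈ , m″ ← go E m′ = l′ , there l∈ , m″

∈-positions⁺ : ∀ E {l p} → l ∈ E → p ∈ ends l → p ∈ positions E
∈-positions⁺ E {l} l∈ m with ∈-++⁻ (source l) m
... | inj₂ t = ∈-++⁺ʳ (sources E) (∈-targets l∈ t)
... | inj₁ s = ∈-++⁺ˡ (go l∈ s)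
  where
  go : ∀ {E l p} → l ∈ E → p ∈ source l → p ∈ sources E
  go (here refl) m = ∈-++⁺ˡ m
  go {l ∷ _} (there l∈) m = ∈-++⁺ʳ (source l) (go l∈ m)

ends-iso : ∀ {f l l′} → LinkIso f l l′ → ∀ {p} → p ∈ ends l′ → ∃[ q ] q ∈ ends l × p ≡ f q
ends-iso ten (here refl) = _ , here refl , refl
ends-iso ten (there (here refl)) = _ , there (here refl) , refl
ends-iso ten (there (there (here refl))) = _ , there (there (here refl)) , refl
ends-iso par (here refl) = _ , here refl , refl
ends-iso par (there (here refl)) = _ , there (here refl) , refl
ends-iso par (there (there (here refl))) = _ , there (there (here refl)) , refl
ends-iso cut (here refl) = _ , here refl , refl
ends-iso cut (there (here refl)) = _ , there (here refl) , refl
ends-iso cut′ (here refl) = _ , there (here refl) , refl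
ends-iso cut′ (there (here refl)) = _ , here refl , refl
ends-iso {f} dai m = ∈-map⁻ f m

preimage-iso : ∀ {f E F l′} → LinksIso f E F → l′ ∈ F → ∃[ l ] l ∈ E × LinkIso f l l′
preimage-iso (i ∷ is) (here refl) = _ , here refl , i
preimage-iso (i ∷ is) (there m) with l , l∈ , j ← preimage-iso is m = l , there l∈ , j

positions-iso : ∀ {f E F} → LinksIso f E F → ∀ {p} → p ∈ positions F → ∃[ q ] q ∈ positions E × p ≡ f q
positions-iso {f} {E} {F} is m with l′ , l′∈ , m′ ← ∈-positions⁻ F m
  with l , l∈ , i ← preimage-iso is l′∈
  with q , q∈ , eq ← ends-iso i m′ = q , ∈-positions⁺ E l∈ q∈ , eq

cutOn-iso : ∀ {f p q c c′} → CutOn p q c → LinkIso f c c′ → CutOn (f p) (f q) c′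
cutOn-iso direct  cut  = direct
cutOn-iso direct  cut′ = swapped
cutOn-iso swapped cut  = swapped
cutOn-iso swapped cut′ = direct

rule-iso : ∀ {f P Q E E′ F} → Injective f → (∀ {p} → P p → Q (f p)) →
           Rule P E E′ → LinksIso f E F → ∃[ F′ ] Rule Q F F′ × LinksIso f E′ F′
rule-iso inj fr (par/ten c) (par ∷ i ∷ ten ∷ []) = _ , par/ten (cutOn-iso c i) , cut ∷ cut ∷ []
rule-iso {f} inj fr (dai/dai {as} {p} {as′} {bs} {q} {bs′} c) (dai ∷ i ∷ dai ∷ [])
  rewrite map-++ f as (p ∷ as′) | map-++ f bs (q ∷ bs′) =
  _ , dai/dai {as = map f as} {bs = map f bs} (cutOn-iso c i) ,
  subst (LinkIso f _ ∘ dai)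
    (trans (map-++ f (as ++ as′) (bs ++ bs′)) (cong₂ _++_ (map-++ f as as′) (map-++ f bs bs′))) dai ∷ []
rule-iso {f} inj fr (ten/dai {as = as} {q} {bs} {q¹ = q¹} {q²} c f₁ f₂ ne) (ten ∷ i ∷ dai ∷ [])
  rewrite map-++ f as (q ∷ bs) =
  _ , ten/dai {as = map f as} (cutOn-iso c i) (fr f₁) (fr f₂) (ne ∘ inj) ,
  cut ∷ cut ∷ subst (LinkIso f _ ∘ dai) (map-++ f as (q¹ ∷ q² ∷ bs)) dai ∷ []
rule-iso {f} inj fr (par/dai {as = as} {p} {bs} {p¹ = p¹} {p²} {as′} {as″} {bs′} {bs″} c f₁ f₂ ne σ τ)
  (par ∷ i ∷ dai ∷ [])
  rewrite map-++ f as (p ∷ bs) =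
  _ , par/dai {as = map f as} {as′ = map f as′} {map f as″} {map f bs′} {map f bs″}
        (cutOn-iso c i) (fr f₁) (fr f₂) (ne ∘ inj)
        (↭-trans (↭-reflexive (sym (map-++ f as′ as″))) (map⁺ f σ))
        (↭-trans (↭-reflexive (sym (map-++ f bs′ bs″))) (map⁺ f τ)) ,
  cut ∷ cut ∷ subst (LinkIso f _ ∘ dai) (map-++ f as′ (p¹ ∷ bs′)) dai
            ∷ subst (LinkIso f _ ∘ dai) (map-++ f as″ (p² ∷ bs″)) dai ∷ []

-- Quantifying over all closed graphs with these links makes winning invariant under permutation:
-- the first step absorbs the permutation, and if there is no step, the list has a single link.
Wins : List Link → Set
Wins E = ∀ H → links H ↭ E → concl H ≡ [] → H ⟶* daimon₀

⟶*-closed : ∀ {G} → G ⟶* daimon₀ → concl G ≡ []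
⟶*-closed ε = refl
⟶*-closed (reduce _ _ _ eq ◅ r) = trans (sym eq) (⟶*-closed r)

wins-daimon₀ : Wins (dai [] ∷ [])
wins-daimon₀ (graph E ps) σ refl with refl ← ↭-singleton-inv σ = ε

-- The reductions exhibited below consist of par/tensor and daimon/daimon steps. These introduce no
-- position, hence a rule available for every notion of freshness.
wins-step : ∀ {E E′ K} → (∀ {P} → Rule P E E′) → Wins (E′ ++ K) → Wins (E ++ K)
wins-step {E′ = E′} {K} r w H σ c =
  reduce {H = graph (E′ ++ K) (concl H)} r σ ↭-refl refl ◅ w _ ↭-refl c

wins-resp-↭ : ∀ {E F} → E ↭ F → Wins F → Wins E
wins-resp-↭ σ w H τ c = w H (↭-trans τ σ) c

fresh-iso : ∀ {f E F H p} → Injective f → LinksIso f E F → H ↭ F → p ∉ positions E → f p ∉ positions H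
fresh-iso {E = E} {H = H} inj is ρ p∉ m
  with l , l∈ , m′ ← ∈-positions⁻ H m
  with q , q∈ , eq ← positions-iso is (∈-positions⁺ _ (∈-resp-↭ ρ l∈) m′)
  with refl ← inj eq = p∉ q∈

-- Steps are transported one at a time, new positions being renamed by the same `f`. All positions
-- of the image come from positions of the source, so injectivity keeps a fresh position fresh.
⟶*-iso : ∀ {f G F} → Injective f → G ⟶* daimon₀ → LinksIso f (links G) F → Wins F
⟶*-iso inj ε (dai ∷ []) = wins-daimon₀
⟶*-iso {f} {G} inj (_◅_ {j = G′} (reduce {redex} r σ τ eq) rs) is H ρ c
  with F , js , σ′ ← Pointwise-↭ σ is
  with F₁ , F₂ , refl , is₁ , is₂ ← Pointwise-++⁻ redex js
  with F₁′ , r′ , is₁′ ← rule-iso inj (fresh-iso inj is ρ) r is₁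
  with F′ , is′ , τ′ ← Pointwise-↭ (↭-sym τ) (Pointwise-++⁺ is₁′ is₂) =
  reduce {H = graph (F₁′ ++ F₂) (concl H)} r′ (↭-trans ρ σ′) ↭-refl refl ◅ ⟶*-iso inj rs is′ _ τ′ c

renameLink-iso : ∀ {f g h} → (∀ p → f (g p) ≡ h p) → ∀ l → LinkIso f (renameLink g l) (renameLink h l)
renameLink-iso {f} {g} eq (ten p₁ p₂ p) rewrite sym (eq p₁) | sym (eq p₂) | sym (eq p) = ten
renameLink-iso {f} {g} eq (par p₁ p₂ p) rewrite sym (eq p₁) | sym (eq p₂) | sym (eq p) = par
renameLink-iso {f} {g} eq (cut p₁ p₂) rewrite sym (eq p₁) | sym (eq p₂) = cut
renameLink-iso {f} {g} eq (dai ps) =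
  subst (LinkIso f _ ∘ dai) (trans (sym (map-∘ ps)) (map-cong eq ps)) dai

rename-iso : ∀ {f g h} → (∀ p → f (g p) ≡ h p) → ∀ E →
             LinksIso f (map (renameLink g) E) (map (renameLink h) E)
rename-iso eq [] = []
rename-iso eq (l ∷ E) = renameLink-iso eq l ∷ rename-iso eq E

renameLink-∘ : ∀ g h l → renameLink g (renameLink h l) ≡ renameLink (g ∘ h) l
renameLink-∘ g h (ten p₁ p₂ p) = refl
renameLink-∘ g h (par p₁ p₂ p) = refl
renameLink-∘ g h (cut p₁ p₂)   = refl
renameLink-∘ g h (dai ps)      = cong dai (sym (map-∘ ps))

rename-∘ : ∀ g h E → map (renameLink g) (map (renameLink h) E) ≡ map (renameLink (g ∘ h)) E
rename-∘ g h E = trans (sym (map-∘ E)) (map-cong (renameLink-∘ g h) E)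

module _ {A : Set} where

  excess-[]⁻ : (xs ys : List A) → drop (length ys) xs ++ drop (length xs) ys ≡ [] → length xs ≡ length ys
  excess-[]⁻ [] [] _ = refl
  excess-[]⁻ (x ∷ xs) (y ∷ ys) eq = cong suc (excess-[]⁻ xs ys eq)

  excess-[]⁺ : (xs ys : List A) → length xs ≡ length ys → drop (length ys) xs ++ drop (length xs) ys ≡ []
  excess-[]⁺ [] [] _ = refl
  excess-[]⁺ (x ∷ xs) (y ∷ ys) eq = excess-[]⁺ xs ys (ℕ.suc-injective eq)

nonempty-∷ : ∀ {A : Set} {xs : List A} {n} → length xs ≡ suc n → ∃[ y ] ∃[ ys ] xs ≡ y ∷ ys
nonempty-∷ {xs = y ∷ ys} _ = y , ys , refl

#_ : Net → ℕ
# S = length (conclₙ S)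

interaction-closed : ∀ S T → # S ≡ # T → concl (interaction S T) ≡ []
interaction-closed S T eq = excess-[]⁺ (map evenly (conclₙ S)) (map oddly (conclₙ T))
  (trans (length-map evenly (conclₙ S)) (trans eq (sym (length-map oddly (conclₙ T)))))

⟂⇒#≡ : ∀ S T → S ⟂ T → # S ≡ # T
⟂⇒#≡ S T r = trans (sym (length-map evenly (conclₙ S)))
  (trans (excess-[]⁻ (map evenly (conclₙ S)) (map oddly (conclₙ T)) (⟶*-closed r))
    (length-map oddly (conclₙ T)))

⟂-intro : ∀ S T → # S ≡ # T → Wins (links (interaction S T)) → S ⟂ T
⟂-intro S T eq w = w _ ↭-refl (interaction-closed S T eq)

-- Exchanging even and odd positions maps the links of one interaction onto those of the other, with
-- every cut reversed.
⟂-sym : ∀ S T → S ⟂ T → T ⟂ S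
⟂-sym S T r = ⟂-intro T S (sym (⟂⇒#≡ S T r))
  (wins-resp-↭ (shifts (map (renameLink evenly) (linksₙ T)) (map (renameLink oddly) (linksₙ S)))
    (⟶*-iso inj r (Pointwise-++⁺ (rename-iso (join-even oddly evenly) (linksₙ S))
      (Pointwise-++⁺ (rename-iso (join-odd oddly evenly) (linksₙ T)) (cuts (conclₙ S) (conclₙ T))))))
  where
  f = join oddly evenly
  inj : Injective f
  inj = join-injective oddly-injective evenly-injective (λ p q eq → evenly≢oddly q p (sym eq))
  cuts : ∀ ps qs → LinksIso f (zipWith cut (map evenly ps) (map oddly qs))
    (zipWith cut (map evenly qs) (map oddly ps))
  cuts [] [] = []
  cuts [] (_ ∷ _) = []
  cuts (_ ∷ _) [] = []
  cuts (p ∷ ps) (q ∷ qs) =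
    subst₂ (λ a b → LinkIso f (cut (evenly p) (oddly q)) (cut a b)) (join-odd oddly evenly q)
      (join-even oddly evenly p) cut′
    ∷ cuts ps qs

Singleton : Net → Set
Singleton T = ∃[ t ] conclₙ T ≡ t ∷ []

interaction-isNet : ∀ R T → Singleton T → ∀ {r rs} → conclₙ R ≡ r ∷ rs →
                    IsNet (graph (links (interaction R T)) (map evenly rs))
interaction-isNet R@(net (graph E _) N) T@(net (graph F _) M) (t , refl) {r} {rs} refl =
  subst (λ C → IsNet (graph (eR ++ oT ++ c ∷ C) (map evenly rs))) (sym (zipWith-zeroʳ cut (map evenly rs)))
    (balance⇒isNet (All.++⁺ dR (All.++⁺ dT ((λ { (_ , ()) }) ∷ []))) u σ)
  where
  B = ∥ᴳ-isNet N M
  eR = map (renameLink evenly) E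
  oT = map (renameLink oddly) F
  dR = All.++⁻ˡ eR (IsNet.source#target B)
  dT = All.++⁻ʳ eR (IsNet.source#target B)
  X = eR ++ oT
  c = cut (evenly r) (oddly t)
  t≡ : targets (eR ++ oT ++ c ∷ []) ≡ targets X
  t≡ = trans (cong targets (sym (++-assoc eR oT _))) (trans (concatMap-++ target X (c ∷ [])) (++-identityʳ _))
  s≡ : sources (eR ++ oT ++ c ∷ []) ≡ sources X ++ source c
  s≡ = trans (cong sources (sym (++-assoc eR oT _))) (concatMap-++ source X (c ∷ []))
  u = subst Unique (sym t≡) (IsNet.targets-unique B)
  σ : targets (eR ++ oT ++ c ∷ []) ↭ sources (eR ++ oT ++ c ∷ []) ++ map evenly rs
  σ rewrite t≡ | s≡ = ↭-trans (balance B)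
    (solve 4 (λ s r rs t → s ⊕ ((r ⊕ rs) ⊕ t) ⊜ (s ⊕ (r ⊕ t)) ⊕ rs) ↭-refl
      (sources X) (evenly r ∷ []) (map evenly rs) (oddly t ∷ []))

feed : ∀ R T → Singleton T → ∀ {r rs} → conclₙ R ≡ r ∷ rs → Net
feed R T s eq = net _ (interaction-isNet R T s eq)

module _ (R T V : Net) (r : Pos) (rs : List Pos) (t : Pos) where

  -- Both `interaction R (T ∥ₙ V)` and `interaction (feed R T s eq) V` consist of the three nets and
  -- the same cuts. Only the three renamings differ, so associativity reduces to an injection
  -- translating one triple of renamings into the other.
  threefold : (g₁ g₂ g₃ : Pos → Pos) → List Link
  threefold g₁ g₂ g₃ = map (renameLink g₁) (linksₙ R) ++ map (renameLink g₂) (linksₙ T) ++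
    map (renameLink g₃) (linksₙ V) ++ cut (g₁ r) (g₂ t) ∷ zipWith cut (map g₁ rs) (map g₃ (conclₙ V))

  threefold-iso : ∀ {f g₁ g₂ g₃ h₁ h₂ h₃} → (∀ p → f (g₁ p) ≡ h₁ p) → (∀ p → f (g₂ p) ≡ h₂ p) →
                  (∀ p → f (g₃ p) ≡ h₃ p) → LinksIso f (threefold g₁ g₂ g₃) (threefold h₁ h₂ h₃)
  threefold-iso {f} {g₁} {g₂} {g₃} {h₁} {h₂} {h₃} e₁ e₂ e₃ =
    Pointwise-++⁺ (rename-iso e₁ (linksₙ R)) (Pointwise-++⁺ (rename-iso e₂ (linksₙ T))
      (Pointwise-++⁺ (rename-iso e₃ (linksₙ V))
        (subst₂ (λ a b → LinkIso f (cut (g₁ r) (g₂ t)) (cut a b)) (e₁ r) (e₂ t) cut ∷ cuts rs (conclₙ V))))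
    where
    cuts : ∀ ps qs → LinksIso f (zipWith cut (map g₁ ps) (map g₃ qs)) (zipWith cut (map h₁ ps) (map h₃ qs))
    cuts [] _ = []
    cuts (_ ∷ _) [] = []
    cuts (p ∷ ps) (q ∷ qs) =
      subst₂ (λ a b → LinkIso f (cut (g₁ p) (g₃ q)) (cut a b)) (e₁ p) (e₃ q) cut ∷ cuts ps qs

interaction-∥ : ∀ R T V (s : Singleton T) {r rs} → conclₙ R ≡ r ∷ rs →
  links (interaction R (T ∥ₙ V)) ↭ threefold R T V r rs (proj₁ s) evenly (oddly ∘ evenly) (oddly ∘ oddly)
interaction-∥ (net (graph E _) _) (net (graph F _) _) V (t , refl) {r} {rs} refl =
  ++⁺ˡ (map (renameLink evenly) E) (↭-reflexive (trans
    (cong₂ _++_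
      (trans (map-++ (renameLink oddly) (map (renameLink evenly) F) (map (renameLink oddly) (linksₙ V)))
        (cong₂ _++_ (rename-∘ oddly evenly F) (rename-∘ oddly oddly (linksₙ V))))
      (cong (λ vs → cut (evenly r) (oddly (evenly t)) ∷ zipWith cut (map evenly rs) vs)
        (sym (map-∘ (conclₙ V)))))
    (++-assoc (map (renameLink (oddly ∘ evenly)) F) _ _)))

interaction-feed : ∀ R T V (s : Singleton T) {r rs} (eq : conclₙ R ≡ r ∷ rs) →
  links (interaction (feed R T s eq) V) ↭ threefold R T V r rs (proj₁ s) (evenly ∘ evenly)
    (evenly ∘ oddly) oddly
interaction-feed (net (graph E _) _) (net (graph F _) _) V (t , refl) {r} {rs} refl = ↭-trans
  (↭-reflexive (cong₂ _++_
    (trans (map-++ (renameLink evenly) (map (renameLink evenly) E) _)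
      (cong₂ _++_ (rename-∘ evenly evenly E)
        (trans (map-++ (renameLink evenly) (map (renameLink oddly) F) _)
          (cong₂ _++_ (rename-∘ evenly oddly F)
            (cong (λ C → cut (evenly (evenly r)) (evenly (oddly t)) ∷ map (renameLink evenly) C)
              (zipWith-zeroʳ cut (map evenly rs)))))))
    (cong (λ us → map (renameLink oddly) (linksₙ V) ++ zipWith cut us (map oddly (conclₙ V)))
      (sym (map-∘ rs)))))
  (solve 5 (λ a b c d e → (a ⊕ (b ⊕ c)) ⊕ (d ⊕ e) ⊜ a ⊕ (b ⊕ (d ⊕ (c ⊕ e)))) ↭-refl
    (map (renameLink (evenly ∘ evenly)) E) (map (renameLink (evenly ∘ oddly)) F)
    (cut (evenly (evenly r)) (evenly (oddly t)) ∷ []) (map (renameLink oddly) (linksₙ V)) _)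

module _ (R T V : Net) (s : Singleton T) {r : Pos} {rs : List Pos} (eq : conclₙ R ≡ r ∷ rs) where

  private
    t = proj₁ s

    #∥ : # (T ∥ₙ V) ≡ suc (# V)
    #∥ rewrite proj₂ s = cong suc (length-map oddly (conclₙ V))

    #feed : suc (# (feed R T s eq)) ≡ # R
    #feed rewrite eq = cong suc (length-map evenly rs)

  ⟂-feed : R ⟂ (T ∥ₙ V) → feed R T s eq ⟂ V
  ⟂-feed o = ⟂-intro (feed R T s eq) V (ℕ.suc-injective (trans #feed (trans (⟂⇒#≡ R (T ∥ₙ V) o) #∥)))
    λ H σ c → ⟶*-iso inj o is H (↭-trans σ (↭-trans (interaction-feed R T V s eq) τ)) c
    where
    -- The positions of `R`, `T`, `V` have the forms 2n, 4n+1, 4n+3 in the interaction with the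
    -- juxtaposition, and 4n, 4n+2, 2n+1 in the interaction of the fed net.
    f = join (evenly ∘ evenly) (join (evenly ∘ oddly) oddly)
    Y = threefold-iso R T V r rs t {f = f} {evenly} {oddly ∘ evenly} {oddly ∘ oddly}
          {evenly ∘ evenly} {evenly ∘ oddly} {oddly}
          (join-even _ _)
          (λ p → trans (join-odd (evenly ∘ evenly) (join (evenly ∘ oddly) oddly) (evenly p))
            (join-even (evenly ∘ oddly) oddly p))
          (λ p → trans (join-odd (evenly ∘ evenly) (join (evenly ∘ oddly) oddly) (oddly p))
            (join-odd (evenly ∘ oddly) oddly p))
    P = Pointwise-↭ (↭-sym (interaction-∥ R T V s eq)) Y
    is = proj₁ (proj₂ P)
    τ = proj₂ (proj₂ P)
    inj : Injective f
    inj = join-injective (evenly-injective ∘ evenly-injective)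
      (join-injective (oddly-injective ∘ evenly-injective) oddly-injective (λ p q → evenly≢oddly (oddly p) q))
      λ p q e → case parity q of λ
        { (even m) → evenly≢oddly p m (evenly-injective (trans e (join-even _ _ m)))
        ; (odd m)  → evenly≢oddly (evenly p) m (trans e (join-odd _ _ m)) }

  feed-⟂ : feed R T s eq ⟂ V → R ⟂ (T ∥ₙ V)
  feed-⟂ o = ⟂-intro R (T ∥ₙ V) (trans (sym #feed) (trans (cong suc (⟂⇒#≡ (feed R T s eq) V o)) (sym #∥)))
    λ H σ c → ⟶*-iso inj o is H (↭-trans σ (↭-trans (interaction-∥ R T V s eq) τ)) c
    where
    f = join (join evenly (oddly ∘ evenly)) (oddly ∘ oddly)
    Y = threefold-iso R T V r rs t {f = f} {evenly ∘ evenly} {evenly ∘ oddly} {oddly}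
          {evenly} {oddly ∘ evenly} {oddly ∘ oddly}
          (λ p → trans (join-even _ _ (evenly p)) (join-even evenly _ p))
          (λ p → trans (join-even _ _ (oddly p)) (join-odd evenly _ p))
          (join-odd _ _)
    P = Pointwise-↭ (↭-sym (interaction-feed R T V s eq)) Y
    is = proj₁ (proj₂ P)
    τ = proj₂ (proj₂ P)
    inj : Injective f
    inj = join-injective
      (join-injective evenly-injective (evenly-injective ∘ oddly-injective) (λ p q → evenly≢oddly p (evenly q)))
      (oddly-injective ∘ oddly-injective)
      λ p q e → case parity p of λ
        { (even m) → evenly≢oddly m (oddly q) (trans (sym (join-even evenly _ m)) e)
        ; (odd m)  → evenly≢oddly m q (oddly-injective (trans (sym (join-odd evenly _ m)) e)) }

-- Removing the inner bi-orthogonals.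

juxtapositions : List NetSet → NetSet
juxtapositions []           = _≡ emptyNet
juxtapositions (𝐀 ∷ [])     = 𝐀
juxtapositions (𝐀 ∷ 𝐁 ∷ 𝐂s) = Juxtaposition 𝐀 (juxtapositions (𝐁 ∷ 𝐂s))

⊆ᗮᗮ : ∀ {𝐀 : NetSet} {T} → 𝐀 T → ((𝐀 ᗮ) ᗮ) T
⊆ᗮᗮ {T = T} T∈ R R⟂ = ⟂-sym R T (R⟂ T T∈)

⟂ᗮᗮ : ∀ {𝐀 : NetSet} {S} → S ⟂ˢ 𝐀 → S ⟂ˢ ((𝐀 ᗮ) ᗮ)
⟂ᗮᗮ {S = S} S⟂ T T∈ = ⟂-sym T S (T∈ S S⟂)

-- A set is contained in its bi-orthogonal, and this is applied at every level of the nesting.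
-- Orthogonality to `parallel` therefore yields orthogonality to plain juxtapositions; `⟂-parallel`
-- goes the other way.
juxtapositions⊆parallel : ∀ 𝐀s {T} → juxtapositions 𝐀s T → parallel 𝐀s T
juxtapositions⊆parallel [] eq = ⊆ᗮᗮ {_≡ emptyNet} eq
juxtapositions⊆parallel (𝐀 ∷ []) T∈ = T∈
juxtapositions⊆parallel (𝐀 ∷ 𝐁 ∷ 𝐂s) (juxtapose a b) =
  ⊆ᗮᗮ {Juxtaposition 𝐀 (parallel (𝐁 ∷ 𝐂s))} (juxtapose a (juxtapositions⊆parallel (𝐁 ∷ 𝐂s) b))

data AllSingleton : List NetSet → Set₁ where
  []  : AllSingleton []
  _∷_ : ∀ {𝐀 𝐀s} → (∀ {T} → 𝐀 T → Singleton T) → AllSingleton 𝐀s → AllSingleton (𝐀 ∷ 𝐀s)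

-- R is orthogonal to T ∥ U exactly when the net obtained by cutting T against the
-- first conclusion of R is orthogonal to U; the latter lets the inner
-- bi-orthogonals be removed one at a time.
⟂-parallel : ∀ 𝐀s → AllSingleton 𝐀s → ∀ R → # R ≡ length 𝐀s →
             R ⟂ˢ juxtapositions 𝐀s → R ⟂ˢ parallel 𝐀s
⟂-parallel [] [] R _ R⟂ = ⟂ᗮᗮ {_≡ emptyNet} {R} R⟂
⟂-parallel (𝐀 ∷ []) _ R _ R⟂ = R⟂
⟂-parallel (𝐀 ∷ 𝐁 ∷ 𝐂s) (s ∷ ss) R #R R⟂ =
  ⟂ᗮᗮ {Juxtaposition 𝐀 (parallel (𝐁 ∷ 𝐂s))} {R} λ { _ (juxtapose {T} {U} a b) → go T U a b }
  where
  go : ∀ T U → 𝐀 T → parallel (𝐁 ∷ 𝐂s) U → R ⟂ (T ∥ₙ U)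
  go T U a b with r , rs , eq ← nonempty-∷ #R = feed-⟂ R T U (s a) eq
    (⟂-parallel (𝐁 ∷ 𝐂s) ss (feed R T (s a) eq)
      (trans (length-map evenly rs) (ℕ.suc-injective (trans (sym (cong length eq)) #R)))
      (λ V V∈ → ⟂-feed R T V (s a) eq (R⟂ (T ∥ₙ V) (juxtapose a V∈))) U b)

-- Cut-free nets as forests

data Kind : Set where
  tensor parr : Kind

dualᵏ : Kind → Kind
dualᵏ tensor = parr
dualᵏ parr   = tensor

connective : Kind → Pos → Pos → Pos → Link
connective tensor = ten
connective parr   = par

data Tree : Set where
  leaf : Pos → Tree
  node : Kind → Pos → Tree → Tree → Tree

root : Tree → Pos
root (leaf p)       = p
root (node _ p _ _) = p

treeLinks : Tree → List Link
treeLinks (leaf p)       = []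
treeLinks (node k p t u) = connective k (root t) (root u) p ∷ treeLinks t ++ treeLinks u

leaves : Tree → List Pos
leaves (leaf p)       = p ∷ []
leaves (node _ _ t u) = leaves t ++ leaves u

occurrences : Tree → List Pos
occurrences (leaf p)       = p ∷ []
occurrences (node _ p t u) = p ∷ occurrences t ++ occurrences u

forestLinks : List Tree → List Link
forestLinks = concatMap treeLinks

forestLeaves forestOccurrences : List Tree → List Pos
forestLeaves      = concatMap leaves
forestOccurrences = concatMap occurrences

dualTree : Tree → Tree
dualTree (leaf p)       = leaf p
dualTree (node k p t u) = node (dualᵏ k) p (dualTree t) (dualTree u)

-- The positions of the inner nodes are forgotten, so that trees of different nets
-- can be compared.
data Painted (X : Set) : Set where
  leaf : X → Painted X
  node : Kind → Painted X → Painted X → Painted X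

paint : {X : Set} → (Pos → X) → Tree → Painted X
paint e (leaf p)       = leaf (e p)
paint e (node k _ t u) = node k (paint e t) (paint e u)

dualᵖ : {X : Set} → Painted X → Painted X
dualᵖ (leaf x)     = leaf x
dualᵖ (node k s t) = node (dualᵏ k) (dualᵖ s) (dualᵖ t)

Shape : Set
Shape = Painted ⊤

shape : Tree → Shape
shape = paint (λ _ → tt)

target-connective : ∀ k {p q r} → target (connective k p q r) ≡ r ∷ []
target-connective tensor = refl
target-connective parr   = refl

source-connective : ∀ k {p q r} → source (connective k p q r) ≡ p ∷ q ∷ []
source-connective tensor = refl
source-connective parr   = refl

root∈ : ∀ t → root t ∈ occurrences t
root∈ (leaf p)       = here refl
root∈ (node _ p _ _) = here refl

leaves⊆occurrences : ∀ t → leaves t ⊆ occurrences t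
leaves⊆occurrences (leaf p) m = m
leaves⊆occurrences (node _ p t u) m with ∈-++⁻ (leaves t) m
... | inj₁ m′ = there (∈-++⁺ˡ (leaves⊆occurrences t m′))
... | inj₂ m′ = there (∈-++⁺ʳ (occurrences t) (leaves⊆occurrences u m′))

tree-balance : ∀ t → targets (treeLinks t) ++ leaves t ↭ root t ∷ sources (treeLinks t)
tree-balance (leaf p) = ↭-refl
tree-balance (node k p t u)
  rewrite target-connective k {root t} {root u} {p} | source-connective k {root t} {root u} {p}
    | concatMap-++ target (treeLinks t) (treeLinks u) | concatMap-++ source (treeLinks t) (treeLinks u) =
  prep p (↭-trans
    (solve 4 (λ a b c d → (a ⊕ b) ⊕ (c ⊕ d) ⊜ (a ⊕ c) ⊕ (b ⊕ d)) ↭-refl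
      (targets (treeLinks t)) (targets (treeLinks u)) (leaves t) (leaves u))
    (↭-trans (++⁺ (tree-balance t) (tree-balance u))
      (solve 4 (λ a b c d → (a ⊕ c) ⊕ (b ⊕ d) ⊜ a ⊕ (b ⊕ (c ⊕ d))) ↭-refl
        (root t ∷ []) (root u ∷ []) (sources (treeLinks t)) (sources (treeLinks u)))))

occurrences-↭ : ∀ t → targets (treeLinks t) ++ leaves t ↭ occurrences t
occurrences-↭ (leaf p) = ↭-refl
occurrences-↭ (node k p t u)
  rewrite target-connective k {root t} {root u} {p} | concatMap-++ target (treeLinks t) (treeLinks u) =
  prep p (↭-trans
    (solve 4 (λ a b c d → (a ⊕ b) ⊕ (c ⊕ d) ⊜ (a ⊕ c) ⊕ (b ⊕ d)) ↭-refl
      (targets (treeLinks t)) (targets (treeLinks u)) (leaves t) (leaves u))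
    (++⁺ (occurrences-↭ t) (occurrences-↭ u)))

forest-balance : ∀ ts → targets (forestLinks ts) ++ forestLeaves ts ↭ sources (forestLinks ts) ++ map root ts
forest-balance [] = ↭-refl
forest-balance (t ∷ ts)
  rewrite concatMap-++ target (treeLinks t) (forestLinks ts) | concatMap-++ source (treeLinks t)
    (forestLinks ts) =
  ↭-trans
    (solve 4 (λ a b c d → (a ⊕ b) ⊕ (c ⊕ d) ⊜ (a ⊕ c) ⊕ (b ⊕ d)) ↭-refl
      (targets (treeLinks t)) (targets (forestLinks ts)) (leaves t) (forestLeaves ts))
    (↭-trans (++⁺ (tree-balance t) (forest-balance ts))
      (solve 4 (λ r s s′ rs → (r ⊕ s) ⊕ (s′ ⊕ rs) ⊜ (s ⊕ s′) ⊕ (r ⊕ rs)) ↭-refl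
        (root t ∷ []) (sources (treeLinks t)) (sources (forestLinks ts)) (map root ts)))

forestOccurrences-↭ : ∀ ts → targets (forestLinks ts) ++ forestLeaves ts ↭ forestOccurrences ts
forestOccurrences-↭ [] = ↭-refl
forestOccurrences-↭ (t ∷ ts) rewrite concatMap-++ target (treeLinks t) (forestLinks ts) =
  ↭-trans
    (solve 4 (λ a b c d → (a ⊕ b) ⊕ (c ⊕ d) ⊜ (a ⊕ c) ⊕ (b ⊕ d)) ↭-refl
      (targets (treeLinks t)) (targets (forestLinks ts)) (leaves t) (forestLeaves ts))
    (++⁺ (occurrences-↭ t) (forestOccurrences-↭ ts))

-- The blocks `bs` are the output lists of the daimons. Distinctness of positions is kept apart, as
-- `Unique (forestOccurrences ts)`, so that the record itself is preserved by every renaming.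
record IsForest (G : Graph) (ts : List Tree) (bs : List (List Pos)) : Set where
  field
    links-↭  : links G ↭ map dai bs ++ forestLinks ts
    leaves-↭ : concat bs ↭ forestLeaves ts
    concl-≡  : concl G ≡ map root ts

targets-dai : ∀ bs → targets (map dai bs) ≡ concat bs
targets-dai []       = refl
targets-dai (b ∷ bs) = cong (b ++_) (targets-dai bs)

sources-dai : ∀ bs → sources (map dai bs) ≡ []
sources-dai []       = refl
sources-dai (b ∷ bs) = sources-dai bs

module _ {G ts bs} (R : IsForest G ts bs) where

  open IsForest R

  targets-forest : targets (links G) ↭ forestOccurrences ts
  targets-forest = ↭-trans (targets-↭ links-↭) (↭-trans
    (↭-reflexive (trans (concatMap-++ target (map dai bs) (forestLinks ts))
      (cong (_++ targets (forestLinks ts)) (targets-dai bs))))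
    (↭-trans (++⁺ʳ _ leaves-↭) (↭-trans (++-comm (forestLeaves ts) _) (forestOccurrences-↭ ts))))

  forest-net-balance : targets (links G) ↭ sources (links G) ++ concl G
  forest-net-balance = ↭-trans (targets-↭ links-↭) (↭-trans
    (↭-reflexive (trans (concatMap-++ target (map dai bs) (forestLinks ts))
      (cong (_++ targets (forestLinks ts)) (targets-dai bs))))
    (↭-trans (++⁺ʳ _ leaves-↭) (↭-trans (++-comm (forestLeaves ts) _) (↭-trans (forest-balance ts)
      (++⁺ (↭-trans
        (↭-reflexive (sym (trans (concatMap-++ source (map dai bs) (forestLinks ts))
          (cong (_++ sources (forestLinks ts)) (sources-dai bs)))))
        (sources-↭ (↭-sym links-↭)))
      (↭-reflexive (sym concl-≡)))))))

unique-children : ∀ {k p t u} → Unique (occurrences (node k p t u)) → Unique (occurrences t) × Unique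
  (occurrences u)
unique-children {t = t} (_ ∷ w) = let (a , b , _) = Unique-++⁻ (occurrences t) w in a , b

treeLinks-disjoint : ∀ t → Unique (occurrences t) → All (λ l → Disjoint (source l) (target l)) (treeLinks t)
treeLinks-disjoint (leaf p) _ = []
treeLinks-disjoint (node k p t u) w = d k ∷
    All.++⁺ (treeLinks-disjoint t (proj₁ (unique-children {k} {p} {t} {u} w)))
            (treeLinks-disjoint u (proj₂ (unique-children {k} {p} {t} {u} w)))
  where
  p∉ = Unique-head w
  d : ∀ k → Disjoint (source (connective k (root t) (root u) p)) (target (connective k (root t) (root u) p))
  d tensor (here refl , here refl) = p∉ (∈-++⁺ˡ (root∈ t))
  d tensor (there (here refl) , here refl) = p∉ (∈-++⁺ʳ (occurrences t) (root∈ u))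
  d parr (here refl , here refl) = p∉ (∈-++⁺ˡ (root∈ t))
  d parr (there (here refl) , here refl) = p∉ (∈-++⁺ʳ (occurrences t) (root∈ u))

forestLinks-disjoint : ∀ ts → Unique (forestOccurrences ts) → All (λ l → Disjoint (source l) (target l))
  (forestLinks ts)
forestLinks-disjoint [] _ = []
forestLinks-disjoint (t ∷ ts) u with a , b , _ ← Unique-++⁻ (occurrences t) u =
  All.++⁺ (treeLinks-disjoint t a) (forestLinks-disjoint ts b)

isForest⇒isNet : ∀ {G ts bs} → IsForest G ts bs → Unique (forestOccurrences ts) → IsNet G
isForest⇒isNet {G} {ts} {bs} R u = balance⇒isNet
  (All-resp-↭ (↭-sym (IsForest.links-↭ R)) (All.++⁺ (All.map⁺ (All.tabulate {xs = bs} λ _ → λ ()))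
    (forestLinks-disjoint ts u)))
  (Unique-resp-↭ (↭-sym (targets-forest R)) u)
  (forest-net-balance R)

unique-occurrences : ∀ {S ts bs} → IsForest (body S) ts bs → Unique (forestOccurrences ts)
unique-occurrences {S} R = Unique-resp-↭ (targets-forest R) (IsNet.targets-unique (isNet S))

renameTree : (Pos → Pos) → Tree → Tree
renameTree f (leaf p)       = leaf (f p)
renameTree f (node k p t u) = node k (f p) (renameTree f t) (renameTree f u)

root-rename : ∀ f t → root (renameTree f t) ≡ f (root t)
root-rename f (leaf p)       = refl
root-rename f (node _ _ _ _) = refl

leaves-rename : ∀ f t → leaves (renameTree f t) ≡ map f (leaves t)
leaves-rename f (leaf p) = refl
leaves-rename f (node _ _ t u) =
  trans (cong₂ _++_ (leaves-rename f t) (leaves-rename f u)) (sym (map-++ f (leaves t) (leaves u)))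

treeLinks-rename : ∀ f t → treeLinks (renameTree f t) ≡ map (renameLink f) (treeLinks t)
treeLinks-rename f (leaf p) = refl
treeLinks-rename f (node k p t u) = cong₂ _∷_ (l k)
  (trans (cong₂ _++_ (treeLinks-rename f t) (treeLinks-rename f u))
    (sym (map-++ (renameLink f) (treeLinks t) (treeLinks u))))
  where
  l : ∀ k → connective k (root (renameTree f t)) (root (renameTree f u)) (f p) ≡ renameLink f
    (connective k (root t) (root u) p)
  l tensor = cong₂ (λ a b → ten a b (f p)) (root-rename f t) (root-rename f u)
  l parr   = cong₂ (λ a b → par a b (f p)) (root-rename f t) (root-rename f u)

paint-rename : ∀ {X} (e : Pos → X) f t → paint e (renameTree f t) ≡ paint (e ∘ f) t
paint-rename e f (leaf p) = refl
paint-rename e f (node k p t u) = cong₂ (node k) (paint-rename e f t) (paint-rename e f u)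

paint-cong : ∀ {X} {e e′ : Pos → X} → (∀ p → e p ≡ e′ p) → ∀ t → paint e t ≡ paint e′ t
paint-cong eq (leaf p) = cong leaf (eq p)
paint-cong eq (node k p t u) = cong₂ (node k) (paint-cong eq t) (paint-cong eq u)

forestLinks-rename : ∀ f ts → forestLinks (map (renameTree f) ts) ≡ map (renameLink f) (forestLinks ts)
forestLinks-rename f [] = refl
forestLinks-rename f (t ∷ ts) =
  trans (cong₂ _++_ (treeLinks-rename f t) (forestLinks-rename f ts))
    (sym (map-++ (renameLink f) (treeLinks t) (forestLinks ts)))

forestLeaves-rename : ∀ f ts → forestLeaves (map (renameTree f) ts) ≡ map f (forestLeaves ts)
forestLeaves-rename f [] = refl
forestLeaves-rename f (t ∷ ts) =
  trans (cong₂ _++_ (leaves-rename f t) (forestLeaves-rename f ts))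
    (sym (map-++ f (leaves t) (forestLeaves ts)))

concat-rename : ∀ (f : Pos → Pos) bs → concat (map (map f) bs) ≡ map f (concat bs)
concat-rename f [] = refl
concat-rename f (b ∷ bs) = trans (cong (map f b ++_) (concat-rename f bs)) (sym (map-++ f b (concat bs)))

rename-dai : ∀ f bs → map (renameLink f) (map dai bs) ≡ map dai (map (map f) bs)
rename-dai f bs = trans (sym (map-∘ bs)) (map-∘ bs)

rename-isForest : ∀ f {G ts bs} → IsForest G ts bs → IsForest (rename f G) (map (renameTree f) ts)
  (map (map f) bs)
rename-isForest f {G} {ts} {bs} R = record
  { links-↭  = ↭-trans (map⁺ (renameLink f) links-↭) (↭-reflexive (trans
      (map-++ (renameLink f) (map dai bs) (forestLinks ts))
      (cong₂ _++_ (rename-dai f bs) (sym (forestLinks-rename f ts)))))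
  ; leaves-↭ = ↭-trans (↭-reflexive (concat-rename f bs)) (↭-trans (map⁺ f leaves-↭)
      (↭-reflexive (sym (forestLeaves-rename f ts))))
  ; concl-≡  = trans (cong (map f) concl-≡) (trans (sym (map-∘ ts))
      (trans (map-cong (λ t → sym (root-rename f t)) ts) (map-∘ ts)))
  }
  where open IsForest R

concat-++ : ∀ {A : Set} (xs ys : List (List A)) → concat (xs ++ ys) ≡ concat xs ++ concat ys
concat-++ [] ys = refl
concat-++ (x ∷ xs) ys = trans (cong (x ++_) (concat-++ xs ys)) (sym (++-assoc x _ _))

sum-isForest : ∀ {G H ts us bs cs} → IsForest G ts bs → IsForest H us cs →
                 IsForest (graph (links G ++ links H) (concl G ++ concl H)) (ts ++ us) (bs ++ cs)
sum-isForest {G} {H} {ts} {us} {bs} {cs} R Q = record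
  { links-↭  = ↭-trans (++⁺ R.links-↭ Q.links-↭) (↭-trans
      (solve 4 (λ a b c d → (a ⊕ b) ⊕ (c ⊕ d) ⊜ (a ⊕ c) ⊕ (b ⊕ d)) ↭-refl (map dai bs) _ (map dai cs) _)
      (↭-reflexive (sym (cong₂ _++_ (map-++ dai bs cs) (concatMap-++ treeLinks ts us)))))
  ; leaves-↭ = ↭-trans (↭-reflexive (concat-++ bs cs)) (↭-trans (++⁺ R.leaves-↭ Q.leaves-↭)
      (↭-reflexive (sym (concatMap-++ leaves ts us))))
  ; concl-≡  = trans (cong₂ _++_ R.concl-≡ Q.concl-≡) (sym (map-++ root ts us))
  }
  where
  module R = IsForest R
  module Q = IsForest Q

∥-isForest : ∀ {G H ts us bs cs} → IsForest G ts bs → IsForest H us cs →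
  IsForest (G ∥ᴳ H) (map (renameTree evenly) ts ++ map (renameTree oddly) us)
                      (map (map evenly) bs ++ map (map oddly) cs)
∥-isForest R Q = sum-isForest (rename-isForest evenly R) (rename-isForest oddly Q)

-- Growing the trees of a labelled cut-free net.

Daimon : Link → Set
Daimon l = ∃[ ps ] l ≡ dai ps

daimons : ∀ {E} → All Daimon E → ∃[ bs ] E ≡ map dai bs
daimons [] = [] , refl
daimons ((ps , refl) ∷ ds) with bs , refl ← daimons ds = ps ∷ bs , refl

≤-sum : ∀ {A : Set} (w : A → ℕ) {x xs} → x ∈ xs → w x ≤ sum (map w xs)
≤-sum w (here refl) = ℕ.m≤m+n _ _
≤-sum w (there m)   = ℕ.≤-trans (≤-sum w m) (ℕ.m≤n+m _ _)

module Decomposition (𝒱 : PropositionalVariables) where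

  open MLL 𝒱

  formulaShape : Formula → Shape
  formulaShape (var _) = leaf tt
  formulaShape (A ⅋ B) = node parr (formulaShape A) (formulaShape B)
  formulaShape (A ⊗ B) = node tensor (formulaShape A) (formulaShape B)

  formulaShape-dual : ∀ A → formulaShape (A ^⊥) ≡ dualᵖ (formulaShape A)
  formulaShape-dual (var _) = refl
  formulaShape-dual (A ⅋ B) = cong₂ (node tensor) (formulaShape-dual A) (formulaShape-dual B)
  formulaShape-dual (A ⊗ B) = cong₂ (node parr) (formulaShape-dual A) (formulaShape-dual B)

  ⊗-injective : ∀ {A B C D} → A ⊗ B ≡ C ⊗ D → A ≡ C × B ≡ D
  ⊗-injective refl = refl , refl

  ⅋-injective : ∀ {A B C D} → A ⅋ B ≡ C ⅋ D → A ≡ C × B ≡ D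
  ⅋-injective refl = refl , refl

  size : Formula → ℕ
  size (var _) = 0
  size (A ⅋ B) = suc (size A + size B)
  size (A ⊗ B) = suc (size A + size B)

  module _ {S : Net} {τ : Pos → Formula} (cf : CutFree S) (lab : IsAtomicLabelling S τ) where

    open IsAtomicLabelling lab

    Atomic : Pos → Set
    Atomic q = ∃[ X ] τ q ≡ var X

    -- The list `E` is the pool of links not yet assigned to a tree, and `ds` holds open positions
    -- set aside. Balance of the pool is the invariant: it guarantees that each position still to be
    -- grown is an output of some link of the pool.
    Grown : List Pos → List Pos → List Link → Set
    Grown cs ds E = ∃[ ts ] ∃[ E′ ] map root ts ≡ cs × E ↭ forestLinks ts ++ E′ ×
      targets E′ ↭ sources E′ ++ forestLeaves ts ++ ds ×
      map shape ts ≡ map (formulaShape ∘ τ) cs × All Atomic (forestLeaves ts)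

    GrownTree : Pos → List Pos → List Link → Set
    GrownTree p ds E = ∃[ t ] ∃[ E′ ] root t ≡ p × E ↭ treeLinks t ++ E′ ×
      targets E′ ↭ sources E′ ++ leaves t ++ ds ×
      shape t ≡ formulaShape (τ p) × All Atomic (leaves t)

    -- The recursion is on the label: the premises of a connective have strictly smaller labels, so
    -- the growth upwards from `p` stops, and it stops at daimons because their outputs are labelled
    -- by variables.
    growTree : ∀ A {p ds E} → τ p ≡ A → E ⊆ linksₙ S → targets E ↭ sources E ++ p ∷ ds → GrownTree p ds E

    growNode : ∀ k (_∙_ : Formula → Formula → Formula) →
      (∀ A B → formulaShape (A ∙ B) ≡ node k (formulaShape A) (formulaShape B)) →
      ∀ {p₁ p₂ p ds E} → τ p ≡ τ p₁ ∙ τ p₂ →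
      (∀ {ds E} → E ⊆ linksₙ S → targets E ↭ sources E ++ p₁ ∷ ds → GrownTree p₁ ds E) →
      (∀ {ds E} → E ⊆ linksₙ S → targets E ↭ sources E ++ p₂ ∷ ds → GrownTree p₂ ds E) →
      E ⊆ linksₙ S → connective k p₁ p₂ p ∈ E → targets E ↭ sources E ++ p ∷ ds → GrownTree p ds E
    growNode k _∙_ shape-∙ {p₁} {p₂} {p} {ds} {E} eq grow₁ grow₂ E⊆ l∈ σ
      with E₁ , ρ ← ∈⇒↭ l∈
      with t , E₂ , refl , ρ₁ , σ₁ , s₁ , a₁ ← grow₁ {p₂ ∷ ds} {E₁}
             (λ m → E⊆ (∈-resp-↭ (↭-sym ρ) (there m)))
             (drop-∷ (↭-trans (↭-trans (↭-reflexive (cong (_++ targets E₁) (sym (target-connective k))))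
               (targets-↭ (↭-sym ρ))) (↭-trans σ (↭-trans (++⁺ʳ (p ∷ ds) (sources-↭ ρ))
               (↭-trans (↭-reflexive (cong (λ z → (z ++ sources E₁) ++ p ∷ ds) (source-connective k)))
               (solve 5 (λ a b s c d → ((a ⊕ b) ⊕ s) ⊕ (c ⊕ d) ⊜ c ⊕ (s ⊕ (a ⊕ (b ⊕ d)))) ↭-refl
                 (p₁ ∷ []) (p₂ ∷ []) (sources E₁) (p ∷ []) ds))))))
      with u , E₃ , refl , ρ₂ , σ₂ , s₂ , a₂ ← grow₂ {leaves t ++ ds} {E₂}
             (λ m → E⊆ (∈-resp-↭ (↭-sym ρ) (there (∈-resp-↭ (↭-sym ρ₁) (∈-++⁺ʳ (treeLinks t) m)))))
             (↭-trans σ₁ (solve 4 (λ s l b d → s ⊕ (l ⊕ (b ⊕ d)) ⊜ s ⊕ (b ⊕ (l ⊕ d))) ↭-refl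
               (sources E₂) (leaves t) (p₂ ∷ []) ds)) =
      node k p t u , E₃ , refl ,
      ↭-trans ρ (prep _ (↭-trans ρ₁ (↭-trans (++⁺ˡ (treeLinks t) ρ₂)
        (↭-reflexive (sym (++-assoc (treeLinks t) _ _)))))) ,
      ↭-trans σ₂ (++⁺ˡ (sources E₃)
        (solve 3 (λ a b d → a ⊕ (b ⊕ d) ⊜ (b ⊕ a) ⊕ d) ↭-refl (leaves u) (leaves t) ds)) ,
      trans (cong₂ (node k) s₁ s₂) (sym (trans (cong formulaShape eq) (shape-∙ _ _))) ,
      All.++⁺ a₁ a₂

    growTree A {p} {ds} {E} eq E⊆ σ with ∈-targets⁻ E (∈-resp-↭ (↭-sym σ) (∈-++⁺ʳ (sources E) (here refl)))
    growTree A {p} {ds} {E} eq E⊆ σ | dai ps , l∈ , m with X , eqX ← atomic (E⊆ l∈) m =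
      leaf p , E , refl , ↭-refl , σ , sym (cong formulaShape eqX) , (X , eqX) ∷ []
    growTree A eq E⊆ σ | ten p₁ p₂ p , l∈ , here refl with label-⊗ (E⊆ l∈)
    growTree (var x) eq E⊆ σ | ten p₁ p₂ p , l∈ , here refl | eq′ = case trans (sym eq) eq′ of λ ()
    growTree (A ⅋ B) eq E⊆ σ | ten p₁ p₂ p , l∈ , here refl | eq′ = case trans (sym eq) eq′ of λ ()
    growTree (A ⊗ B) eq E⊆ σ | ten p₁ p₂ p , l∈ , here refl | eq′ with eqˡ , eqʳ ← ⊗-injective
      (trans (sym eq′) eq) =
      growNode tensor _⊗_ (λ _ _ → refl) eq′ (growTree A eqˡ) (growTree B eqʳ) E⊆ l∈ σ
    growTree A eq E⊆ σ | par p₁ p₂ p , l∈ , here refl with label-⅋ (E⊆ l∈)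
    growTree (var x) eq E⊆ σ | par p₁ p₂ p , l∈ , here refl | eq′ = case trans (sym eq) eq′ of λ ()
    growTree (A ⊗ B) eq E⊆ σ | par p₁ p₂ p , l∈ , here refl | eq′ = case trans (sym eq) eq′ of λ ()
    growTree (A ⅋ B) eq E⊆ σ | par p₁ p₂ p , l∈ , here refl | eq′ with eqˡ , eqʳ ← ⅋-injective
      (trans (sym eq′) eq) =
      growNode parr _⅋_ (λ _ _ → refl) eq′ (growTree A eqˡ) (growTree B eqʳ) E⊆ l∈ σ

    growForest : ∀ cs {ds E} → E ⊆ linksₙ S → targets E ↭ sources E ++ cs ++ ds → Grown cs ds E
    growForest [] E⊆ σ = [] , _ , refl , ↭-refl , σ , refl , []
    growForest (c ∷ cs) {ds} {E} E⊆ σ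
      with t , E₁ , refl , ρ₁ , σ₁ , s₁ , a₁ ← growTree _ {c} {cs ++ ds} refl E⊆ σ
      with ts , E₂ , refl , ρ₂ , σ₂ , s₂ , a₂ ← growForest cs {leaves t ++ ds} {E₁}
             (λ m → E⊆ (∈-resp-↭ (↭-sym ρ₁) (∈-++⁺ʳ (treeLinks t) m)))
             (↭-trans σ₁ (++⁺ˡ (sources E₁) (shifts (leaves t) cs))) =
      t ∷ ts , E₂ , refl ,
      ↭-trans ρ₁ (↭-trans (++⁺ˡ (treeLinks t) ρ₂) (↭-reflexive (sym (++-assoc (treeLinks t) _ _)))) ,
      ↭-trans σ₂ (++⁺ˡ (sources E₂)
        (solve 3 (λ a b d → a ⊕ (b ⊕ d) ⊜ (b ⊕ a) ⊕ d) ↭-refl (forestLeaves ts) (leaves t) ds)) ,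
      cong₂ _∷_ s₁ s₂ , All.++⁺ a₁ a₂

    label-connective : ∀ k {p₁ p₂ p} → connective k p₁ p₂ p ∈ linksₙ S → size (τ p) ≡ suc
      (size (τ p₁) + size (τ p₂))
    label-connective tensor l∈ = cong size (label-⊗ l∈)
    label-connective parr   l∈ = cong size (label-⅋ l∈)

    -- A connective link left over would have an output that is again an input of
    -- a left-over connective link, with a larger label.
    no-connective : ∀ {E ds} → E ⊆ linksₙ S → targets E ↭ sources E ++ ds → All Atomic ds →
                    ∀ k {p₁ p₂ p} → connective k p₁ p₂ p ∉ E
    no-connective {E} {ds} E⊆ σ at k {p = p} l∈ = climb (sum (map (size ∘ τ) (targets E))) k l∈ (ℕ.m≤n+m _ _)
      where
      output∈ : ∀ k {p₁ p₂ p} → connective k p₁ p₂ p ∈ E → p ∈ targets E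
      output∈ k {p = p} l∈ = ∈-targets l∈ (subst (p ∈_) (sym (target-connective k)) (here refl))

      source⁻ : ∀ F {p} → p ∈ sources F → ∃[ l ] l ∈ F × p ∈ source l
      source⁻ (l ∷ F) m with ∈-++⁻ (source l) m
      ... | inj₁ m′ = l , here refl , m′
      ... | inj₂ m′ with l′ , l∈ , m″ ← source⁻ F m′ = l′ , there l∈ , m″

      larger : ∀ l {p} → l ∈ E → p ∈ source l → ∃[ k ] ∃[ p₁ ] ∃[ p₂ ] ∃[ q ] connective k p₁ p₂ q ∈ E × size
        (τ p) < size (τ q)
      larger (ten p₁ p₂ q) l∈ (here refl) = tensor , p₁ , p₂ , q , l∈ , subst (size (τ p₁) <_)
        (sym (label-connective tensor (E⊆ l∈))) (s≤s (ℕ.m≤m+n _ _))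
      larger (ten p₁ p₂ q) l∈ (there (here refl)) = tensor , p₁ , p₂ , q , l∈ , subst (size (τ p₂) <_)
        (sym (label-connective tensor (E⊆ l∈))) (s≤s (ℕ.m≤n+m _ _))
      larger (par p₁ p₂ q) l∈ (here refl) = parr , p₁ , p₂ , q , l∈ , subst (size (τ p₁) <_)
        (sym (label-connective parr (E⊆ l∈))) (s≤s (ℕ.m≤m+n _ _))
      larger (par p₁ p₂ q) l∈ (there (here refl)) = parr , p₁ , p₂ , q , l∈ , subst (size (τ p₂) <_)
        (sym (label-connective parr (E⊆ l∈))) (s≤s (ℕ.m≤n+m _ _))
      larger (cut p₁ p₂) l∈ m = ⊥-elim (cf p₁ p₂ (E⊆ l∈))

      -- The fuel `n` bounds how much the size of the label can still increase: no size exceeds the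
      -- sum of the sizes over all targets.
      climb : ∀ n k {p₁ p₂ p} → connective k p₁ p₂ p ∈ E → sum (map (size ∘ τ) (targets E)) ≤ size (τ p) + n → ⊥
      climb n k {p = p} l∈ b with ∈-++⁻ (sources E) (∈-resp-↭ σ (output∈ k l∈))
      ... | inj₂ d = ℕ.1+n≢0 (trans (sym (label-connective k (E⊆ l∈))) (cong size (proj₂ (All.lookup at d))))
      ... | inj₁ s with l′ , l′∈ , m ← source⁻ E s with k′ , _ , _ , q , l″∈ , lt ← larger l′ l′∈ m with n
      ... | zero = ℕ.<-irrefl refl (ℕ.≤-trans lt (ℕ.≤-trans (≤-sum (size ∘ τ) (output∈ k′ l″∈))
          (subst (_ ≤_) (ℕ.+-identityʳ _) b)))
      ... | suc n = climb n k′ l″∈ (ℕ.≤-trans b (ℕ.≤-trans (ℕ.≤-reflexive (ℕ.+-suc _ n)) (ℕ.+-monoˡ-≤ n lt)))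

    only-daimons : ∀ ts E → linksₙ S ↭ forestLinks ts ++ E → targets E ↭ sources E ++ forestLeaves ts →
                   All Atomic (forestLeaves ts) → ∀ l → l ∈ E → Daimon l
    only-daimons ts E ρ σ a l l∈ = go l l∈
      where
      E⊆ : E ⊆ linksₙ S
      E⊆ m = ∈-resp-↭ (↭-sym ρ) (∈-++⁺ʳ (forestLinks ts) m)
      go : ∀ l → l ∈ E → Daimon l
      go (ten p₁ p₂ p) m = ⊥-elim (no-connective E⊆ σ a tensor m)
      go (par p₁ p₂ p) m = ⊥-elim (no-connective E⊆ σ a parr m)
      go (cut p₁ p₂) m = ⊥-elim (cf p₁ p₂ (E⊆ m))
      go (dai ps) m = ps , refl

    decompose : ∃[ ts ] ∃[ bs ] IsForest (body S) ts bs × map shape ts ≡ map (formulaShape ∘ τ) (conclₙ S)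
    decompose
      with ts , E , r , ρ , σ , s , a ← growForest (conclₙ S) {[]} {linksₙ S} id
             (↭-trans (balance (isNet S)) (++⁺ˡ _ (↭-reflexive (sym (++-identityʳ (conclₙ S))))))
      with bs , refl ← daimons {E} (All.tabulate λ {l} → only-daimons ts E ρ
        (↭-trans σ (++⁺ˡ (sources E) (↭-reflexive (++-identityʳ _)))) a l)
      = ts , bs , record
        { links-↭  = ↭-trans ρ (++-comm (forestLinks ts) (map dai bs))
        ; leaves-↭ = ↭-trans (↭-reflexive (sym (targets-dai bs))) (↭-trans σ
            (↭-reflexive (trans (cong (_++ _) (sources-dai bs)) (++-identityʳ _))))
        ; concl-≡  = sym r
        } , s

-- Invariants of cut elimination

-- A pair does not record whether it comes from a tensor or a par, so the two sides of a cut between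
-- dual trees can carry the same value.
data Val : Set where
  atom : Bool → Val
  pair : Val → Val → Val

pair-injective : ∀ {v₁ v₂ w₁ w₂} → pair v₁ v₂ ≡ pair w₁ w₂ → v₁ ≡ w₁ × v₂ ≡ w₂
pair-injective refl = refl , refl

atom-injective : ∀ {b c} → atom b ≡ atom c → b ≡ c
atom-injective refl = refl

total : (Link → ℕ) → List Link → ℕ
total w E = sum (map w E)

total-↭ : ∀ w {E F} → E ↭ F → total w E ≡ total w F
total-↭ w σ = ℕ.sum-↭ (map⁺ w σ)

total-++ : ∀ w E F → total w (E ++ F) ≡ total w E + total w F
total-++ w E F = trans (cong sum (map-++ w E F)) (ℕ.sum-++ (map w E) (map w F))

isDai isJoin : Link → ℕ
isDai (dai _) = 1
isDai _       = 0
isJoin (ten _ _ _) = 1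
isJoin (cut _ _)   = 1
isJoin _           = 0

-- The number of daimons minus the number of tensors and cuts is invariant under
-- every reduction rule.
⟶*-weight : ∀ {G} → G ⟶* daimon₀ → total isDai (links G) ≡ suc (total isJoin (links G))
⟶*-weight ε = refl
⟶*-weight {G} (_◅_ {j = G′} (reduce {redex} {reduct} {context} r σ τ _) rs) =
  trans (total-↭ isDai σ) (trans (total-++ isDai redex context) (trans
    (lemma r (trans (sym (trans (total-↭ isDai τ) (total-++ isDai reduct context)))
      (trans (⟶*-weight rs) (cong suc (trans (total-↭ isJoin τ) (total-++ isJoin reduct context))))))
    (cong suc (sym (trans (total-↭ isJoin σ) (total-++ isJoin redex context))))))
  where
  lemma : ∀ {F E E′ m n} → Rule F E E′ → total isDai E′ + m ≡ suc (total isJoin E′ + n) →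
          total isDai E + m ≡ suc (total isJoin E + n)
  lemma (par/ten direct) eq  = eq
  lemma (par/ten swapped) eq = eq
  lemma (dai/dai direct) eq  = cong suc eq
  lemma (dai/dai swapped) eq = cong suc eq
  lemma (ten/dai direct _ _ _) eq  = eq
  lemma (ten/dai swapped _ _ _) eq = eq
  lemma (par/dai direct _ _ _ _ _) eq  = ℕ.suc-injective eq
  lemma (par/dai swapped _ _ _ _ _) eq = ℕ.suc-injective eq

dai-[]≢ : ∀ as {p bs} → dai [] ≢ dai (as ++ p ∷ bs)
dai-[]≢ [] ()
dai-[]≢ (_ ∷ _) ()

empty∉redex : ∀ {F E E′} → Rule F E E′ → dai [] ∉ E
empty∉redex (par/ten direct) (there (there (here ())))
empty∉redex (par/ten swapped) (there (there (here ())))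
empty∉redex (dai/dai {as = as} c) (here eq) = dai-[]≢ as eq
empty∉redex (dai/dai direct) (there (here ()))
empty∉redex (dai/dai swapped) (there (here ()))
empty∉redex (dai/dai {bs = bs} c) (there (there (here eq))) = dai-[]≢ bs eq
empty∉redex (ten/dai direct _ _ _) (there (here ()))
empty∉redex (ten/dai swapped _ _ _) (there (here ()))
empty∉redex (ten/dai {as = as} _ _ _ _) (there (there (here eq))) = dai-[]≢ as eq
empty∉redex (par/dai direct _ _ _ _ _) (there (here ()))
empty∉redex (par/dai swapped _ _ _ _ _) (there (here ()))
empty∉redex (par/dai {as = as} _ _ _ _ _ _) (there (there (here eq))) = dai-[]≢ as eq

reduct-nonempty : ∀ {F E E′ K} → Rule F E E′ → E′ ++ K ≢ []
reduct-nonempty (par/ten _) ()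
reduct-nonempty (dai/dai _) ()
reduct-nonempty (ten/dai _ _ _ _) ()
reduct-nonempty (par/dai _ _ _ _ _ _) ()

-- An empty daimon belongs to no redex, so it survives every step, and every reduct puts some link
-- beside it. Since the reduction must end with that daimon alone, no step can occur.
⟶*-empty : ∀ {G E} → G ⟶* daimon₀ → links G ↭ dai [] ∷ E → E ≡ []
⟶*-empty ε σ = ↭-empty-inv (↭-sym (drop-∷ σ))
⟶*-empty (reduce {redex} {reduct} {context} r σ τ _ ◅ rs) ρ
  with ∈-++⁻ redex (∈-resp-↭ σ (∈-resp-↭ (↭-sym ρ) (here refl)))
... | inj₁ m = ⊥-elim (empty∉redex r m)
... | inj₂ m with context′ , π ← ∈⇒↭ m =
  ⊥-elim (reduct-nonempty r (⟶*-empty rs (↭-trans τ (↭-trans (++⁺ˡ reduct π) (shift _ reduct context′)))))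

-- Relational experiments: R relates a position to the values it may carry, and a
-- daimon carries one boolean on all its outputs.
module Experiment (R : Pos → Val → Set) where

  -- Existence and uniqueness are both required, so one output already determines the colour. A
  -- daimon without outputs has both colours.
  Coloured : Bool → List Pos → Set
  Coloured b ps = ∀ {p} → p ∈ ps → R p (atom b) × (∀ {v} → R p v → v ≡ atom b)

  Splits : Pos → Pos → Pos → Set
  Splits p₁ p₂ p = ∀ {v} → R p v → ∃[ v₁ ] ∃[ v₂ ] v ≡ pair v₁ v₂ × R p₁ v₁ × R p₂ v₂

  Valid : Link → Set
  Valid (ten p₁ p₂ p) = Splits p₁ p₂ p
  Valid (par p₁ p₂ p) = Splits p₁ p₂ p
  Valid (cut p q)     = ∃[ v ] R p v × R q v
  Valid (dai ps)      = ∃[ b ] Coloured b ps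

  valid-cut : ∀ {p q c} → CutOn p q c → Valid c → ∃[ v ] R p v × R q v
  valid-cut direct  (v , r , s) = v , r , s
  valid-cut swapped (v , r , s) = v , s , r

  coloured-unique : ∀ {b c p ps} → p ∈ ps → Coloured b ps → Coloured c ps → b ≡ c
  coloured-unique m κ κ′ = atom-injective (proj₂ (κ′ m) (proj₁ (κ m)))

  split-atom : ∀ {p₁ p₂ p q v b ps} → Splits p₁ p₂ p → Coloured b ps → q ∈ ps → R p v → R q v → ⊥
  split-atom s κ m r r′ with _ , _ , refl , _ ← s r = case proj₂ (κ m) r′ of λ ()

  -- A valid cut forces its two ends to share a value. Two daimons that merge therefore have the
  -- same colour, and a connective never meets a daimon, since a pair is not an atom. All daimons
  -- end up in a single one, so they must agree from the start.
  ⟶*-uniform : ∀ {G} → G ⟶* daimon₀ → All Valid (links G) → ∀ {b ps} → dai ps ∈ links G → Coloured b ps →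
               ∀ {qs} → dai qs ∈ links G → Coloured b qs
  ⟶*-uniform ε _ (here refl) κ (here refl) = κ
  ⟶*-uniform {G} (_◅_ {j = G′} (reduce {redex} {reduct} {context} r σ τ _) rs) vs {b} {ps} d κ {qs} d′ =
    go r (All-resp-↭ σ vs) (∈-resp-↭ σ d) (∈-resp-↭ σ d′) τ
    where
    go : ∀ {F E E′} → Rule F E E′ → All Valid (E ++ context) → dai ps ∈ E ++ context → dai qs ∈ E ++ context →
         links G′ ↭ E′ ++ context → Coloured b qs
    go {E′ = E′} (par/ten {p₁} {p₂} {p} {q₁} {q₂} {q} c) (π ∷ χ ∷ θ ∷ γ) m m′ τ =
      ⟶*-uniform rs (All-resp-↭ (↭-sym τ) (All.++⁺ cuts γ)) (keep c m) κ (keep c m′)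
      where
      cuts : All Valid E′
      cuts with v , x , y ← valid-cut c χ
           with v₁ , v₂ , refl , x₁ , x₂ ← π x
           with w₁ , w₂ , eq , y₁ , y₂ ← θ y
           with refl , refl ← pair-injective eq = (v₁ , x₁ , y₁) ∷ (v₂ , x₂ , y₂) ∷ []
      keep : ∀ {c rs} → CutOn p q c → dai rs ∈ par p₁ p₂ p ∷ c ∷ ten q₁ q₂ q ∷ context → dai rs ∈ links G′
      keep direct  (there (there (there m))) = ∈-resp-↭ (↭-sym τ) (there (there m))
      keep swapped (there (there (there m))) = ∈-resp-↭ (↭-sym τ) (there (there m))
    go (dai/dai {as} {p} {as′} {bs} {q} {bs′} {c} χ) ((β₁ , κ₁) ∷ ξ ∷ (β₂ , κ₂) ∷ γ) m m′ τ = result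
      (locate χ m) (locate χ m′)
      where
      A = as ++ p ∷ as′
      B = bs ++ q ∷ bs′
      M = (as ++ as′) ++ (bs ++ bs′)
      p∈ : p ∈ A
      p∈ = ∈-++⁺ʳ as (here refl)
      q∈ : q ∈ B
      q∈ = ∈-++⁺ʳ bs (here refl)
      β≡ : β₁ ≡ β₂
      β≡ with v , x , y ← valid-cut χ ξ = atom-injective (trans (sym (proj₂ (κ₁ p∈) x)) (proj₂ (κ₂ q∈) y))
      merged : ∀ {c} → Coloured c A → Coloured c B → Coloured c M
      merged α β m with ∈-++⁻ (as ++ as′) m
      ... | inj₁ m₁ with ∈-++⁻ as m₁
      ...   | inj₁ m₂ = α (∈-++⁺ˡ m₂)
      ...   | inj₂ m₂ = α (∈-++⁺ʳ as (there m₂))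
      merged α β m | inj₂ m₁ with ∈-++⁻ bs m₁
      ...   | inj₁ m₂ = β (∈-++⁺ˡ m₂)
      ...   | inj₂ m₂ = β (∈-++⁺ʳ bs (there m₂))
      κ₂′ : Coloured β₁ B
      κ₂′ = subst (λ c → Coloured c B) (sym β≡) κ₂
      κM : Coloured β₁ M
      κM = merged κ₁ κ₂′
      vs′ : All Valid (links G′)
      vs′ = All-resp-↭ (↭-sym τ) ((β₁ , κM) ∷ γ)
      M∈ : dai M ∈ links G′
      M∈ = ∈-resp-↭ (↭-sym τ) (here refl)
      later : ∀ {rs} → dai rs ∈ context → dai rs ∈ links G′
      later m = ∈-resp-↭ (↭-sym τ) (there m)

      data Place (xs : List Pos) : Set where
        first  : xs ≡ A → Place xs
        second : xs ≡ B → Place xs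
        beside : dai xs ∈ context → Place xs

      locate : ∀ {c xs} → CutOn p q c → dai xs ∈ dai A ∷ c ∷ dai B ∷ context → Place xs
      locate _ (here refl) = first refl
      locate direct  (there (here ()))
      locate swapped (there (here ()))
      locate _ (there (there (here refl))) = second refl
      locate _ (there (there (there m))) = beside m

      from-colour : b ≡ β₁ → Place qs → Coloured b qs
      from-colour refl (first refl)  = κ₁
      from-colour refl (second refl) = κ₂′
      from-colour refl (beside m)    = ⟶*-uniform rs vs′ M∈ κM (later m)

      -- Comparing the colours of `ps` and `M` requires an output of `M`. If `M` were empty, nothing
      -- could stand beside it.
      M-nonempty : dai ps ∈ context → ∃[ x ] x ∈ M
      M-nonempty m with M
      ... | x ∷ _ = x , here refl
      ... | [] with refl ← ⟶*-empty rs τ = case m of λ ()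

      result : Place ps → Place qs → Coloured b qs
      result (first refl) pl = from-colour (coloured-unique p∈ κ κ₁) pl
      result (second refl) pl = from-colour (coloured-unique q∈ κ κ₂′) pl
      result (beside m) pl with x , x∈ ← M-nonempty m =
        from-colour (coloured-unique x∈ (⟶*-uniform rs vs′ (later m) κ M∈) κM) pl
    go (ten/dai {as = as} c _ _ _) (π ∷ χ ∷ (β , δ) ∷ γ) with v , x , y ← valid-cut c χ =
      ⊥-elim (split-atom π δ (∈-++⁺ʳ as (here refl)) x y)
    go (par/dai {as = as} c _ _ _ _ _) (π ∷ χ ∷ (β , δ) ∷ γ) with v , x , y ← valid-cut c χ =
      ⊥-elim (split-atom π δ (∈-++⁺ʳ as (here refl)) x y)

-- Experiments on the interaction of two forests.

erase : Painted Bool → Val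
erase (leaf b)     = atom b
erase (node _ s t) = pair (erase s) (erase t)

erase-dual : ∀ s → erase (dualᵖ s) ≡ erase s
erase-dual (leaf b)     = refl
erase-dual (node _ s t) = cong₂ pair (erase-dual s) (erase-dual t)

cutRoots : List Tree → List Tree → List Link
cutRoots ts us = zipWith cut (map root ts) (map root us)

closedLinks : List (List Pos) → List Tree → List Tree → List Link
closedLinks bs ts us = map dai bs ++ forestLinks (ts ++ us) ++ cutRoots ts us

interaction-links : ∀ {S T ts us bs cs} → IsForest (body S) ts bs → IsForest (body T) us cs →
  links (interaction S T) ↭
  closedLinks (map (map evenly) bs ++ map (map oddly) cs) (map (renameTree evenly) ts)
    (map (renameTree oddly) us)
interaction-links {S} {T} {ts} {us} {bs} {cs} R Q = ↭-trans
  (↭-reflexive (trans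
    (cong₂ (λ ps qs → map (renameLink evenly) (linksₙ S) ++ map (renameLink oddly)
      (linksₙ T) ++ zipWith cut ps qs)
      (IsForest.concl-≡ (rename-isForest evenly R)) (IsForest.concl-≡ (rename-isForest oddly Q)))
    (sym (++-assoc (map (renameLink evenly) (linksₙ S)) _ _))))
  (↭-trans (++⁺ʳ _ (IsForest.links-↭ (∥-isForest R Q)))
    (↭-reflexive (++-assoc (map dai (map (map evenly) bs ++ map (map oddly) cs)) _ _)))

module _ (E : List Link) (e : Pos → Bool) where

  -- The experiment generated by a colouring of the initial positions. As an inductive relation it
  -- can be defined before knowing that the links form trees; uniqueness of targets makes it
  -- single-valued where this matters.
  data Carries : Pos → Val → Set where
    initial : ∀ {ps p} → dai ps ∈ E → p ∈ ps → Carries p (atom (e p))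
    above   : ∀ {k p₁ p₂ p v₁ v₂} → connective k p₁ p₂ p ∈ E → Carries p₁ v₁ → Carries p₂ v₂ → Carries p
      (pair v₁ v₂)

  carries-root : ∀ t → treeLinks t ⊆ E → (∀ {p} → p ∈ leaves t → ∃[ ps ] dai ps ∈ E × p ∈ ps) →
                 Carries (root t) (erase (paint e t))
  carries-root (leaf p) _ d with _ , d∈ , m ← d (here refl) = initial d∈ m
  carries-root (node k p t u) s d = above (s (here refl))
    (carries-root t (λ m → s (there (∈-++⁺ˡ m))) (λ m → d (∈-++⁺ˡ m)))
    (carries-root u (λ m → s (there (∈-++⁺ʳ (treeLinks t) m))) (λ m → d (∈-++⁺ʳ (leaves t) m)))

  open Experiment Carries

  module _ (u : Unique (targets E)) where

    carries-daimon : ∀ {ps} b → dai ps ∈ E → (∀ {p} → p ∈ ps → e p ≡ b) → Coloured b ps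
    carries-daimon {ps} b d mono {p} m = subst (Carries p ∘ atom) (mono m) (initial d m) , unique
      where
      unique : ∀ {v} → Carries p v → v ≡ atom b
      unique (initial _ _) = cong atom (mono m)
      unique (above {tensor} l∈ _ _) = case target-injective u d l∈ m (here refl) of λ ()
      unique (above {parr} l∈ _ _) = case target-injective u d l∈ m (here refl) of λ ()

    carries-connective : ∀ k {p₁ p₂ p} → connective k p₁ p₂ p ∈ E → Valid (connective k p₁ p₂ p)
    carries-connective tensor l∈ (initial d m) = case target-injective u l∈ d (here refl) m of λ ()
    carries-connective tensor l∈ (above {parr} l′∈ _ _) = case target-injective u l∈ l′∈ (here refl)
      (here refl) of λ ()
    carries-connective tensor l∈ (above {tensor} l′∈ x y) with refl ← target-injective u l∈ l′∈ (here refl)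
      (here refl) =
      _ , _ , refl , x , y
    carries-connective parr l∈ (initial d m) = case target-injective u l∈ d (here refl) m of λ ()
    carries-connective parr l∈ (above {tensor} l′∈ _ _) = case target-injective u l∈ l′∈ (here refl)
      (here refl) of λ ()
    carries-connective parr l∈ (above {parr} l′∈ x y) with refl ← target-injective u l∈ l′∈ (here refl)
      (here refl) =
      _ , _ , refl , x , y

tree-connective : ∀ t {l} → l ∈ treeLinks t → ∃[ k ] ∃[ p₁ ] ∃[ p₂ ] ∃[ p ] l ≡ connective k p₁ p₂ p
tree-connective (node k p t u) (here refl) = k , root t , root u , p , refl
tree-connective (node k p t u) (there m) with ∈-++⁻ (treeLinks t) m
... | inj₁ m′ = tree-connective t m′
... | inj₂ m′ = tree-connective u m′

forest-connective : ∀ ts {l} → l ∈ forestLinks ts → ∃[ k ] ∃[ p₁ ] ∃[ p₂ ] ∃[ p ] l ≡ connective k p₁ p₂ p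
forest-connective (t ∷ ts) m with ∈-++⁻ (treeLinks t) m
... | inj₁ m′ = tree-connective t m′
... | inj₂ m′ = forest-connective ts m′

connective≢dai : ∀ k {p₁ p₂ p ps} → connective k p₁ p₂ p ≢ dai ps
connective≢dai tensor ()
connective≢dai parr ()

dai∉forest : ∀ ts {ps} → dai ps ∉ forestLinks ts
dai∉forest ts m with k , _ , _ , _ , eq ← forest-connective ts m = connective≢dai k (sym eq)

∈-map-dai⁻ : ∀ {bs ps} → dai ps ∈ map dai bs → ps ∈ bs
∈-map-dai⁻ m with _ , m′ , refl ← ∈-map⁻ dai m = m′

forest-⊆ : ∀ {ts t} → t ∈ ts → treeLinks t ⊆ forestLinks ts
forest-⊆ (here refl) m = ∈-++⁺ˡ m
forest-⊆ {t′ ∷ _} (there t∈) m = ∈-++⁺ʳ (treeLinks t′) (forest-⊆ t∈ m)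

forestLeaves-⊆ : ∀ {ts t} → t ∈ ts → leaves t ⊆ forestLeaves ts
forestLeaves-⊆ (here refl) m = ∈-++⁺ˡ m
forestLeaves-⊆ {t′ ∷ _} (there t∈) m = ∈-++⁺ʳ (leaves t′) (forestLeaves-⊆ t∈ m)

targets-cutRoots : ∀ ts us → targets (cutRoots ts us) ≡ []
targets-cutRoots [] _ = refl
targets-cutRoots (_ ∷ _) [] = refl
targets-cutRoots (_ ∷ ts) (_ ∷ us) = targets-cutRoots ts us

-- Equality of painted trees states at once that facing trees have dual shapes and that facing
-- leaves have the same colour.
Matching : (Pos → Bool) → List Tree → List Tree → Set
Matching e = Pointwise (λ t u → paint e t ≡ dualᵖ (paint e u))

Monochrome : (Pos → Bool) → List Pos → Set
Monochrome e ps = ∃[ b ] ∀ {p} → p ∈ ps → e p ≡ b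

module _ {bs ts us} (e : Pos → Bool) (σ : concat bs ↭ forestLeaves (ts ++ us))
         (u : Unique (forestOccurrences (ts ++ us)))
         (mono : ∀ {b} → b ∈ bs → Monochrome e b) (match : Matching e ts us) where

  private
    E = closedLinks bs ts us

    uE : Unique (targets E)
    uE = Unique-resp-↭ (↭-sym (↭-trans
      (↭-reflexive (trans (concatMap-++ target (map dai bs) (forestLinks (ts ++ us) ++ cutRoots ts us))
        (cong₂ _++_ (targets-dai bs) (trans (concatMap-++ target (forestLinks (ts ++ us)) (cutRoots ts us))
          (trans (cong (targets (forestLinks (ts ++ us)) ++_) (targets-cutRoots ts us)) (++-identityʳ _))))))
      (↭-trans (++⁺ʳ _ σ) (↭-trans (++-comm (forestLeaves (ts ++ us)) _) (forestOccurrences-↭ (ts ++ us)))))) u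

    root-carries : ∀ {t} → t ∈ ts ++ us → Carries E e (root t) (erase (paint e t))
    root-carries {t} t∈ = carries-root E e t (λ m → ∈-++⁺ʳ (map dai bs) (∈-++⁺ˡ (forest-⊆ t∈ m)))
      λ m → let b , m′ , b∈ = ∈-concat⁻′ bs (∈-resp-↭ (↭-sym σ) (forestLeaves-⊆ t∈ m))
            in b , ∈-++⁺ˡ (∈-map⁺ dai b∈) , m′

  open Experiment (Carries E e)

  closed-valid : All Valid E
  closed-valid = All.++⁺
    (All.map⁺ (All.tabulate λ {b} b∈ →
      let c , m = mono b∈ in c , carries-daimon E e uE c (∈-++⁺ˡ (∈-map⁺ dai b∈)) m))
    (All.++⁺
      (All.tabulate λ {l} m → let k , p₁ , p₂ , p , eq = forest-connective (ts ++ us) m in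
        subst Valid (sym eq) (carries-connective E e uE k (subst (_∈ E) eq (∈-++⁺ʳ (map dai bs) (∈-++⁺ˡ m)))))
      (cuts match ∈-++⁺ˡ (∈-++⁺ʳ ts)))
    where
    cuts : ∀ {ts′ us′} → Matching e ts′ us′ → ts′ ⊆ ts ++ us → us′ ⊆ ts ++ us → All Valid (cutRoots ts′ us′)
    cuts [] _ _ = []
    cuts {t ∷ ts′} {v ∷ us′} (eq ∷ eqs) f g =
      (erase (paint e t) , root-carries (f (here refl)) ,
       subst (Carries E e (root v)) (trans (sym (erase-dual (paint e v))) (cong erase (sym eq)))
         (root-carries (g (here refl))))
      ∷ cuts eqs (f ∘ there) (g ∘ there)

  -- The colouring generates an experiment valid on every link of the interaction: on daimons
  -- because it is monochrome there, on cuts because it is matching. Uniformity then makes it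
  -- constant on all daimons.
  ⟶*-monochrome : ∀ {G} → G ⟶* daimon₀ → links G ↭ E →
                  ∀ {ps qs p q} → ps ∈ bs → qs ∈ bs → p ∈ ps → q ∈ qs → e p ≡ e q
  ⟶*-monochrome r ρ ps∈ qs∈ p∈ q∈ with b , m ← mono ps∈ =
    trans (m p∈) (sym (atom-injective (proj₂
      (⟶*-uniform r (All-resp-↭ (↭-sym ρ) closed-valid)
        (∈-resp-↭ (↭-sym ρ) (∈-++⁺ˡ (∈-map⁺ dai ps∈)))
        (carries-daimon E e uE b (∈-++⁺ˡ (∈-map⁺ dai ps∈)) m)
        (∈-resp-↭ (↭-sym ρ) (∈-++⁺ˡ (∈-map⁺ dai qs∈))) q∈)
      (initial (∈-++⁺ˡ (∈-map⁺ dai qs∈)) q∈))))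

-- Counting tensors, pars, cuts and daimons.

tensors pars : Tree → ℕ
tensors (leaf _)          = 0
tensors (node tensor _ t u) = suc (tensors t + tensors u)
tensors (node parr _ t u)   = tensors t + tensors u
pars (leaf _)          = 0
pars (node tensor _ t u) = pars t + pars u
pars (node parr _ t u)   = suc (pars t + pars u)

forestTensors forestPars : List Tree → ℕ
forestTensors ts = sum (map tensors ts)
forestPars ts    = sum (map pars ts)

forestTensors-++ : ∀ ts us → forestTensors (ts ++ us) ≡ forestTensors ts + forestTensors us
forestTensors-++ ts us = trans (cong sum (map-++ tensors ts us)) (ℕ.sum-++ (map tensors ts) (map tensors us))

forestPars-++ : ∀ ts us → forestPars (ts ++ us) ≡ forestPars ts + forestPars us
forestPars-++ ts us = trans (cong sum (map-++ pars ts us)) (ℕ.sum-++ (map pars ts) (map pars us))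

+-interchange : ∀ a b c d → (a + b) + (c + d) ≡ (a + c) + (b + d)
+-interchange = +-*-Solver.solve 4 (λ a b c d → (a :+ b) :+ (c :+ d) := (a :+ c) :+ (b :+ d)) refl
  where open +-*-Solver using (_:+_; _:=_)

joins-treeLinks : ∀ t → total isJoin (treeLinks t) ≡ tensors t
joins-treeLinks (leaf _) = refl
joins-treeLinks (node tensor _ t u) =
  cong suc (trans (total-++ isJoin (treeLinks t) (treeLinks u)) (cong₂ _+_ (joins-treeLinks t)
    (joins-treeLinks u)))
joins-treeLinks (node parr _ t u) =
  trans (total-++ isJoin (treeLinks t) (treeLinks u)) (cong₂ _+_ (joins-treeLinks t) (joins-treeLinks u))

joins-forestLinks : ∀ ts → total isJoin (forestLinks ts) ≡ forestTensors ts
joins-forestLinks [] = refl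
joins-forestLinks (t ∷ ts) =
  trans (total-++ isJoin (treeLinks t) (forestLinks ts)) (cong₂ _+_ (joins-treeLinks t) (joins-forestLinks ts))

daimons-treeLinks : ∀ t → total isDai (treeLinks t) ≡ 0
daimons-treeLinks (leaf _) = refl
daimons-treeLinks (node tensor _ t u) =
  trans (total-++ isDai (treeLinks t) (treeLinks u)) (cong₂ _+_ (daimons-treeLinks t) (daimons-treeLinks u))
daimons-treeLinks (node parr _ t u) =
  trans (total-++ isDai (treeLinks t) (treeLinks u)) (cong₂ _+_ (daimons-treeLinks t) (daimons-treeLinks u))

daimons-forestLinks : ∀ ts → total isDai (forestLinks ts) ≡ 0
daimons-forestLinks [] = refl
daimons-forestLinks (t ∷ ts) =
  trans (total-++ isDai (treeLinks t) (forestLinks ts)) (cong₂ _+_ (daimons-treeLinks t)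
    (daimons-forestLinks ts))

joins-dai : ∀ bs → total isJoin (map dai bs) ≡ 0
joins-dai []       = refl
joins-dai (_ ∷ bs) = joins-dai bs

daimons-dai : ∀ bs → total isDai (map dai bs) ≡ length bs
daimons-dai []       = refl
daimons-dai (_ ∷ bs) = cong suc (daimons-dai bs)

joins-cutRoots : ∀ ts us → length ts ≡ length us → total isJoin (cutRoots ts us) ≡ length ts
joins-cutRoots [] [] _ = refl
joins-cutRoots (_ ∷ ts) (_ ∷ us) eq = cong suc (joins-cutRoots ts us (ℕ.suc-injective eq))

daimons-cutRoots : ∀ ts us → total isDai (cutRoots ts us) ≡ 0
daimons-cutRoots [] _ = refl
daimons-cutRoots (_ ∷ _) [] = refl
daimons-cutRoots (_ ∷ ts) (_ ∷ us) = daimons-cutRoots ts us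

closed-joins : ∀ bs ts us → length ts ≡ length us → total isJoin (closedLinks bs ts us) ≡ forestTensors
  (ts ++ us) + length ts
closed-joins bs ts us eq = trans (total-++ isJoin (map dai bs) _) (trans (cong₂ _+_ (joins-dai bs)
  (total-++ isJoin (forestLinks (ts ++ us)) _)) (cong₂ _+_ (joins-forestLinks (ts ++ us))
    (joins-cutRoots ts us eq)))

closed-daimons : ∀ bs ts us → total isDai (closedLinks bs ts us) ≡ length bs
closed-daimons bs ts us = trans (total-++ isDai (map dai bs) _) (trans (cong₂ _+_ (daimons-dai bs)
  (trans (total-++ isDai (forestLinks (ts ++ us)) _)
    (cong₂ _+_ (daimons-forestLinks (ts ++ us)) (daimons-cutRoots ts us)))) (ℕ.+-identityʳ _))

-- Reduction of dual forests

linkIso-refl : ∀ l → LinkIso id l l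
linkIso-refl (ten _ _ _) = ten
linkIso-refl (par _ _ _) = par
linkIso-refl (cut _ _)   = cut
linkIso-refl (dai ps)    = subst (LinkIso id (dai ps) ∘ dai) (map-id ps) dai

linksIso-refl : ∀ E → LinksIso id E E
linksIso-refl []      = []
linksIso-refl (l ∷ E) = linkIso-refl l ∷ linksIso-refl E

wins-iso : ∀ {E F} → LinksIso id E F → Wins E → Wins F
wins-iso {E} is w = ⟶*-iso id (w (graph E []) ↭-refl refl) is

module _ {A B : Set} {_∙_ : A → A → B} where

  zipWith-++ : ∀ xs us {ys vs} → length xs ≡ length us →
               zipWith _∙_ (xs ++ ys) (us ++ vs) ≡ zipWith _∙_ xs us ++ zipWith _∙_ ys vs
  zipWith-++ [] [] _ = refl
  zipWith-++ (x ∷ xs) (u ∷ us) eq = cong (_ ∷_) (zipWith-++ xs us (ℕ.suc-injective eq))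

length-leaves : ∀ t u → shape t ≡ dualᵖ (shape u) → length (leaves t) ≡ length (leaves u)
length-leaves (leaf _) (leaf _) _ = refl
length-leaves (node k _ t t′) (node l _ u u′) eq with shape t in eqt | shape t′ in eqt′
length-leaves (node k _ t t′) (node l _ u u′) refl | _ | _ =
  trans (length-++ (leaves t)) (trans (cong₂ _+_ (length-leaves t u eqt) (length-leaves t′ u′ eqt′))
    (sym (length-++ (leaves u))))

node-injective : ∀ {X} {k l} {s t s′ t′ : Painted X} → node k s t ≡ node l s′ t′ → k ≡ l × s ≡ s′ × t ≡ t′
node-injective refl = refl , refl , refl

Dual : List Tree → List Tree → Set
Dual = Pointwise (λ t u → shape t ≡ dualᵖ (shape u))

-- Dual trees unfold against each other by par/tensor steps, corresponding premises being cut again,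
-- until only cuts between corresponding leaves remain; `K` is the surrounding context.
wins-trees : ∀ t u K → shape t ≡ dualᵖ (shape u) → Wins (zipWith cut (leaves t) (leaves u) ++ K) →
             Wins (treeLinks t ++ treeLinks u ++ cut (root t) (root u) ∷ K)

wins-children : ∀ t t′ u u′ K → shape t ≡ dualᵖ (shape u) → shape t′ ≡ dualᵖ (shape u′) →
  Wins (zipWith cut (leaves t ++ leaves t′) (leaves u ++ leaves u′) ++ K) →
  Wins (cut (root t) (root u) ∷ cut (root t′) (root u′) ∷ (treeLinks t ++ treeLinks t′) ++
    (treeLinks u ++ treeLinks u′) ++ K)
wins-children t t′ u u′ K eq eq′ w = wins-resp-↭
  (solve 7 (λ c c′ a a′ b b′ k → c ⊕ (c′ ⊕ ((a ⊕ a′) ⊕ ((b ⊕ b′) ⊕ k))) ⊜ a ⊕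
    (b ⊕ (c ⊕ (a′ ⊕ (b′ ⊕ (c′ ⊕ k)))))) ↭-refl
    (cut (root t) (root u) ∷ []) (cut (root t′) (root u′) ∷ []) (treeLinks t) (treeLinks t′) (treeLinks u)
      (treeLinks u′) K)
  (wins-trees t u _ eq (wins-resp-↭
    (solve 5 (λ z a b c k → z ⊕ (a ⊕ (b ⊕ (c ⊕ k))) ⊜ a ⊕ (b ⊕ (c ⊕ (z ⊕ k)))) ↭-refl
      (zipWith cut (leaves t) (leaves u)) (treeLinks t′) (treeLinks u′) (cut (root t′) (root u′) ∷ []) K)
    (wins-trees t′ u′ _ eq′ (wins-resp-↭
      (↭-trans (shifts (zipWith cut (leaves t′) (leaves u′)) (zipWith cut (leaves t) (leaves u)))
        (↭-reflexive (trans (sym (++-assoc (zipWith cut (leaves t) (leaves u)) _ K))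
          (cong (_++ K) (sym (zipWith-++ (leaves t) (leaves u) (length-leaves t u eq)))))))
      w))))

wins-trees (leaf p) (leaf q) K _ w = w
wins-trees (node tensor p t t′) (node parr q u u′) K eq w with _ , eq₁ , eq₂ ← node-injective eq = wins-resp-↭
  (solve 6 (λ t a b p c k → (t ⊕ a) ⊕ ((p ⊕ b) ⊕ (c ⊕ k)) ⊜ (p ⊕ (c ⊕ t)) ⊕ (a ⊕ (b ⊕ k))) ↭-refl
    (ten (root t) (root t′) p ∷ []) (treeLinks t ++ treeLinks t′) (treeLinks u ++ treeLinks u′)
    (par (root u) (root u′) q ∷ []) (cut p q ∷ []) K)
  (wins-step (par/ten swapped)
    -- The reduction rule puts the inputs of the par first. Here the par is on the side of `u`, so
    -- the two new cuts come out reversed.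
    (wins-iso (cut′ ∷ cut′ ∷ linksIso-refl _) (wins-children t t′ u u′ K eq₁ eq₂ w)))
wins-trees (node parr p t t′) (node tensor q u u′) K eq w with _ , eq₁ , eq₂ ← node-injective eq = wins-resp-↭
  (solve 6 (λ t a b p c k → (t ⊕ a) ⊕ ((p ⊕ b) ⊕ (c ⊕ k)) ⊜ (t ⊕ (c ⊕ p)) ⊕ (a ⊕ (b ⊕ k))) ↭-refl
    (par (root t) (root t′) p ∷ []) (treeLinks t ++ treeLinks t′) (treeLinks u ++ treeLinks u′)
    (ten (root u) (root u′) q ∷ []) (cut p q ∷ []) K)
  (wins-step (par/ten direct) (wins-children t t′ u u′ K eq₁ eq₂ w))
wins-trees (node tensor _ _ _) (node tensor _ _ _) K () w
wins-trees (node parr _ _ _) (node parr _ _ _) K () w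

wins-forest : ∀ {ts us} K → Dual ts us → Wins (zipWith cut (forestLeaves ts) (forestLeaves us) ++ K) →
              Wins (forestLinks ts ++ forestLinks us ++ cutRoots ts us ++ K)
wins-forest K [] w = w
wins-forest {t ∷ ts} {u ∷ us} K (eq ∷ eqs) w = wins-resp-↭
  (solve 6 (λ a a′ b b′ c k → (a ⊕ a′) ⊕ ((b ⊕ b′) ⊕ (c ⊕ k)) ⊜ a ⊕ (b ⊕ (c ⊕ (a′ ⊕ (b′ ⊕ k))))) ↭-refl
    (treeLinks t) (forestLinks ts) (treeLinks u) (forestLinks us) (cut (root t) (root u) ∷ [])
      (cutRoots ts us ++ K))
  (wins-trees t u _ eq (wins-resp-↭
    (solve 4 (λ z a b k → z ⊕ (a ⊕ (b ⊕ k)) ⊜ a ⊕ (b ⊕ (k ⊕ z))) ↭-refl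
      (zipWith cut (leaves t) (leaves u)) (forestLinks ts) (forestLinks us) (cutRoots ts us ++ K))
    (wins-resp-↭ (++⁺ˡ (forestLinks ts) (++⁺ˡ (forestLinks us) (↭-reflexive (++-assoc (cutRoots ts us) K _))))
    (wins-forest (K ++ zipWith cut (leaves t) (leaves u)) eqs (wins-resp-↭
      (↭-trans (solve 3 (λ a k z → a ⊕ (k ⊕ z) ⊜ (z ⊕ a) ⊕ k) ↭-refl
        (zipWith cut (forestLeaves ts) (forestLeaves us)) K (zipWith cut (leaves t) (leaves u)))
        (↭-reflexive (cong (_++ K) (sym (zipWith-++ (leaves t) (leaves u) (length-leaves t u eq))))))
      w)))))

-- Merging daimons along the cuts between leaves.

Edge : Set
Edge = Pos × Pos

edgeCut : Edge → Link
edgeCut (p , q) = cut p q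

endpoints : List Edge → List Pos
endpoints = concatMap (λ (p , q) → p ∷ q ∷ [])

-- A disconnection of the multigraph with the blocks as nodes and the cuts as edges. Nonemptiness
-- concerns the lists of blocks: a block without positions is an isolated node and may form a side
-- by itself.
record Split (bs : List (List Pos)) (es : List Edge) : Set where
  field
    bs₁ bs₂ : List (List Pos)
    es₁ es₂ : List Edge
    blocks-↭   : bs ↭ bs₁ ++ bs₂
    edges-↭    : es ↭ es₁ ++ es₂
    closed₁    : concat bs₁ ↭ endpoints es₁
    closed₂    : concat bs₂ ↭ endpoints es₂
    nonempty₁  : bs₁ ≢ []
    nonempty₂  : bs₂ ≢ []

split-sym : ∀ {bs es} → Split bs es → Split bs es
split-sym s = record
  { bs₁ = bs₂ ; bs₂ = bs₁ ; es₁ = es₂ ; es₂ = es₁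
  ; blocks-↭ = ↭-trans blocks-↭ (++-comm bs₁ bs₂) ; edges-↭ = ↭-trans edges-↭ (++-comm es₁ es₂)
  ; closed₁ = closed₂ ; closed₂ = closed₁ ; nonempty₁ = nonempty₂ ; nonempty₂ = nonempty₁ }
  where open Split s

concat-↭ : ∀ {A : Set} {xs ys : List (List A)} → xs ↭ ys → concat xs ↭ concat ys
concat-↭ {xs = xs} {ys} σ = subst₂ _↭_ (cong concat (map-id xs)) (cong concat (map-id ys)) (concatMap⁺ id σ)

++-≢[] : ∀ {A : Set} (xs : List A) {ys} → xs ≢ [] → xs ++ ys ≢ []
++-≢[] [] ne _ = ne refl
++-≢[] (_ ∷ _) _ ()

-- The list `ms` consists of the one block or the two blocks that became `M` when `p` and `q` were
-- removed. Restoring them together with the cut, on the side of the split where `M` lies, leaves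
-- the other side untouched.
unmerge : ∀ {M ms cs bs p q es} → ms ≢ [] → bs ↭ ms ++ cs → concat ms ↭ p ∷ q ∷ M →
          Split (M ∷ cs) es → Split bs ((p , q) ∷ es)
unmerge {M} {ms} {cs} {bs} {p} {q} {es} ne σ μ s = [ (λ m → go s m) , (λ m → go (split-sym s) m) ]′
    (∈-++⁻ (Split.bs₁ s) (∈-resp-↭ (Split.blocks-↭ s) (here refl)))
  where
  go : (s : Split (M ∷ cs) es) → M ∈ Split.bs₁ s → Split bs ((p , q) ∷ es)
  go s m with r , ρ ← ∈⇒↭ m = record
    { bs₁ = ms ++ r ; bs₂ = bs₂ ; es₁ = (p , q) ∷ es₁ ; es₂ = es₂
    ; blocks-↭  = ↭-trans σ (↭-trans (++⁺ˡ ms (drop-∷ (↭-trans blocks-↭ (++⁺ʳ bs₂ ρ))))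
                    (↭-reflexive (sym (++-assoc ms r bs₂))))
    ; edges-↭   = prep _ edges-↭
    ; closed₁   = ↭-trans (↭-reflexive (concat-++ ms r)) (↭-trans (++⁺ʳ (concat r) μ)
                    (prep p (prep q (↭-trans (↭-sym (concat-↭ ρ)) closed₁))))
    ; closed₂   = closed₂
    ; nonempty₁ = ++-≢[] ms ne
    ; nonempty₂ = nonempty₂
    }
    where open Split s

-- Contracts the cuts one by one; a cut with both ends in one block leaves too few
-- cuts to connect the blocks.
wins-or-split : ∀ es bs → concat bs ↭ endpoints es → suc (length es) ≤ length bs →
                (length bs ≡ suc (length es) × Wins (map dai bs ++ map edgeCut es)) ⊎ Split bs es
wins-or-split [] (b ∷ []) σ _ with refl ← ↭-empty-inv (↭-trans (↭-reflexive (sym (++-identityʳ b))) σ) =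
  inj₁ (refl , wins-daimon₀)
wins-or-split [] (b ∷ c ∷ bs) σ _ with eq ← ↭-empty-inv σ with b
... | [] = inj₂ record
  { bs₁ = [] ∷ [] ; bs₂ = c ∷ bs ; es₁ = [] ; es₂ = []
  ; blocks-↭ = ↭-refl ; edges-↭ = ↭-refl ; closed₁ = ↭-refl ; closed₂ = ↭-reflexive eq
  ; nonempty₁ = λ () ; nonempty₂ = λ () }
wins-or-split ((p , q) ∷ es) bs σ le
  with b , p∈b , b∈ ← ∈-concat⁻′ bs (∈-resp-↭ (↭-sym σ) (here refl))
  with bs′ , ρ ← ∈⇒↭ b∈
  with as , as′ , refl ← ∈-∃++ p∈b = cases (∈-++⁻ (as ++ as′) (∈-resp-↭ (↭-sym σ′) (here refl)))
  where
  σ′ : (as ++ as′) ++ concat bs′ ↭ q ∷ endpoints es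
  σ′ = drop-∷ (↭-trans (↭-sym (↭-trans (concat-↭ ρ) (++⁺ʳ (concat bs′) (shift p as as′)))) σ)

  le′ : suc (suc (length es)) ≤ suc (length bs′)
  le′ = subst (_ ≤_) (↭-length ρ) le

  Goal : Set
  Goal = (length bs ≡ suc (suc (length es)) × Wins (map dai bs ++ cut p q ∷ map edgeCut es)) ⊎ Split bs
    ((p , q) ∷ es)

  cases : q ∈ as ++ as′ ⊎ q ∈ concat bs′ → Goal
  cases (inj₁ q∈) with N , ν ← ∈⇒↭ q∈ =
    case wins-or-split es (N ∷ bs′) (drop-∷ (↭-trans (++⁺ʳ (concat bs′) (↭-sym ν)) σ′))
      (ℕ.≤-trans (ℕ.n≤1+n _) le′) of λ
      -- Winning requires exactly one block more than the remaining cuts, whereas here there are at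
      -- least two more.
      { (inj₁ (eq , _)) → ⊥-elim (ℕ.<-irrefl (sym eq) le′)
      ; (inj₂ s) → inj₂ (unmerge {ms = (as ++ p ∷ as′) ∷ []} (λ ()) ρ
          (↭-trans (↭-reflexive (++-identityʳ _)) (↭-trans (shift p as as′) (prep p ν))) s) }
  cases (inj₂ q∈)
    with c , q∈c , c∈ ← ∈-concat⁻′ bs′ q∈
    with bs″ , ρ′ ← ∈⇒↭ c∈
    with cs , cs′ , refl ← ∈-∃++ q∈c =
    case wins-or-split es (M ∷ bs″) σ″ (ℕ.≤-pred le″) of λ
      { (inj₁ (eq , w)) → inj₁ (trans (↭-length ρ″) (cong suc eq) , wins-resp-↭ π
          (wins-step {K = map dai bs″ ++ map edgeCut es} (dai/dai {as = as} {bs = cs} direct) w))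
      ; (inj₂ s) → inj₂ (unmerge {ms = (as ++ p ∷ as′) ∷ (cs ++ q ∷ cs′) ∷ []} (λ ()) ρ″ μ s) }
    where
    M = (as ++ as′) ++ (cs ++ cs′)
    ρ″ : bs ↭ (as ++ p ∷ as′) ∷ (cs ++ q ∷ cs′) ∷ bs″
    ρ″ = ↭-trans ρ (prep _ ρ′)
    le″ : suc (suc (length es)) ≤ suc (suc (length bs″))
    le″ = subst (_ ≤_) (↭-length ρ″) le
    μ : (as ++ p ∷ as′) ++ (cs ++ q ∷ cs′) ++ [] ↭ p ∷ q ∷ M
    μ = ↭-trans (++⁺ (shift p as as′) (↭-trans (↭-reflexive (++-identityʳ _)) (shift q cs cs′)))
          (prep p (shift q (as ++ as′) (cs ++ cs′)))
    σ″ : M ++ concat bs″ ↭ endpoints es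
    σ″ = drop-∷ (↭-trans (↭-trans
      (solve 4 (λ q a c r → q ⊕ ((a ⊕ c) ⊕ r) ⊜ a ⊕ ((q ⊕ c) ⊕ r)) ↭-refl (q ∷ []) (as ++ as′) (cs ++ cs′)
        (concat bs″))
      (++⁺ˡ (as ++ as′) (↭-trans (++⁺ʳ (concat bs″) (↭-sym (shift q cs cs′))) (↭-sym (concat-↭ ρ′))))) σ′)
    π : map dai bs ++ cut p q ∷ map edgeCut es ↭
        dai (as ++ p ∷ as′) ∷ cut p q ∷ dai (cs ++ q ∷ cs′) ∷ (map dai bs″ ++ map edgeCut es)
    π = ↭-trans (++⁺ʳ _ (map⁺ dai ρ″))
      (solve 5 (λ a b d c e → (a ⊕ (b ⊕ d)) ⊕ (c ⊕ e) ⊜ a ⊕ (c ⊕ (b ⊕ (d ⊕ e)))) ↭-refl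
        (dai (as ++ p ∷ as′) ∷ []) (dai (cs ++ q ∷ cs′) ∷ []) (map dai bs″) (cut p q ∷ []) (map edgeCut es))

endpoints-zip : ∀ xs ys → length xs ≡ length ys → endpoints (zipWith _,_ xs ys) ↭ xs ++ ys
endpoints-zip [] [] _ = ↭-refl
endpoints-zip (x ∷ xs) (y ∷ ys) eq =
  prep x (↭-trans (prep y (endpoints-zip xs ys (ℕ.suc-injective eq))) (↭-sym (shift y xs ys)))

edgeCut-zip : ∀ xs ys → map edgeCut (zipWith _,_ xs ys) ≡ zipWith cut xs ys
edgeCut-zip [] _ = refl
edgeCut-zip (_ ∷ _) [] = refl
edgeCut-zip (x ∷ xs) (y ∷ ys) = cong (_ ∷_) (edgeCut-zip xs ys)

length-zip : ∀ (xs ys : List Pos) → length xs ≡ length ys → length (zipWith _,_ xs ys) ≡ length xs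
length-zip [] [] _ = refl
length-zip (_ ∷ xs) (_ ∷ ys) eq = cong suc (length-zip xs ys (ℕ.suc-injective eq))

++-injective : ∀ {A : Set} (xs us : List A) {ys vs} → length xs ≡ length us → xs ++ ys ≡ us ++ vs →
  xs ≡ us × ys ≡ vs
++-injective [] [] _ eq = refl , eq
++-injective (x ∷ xs) (u ∷ us) l eq with a , b ← ++-injective xs us (ℕ.suc-injective l) (∷-injectiveʳ eq) =
  cong₂ _∷_ (∷-injectiveˡ eq) a , b

paint-match : ∀ {X} {e e′ : Pos → X} t u → shape t ≡ dualᵖ (shape u) → map e (leaves t) ≡ map e′ (leaves u) →
              paint e t ≡ dualᵖ (paint e′ u)
paint-match (leaf p) (leaf q) _ eq = cong leaf (∷-injectiveˡ eq)
paint-match {e = e} {e′} (node k _ t t′) (node l _ u u′) s eq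
  with refl , s₁ , s₂ ← node-injective s
  with eq₁ , eq₂ ← ++-injective (map e (leaves t)) (map e′ (leaves u))
         (trans (length-map e (leaves t)) (trans (length-leaves t u s₁) (sym (length-map e′ (leaves u)))))
         (trans (sym (map-++ e (leaves t) (leaves t′))) (trans eq (map-++ e′ (leaves u) (leaves u′)))) =
  cong₂ (node k) (paint-match t u s₁ eq₁) (paint-match t′ u′ s₂ eq₂)

length-forestLeaves : ∀ {ts us} → Dual ts us → length (forestLeaves ts) ≡ length (forestLeaves us)
length-forestLeaves [] = refl
length-forestLeaves {t ∷ ts} {u ∷ us} (eq ∷ eqs) = trans (length-++ (leaves t))
  (trans (cong₂ _+_ (length-leaves t u eq) (length-forestLeaves eqs)) (sym (length-++ (leaves u))))

matching : ∀ {e ts us} → Dual ts us → map e (forestLeaves ts) ≡ map e (forestLeaves us) → Matching e ts us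
matching [] _ = []
matching {e} {t ∷ ts} {u ∷ us} (s ∷ ss) eq
  with eq₁ , eq₂ ← ++-injective (map e (leaves t)) (map e (leaves u))
         (trans (length-map e (leaves t)) (trans (length-leaves t u s) (sym (length-map e (leaves u)))))
         (trans (sym (map-++ e (leaves t) (forestLeaves ts))) (trans eq
           (map-++ e (leaves u) (forestLeaves us)))) =
  paint-match t u s eq₁ ∷ matching ss eq₂

map-zip-≡ : ∀ {e : Pos → Bool} xs ys → length xs ≡ length ys →
            (∀ {p q} → (p , q) ∈ zipWith _,_ xs ys → e p ≡ e q) → map e xs ≡ map e ys
map-zip-≡ [] [] _ _ = refl
map-zip-≡ (x ∷ xs) (y ∷ ys) l h = cong₂ _∷_ (h (here refl)) (map-zip-≡ xs ys (ℕ.suc-injective l) (h ∘ there))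

∈-endpoints : ∀ {es p q} → (p , q) ∈ es → p ∈ endpoints es × q ∈ endpoints es
∈-endpoints (here refl) = here refl , there (here refl)
∈-endpoints (there m) with a , b ← ∈-endpoints m = there (there a) , there (there b)

nonempty-member : ∀ {A : Set} {xs : List A} → xs ≢ [] → ∃[ x ] x ∈ xs
nonempty-member {xs = []} ne = ⊥-elim (ne refl)
nonempty-member {xs = x ∷ _} _ = x , here refl

Connected : List (List Pos) → List Tree → List Tree → Set
Connected bs ts us = ∀ e → (∀ {b} → b ∈ bs → Monochrome e b) → Matching e ts us →
                     ∀ {b c p q} → b ∈ bs → c ∈ bs → p ∈ b → q ∈ c → e p ≡ e q

++-length≢1 : ∀ {A : Set} (xs ys : List A) → xs ≢ [] → ys ≢ [] → length (xs ++ ys) ≢ 1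
++-length≢1 [] _ ne _ _ = ne refl
++-length≢1 (_ ∷ _) [] _ ne _ = ne refl
++-length≢1 (_ ∷ xs) (_ ∷ ys) _ _ eq = case trans (sym eq) (cong suc (trans (length-++ xs) (ℕ.+-suc _ _))) of λ
  ()

-- Membership in the first side of a split is a colouring that is monochrome on blocks, matching and
-- not constant, provided both sides contain a position. The alternative `length bs ≡ 1` covers the
-- empty sequent, where the only block is empty and colours say nothing.
no-split : ∀ {bs ts us} → concat bs ↭ forestLeaves (ts ++ us) → Unique (forestOccurrences (ts ++ us)) →
  Dual ts us →
           length bs ≡ 1 ⊎ (All (_≢ []) bs × Connected bs ts us) →
           ¬ Split bs (zipWith _,_ (forestLeaves ts) (forestLeaves us))
no-split {bs} {ts} {us} σ u d conn s = [ one , many ]′ conn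
  where
  open Split s
  es = zipWith _,_ (forestLeaves ts) (forestLeaves us)
  one : length bs ≡ 1 → ⊥
  one eq = ++-length≢1 bs₁ bs₂ nonempty₁ nonempty₂ (trans (sym (↭-length blocks-↭)) eq)

  e : Pos → Bool
  e p = does (p ∈? concat bs₁)

  e-true : ∀ {p} → p ∈ concat bs₁ → e p ≡ true
  e-true {p} m with p ∈? concat bs₁
  ... | yes _ = refl
  ... | no ¬m = ⊥-elim (¬m m)

  disjoint : Disjoint (concat bs₁) (concat bs₂)
  disjoint = proj₂ (proj₂ (Unique-++⁻ (concat bs₁) (subst Unique (concat-++ bs₁ bs₂)
    (Unique-resp-↭ (↭-trans (↭-sym σ) (concat-↭ blocks-↭)) unique-leaves))))
    where
    unique-leaves : Unique (forestLeaves (ts ++ us))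
    unique-leaves = proj₁ (proj₂ (Unique-++⁻ (targets (forestLinks (ts ++ us)))
      (Unique-resp-↭ (↭-sym (forestOccurrences-↭ (ts ++ us))) u)))

  e-false : ∀ {p} → p ∈ concat bs₂ → e p ≡ false
  e-false {p} m with p ∈? concat bs₁
  ... | yes m′ = ⊥-elim (disjoint (m′ , m))
  ... | no _ = refl

  mono : ∀ {b} → b ∈ bs → Monochrome e b
  mono b∈ with ∈-++⁻ bs₁ (∈-resp-↭ blocks-↭ b∈)
  ... | inj₁ m = true , λ p∈ → e-true (∈-concat⁺′ p∈ m)
  ... | inj₂ m = false , λ p∈ → e-false (∈-concat⁺′ p∈ m)

  match : Matching e ts us
  match = matching d (map-zip-≡ (forestLeaves ts) (forestLeaves us) (length-forestLeaves d) λ m →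
    case ∈-++⁻ es₁ (∈-resp-↭ edges-↭ m) of λ
      { (inj₁ m′) → let a , b = ∈-endpoints m′ in
          trans (e-true (∈-resp-↭ (↭-sym closed₁) a)) (sym (e-true (∈-resp-↭ (↭-sym closed₁) b)))
      ; (inj₂ m′) → let a , b = ∈-endpoints m′ in
          trans (e-false (∈-resp-↭ (↭-sym closed₂) a)) (sym (e-false (∈-resp-↭ (↭-sym closed₂) b))) })

  many : All (_≢ []) bs × Connected bs ts us → ⊥
  many (ne , c)
    with b , b∈ ← nonempty-member nonempty₁ | b′ , b′∈ ← nonempty-member nonempty₂
    with m ← ∈-resp-↭ (↭-sym blocks-↭) (∈-++⁺ˡ b∈) | m′ ← ∈-resp-↭ (↭-sym blocks-↭) (∈-++⁺ʳ bs₁ b′∈)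
    with p , p∈ ← nonempty-member (All.lookup ne m) | q , q∈ ← nonempty-member (All.lookup ne m′) =
    case trans (sym (e-true (∈-concat⁺′ p∈ b∈))) (trans (c e mono match m m′ p∈ q∈)
      (e-false (∈-concat⁺′ q∈ b′∈))) of λ ()

wins-closed : ∀ {bs ts us} → concat bs ↭ forestLeaves (ts ++ us) → Unique (forestOccurrences (ts ++ us)) →
  Dual ts us →
              suc (length (forestLeaves ts)) ≤ length bs →
              length bs ≡ 1 ⊎ (All (_≢ []) bs × Connected bs ts us) → Wins (closedLinks bs ts us)
wins-closed {bs} {ts} {us} σ u d le conn
  with wins-or-split (zipWith _,_ (forestLeaves ts) (forestLeaves us)) bs
         (↭-trans σ (↭-trans (↭-reflexive (concatMap-++ leaves ts us))
           (↭-sym (endpoints-zip (forestLeaves ts) (forestLeaves us) (length-forestLeaves d)))))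
         (subst (λ n → suc n ≤ length bs) (sym (length-zip (forestLeaves ts) (forestLeaves us)
           (length-forestLeaves d))) le)
... | inj₂ s = ⊥-elim (no-split σ u d conn s)
... | inj₁ (_ , w) = wins-resp-↭
  (↭-trans (++⁺ˡ (map dai bs) (++⁺ʳ (cutRoots ts us) (↭-reflexive (concatMap-++ treeLinks ts us))))
    (solve 4 (λ d a b c → d ⊕ ((a ⊕ b) ⊕ c) ⊜ a ⊕ (b ⊕ (c ⊕ d))) ↭-refl (map dai bs) (forestLinks ts)
      (forestLinks us) (cutRoots ts us)))
  (wins-forest (map dai bs) d (wins-resp-↭
    (↭-trans (++-comm (zipWith cut (forestLeaves ts) (forestLeaves us)) (map dai bs))
      (++⁺ˡ (map dai bs) (↭-reflexive (sym (edgeCut-zip (forestLeaves ts) (forestLeaves us))))))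
    w))

-- Switchings of forests

replace-≡ : ∀ r p → replace r p r ≡ p
replace-≡ r p with r ≟ r
... | yes _ = refl
... | no ne = ⊥-elim (ne refl)

replace-≢ : ∀ {r p x} → x ≢ r → replace r p x ≡ x
replace-≢ {r} {p} {x} ne with x ≟ r
... | yes eq = ⊥-elim (ne eq)
... | no _ = refl

setRoot : Pos → Tree → Tree
setRoot p (leaf _)       = leaf p
setRoot p (node k _ t u) = node k p t u

root-setRoot : ∀ p t → root (setRoot p t) ≡ p
root-setRoot p (leaf _)       = refl
root-setRoot p (node _ _ _ _) = refl

below : Tree → List Pos
below (leaf _)       = []
below (node _ _ t u) = occurrences t ++ occurrences u

occurrences-root : ∀ t → occurrences t ≡ root t ∷ below t
occurrences-root (leaf _)       = refl
occurrences-root (node _ _ _ _) = refl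

occurrences-setRoot : ∀ p t → occurrences (setRoot p t) ≡ p ∷ below t
occurrences-setRoot p (leaf _)       = refl
occurrences-setRoot p (node _ _ _ _) = refl

kept severed : Side → Pos → Pos → Pos
kept left  p₁ p₂ = p₁
kept right p₁ p₂ = p₂
severed left  p₁ p₂ = p₂
severed right p₁ p₂ = p₁

-- TreeStep s p₁ p₂ p t t′ v: switching the par link with inputs p₁, p₂ and output
-- p inside t leaves t′ in place of t and detaches v.
data TreeStep : Side → Pos → Pos → Pos → Tree → Tree → Tree → Set where
  hereˡ : ∀ {p t u} → TreeStep left (root t) (root u) p (node parr p t u) (setRoot p t) u
  hereʳ : ∀ {p t u} → TreeStep right (root t) (root u) p (node parr p t u) (setRoot p u) t
  inˡ   : ∀ {s p₁ p₂ p k q t t′ u v} → TreeStep s p₁ p₂ p t t′ v →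
          TreeStep s p₁ p₂ p (node k q t u) (node k q t′ u) v
  inʳ   : ∀ {s p₁ p₂ p k q t u u′ v} → TreeStep s p₁ p₂ p u u′ v →
          TreeStep s p₁ p₂ p (node k q t u) (node k q t u′) v

step-root : ∀ {s p₁ p₂ p t t′ v} → TreeStep s p₁ p₂ p t t′ v → root t′ ≡ root t
step-root (hereˡ {p} {t}) = root-setRoot p t
step-root (hereʳ {p} {u = u}) = root-setRoot p u
step-root (inˡ _) = refl
step-root (inʳ _) = refl

step-severed : ∀ {s p₁ p₂ p t t′ v} → TreeStep s p₁ p₂ p t t′ v → root v ≡ severed s p₁ p₂
step-severed hereˡ = refl
step-severed hereʳ = refl
step-severed (inˡ st) = step-severed st
step-severed (inʳ st) = step-severed st

pars-setRoot : ∀ p t → pars (setRoot p t) ≡ pars t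
pars-setRoot p (leaf _)            = refl
pars-setRoot p (node tensor _ _ _) = refl
pars-setRoot p (node parr _ _ _)   = refl

step-pars : ∀ {s p₁ p₂ p t t′ v} → TreeStep s p₁ p₂ p t t′ v → pars t ≡ suc (pars t′ + pars v)
step-pars (hereˡ {p} {t} {u}) = cong (λ n → suc (n + pars u)) (sym (pars-setRoot p t))
step-pars (hereʳ {p} {t} {u}) = cong suc (trans (ℕ.+-comm (pars t) (pars u))
  (cong (_+ pars t) (sym (pars-setRoot p u))))
step-pars (inˡ {k = tensor} {t′ = t′} {u} {v} st) = trans (cong (_+ pars u) (step-pars st))
  (cong suc (trans (ℕ.+-assoc (pars t′) (pars v) (pars u)) (trans (cong (pars t′ +_)
    (ℕ.+-comm (pars v) (pars u)))
    (sym (ℕ.+-assoc (pars t′) (pars u) (pars v))))))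
step-pars (inˡ {k = parr} {t′ = t′} {u} {v} st) = cong suc (trans (cong (_+ pars u) (step-pars st))
  (cong suc (trans (ℕ.+-assoc (pars t′) (pars v) (pars u)) (trans (cong (pars t′ +_)
    (ℕ.+-comm (pars v) (pars u)))
    (sym (ℕ.+-assoc (pars t′) (pars u) (pars v)))))))
step-pars (inʳ {k = tensor} {t = t} {u′ = u′} {v} st) = trans (cong (pars t +_) (step-pars st))
  (trans (ℕ.+-suc (pars t) _) (cong suc (sym (ℕ.+-assoc (pars t) (pars u′) (pars v)))))
step-pars (inʳ {k = parr} {t = t} {u′ = u′} {v} st) = cong suc (trans (cong (pars t +_) (step-pars st))
  (trans (ℕ.+-suc (pars t) _) (cong suc (sym (ℕ.+-assoc (pars t) (pars u′) (pars v))))))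

step-occurrences : ∀ {s p₁ p₂ p t t′ v} → TreeStep s p₁ p₂ p t t′ v →
                   occurrences t ↭ kept s p₁ p₂ ∷ occurrences t′ ++ occurrences v
step-occurrences (hereˡ {p} {t} {u}) rewrite occurrences-root t | occurrences-setRoot p t = swap p
  (root t) ↭-refl
step-occurrences (hereʳ {p} {t} {u}) rewrite occurrences-root u | occurrences-setRoot p u =
  solve 4 (λ p t r b → p ⊕ (t ⊕ (r ⊕ b)) ⊜ r ⊕ ((p ⊕ b) ⊕ t)) ↭-refl (p ∷ []) (occurrences t) (root u ∷ [])
    (below u)
step-occurrences {s} {p₁} {p₂} (inˡ {q = q} {t′ = t′} {u} {v} st) =
  ↭-trans (prep q (++⁺ʳ (occurrences u) (step-occurrences st)))
    (solve 5 (λ q r a v u → q ⊕ ((r ⊕ (a ⊕ v)) ⊕ u) ⊜ r ⊕ ((q ⊕ (a ⊕ u)) ⊕ v)) ↭-refl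
      (q ∷ []) (kept s p₁ p₂ ∷ []) (occurrences t′) (occurrences v) (occurrences u))
step-occurrences {s} {p₁} {p₂} (inʳ {q = q} {t} {u′ = u′} {v} st) =
  ↭-trans (prep q (++⁺ˡ (occurrences t) (step-occurrences st)))
    (solve 5 (λ q r a v t → q ⊕ (t ⊕ (r ⊕ (a ⊕ v))) ⊜ r ⊕ ((q ⊕ (t ⊕ a)) ⊕ v)) ↭-refl
      (q ∷ []) (kept s p₁ p₂ ∷ []) (occurrences u′) (occurrences v) (occurrences t))

kept∈ : ∀ {s p₁ p₂ p t t′ v} → TreeStep s p₁ p₂ p t t′ v → kept s p₁ p₂ ∈ occurrences t
kept∈ st = ∈-resp-↭ (↭-sym (step-occurrences st)) (here refl)

retarget-connective : ∀ f k {p₁ p₂ p} → retarget f (connective k p₁ p₂ p) ≡ connective k p₁ p₂ (f p)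
retarget-connective f tensor = refl
retarget-connective f parr   = refl

module _ {X : Set} (Q : Pos → X) where

  paint-fixed : ∀ {r p} t → r ∉ occurrences t → paint (Q ∘ replace r p) t ≡ paint Q t
  paint-fixed (leaf x) r∉ = cong (leaf ∘ Q) (replace-≢ (λ { refl → r∉ (here refl) }))
  paint-fixed (node k q t u) r∉ = cong₂ (node k) (paint-fixed t (r∉ ∘ there ∘ ∈-++⁺ˡ))
    (paint-fixed u (r∉ ∘ there ∘ ∈-++⁺ʳ (occurrences t)))

  paint-setRoot : ∀ {p} t → Unique (occurrences t) → paint (Q ∘ replace (root t) p) t ≡ paint Q (setRoot p t)
  paint-setRoot (leaf x) _ = cong (leaf ∘ Q) (replace-≡ x _)
  paint-setRoot (node k q t u) w = cong₂ (node k) (paint-fixed t (Unique-head w ∘ ∈-++⁺ˡ))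
    (paint-fixed u (Unique-head w ∘ ∈-++⁺ʳ (occurrences t)))

leaves-fixed : ∀ {r p} t → r ∉ occurrences t → map (replace r p) (leaves t) ≡ leaves t
leaves-fixed (leaf x) r∉ = cong (_∷ []) (replace-≢ (λ { refl → r∉ (here refl) }))
leaves-fixed (node k q t u) r∉ = trans (map-++ _ (leaves t) (leaves u))
  (cong₂ _++_ (leaves-fixed t (r∉ ∘ there ∘ ∈-++⁺ˡ)) (leaves-fixed u (r∉ ∘ there ∘ ∈-++⁺ʳ (occurrences t))))

leaves-setRoot : ∀ {p} t → Unique (occurrences t) → map (replace (root t) p) (leaves t) ≡ leaves (setRoot p t)
leaves-setRoot (leaf x) _ = cong (_∷ []) (replace-≡ x _)
leaves-setRoot (node k q t u) w = trans (map-++ _ (leaves t) (leaves u))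
  (cong₂ _++_ (leaves-fixed t (Unique-head w ∘ ∈-++⁺ˡ)) (leaves-fixed u
    (Unique-head w ∘ ∈-++⁺ʳ (occurrences t))))

treeLinks-fixed : ∀ {r p} t → r ∉ occurrences t → map (retarget (replace r p)) (treeLinks t) ≡ treeLinks t
treeLinks-fixed (leaf x) r∉ = refl
treeLinks-fixed {r} {p} (node k q t u) r∉ = cong₂ _∷_
  (trans (retarget-connective _ k) (cong (connective k (root t) (root u))
    (replace-≢ (λ { refl → r∉ (here refl) }))))
  (trans (map-++ _ (treeLinks t) (treeLinks u)) (cong₂ _++_ (treeLinks-fixed t (r∉ ∘ there ∘ ∈-++⁺ˡ))
    (treeLinks-fixed u (r∉ ∘ there ∘ ∈-++⁺ʳ (occurrences t)))))

treeLinks-setRoot : ∀ {p} t → Unique (occurrences t) →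
                    map (retarget (replace (root t) p)) (treeLinks t) ≡ treeLinks (setRoot p t)
treeLinks-setRoot (leaf x) _ = refl
treeLinks-setRoot {p} (node k q t u) w = cong₂ _∷_
  (trans (retarget-connective _ k) (cong (connective k (root t) (root u)) (replace-≡ q p)))
  (trans (map-++ _ (treeLinks t) (treeLinks u)) (cong₂ _++_ (treeLinks-fixed t (Unique-head w ∘ ∈-++⁺ˡ))
    (treeLinks-fixed u (Unique-head w ∘ ∈-++⁺ʳ (occurrences t)))))

unique-sibling : ∀ {t u x} {q : Pos} → Unique (q ∷ occurrences t ++ occurrences u) → x ∈ occurrences t →
  x ∉ occurrences u
unique-sibling {t} (_ ∷ w) m m′ = proj₂ (proj₂ (Unique-++⁻ (occurrences t) w)) (m , m′)

step-links : ∀ {s p₁ p₂ p t t′ v} → TreeStep s p₁ p₂ p t t′ v → Unique (occurrences t) →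
  ∃[ E ] treeLinks t ↭ par p₁ p₂ p ∷ E × map (retarget (replace (kept s p₁ p₂) p)) E ↭ treeLinks t′ ++
    treeLinks v
step-links (hereˡ {p} {t} {u}) w = _ , ↭-refl , ↭-reflexive
  (trans (map-++ _ (treeLinks t) (treeLinks u)) (cong₂ _++_
    (treeLinks-setRoot t (proj₁ (unique-children {parr} {p} {t} {u} w)))
    (treeLinks-fixed u (unique-sibling {t} {u} w (root∈ t)))))
step-links (hereʳ {p} {t} {u}) w = _ , ↭-refl , ↭-trans (↭-reflexive
  (trans (map-++ _ (treeLinks t) (treeLinks u)) (cong₂ _++_
    (treeLinks-fixed t (λ m → unique-sibling {t} {u} w m (root∈ u)))
    (treeLinks-setRoot u (proj₂ (unique-children {parr} {p} {t} {u} w))))))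
  (++-comm (treeLinks t) (treeLinks (setRoot p u)))
step-links {s} {p₁} {p₂} {p} (inˡ {k = k} {q} {t} {t′} {u} {v} st) w
  with E , σ , τ ← step-links st (proj₁ (unique-children {k} {q} {t} {u} w)) =
  connective k (root t) (root u) q ∷ E ++ treeLinks u ,
  ↭-trans (prep _ (++⁺ʳ (treeLinks u) σ)) (swap _ _ ↭-refl) ,
  ↭-trans (↭-reflexive (cong₂ _∷_
    (trans (retarget-connective _ k) (cong₂ (λ a b → connective k a (root u) b) (sym (step-root st))
      (replace-≢ {r = kept s p₁ p₂} (λ { refl → Unique-head w (∈-++⁺ˡ (kept∈ st)) }))))
    (map-++ _ E (treeLinks u))))
  (prep _ (↭-trans (++⁺ τ (↭-reflexive (treeLinks-fixed u (unique-sibling {t} {u} w (kept∈ st)))))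
    (solve 3 (λ a b c → (a ⊕ b) ⊕ c ⊜ (a ⊕ c) ⊕ b) ↭-refl (treeLinks t′) (treeLinks v) (treeLinks u))))
step-links {s} {p₁} {p₂} {p} (inʳ {k = k} {q} {t} {u} {u′} {v} st) w
  with E , σ , τ ← step-links st (proj₂ (unique-children {k} {q} {t} {u} w)) =
  connective k (root t) (root u) q ∷ treeLinks t ++ E ,
  ↭-trans (prep _ (↭-trans (++⁺ˡ (treeLinks t) σ) (shift _ (treeLinks t) E))) (swap _ _ ↭-refl) ,
  ↭-trans (↭-reflexive (cong₂ _∷_
    (trans (retarget-connective _ k) (cong₂ (λ a b → connective k (root t) a b) (sym (step-root st))
      (replace-≢ {r = kept s p₁ p₂} (λ { refl → Unique-head w (∈-++⁺ʳ (occurrences t) (kept∈ st)) }))))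
    (map-++ _ (treeLinks t) E)))
  (prep _ (↭-trans (++⁺ (↭-reflexive (treeLinks-fixed t (λ m → unique-sibling {t} {u} w m (kept∈ st)))) τ)
    (↭-reflexive (sym (++-assoc (treeLinks t) (treeLinks u′) (treeLinks v))))))

step-leaves : ∀ {s p₁ p₂ p t t′ v} → TreeStep s p₁ p₂ p t t′ v → Unique (occurrences t) →
  map (replace (kept s p₁ p₂) p) (leaves t) ↭ leaves t′ ++ leaves v
step-leaves (hereˡ {p} {t} {u}) w = ↭-reflexive
  (trans (map-++ _ (leaves t) (leaves u)) (cong₂ _++_
    (leaves-setRoot t (proj₁ (unique-children {parr} {p} {t} {u} w)))
    (leaves-fixed u (unique-sibling {t} {u} w (root∈ t)))))
step-leaves (hereʳ {p} {t} {u}) w = ↭-trans (↭-reflexive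
  (trans (map-++ _ (leaves t) (leaves u)) (cong₂ _++_
    (leaves-fixed t (λ m → unique-sibling {t} {u} w m (root∈ u)))
    (leaves-setRoot u (proj₂ (unique-children {parr} {p} {t} {u} w))))))
  (++-comm (leaves t) (leaves (setRoot p u)))
step-leaves (inˡ {k = k} {q} {t} {t′} {u} {v} st) w =
  ↭-trans (↭-reflexive (map-++ _ (leaves t) (leaves u)))
  (↭-trans (++⁺ (step-leaves st (proj₁ (unique-children {k} {q} {t} {u} w)))
      (↭-reflexive (leaves-fixed u (unique-sibling {t} {u} w (kept∈ st)))))
    (solve 3 (λ a b c → (a ⊕ b) ⊕ c ⊜ (a ⊕ c) ⊕ b) ↭-refl (leaves t′) (leaves v) (leaves u)))
step-leaves (inʳ {k = k} {q} {t} {u} {u′} {v} st) w =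
  ↭-trans (↭-reflexive (map-++ _ (leaves t) (leaves u)))
  (↭-trans (++⁺ (↭-reflexive (leaves-fixed t (λ m → unique-sibling {t} {u} w m (kept∈ st))))
      (step-leaves st (proj₂ (unique-children {k} {q} {t} {u} w))))
    (↭-reflexive (sym (++-assoc (leaves t) (leaves u′) (leaves v)))))

forestLinks-fixed : ∀ {r p} ts → r ∉ forestOccurrences ts → map (retarget (replace r p))
  (forestLinks ts) ≡ forestLinks ts
forestLinks-fixed [] _ = refl
forestLinks-fixed (t ∷ ts) r∉ = trans (map-++ _ (treeLinks t) (forestLinks ts))
  (cong₂ _++_ (treeLinks-fixed t (r∉ ∘ ∈-++⁺ˡ)) (forestLinks-fixed ts (r∉ ∘ ∈-++⁺ʳ (occurrences t))))

forestLeaves-fixed : ∀ {r p} ts → r ∉ forestOccurrences ts → map (replace r p)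
  (forestLeaves ts) ≡ forestLeaves ts
forestLeaves-fixed [] _ = refl
forestLeaves-fixed (t ∷ ts) r∉ = trans (map-++ _ (leaves t) (forestLeaves ts))
  (cong₂ _++_ (leaves-fixed t (r∉ ∘ ∈-++⁺ˡ)) (forestLeaves-fixed ts (r∉ ∘ ∈-++⁺ʳ (occurrences t))))

retarget-dai : ∀ f bs → map (retarget f) (map dai bs) ≡ map dai (map (map f) bs)
retarget-dai f bs = trans (sym (map-∘ bs)) (map-∘ bs)

module ForestStep {s p₁ p₂ p t t′ v} (as cs : List Tree) (st : TreeStep s p₁ p₂ p t t′ v)
                  (w : Unique (forestOccurrences (as ++ t ∷ cs))) where

  r : Pos
  r = kept s p₁ p₂

  f : Pos → Pos
  f = replace r p

  -- The detached tree comes last because a switching step makes its root the last conclusion.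
  after : List Tree
  after = as ++ t′ ∷ cs ++ v ∷ []

  private
    w′ : Unique (forestOccurrences as ++ occurrences t ++ forestOccurrences cs)
    w′ = subst Unique (concatMap-++ occurrences as (t ∷ cs)) w

    wt : Unique (occurrences t)
    wt = proj₁ (Unique-++⁻ (occurrences t) (proj₁ (proj₂ (Unique-++⁻ (forestOccurrences as) w′))))

    r∉as : r ∉ forestOccurrences as
    r∉as m = proj₂ (proj₂ (Unique-++⁻ (forestOccurrences as) w′)) (m , ∈-++⁺ˡ (kept∈ st))

    r∉cs : r ∉ forestOccurrences cs
    r∉cs m = proj₂ (proj₂ (Unique-++⁻ (occurrences t) (proj₁ (proj₂ (Unique-++⁻ (forestOccurrences as) w′)))))
      (kept∈ st , m)

    concatMap-after : (h : Tree → List Pos) → concatMap h after ↭ concatMap h as ++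
      (h t′ ++ h v) ++ concatMap h cs
    concatMap-after h = ↭-trans
      (↭-reflexive (trans (concatMap-++ h as _) (cong (λ z → concatMap h as ++ h t′ ++ z)
        (concatMap-++ h cs (v ∷ [])))))
      (↭-trans (++⁺ˡ (concatMap h as) (++⁺ˡ (h t′) (++⁺ˡ (concatMap h cs) (↭-reflexive (++-identityʳ (h v))))))
        (solve 4 (λ a t c v → a ⊕ (t ⊕ (c ⊕ v)) ⊜ a ⊕ ((t ⊕ v) ⊕ c)) ↭-refl (concatMap h as) (h t′)
          (concatMap h cs) (h v)))

  unique-after : Unique (forestOccurrences after)
  unique-after = AllPairs.tail (Unique-resp-↭ (↭-trans
    (++⁺ˡ (forestOccurrences as) (++⁺ʳ (forestOccurrences cs) (step-occurrences st)))
    (↭-trans (shift r (forestOccurrences as) _) (prep r (↭-sym (concatMap-after occurrences))))) w′)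

  module _ {G bs E} (F : IsForest G (as ++ t ∷ cs) bs) (ρ : links G ↭ par p₁ p₂ p ∷ E) where

    private
      E₀ = proj₁ (step-links st wt)
      σ₀ = proj₁ (proj₂ (step-links st wt))
      τ₀ = proj₂ (proj₂ (step-links st wt))

      E-↭ : E ↭ map dai bs ++ forestLinks as ++ E₀ ++ forestLinks cs
      E-↭ = drop-∷ (↭-trans (↭-sym ρ) (↭-trans (IsForest.links-↭ F) (↭-trans
        (++⁺ˡ (map dai bs) (↭-trans (↭-reflexive (concatMap-++ treeLinks as (t ∷ cs)))
          (++⁺ˡ (forestLinks as) (++⁺ʳ (forestLinks cs) σ₀))))
        (solve 5 (λ b a l e c → b ⊕ (a ⊕ ((l ⊕ e) ⊕ c)) ⊜ l ⊕ (b ⊕ (a ⊕ (e ⊕ c)))) ↭-refl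
          (map dai bs) (forestLinks as) (par p₁ p₂ p ∷ []) E₀ (forestLinks cs)))))

    isForest-after : IsForest (graph (map (retarget f) E) (concl G ++ severed s p₁ p₂ ∷ [])) after
      (map (map f) bs)
    isForest-after = record
      { links-↭ = ↭-trans (map⁺ (retarget f) E-↭) (↭-trans
          (↭-reflexive (trans (map-++ (retarget f) (map dai bs) _) (cong₂ _++_ (retarget-dai f bs)
            (trans (map-++ (retarget f) (forestLinks as) _) (cong₂ _++_ (forestLinks-fixed as r∉as)
              (trans (map-++ (retarget f) E₀ _) (cong (map (retarget f) E₀ ++_)
                (forestLinks-fixed cs r∉cs))))))))
          (++⁺ˡ (map dai (map (map f) bs)) (↭-trans
            (++⁺ˡ (forestLinks as) (++⁺ʳ (forestLinks cs) τ₀))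
            (↭-sym (↭-trans (↭-reflexive (trans (concatMap-++ treeLinks as _)
                (cong (λ z → forestLinks as ++ treeLinks t′ ++ z) (concatMap-++ treeLinks cs (v ∷ [])))))
              (↭-trans (++⁺ˡ (forestLinks as) (++⁺ˡ (treeLinks t′) (++⁺ˡ (forestLinks cs)
                (↭-reflexive (++-identityʳ (treeLinks v))))))
              (solve 4 (λ a t c v → a ⊕ (t ⊕ (c ⊕ v)) ⊜ a ⊕ ((t ⊕ v) ⊕ c)) ↭-refl
                (forestLinks as) (treeLinks t′) (forestLinks cs) (treeLinks v))))))))
      ; leaves-↭ = ↭-trans (↭-reflexive (concat-rename f bs)) (↭-trans (map⁺ f (IsForest.leaves-↭ F)) (↭-trans
          (↭-reflexive (trans (cong (map f) (concatMap-++ leaves as (t ∷ cs)))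
            (trans (map-++ f (forestLeaves as) _) (cong₂ _++_ (forestLeaves-fixed as r∉as)
              (trans (map-++ f (leaves t) _) (cong (map f (leaves t) ++_) (forestLeaves-fixed cs r∉cs)))))))
          (↭-trans (++⁺ˡ (forestLeaves as) (++⁺ʳ (forestLeaves cs) (step-leaves st wt)))
            (↭-sym (concatMap-after leaves)))))
      ; concl-≡ = trans (cong (_++ severed s p₁ p₂ ∷ []) (IsForest.concl-≡ F))
          (trans (cong₂ _++_ (trans (map-++ root as (t ∷ cs)) (trans
              (cong (λ z → map root as ++ z ∷ map root cs) (sym (step-root st)))
                (sym (map-++ root as (t′ ∷ cs)))))
            (cong (_∷ []) (sym (step-severed st))))
          (trans (sym (map-++ root (as ++ t′ ∷ cs) (v ∷ []))) (cong (map root)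
            (++-assoc as (t′ ∷ cs) (v ∷ [])))))
      }

  length-after : length after ≡ suc (length (as ++ t ∷ cs))
  length-after = trans (length-++ as) (trans (cong (λ n → length as + suc n)
    (trans (length-++ cs) (ℕ.+-comm (length cs) 1)))
    (trans (ℕ.+-suc (length as) _) (cong suc (sym (length-++ as)))))

  pars-after : forestPars (as ++ t ∷ cs) ≡ suc (forestPars after)
  pars-after = trans (forestPars-++ as (t ∷ cs)) (trans (cong (λ n → forestPars as + (n + forestPars cs))
    (step-pars st))
    (trans (+-*-Solver.solve 4 (λ a x y c → a :+ ((con 1 :+ (x :+ y)) :+ c) := con 1 :+
      (a :+ (x :+ (c :+ (y :+ con 0)))))
      refl (forestPars as) (pars t′) (pars v) (forestPars cs))
    (cong suc (sym (trans (forestPars-++ as _) (cong (λ n → forestPars as + (pars t′ + n))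
      (forestPars-++ cs (v ∷ [])))))) ))
    where
    open +-*-Solver using (_:+_; _:=_; con)

side-step : ∀ {G E p₁ p₂ p} s → links G ↭ par p₁ p₂ p ∷ E →
  SwitchingStep G (replace (kept s p₁ p₂) p)
    (graph (map (retarget (replace (kept s p₁ p₂) p)) E) (concl G ++ severed s p₁ p₂ ∷ []))
side-step left  ρ = leftStep ρ
side-step right ρ = rightStep ρ

locate-tree : ∀ s t {p₁ p₂ p} → par p₁ p₂ p ∈ treeLinks t → ∃[ t′ ] ∃[ v ] TreeStep s p₁ p₂ p t t′ v
locate-tree left  (node parr q t u) (here refl) = _ , _ , hereˡ
locate-tree right (node parr q t u) (here refl) = _ , _ , hereʳ
locate-tree s (node k q t u) (there m) with ∈-++⁻ (treeLinks t) m
... | inj₁ m′ with _ , _ , st ← locate-tree s t m′ = _ , _ , inˡ st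
... | inj₂ m′ with _ , _ , st ← locate-tree s u m′ = _ , _ , inʳ st

locate-forest : ∀ ts {l} → l ∈ forestLinks ts → ∃[ as ] ∃[ t ] ∃[ cs ] ts ≡ as ++ t ∷ cs × l ∈ treeLinks t
locate-forest (t ∷ ts) m with ∈-++⁻ (treeLinks t) m
... | inj₁ m′ = [] , t , ts , refl , m′
... | inj₂ m′ with as , u , cs , refl , m″ ← locate-forest ts m′ = t ∷ as , u , cs , refl , m″

-- The colours that the root of a tree can take when the edges selected by some
-- switching join positions of the same colour.
data Switchable : Painted Bool → Bool → Set where
  leaf : ∀ {b} → Switchable (leaf b) b
  ten  : ∀ {s t b} → Switchable s b → Switchable t b → Switchable (node tensor s t) b
  parˡ : ∀ {s t b c} → Switchable s b → Switchable t c → Switchable (node parr s t) b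
  parʳ : ∀ {s t b c} → Switchable s b → Switchable t c → Switchable (node parr s t) c

-- Colours are read backwards along the step. The replacement identifies the kept premise with the
-- output of the par, which accounts for the selected edge; the detached tree may take any colour
-- `c`.
step-switchable : ∀ {s p₁ p₂ p t t′ v} (Q : Pos → Bool) → TreeStep s p₁ p₂ p t t′ v → Unique (occurrences t) →
  ∀ {b c} → Switchable (paint Q t′) b → Switchable (paint Q v) c → Switchable
    (paint (Q ∘ replace (kept s p₁ p₂) p) t) b
step-switchable Q (hereˡ {p} {t} {u}) w x y = parˡ
  (subst (λ z → Switchable z _) (sym (paint-setRoot Q t (proj₁ (unique-children {parr} {p} {t} {u} w)))) x)
  (subst (λ z → Switchable z _) (sym (paint-fixed Q u (unique-sibling {t} {u} w (root∈ t)))) y)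
step-switchable Q (hereʳ {p} {t} {u}) w x y = parʳ
  (subst (λ z → Switchable z _) (sym (paint-fixed Q t (λ m → unique-sibling {t} {u} w m (root∈ u)))) y)
  (subst (λ z → Switchable z _) (sym (paint-setRoot Q u (proj₂ (unique-children {parr} {p} {t} {u} w)))) x)
step-switchable Q (inˡ {k = k} {q} {t} {u = u} st) w x y = go k x
  where
  ih = λ {b} x → step-switchable Q st (proj₁ (unique-children {k} {q} {t} {u} w)) {b} x y
  u≡ : ∀ {b} → Switchable (paint Q u) b → Switchable (paint (Q ∘ replace _ _) u) b
  u≡ = subst (λ z → Switchable z _) (sym (paint-fixed Q u (unique-sibling {t} {u} w (kept∈ st))))
  go : ∀ k {b} → Switchable (node k _ (paint Q u)) b → Switchable (node k (paint (Q ∘ replace _ _) t)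
    (paint (Q ∘ replace _ _) u)) b
  go tensor (ten a b) = ten (ih a) (u≡ b)
  go parr (parˡ a b) = parˡ (ih a) (u≡ b)
  go parr (parʳ a b) = parʳ (ih a) (u≡ b)
step-switchable Q (inʳ {k = k} {q} {t} {u} st) w x y = go k x
  where
  ih = λ {b} x → step-switchable Q st (proj₂ (unique-children {k} {q} {t} {u} w)) {b} x y
  t≡ : ∀ {b} → Switchable (paint Q t) b → Switchable (paint (Q ∘ replace _ _) t) b
  t≡ = subst (λ z → Switchable z _) (sym (paint-fixed Q t (λ m → unique-sibling {t} {u} w m (kept∈ st))))
  go : ∀ k {b} → Switchable (node k (paint Q t) _) b → Switchable (node k (paint (Q ∘ replace _ _) t)
    (paint (Q ∘ replace _ _) u)) b
  go tensor (ten a b) = ten (t≡ a) (ih b)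
  go parr (parˡ a b) = parˡ (t≡ a) (ih b)
  go parr (parʳ a b) = parʳ (t≡ a) (ih b)

ParFree : List Tree → Set
ParFree ts = ∀ p₁ p₂ p → par p₁ p₂ p ∉ forestLinks ts

pars≡0 : ∀ t → (∀ p₁ p₂ p → par p₁ p₂ p ∉ treeLinks t) → pars t ≡ 0
pars≡0 (leaf _) _ = refl
pars≡0 (node tensor p t u) n = cong₂ _+_ (pars≡0 t (λ _ _ _ m → n _ _ _ (there (∈-++⁺ˡ m))))
  (pars≡0 u (λ _ _ _ m → n _ _ _ (there (∈-++⁺ʳ (treeLinks t) m))))
pars≡0 (node parr p t u) n = ⊥-elim (n _ _ _ (here refl))

forestPars≡0 : ∀ ts → ParFree ts → forestPars ts ≡ 0
forestPars≡0 [] _ = refl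
forestPars≡0 (t ∷ ts) n = cong₂ _+_ (pars≡0 t (λ _ _ _ m → n _ _ _ (∈-++⁺ˡ m)))
  (forestPars≡0 ts (λ _ _ _ m → n _ _ _ (∈-++⁺ʳ (treeLinks t) m)))

parFree-switchable : ∀ (Q : Pos → Bool) {b} t → pars t ≡ 0 → (∀ {p} → p ∈ leaves t → Q p ≡ b) → Switchable
  (paint Q t) b
parFree-switchable Q (leaf p) _ m = subst (Switchable (leaf (Q p))) (m (here refl)) leaf
parFree-switchable Q (node tensor p t u) eq m = ten
  (parFree-switchable Q t (ℕ.m+n≡0⇒m≡0 (pars t) eq) (m ∘ ∈-++⁺ˡ))
  (parFree-switchable Q u (ℕ.m+n≡0⇒n≡0 (pars t) eq) (m ∘ ∈-++⁺ʳ (leaves t)))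

-- What any given switching reveals. Each par detaches one tree, whence the number of conclusions;
-- and a colouring constant on the leaves above each conclusion lifts to one in which the edges
-- selected by this switching join equal colours.
record Switched (G : Graph) (ι : Pos → Pos) (H : Graph) (ts : List Tree) (bs : List (List Pos)) : Set where
  field
    trees      : List Tree
    isForest   : IsForest H trees (map (map ι) bs)
    unique     : Unique (forestOccurrences trees)
    par-free   : forestPars trees ≡ 0
    length-≡   : length trees ≡ length ts + forestPars ts
    switchable : ∀ Q → (∀ {u} → u ∈ trees → Monochrome Q (leaves u)) →
                 ∀ {t} → t ∈ ts → ∃[ b ] Switchable (paint (Q ∘ ι) t) b

tree-pars≡0 : ∀ {ts t} → t ∈ ts → forestPars ts ≡ 0 → pars t ≡ 0
tree-pars≡0 {t ∷ _} (here refl) eq = ℕ.m+n≡0⇒m≡0 (pars t) eq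
tree-pars≡0 {t ∷ _} (there m) eq = tree-pars≡0 m (ℕ.m+n≡0⇒n≡0 (pars t) eq)

unique-tree : ∀ {ts t} → t ∈ ts → Unique (forestOccurrences ts) → Unique (occurrences t)
unique-tree {t ∷ ts} (here refl) w = proj₁ (Unique-++⁻ (occurrences t) w)
unique-tree {t ∷ ts} (there m) w = unique-tree m (proj₁ (proj₂ (Unique-++⁻ (occurrences t) w)))

occurrences-⊆ : ∀ {ts t} → t ∈ ts → occurrences t ⊆ forestOccurrences ts
occurrences-⊆ (here refl) m = ∈-++⁺ˡ m
occurrences-⊆ {t′ ∷ _} (there t∈) m = ∈-++⁺ʳ (occurrences t′) (occurrences-⊆ t∈ m)

switched-normal : ∀ {G ts bs} → (∀ p₁ p₂ p → par p₁ p₂ p ∉ links G) → IsForest G ts bs → Unique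
  (forestOccurrences ts) →
                  Switched G id G ts bs
switched-normal {G} {ts} {bs} n F w = record
  { trees      = ts
  ; isForest   = subst (IsForest G ts) (sym (trans (map-cong map-id bs) (map-id bs))) F
  ; unique     = w
  ; par-free   = none
  ; length-≡   = sym (trans (cong (length ts +_) none) (ℕ.+-identityʳ _))
  ; switchable = λ Q m {t} t∈ → let b , h = m t∈ in b , parFree-switchable Q t (tree-pars≡0 t∈ none) h
  }
  where
  none = forestPars≡0 ts λ _ _ _ m → n _ _ _ (∈-resp-↭ (↭-sym (IsForest.links-↭ F)) (∈-++⁺ʳ (map dai bs) m))

switched-step : ∀ {G E s p₁ p₂ p t t′ v bs ι H} as cs (st : TreeStep s p₁ p₂ p t t′ v)
  (w : Unique (forestOccurrences (as ++ t ∷ cs))) → let open ForestStep as cs st w in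
  Switched (graph (map (retarget f) E) (concl G ++ severed s p₁ p₂ ∷ [])) ι H after (map (map f) bs) →
  Switched G (ι ∘ f) H (as ++ t ∷ cs) bs
switched-step {t = t} {t′} {v} {bs} {ι} {H} as cs st w S = record
  { trees      = trees
  ; isForest   = subst (IsForest H trees) (trans (sym (map-∘ bs)) (map-cong (λ b → sym (map-∘ b)) bs)) isForest
  ; unique     = unique
  ; par-free   = par-free
  ; length-≡   = trans length-≡ (trans (cong (_+ forestPars after) length-after)
                   (trans (sym (ℕ.+-suc _ (forestPars after))) (cong (length (as ++ t ∷ cs) +_)
                     (sym pars-after))))
  ; switchable = λ Q m t∈ → sw Q (switchable Q m) t∈
  }
  where
  open ForestStep as cs st w
  open Switched S
  sw : ∀ Q → (∀ {u} → u ∈ after → ∃[ b ] Switchable (paint (Q ∘ ι) u) b) →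
       ∀ {u} → u ∈ as ++ t ∷ cs → ∃[ b ] Switchable (paint (Q ∘ ι ∘ f) u) b
  sw Q h {u} u∈ with ∈-++⁻ as u∈
  ... | inj₁ m with b , x ← h (∈-++⁺ˡ m) = b , subst (λ z → Switchable z b) (sym (paint-fixed (Q ∘ ι) u r∉)) x
    where
    r∉ : r ∉ occurrences u
    r∉ m′ = proj₂ (proj₂ (Unique-++⁻ (forestOccurrences as) (subst Unique
      (concatMap-++ occurrences as (t ∷ cs)) w)))
      (occurrences-⊆ m m′ , ∈-++⁺ˡ (kept∈ st))
  ... | inj₂ (here refl) with b , x ← h (∈-++⁺ʳ as (here refl))
                         with c , y ← h (∈-++⁺ʳ as (there (∈-++⁺ʳ cs (here refl)))) =
    b , step-switchable (Q ∘ ι) st (unique-tree (∈-++⁺ʳ as (here refl)) w) x y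
  ... | inj₂ (there m) with b , x ← h (∈-++⁺ʳ as (there (∈-++⁺ˡ m))) =
    b , subst (λ z → Switchable z b) (sym (paint-fixed (Q ∘ ι) u r∉)) x
    where
    r∉ : r ∉ occurrences u
    r∉ m′ = proj₂ (proj₂ (Unique-++⁻ (occurrences t) (proj₁ (proj₂ (Unique-++⁻ (forestOccurrences as)
      (subst Unique (concatMap-++ occurrences as (t ∷ cs)) w)))))) (kept∈ st , occurrences-⊆ m m′)

switched-par : ∀ {G E p₁ p₂ p ts bs ι H} s → links G ↭ par p₁ p₂ p ∷ E → IsForest G ts bs → Unique
  (forestOccurrences ts) →
  (∀ {us cs} → IsForest (graph (map (retarget (replace (kept s p₁ p₂) p)) E)
    (concl G ++ severed s p₁ p₂ ∷ [])) us cs →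
     Unique (forestOccurrences us) →
     Switched (graph (map (retarget (replace (kept s p₁ p₂) p)) E) (concl G ++ severed s p₁ p₂ ∷
       [])) ι H us cs) →
  Switched G (ι ∘ replace (kept s p₁ p₂) p) H ts bs
switched-par {ts = ts} {bs} s ρ F w k with ∈-++⁻ (map dai bs) (∈-resp-↭ (IsForest.links-↭ F)
  (∈-resp-↭ (↭-sym ρ) (here refl)))
... | inj₁ m with _ , _ , () ← ∈-map⁻ dai m
... | inj₂ m with as , t , cs , refl , m′ ← locate-forest ts m with t′ , v , st ← locate-tree s t m′ =
  switched-step as cs st w (k (ForestStep.isForest-after as cs st w F ρ) (ForestStep.unique-after as cs st w))

switched : ∀ {G ι H ts bs} → Switching G ι H → IsForest G ts bs → Unique (forestOccurrences ts) →
  Switched G ι H ts bs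
switched (normal n) F w = switched-normal n F w
switched (step (leftStep ρ) S) F w  = switched-par left ρ F w (switched S)
switched (step (rightStep ρ) S) F w = switched-par right ρ F w (switched S)

-- Colourings and natural orders

-- The counterpart of `Switchable` when inner positions are coloured too: at each par some premise
-- has the colour of the output, and a switching can keep that premise.
data Valid (e : Pos → Bool) : Tree → Set where
  leaf : ∀ {p} → Valid e (leaf p)
  ten  : ∀ {p t u} → e (root t) ≡ e p → e (root u) ≡ e p → Valid e t → Valid e u → Valid e (node tensor p t u)
  parˡ : ∀ {p t u} → e (root t) ≡ e p → Valid e t → Valid e u → Valid e (node parr p t u)
  parʳ : ∀ {p t u} → e (root u) ≡ e p → Valid e t → Valid e u → Valid e (node parr p t u)

valid-setRoot : ∀ {e p} t → e (root t) ≡ e p → Valid e t → Valid e (setRoot p t)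
valid-setRoot (leaf _) eq leaf = leaf
valid-setRoot (node _ _ _ _) eq (ten a b x y) = ten (trans a eq) (trans b eq) x y
valid-setRoot (node _ _ _ _) eq (parˡ a x y) = parˡ (trans a eq) x y
valid-setRoot (node _ _ _ _) eq (parʳ a x y) = parʳ (trans a eq) x y

valid-leaves : ∀ {e t} → Valid e t → pars t ≡ 0 → ∀ {p} → p ∈ leaves t → e p ≡ e (root t)
valid-leaves leaf _ (here refl) = refl
valid-leaves {t = node _ _ t u} (ten a b x y) eq m with ∈-++⁻ (leaves t) m
... | inj₁ m′ = trans (valid-leaves x (ℕ.m+n≡0⇒m≡0 (pars t) eq) m′) a
... | inj₂ m′ = trans (valid-leaves y (ℕ.m+n≡0⇒n≡0 (pars t) eq) m′) b

ValidStep : (Pos → Bool) → Tree → Set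
ValidStep e t = ∃[ s ] ∃[ p₁ ] ∃[ p₂ ] ∃[ p ] ∃[ t′ ] ∃[ v ]
  TreeStep s p₁ p₂ p t t′ v × e (kept s p₁ p₂) ≡ e p × Valid e t′ × Valid e v

valid-step : ∀ {e} t → Valid e t → pars t ≢ 0 → ValidStep e t
valid-step (leaf _) _ n = ⊥-elim (n refl)
valid-step {e} (node tensor p t u) (ten a b x y) n with pars t ≟ 0
... | no n′ with _ , _ , _ , _ , _ , _ , st , eq , x′ , z ← valid-step t x n′ =
  _ , _ , _ , _ , _ , _ , inˡ st , eq , ten (trans (cong e (step-root st)) a) b x′ y , z
... | yes eq₀ with _ , _ , _ , _ , _ , _ , st , eq , y′ , z ← valid-step u y (n ∘ cong₂ _+_ eq₀) =
  _ , _ , _ , _ , _ , _ , inʳ st , eq , ten a (trans (cong e (step-root st)) b) x y′ , z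
valid-step (node parr p t u) (parˡ a x y) _ = _ , _ , _ , _ , _ , _ , hereˡ , a , valid-setRoot t a x , y
valid-step (node parr p t u) (parʳ b x y) _ = _ , _ , _ , _ , _ , _ , hereʳ , b , valid-setRoot u b y , x

par∉tree : ∀ t {p₁ p₂ p} → pars t ≡ 0 → par p₁ p₂ p ∉ treeLinks t
par∉tree (node tensor _ t u) eq (there m) with ∈-++⁻ (treeLinks t) m
... | inj₁ m′ = par∉tree t (ℕ.m+n≡0⇒m≡0 (pars t) eq) m′
... | inj₂ m′ = par∉tree u (ℕ.m+n≡0⇒n≡0 (pars t) eq) m′

par∉forest : ∀ ts {p₁ p₂ p} → forestPars ts ≡ 0 → par p₁ p₂ p ∉ forestLinks ts
par∉forest (t ∷ ts) eq m with ∈-++⁻ (treeLinks t) m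
... | inj₁ m′ = par∉tree t (ℕ.m+n≡0⇒m≡0 (pars t) eq) m′
... | inj₂ m′ = par∉forest ts (ℕ.m+n≡0⇒n≡0 (pars t) eq) m′

some-par : ∀ ts {n} → forestPars ts ≡ suc n → ∃[ as ] ∃[ t ] ∃[ cs ] ts ≡ as ++ t ∷ cs × pars t ≢ 0
some-par (t ∷ ts) eq with pars t ≟ 0
... | no n = [] , t , ts , refl , n
... | yes eq₀ with as , u , cs , refl , n ← some-par ts (trans (cong (_+ forestPars ts) (sym eq₀)) eq) =
  t ∷ as , u , cs , refl , n

step-link∈ : ∀ {s p₁ p₂ p t t′ v} → TreeStep s p₁ p₂ p t t′ v → par p₁ p₂ p ∈ treeLinks t
step-link∈ hereˡ = here refl
step-link∈ hereʳ = here refl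
step-link∈ (inˡ st) = there (∈-++⁺ˡ (step-link∈ st))
step-link∈ (inʳ {t = t} st) = there (∈-++⁺ʳ (treeLinks t) (step-link∈ st))

replace-colour : ∀ {e : Pos → Bool} {r p} → e r ≡ e p → ∀ x → e (replace r p x) ≡ e x
replace-colour {e} {r} {p} eq x with x ≟ r
... | yes refl = sym eq
... | no _ = refl

record ColouredSwitching (e : Pos → Bool) (G : Graph) (ts : List Tree) (bs : List (List Pos)) : Set where
  field
    ι         : Pos → Pos
    H         : Graph
    switching : Switching G ι H
    trees     : List Tree
    isForest  : IsForest H trees (map (map ι) bs)
    unique    : Unique (forestOccurrences trees)
    par-free  : forestPars trees ≡ 0
    length-≡  : length trees ≡ length ts + forestPars ts
    valid     : All (Valid e) trees
    colour    : ∀ x → e (ι x) ≡ e x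

-- At each par a premise coloured like the output is kept, so the identifications made by the
-- switching do not change colours and validity persists. Once no par is left, each tree has a
-- single colour.
colouredSwitching : ∀ {e} n {G ts bs} → forestPars ts ≡ n → IsForest G ts bs → Unique (forestOccurrences ts) →
                    All (Valid e) ts → ColouredSwitching e G ts bs
colouredSwitching zero {G} {ts} {bs} eq F w v = record
  { switching = normal λ p₁ p₂ p m → no-par (∈-++⁻ (map dai bs) (∈-resp-↭ (IsForest.links-↭ F) m))
  ; isForest  = subst (IsForest G ts) (sym (trans (map-cong map-id bs) (map-id bs))) F
  ; unique    = w
  ; par-free  = eq
  ; length-≡  = sym (trans (cong (length ts +_) eq) (ℕ.+-identityʳ _))
  ; valid     = v
  ; colour    = λ _ → refl
  }
  where
  no-par : ∀ {p₁ p₂ p} → par p₁ p₂ p ∈ map dai bs ⊎ par p₁ p₂ p ∈ forestLinks ts → ⊥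
  no-par (inj₁ m) with _ , _ , () ← ∈-map⁻ dai m
  no-par (inj₂ m) = par∉forest ts eq m
colouredSwitching {e} (suc n) {G} {ts} {bs} eq F w v
  with as , t , cs , refl , ne ← some-par ts eq
  with s , p₁ , p₂ , p , t′ , u , st , col , vt , vu ← valid-step t (All.head (All.++⁻ʳ as v)) ne
  with E , ρ ← ∈⇒↭ (∈-resp-↭ (↭-sym (IsForest.links-↭ F)) (∈-++⁺ʳ (map dai bs)
    (forest-⊆ {as ++ t ∷ cs} (∈-++⁺ʳ as (here refl)) (step-link∈ st)))) =
  record
  { switching = step (side-step s ρ) switching
  ; isForest  = subst (IsForest H trees) (trans (sym (map-∘ bs)) (map-cong (λ b → sym (map-∘ b)) bs)) isForest
  ; unique    = unique
  ; par-free  = par-free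
  ; length-≡  = trans length-≡ (trans (cong (_+ forestPars after) length-after)
                  (trans (sym (ℕ.+-suc _ (forestPars after))) (cong (length (as ++ t ∷ cs) +_)
                    (sym pars-after))))
  ; valid     = valid
  ; colour    = λ x → trans (colour (f x)) (replace-colour {e} col x)
  }
  where
  open ForestStep as cs st w
  open ColouredSwitching (colouredSwitching n (ℕ.suc-injective (trans (sym pars-after) eq))
    (isForest-after F ρ) unique-after
    (All.++⁺ (All.++⁻ˡ as v) (vt ∷ All.++⁺ (All.tail (All.++⁻ʳ as v)) (vu ∷ []))))

-- Addresses and ranks of the leaves of a tree.

data At : Tree → Address → Pos → Set where
  leaf : ∀ {p} → At (leaf p) [] p
  inˡ  : ∀ {k q t u w p} → At t w p → At (node k q t u) (left ∷ w) p
  inʳ  : ∀ {k q t u w p} → At u w p → At (node k q t u) (right ∷ w) p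

at⇒∈ : ∀ {t w p} → At t w p → p ∈ leaves t
at⇒∈ leaf = here refl
at⇒∈ (inˡ a) = ∈-++⁺ˡ (at⇒∈ a)
at⇒∈ (inʳ {t = t} a) = ∈-++⁺ʳ (leaves t) (at⇒∈ a)

∈⇒at : ∀ t {p} → p ∈ leaves t → ∃[ w ] At t w p
∈⇒at (leaf _) (here refl) = [] , leaf
∈⇒at (node k q t u) m with ∈-++⁻ (leaves t) m
... | inj₁ m′ with w , a ← ∈⇒at t m′ = left ∷ w , inˡ a
... | inj₂ m′ with w , a ← ∈⇒at u m′ = right ∷ w , inʳ a

isConnective : ∀ k {p₁ p₂ p} → Connective p₁ p₂ p (connective k p₁ p₂ p)
isConnective tensor = isTen
isConnective parr   = isPar

at⇒path : ∀ {G t w p} → treeLinks t ⊆ links G → At t w p → Path G (root t) w p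
at⇒path s leaf = here
at⇒path s (inˡ {k} a) = goLeft (s (here refl)) (isConnective k) (at⇒path (s ∘ there ∘ ∈-++⁺ˡ) a)
at⇒path s (inʳ {k} {t = t} a) = goRight (s (here refl)) (isConnective k)
  (at⇒path (s ∘ there ∘ ∈-++⁺ʳ (treeLinks t)) a)

Initial : Graph → Pos → Set
Initial G p = ∃[ ps ] dai ps ∈ links G × p ∈ ps

module _ {G : Graph} (u : Unique (targets (links G))) where

  initial-not-output : ∀ {p₁ p₂ p l} → l ∈ links G → Connective p₁ p₂ p l → ¬ Initial G p
  initial-not-output l∈ isTen (_ , d , m) = case target-injective u l∈ d (here refl) m of λ ()
  initial-not-output l∈ isPar (_ , d , m) = case target-injective u l∈ d (here refl) m of λ ()

  connective-unique : ∀ k {p₁ p₂ q₁ q₂ p l} → connective k p₁ p₂ p ∈ links G → l ∈ links G →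
    Connective q₁ q₂ p l →
                      p₁ ≡ q₁ × p₂ ≡ q₂
  connective-unique tensor c l∈ isTen with refl ← target-injective u c l∈ (here refl) (here refl) = refl , refl
  connective-unique tensor c l∈ isPar = case target-injective u c l∈ (here refl) (here refl) of λ ()
  connective-unique parr c l∈ isPar with refl ← target-injective u c l∈ (here refl) (here refl) = refl , refl
  connective-unique parr c l∈ isTen = case target-injective u c l∈ (here refl) (here refl) of λ ()

  -- A position is an output of one link only, so a path towards an initial position can neither
  -- stop at a node, nor leave the tree there, nor continue past a leaf.
  path⇒at : ∀ t {w p} → treeLinks t ⊆ links G → (∀ {x} → x ∈ leaves t → Initial G x) → Initial G p →
            Path G (root t) w p → At t w p
  path⇒at (leaf q) s i j here = leaf
  path⇒at (leaf q) s i j (goLeft l∈ c _) = ⊥-elim (initial-not-output l∈ c (i (here refl)))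
  path⇒at (leaf q) s i j (goRight l∈ c _) = ⊥-elim (initial-not-output l∈ c (i (here refl)))
  path⇒at (node k q t t′) s i j here = ⊥-elim (initial-not-output (s (here refl)) (isConnective k) j)
  path⇒at (node k q t t′) s i j (goLeft l∈ c π) with refl , _ ← connective-unique k (s (here refl)) l∈ c =
    inˡ (path⇒at t (s ∘ there ∘ ∈-++⁺ˡ) (i ∘ ∈-++⁺ˡ) j π)
  path⇒at (node k q t t′) s i j (goRight l∈ c π) with _ , refl ← connective-unique k (s (here refl)) l∈ c =
    inʳ (path⇒at t′ (s ∘ there ∘ ∈-++⁺ʳ (treeLinks t)) (i ∘ ∈-++⁺ʳ (leaves t)) j π)

at-unique : ∀ {t w w′ p} → Unique (leaves t) → At t w p → At t w′ p → w ≡ w′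
at-unique u leaf leaf = refl
at-unique {node _ _ t _} u (inˡ a) (inˡ b) = cong (left ∷_) (at-unique (proj₁ (Unique-++⁻ (leaves t) u)) a b)
at-unique {node _ _ t _} u (inˡ a) (inʳ b) = ⊥-elim (proj₂ (proj₂ (Unique-++⁻ (leaves t) u)) (at⇒∈ a , at⇒∈ b))
at-unique {node _ _ t _} u (inʳ a) (inˡ b) = ⊥-elim (proj₂ (proj₂ (Unique-++⁻ (leaves t) u)) (at⇒∈ b , at⇒∈ a))
at-unique {node _ _ t _} u (inʳ a) (inʳ b) = cong (right ∷_) (at-unique
  (proj₁ (proj₂ (Unique-++⁻ (leaves t) u))) a b)

_<ʷ_ : Address → Address → Set
_<ʷ_ = Lex-< _≡_ _<ˢ_

<ʷ-asym : ∀ {v w} → v <ʷ w → w <ʷ v → ⊥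
<ʷ-asym (Lex.base ()) _
<ʷ-asym (Lex.this left<right) (Lex.this ())
<ʷ-asym (Lex.this left<right) (Lex.next () _)
<ʷ-asym (Lex.next refl _) (Lex.this ())
<ʷ-asym (Lex.next refl a) (Lex.next refl b) = <ʷ-asym a b

Precedes : Tree → Pos → Pos → Set
Precedes t p q = ∃[ v ] ∃[ w ] At t v p × At t w q × v <ʷ w

leaves-ordered : ∀ t → AllPairs (Precedes t) (leaves t)
leaves-ordered (leaf _) = [] ∷ []
leaves-ordered (node k q t u) = AllPairs.++⁺
  (AllPairs.map (λ (v , w , a , b , lt) → left ∷ v , left ∷ w , inˡ a , inˡ b , Lex.next refl lt)
    (leaves-ordered t))
  (AllPairs.map (λ (v , w , a , b , lt) → right ∷ v , right ∷ w , inʳ a , inʳ b , Lex.next refl lt)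
    (leaves-ordered u))
  (All.tabulate λ x∈ → All.tabulate λ y∈ → let v , a = ∈⇒at t x∈ ; w , b = ∈⇒at u y∈ in
    left ∷ v , right ∷ w , inˡ a , inʳ b , Lex.this left<right)

sorted-unique : ∀ {R : Pos → Pos → Set} {xs ys} → (∀ {x y} → x ∈ xs → y ∈ xs → R x y → R y x → ⊥) →
                AllPairs R xs → AllPairs R ys → xs ↭ ys → xs ≡ ys
sorted-unique {xs = []} _ _ _ σ = sym (↭-empty-inv (↭-sym σ))
sorted-unique {xs = x ∷ xs} {[]} _ _ _ σ = ⊥-elim (¬x∷xs↭[] σ)
sorted-unique {xs = x ∷ xs} {y ∷ ys} asym (r ∷ rs) (s ∷ ss) σ with x ≟ y
... | yes refl = cong (x ∷_) (sorted-unique (λ m m′ → asym (there m) (there m′)) rs ss (drop-∷ σ))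
... | no ne with ∈-resp-↭ σ (here refl) | ∈-resp-↭ (↭-sym σ) (here refl)
...   | here eq | _ = ⊥-elim (ne eq)
...   | _ | here eq = ⊥-elim (ne (sym eq))
...   | there m | there m′ = ⊥-elim (asym (here refl) (there m′) (All.lookup r m′) (All.lookup s m))

initials-tree : ∀ t → concatMap daimonOutputs (treeLinks t) ≡ []
initials-tree (leaf _) = refl
initials-tree (node tensor _ t u) = trans (concatMap-++ daimonOutputs (treeLinks t) (treeLinks u))
  (cong₂ _++_ (initials-tree t) (initials-tree u))
initials-tree (node parr _ t u) = trans (concatMap-++ daimonOutputs (treeLinks t) (treeLinks u))
  (cong₂ _++_ (initials-tree t) (initials-tree u))

initials-forest : ∀ ts → concatMap daimonOutputs (forestLinks ts) ≡ []
initials-forest [] = refl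
initials-forest (t ∷ ts) = trans (concatMap-++ daimonOutputs (treeLinks t) (forestLinks ts))
  (cong₂ _++_ (initials-tree t) (initials-forest ts))

initials-dai : ∀ bs → concatMap daimonOutputs (map dai bs) ≡ concat bs
initials-dai [] = refl
initials-dai (b ∷ bs) = cong (b ++_) (initials-dai bs)

initials-↭ : ∀ {S ts bs} → IsForest (body S) ts bs → initials S ↭ forestLeaves ts
initials-↭ {ts = ts} {bs} F = ↭-trans (concatMap⁺ daimonOutputs (IsForest.links-↭ F)) (↭-trans
  (↭-reflexive (trans (concatMap-++ daimonOutputs (map dai bs) (forestLinks ts))
    (trans (cong₂ _++_ (initials-dai bs) (initials-forest ts)) (++-identityʳ _))))
  (IsForest.leaves-↭ F))

leaf-initial : ∀ {G ts bs x} → IsForest G ts bs → x ∈ forestLeaves ts → Initial G x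
leaf-initial {bs = bs} F m with b , m′ , b∈ ← ∈-concat⁻′ bs (∈-resp-↭ (↭-sym (IsForest.leaves-↭ F)) m) =
  b , ∈-resp-↭ (↭-sym (IsForest.links-↭ F)) (∈-++⁺ˡ (∈-map⁺ dai b∈)) , m′

forest-tree-⊆ : ∀ {G ts bs t} → IsForest G ts bs → t ∈ ts → treeLinks t ⊆ links G
forest-tree-⊆ {bs = bs} F t∈ m = ∈-resp-↭ (↭-sym (IsForest.links-↭ F)) (∈-++⁺ʳ (map dai bs) (forest-⊆ t∈ m))

dai∈⇒block : ∀ {G ts bs ps} → IsForest G ts bs → dai ps ∈ links G → ps ∈ bs
dai∈⇒block {ts = ts} {bs} F m with ∈-++⁻ (map dai bs) (∈-resp-↭ (IsForest.links-↭ F) m)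
... | inj₁ m′ = ∈-map-dai⁻ m′
... | inj₂ m′ = ⊥-elim (dai∉forest ts m′)

unique-forestLeaves : ∀ ts → Unique (forestOccurrences ts) → Unique (forestLeaves ts)
unique-forestLeaves ts w = proj₁ (proj₂ (Unique-++⁻ (targets (forestLinks ts))
  (Unique-resp-↭ (↭-sym (forestOccurrences-↭ ts)) w)))

unique-targets : ∀ {G ts bs} → IsForest G ts bs → Unique (forestOccurrences ts) → Unique (targets (links G))
unique-targets F w = Unique-resp-↭ (↭-sym (targets-forest F)) w

-- With a single conclusion, the natural order is the left-to-right order of the leaves. Addresses
-- are unique, so the order is asymmetric on leaves and at most one enumeration is sorted; ranks
-- thus become indices in `leaves t`.
module Ranks {E t bs} {N : IsNet (graph E (root t ∷ []))} (F : IsForest (graph E (root t ∷ []))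
  (t ∷ []) bs) where

  private
    S : Net
    S = net (graph E (root t ∷ [])) N

    leaves≡ : forestLeaves (t ∷ []) ≡ leaves t
    leaves≡ = ++-identityʳ (leaves t)

    unique : Unique (leaves t)
    unique = subst Unique leaves≡ (unique-forestLeaves (t ∷ []) (unique-occurrences {S} F))

    init : ∀ {x} → x ∈ leaves t → Initial (body S) x
    init m = leaf-initial F (subst (_ ∈_) (sym leaves≡) m)

    address : ∀ {p a} → p ∈ leaves t → HasAddress S p a → At t (proj₂ a) p
    address {a = zero , w} m π = path⇒at (IsNet.targets-unique N) t (forest-tree-⊆ F (here refl)) init
      (init m) π

    natural : NaturalOrder S (leaves t)
    natural = ↭-sym (↭-trans (initials-↭ {S} F) (↭-reflexive leaves≡)) ,
      AllPairs.map (λ (v , w , a , b , lt) → (zero , v) , (zero , w) ,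
        at⇒path (forest-tree-⊆ F (here refl)) a , at⇒path (forest-tree-⊆ F (here refl)) b , inj₂ (refl , lt))
          (leaves-ordered t)

    asym : ∀ {x y} → x ∈ leaves t → y ∈ leaves t → Before S x y → Before S y x → ⊥
    asym m m′ ((zero , v) , (zero , w) , a , b , inj₂ (refl , lt)) ((zero , w′) , (zero , v′) , b′ , a′ , inj₂
      (refl , lt′))
      with refl ← at-unique unique (address {a = zero , v} m a) (address {a = zero , v′} m a′)
         | refl ← at-unique unique (address {a = zero , w} m′ b) (address
           {a = zero , w′} m′ b′) = <ʷ-asym lt lt′

    natural-unique : ∀ {ps} → NaturalOrder S ps → leaves t ≡ ps
    natural-unique (σ , o) = sorted-unique asym (proj₂ natural) o (↭-trans (proj₁ natural) (↭-sym σ))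

  rank⁺ : ∀ j → Rank S (lookup (leaves t) j) (suc (toℕ j))
  rank⁺ j = leaves t , natural , j , refl , refl

  rank⁻ : ∀ {p k} → Rank S p k → ∃[ j ] lookup (leaves t) j ≡ p × suc (toℕ j) ≡ k
  rank⁻ (ps , o , j , eq , eq′) with refl ← natural-unique o = j , eq , eq′

  rank-unique : ∀ {p q k} → Rank S p k → Rank S q k → p ≡ q
  rank-unique r s with i , refl , refl ← rank⁻ r | j , refl , eq ← rank⁻ s
    with refl ← Fin.toℕ-injective (ℕ.suc-injective eq) = refl

path-connective : ∀ {G H q w p} → (∀ {l a b c} → l ∈ links G → Connective a b c l →
  ∃[ l′ ] l′ ∈ links H × Connective a b c l′) →
                  Path G q w p → Path H q w p
path-connective f here = here
path-connective f (goLeft l∈ c π) with _ , l′∈ , c′ ← f l∈ c = goLeft l′∈ c′ (path-connective f π)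
path-connective f (goRight l∈ c π) with _ , l′∈ , c′ ← f l∈ c = goRight l′∈ c′ (path-connective f π)

root-dual : ∀ t → root (dualTree t) ≡ root t
root-dual (leaf _)       = refl
root-dual (node _ _ _ _) = refl

leaves-dual : ∀ t → leaves (dualTree t) ≡ leaves t
leaves-dual (leaf _)       = refl
leaves-dual (node _ _ t u) = cong₂ _++_ (leaves-dual t) (leaves-dual u)

occurrences-dual : ∀ t → occurrences (dualTree t) ≡ occurrences t
occurrences-dual (leaf _)       = refl
occurrences-dual (node _ p t u) = cong (p ∷_) (cong₂ _++_ (occurrences-dual t) (occurrences-dual u))

paint-dual : ∀ {X} (e : Pos → X) t → paint e (dualTree t) ≡ dualᵖ (paint e t)
paint-dual e (leaf _)       = refl
paint-dual e (node k _ t u) = cong₂ (node (dualᵏ k)) (paint-dual e t) (paint-dual e u)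

dualTree-involutive : ∀ t → dualTree (dualTree t) ≡ t
dualTree-involutive (leaf _) = refl
dualTree-involutive (node tensor _ t u) = cong₂ (node tensor _) (dualTree-involutive t) (dualTree-involutive u)
dualTree-involutive (node parr _ t u)   = cong₂ (node parr _) (dualTree-involutive t) (dualTree-involutive u)

dualᵖ-involutive : ∀ {X} (s : Painted X) → dualᵖ (dualᵖ s) ≡ s
dualᵖ-involutive (leaf _) = refl
dualᵖ-involutive (node tensor s t) = cong₂ (node tensor) (dualᵖ-involutive s) (dualᵖ-involutive t)
dualᵖ-involutive (node parr s t)   = cong₂ (node parr) (dualᵖ-involutive s) (dualᵖ-involutive t)

pars≡tensors : ∀ t u → shape t ≡ dualᵖ (shape u) → pars t ≡ tensors u
pars≡tensors (leaf _) (leaf _) _ = refl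
pars≡tensors (node k _ t t′) (node l _ u u′) eq with refl , eq₁ , eq₂ ← node-injective eq with l
... | tensor = cong suc (cong₂ _+_ (pars≡tensors t u eq₁) (pars≡tensors t′ u′ eq₂))
... | parr   = cong₂ _+_ (pars≡tensors t u eq₁) (pars≡tensors t′ u′ eq₂)

connective-dual : ∀ t {l a b c} → l ∈ treeLinks t → Connective a b c l → ∃[ l′ ] l′ ∈ treeLinks
  (dualTree t) × Connective a b c l′
connective-dual (node tensor p t u) (here refl) isTen =
  _ , here refl , subst₂ (λ x y → Connective (root t) (root u) p (par x y p)) (sym (root-dual t))
    (sym (root-dual u)) isPar
connective-dual (node parr p t u) (here refl) isPar =
  _ , here refl , subst₂ (λ x y → Connective (root t) (root u) p (ten x y p)) (sym (root-dual t))
    (sym (root-dual u)) isTen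
connective-dual (node k p t u) (there m) c with ∈-++⁻ (treeLinks t) m
... | inj₁ m′ with l′ , m″ , c′ ← connective-dual t m′ c = l′ , there (∈-++⁺ˡ m″) , c′
... | inj₂ m′ with l′ , m″ , c′ ← connective-dual u m′ c = l′ , there (∈-++⁺ʳ (treeLinks (dualTree t)) m″) , c′

-- Tests from colourings

map-split : ∀ {f : Pos → Pos} xs ys {zs} → map f ys ≡ xs ++ zs → ∃[ as ] ∃[ bs ] ys ≡ as ++ bs × map f as ≡ xs
  × map f bs ≡ zs
map-split [] ys eq = [] , ys , refl , refl , eq
map-split (x ∷ xs) (y ∷ ys) eq with as , bs , refl , e₁ , e₂ ← map-split xs ys (∷-injectiveʳ eq) =
  y ∷ as , bs , refl , cong₂ _∷_ (∷-injectiveˡ eq) e₁ , e₂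

-- This pulls back the components of a switching: a list of leaves is cut into pieces whose images
-- are the leaf lists of the components.
split-map : ∀ {X : Set} {h : X → List Pos} (f : Pos → Pos) us {ys} → map f ys ≡ concatMap h us →
            ∃[ bs ] concat bs ≡ ys × Pointwise (λ b u → map f b ≡ h u) bs us
split-map f [] {[]} eq = [] , refl , []
split-map {h = h} f (u ∷ us) {ys} eq with as , cs , refl , e₁ , e₂ ← map-split (h u) ys eq with bs , refl ,
  ps ← split-map f us e₂ =
  as ∷ bs , refl , e₁ ∷ ps

unique-map⁻ : ∀ {f : Pos → Pos} xs {x y} → Unique (map f xs) → x ∈ xs → y ∈ xs → f x ≡ f y → x ≡ y
unique-map⁻ (z ∷ xs) u (here refl) (here refl) _ = refl
unique-map⁻ {f} (z ∷ xs) u (here refl) (there m) eq = ⊥-elim (Unique-head u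
  (subst (_∈ map f xs) (sym eq) (∈-map⁺ f m)))
unique-map⁻ {f} (z ∷ xs) u (there m) (here refl) eq = ⊥-elim (Unique-head u
  (subst (_∈ map f xs) eq (∈-map⁺ f m)))
unique-map⁻ (z ∷ xs) u (there m) (there m′) eq = unique-map⁻ xs (AllPairs.tail u) m m′ eq

pointwise-∈ˡ : ∀ {A B : Set} {R : A → B → Set} {xs ys x} → Pointwise R xs ys → x ∈ xs → ∃[ y ] y ∈ ys × R x y
pointwise-∈ˡ (r ∷ rs) (here refl) = _ , here refl , r
pointwise-∈ˡ (r ∷ rs) (there m) with y , m′ , r′ ← pointwise-∈ˡ rs m = y , there m′ , r′

pointwise-∈ʳ : ∀ {A B : Set} {R : A → B → Set} {xs ys y} → Pointwise R xs ys → y ∈ ys → ∃[ x ] x ∈ xs × R x y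
pointwise-∈ʳ (r ∷ rs) (here refl) = _ , here refl , r
pointwise-∈ʳ (r ∷ rs) (there m) with x , m′ , r′ ← pointwise-∈ʳ rs m = x , there m′ , r′

some-leaf : ∀ t → ∃[ x ] x ∈ leaves t
some-leaf (leaf p) = p , here refl
some-leaf (node _ _ t u) with x , m ← some-leaf t = x , ∈-++⁺ˡ m

pointwise-length : ∀ {A B : Set} {R : A → B → Set} {xs ys} → Pointwise R xs ys → length xs ≡ length ys
pointwise-length [] = refl
pointwise-length (_ ∷ rs) = cong suc (pointwise-length rs)

treeNet : (t : Tree) (bs : List (List Pos)) → Unique (occurrences t) → concat bs ↭ leaves t →
          Σ[ N ∈ IsNet (graph (map dai bs ++ treeLinks t) (root t ∷ [])) ]
            IsForest (graph (map dai bs ++ treeLinks t) (root t ∷ [])) (t ∷ []) bs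
treeNet t bs u σ = isForest⇒isNet F (subst Unique (sym (++-identityʳ (occurrences t))) u) , F
  where
  F : IsForest (graph (map dai bs ++ treeLinks t) (root t ∷ [])) (t ∷ []) bs
  F = record
    { links-↭  = ↭-reflexive (cong (map dai bs ++_) (sym (++-identityʳ (treeLinks t))))
    ; leaves-↭ = ↭-trans σ (↭-reflexive (sym (++-identityʳ (leaves t))))
    ; concl-≡  = refl
    }

path-leaf : ∀ {H us bs u w y} → IsForest H us bs → Unique (forestOccurrences us) → u ∈ us →
  y ∈ forestLeaves us →
            Path H (root u) w y → y ∈ leaves u
path-leaf {u = u} F w u∈ y∈ π = at⇒∈ (path⇒at (unique-targets F w) u (forest-tree-⊆ F u∈)
  (λ m → leaf-initial F (forestLeaves-⊆ u∈ m)) (leaf-initial F y∈) π)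

-- The test attached to a valid colouring of one tree: its daimons are the components of a switching
-- that respects the colouring, hence are monochrome. The classes of a switching depend on the tree
-- alone, so the reference net is given one daimon on all leaves.
module SwitchingTest (e : Pos → Bool) (t : Tree) (u : Unique (occurrences t)) (v : Valid e t) where

  reference = treeNet t (leaves t ∷ []) u (↭-reflexive (++-identityʳ (leaves t)))

  S : Net
  S = net (graph (map dai (leaves t ∷ []) ++ treeLinks t) (root t ∷ [])) (proj₁ reference)

  open ColouredSwitching (colouredSwitching {e} _ refl (proj₂ reference)
    (subst Unique (sym (++-identityʳ (occurrences t))) u) (v ∷ [])) public

  private
    leaves-trees : map ι (leaves t) ↭ forestLeaves trees
    leaves-trees = ↭-trans (↭-reflexive (sym (++-identityʳ _))) (IsForest.leaves-↭ isForest)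

    -- The permutation of the images is lifted to the leaves of `t`, which are thereby listed
    -- component by component.
    inverse = ↭-map-inv ι leaves-trees

    pieces = split-map ι trees (sym (proj₁ (proj₂ inverse)))

  blocks : List (List Pos)
  blocks = proj₁ pieces

  blocks-↭ : concat blocks ↭ leaves t
  blocks-↭ = ↭-trans (↭-reflexive (proj₁ (proj₂ pieces))) (↭-sym (proj₂ (proj₂ inverse)))

  blocks-trees : Pointwise (λ b s → map ι b ≡ leaves s) blocks trees
  blocks-trees = proj₂ (proj₂ pieces)

  length-blocks : length blocks ≡ suc (pars t)
  length-blocks = trans (pointwise-length blocks-trees) (trans length-≡ (cong suc (ℕ.+-identityʳ (pars t))))

  blocks-monochrome : ∀ {b} → b ∈ blocks → Monochrome e b
  blocks-monochrome {b} b∈ with s , s∈ , eq ← pointwise-∈ˡ blocks-trees b∈ = e (root s) , λ {p} p∈ →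
    trans (sym (colour p)) (valid-leaves (All.lookup valid s∈) (tree-pars≡0 s∈ par-free)
      (subst (ι p ∈_) eq (∈-map⁺ ι p∈)))

  private
    test = treeNet (dualTree t) blocks (subst Unique (sym (occurrences-dual t)) u)
      (↭-trans blocks-↭ (↭-reflexive (sym (leaves-dual t))))

  test-isForest = proj₂ test

  T : Net
  T = net (graph (map dai blocks ++ treeLinks (dualTree t)) (root (dualTree t) ∷ [])) (proj₁ test)

  private
    initials-S : initials S ↭ leaves t
    initials-S = ↭-trans (initials-↭ {S} (proj₂ reference)) (↭-reflexive (++-identityʳ (leaves t)))

    initials-T : initials T ↭ leaves t
    initials-T = ↭-trans (initials-↭ {T} (proj₂ test)) (↭-reflexive (trans (++-identityʳ _) (leaves-dual t)))

    -- Dualizing exchanges the kinds of the links and keeps all positions, so both nets have the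
    -- same paths, hence the same addresses and ranks.
    S⇒T : ∀ {l a b c} → l ∈ linksₙ S → Connective a b c l → ∃[ l′ ] l′ ∈ linksₙ T × Connective a b c l′
    S⇒T (here refl) ()
    S⇒T (there m) c with l′ , m′ , c′ ← connective-dual t m c = l′ , ∈-++⁺ʳ (map dai blocks) m′ , c′

    T⇒S : ∀ {l a b c} → l ∈ linksₙ T → Connective a b c l → ∃[ l′ ] l′ ∈ linksₙ S × Connective a b c l′
    T⇒S m c with ∈-++⁻ (map dai blocks) m
    ... | inj₁ m′ with _ , _ , refl ← ∈-map⁻ dai m′ with () ← c
    ... | inj₂ m′ with l′ , m″ , c′ ← connective-dual (dualTree t) m′ c =
      l′ , there (subst (λ z → l′ ∈ treeLinks z) (dualTree-involutive t) m″) , c′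

    address-S⇒T : ∀ {p a} → HasAddress S p a → HasAddress T p a
    address-S⇒T {p} {zero , w} π = subst (λ q → Path (body T) q w p) (sym (root-dual t)) (path-connective S⇒T π)

    address-T⇒S : ∀ {p a} → HasAddress T p a → HasAddress S p a
    address-T⇒S {p} {zero , w} π = subst (λ q → Path (body S) q w p) (root-dual t) (path-connective T⇒S π)

    rank-S⇒T : ∀ {p k} → Rank S p k → Rank T p k
    rank-S⇒T (ps , (σ , o) , r) = ps , (↭-trans σ (↭-trans initials-S (↭-sym initials-T)) ,
      AllPairs.map (λ (a , b , x , y , lt) → a , b , address-S⇒T {a = a} x , address-S⇒T {a = b} y , lt) o) , r

    rank-T⇒S : ∀ {p k} → Rank T p k → Rank S p k
    rank-T⇒S (ps , (σ , o) , r) = ps , (↭-trans σ (↭-trans initials-T (↭-sym initials-S)) ,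
      AllPairs.map (λ (a , b , x , y , lt) → a , b , address-T⇒S {a = a} x , address-T⇒S {a = b} y , lt) o) , r

    Q = switchingPartition S ι H

    module _ {b s} (b∈ : b ∈ blocks) (s∈ : s ∈ trees) (eq : map ι b ≡ leaves s) (q∈ : root s ∈ concl H) where

      block⇒class : ∀ {p} → p ∈ b → class Q (root s , q∈) p
      block⇒class {p} m = ∈-resp-↭ (↭-sym initials-S) (∈-resp-↭ blocks-↭ (∈-concat⁺′ m b∈)) ,
        (let w , a = ∈⇒at s (subst (ι p ∈_) eq (∈-map⁺ ι m)) in w , at⇒path (forest-tree-⊆ isForest s∈) a)

      class⇒block : ∀ {p} → class Q (root s , q∈) p → p ∈ b
      class⇒block {p} (m , w , π) = subst (_∈ b) (sym p≡) p′∈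
        where
        p∈t : p ∈ leaves t
        p∈t = ∈-resp-↭ initials-S m
        ιp∈ : ι p ∈ leaves s
        ιp∈ = path-leaf isForest unique s∈ (∈-resp-↭ leaves-trees (∈-map⁺ ι p∈t)) π
        pre = ∈-map⁻ ι (subst (ι p ∈_) (sym eq) ιp∈)
        p′∈ = proj₁ (proj₂ pre)
        p≡ : p ≡ proj₁ pre
        p≡ = unique-map⁻ (leaves t) (Unique-resp-↭ (↭-sym leaves-trees) (unique-forestLeaves trees unique))
          p∈t (∈-resp-↭ blocks-↭ (∈-concat⁺′ p′∈ b∈)) (proj₂ (proj₂ pre))

  partitions : Nat T (daimonPartition T) ≋ Nat S (switchingPartition S ι H)
  partitions = (λ (b , d) →
      let b∈ = dai∈⇒block {body T} (proj₂ test) d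
          s , s∈ , eq = pointwise-∈ˡ blocks-trees b∈
          q∈ = subst (root s ∈_) (sym (IsForest.concl-≡ isForest)) (∈-map⁺ root s∈)
      in (root s , q∈) , (λ (p , m , r) → p , block⇒class b∈ s∈ eq q∈ m , rank-T⇒S r)
                       , (λ (p , m , r) → p , class⇒block b∈ s∈ eq q∈ m , rank-S⇒T r))
    , (λ (q , q∈) →
      let s , s∈ , q≡ = ∈-map⁻ root (subst (q ∈_) (IsForest.concl-≡ isForest) q∈)
          b , b∈ , eq = pointwise-∈ʳ blocks-trees s∈
      in (b , ∈-++⁺ˡ (∈-map⁺ dai b∈)) ,
         helper q q∈ s s∈ q≡ b b∈ eq)
    where
    helper : ∀ q (q∈ : q ∈ concl H) s → s ∈ trees → q ≡ root s → ∀ b (b∈ : b ∈ blocks) → map ι b ≡ leaves s →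
             class (Nat T (daimonPartition T)) (b , ∈-++⁺ˡ (∈-map⁺ dai b∈)) ≐ class (Nat S Q) (q , q∈)
    helper q q∈ s s∈ refl b b∈ eq = (λ (p , m , r) → p , block⇒class b∈ s∈ eq q∈ m , rank-T⇒S r)
                                  , (λ (p , m , r) → p , class⇒block b∈ s∈ eq q∈ m , rank-S⇒T r)

no-cuts : ∀ {S ts bs} → IsForest (body S) ts bs → CutFree S
no-cuts {ts = ts} {bs} F p q m with ∈-++⁻ (map dai bs) (∈-resp-↭ (IsForest.links-↭ F) m)
... | inj₁ m′ with _ , _ , () ← ∈-map⁻ dai m′
... | inj₂ m′ with forest-connective ts m′
...   | tensor , _ , _ , _ , ()
...   | parr , _ , _ , _ , ()

-- Colourings from tests

-- A colouring with prescribed values along a list; the value `true` elsewhere is arbitrary.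
assoc : List Pos → List Bool → Pos → Bool
assoc (x ∷ xs) (b ∷ bs) y with y ≟ x
... | yes _ = b
... | no _  = assoc xs bs y
assoc _ _ _ = true

assoc-lookup : ∀ xs bs → Unique xs → (eq : length xs ≡ length bs) → ∀ j → assoc xs bs (lookup xs j) ≡ lookup bs
  (subst Fin eq j)
assoc-lookup (x ∷ xs) (b ∷ bs) u eq zero with x ≟ x
... | yes _ = cong (lookup (b ∷ bs)) (sym (subst-zero eq))
  where
  subst-zero : ∀ {m n} (eq : suc m ≡ suc n) → subst Fin eq zero ≡ zero
  subst-zero refl = refl
... | no ne = ⊥-elim (ne refl)
assoc-lookup (x ∷ xs) (b ∷ bs) u eq (suc j) with lookup xs j ≟ x
... | yes eq′ = ⊥-elim (Unique-head u (subst (_∈ xs) eq′ (∈-lookup j)))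
... | no _ = trans (assoc-lookup xs bs (AllPairs.tail u) (ℕ.suc-injective eq) j)
    (cong (lookup (b ∷ bs)) (sym (subst-suc eq (ℕ.suc-injective eq) j)))
  where
  subst-suc : ∀ {m n} (eq : suc m ≡ suc n) (eq′ : m ≡ n) j → subst Fin eq (suc j) ≡ suc (subst Fin eq′ j)
  subst-suc refl refl j = refl

toℕ-subst : ∀ {m n} (eq : m ≡ n) (j : Fin m) → toℕ (subst Fin eq j) ≡ toℕ j
toℕ-subst refl j = refl

map-assoc : ∀ xs bs → Unique xs → length xs ≡ length bs → map (assoc xs bs) xs ≡ bs
map-assoc [] [] _ _ = refl
map-assoc (x ∷ xs) (b ∷ bs) u eq = cong₂ _∷_ head (trans (cong-∈ xs (λ m → other m))
  (map-assoc xs bs (AllPairs.tail u) (ℕ.suc-injective eq)))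
  where
  head : assoc (x ∷ xs) (b ∷ bs) x ≡ b
  head with x ≟ x
  ... | yes _ = refl
  ... | no ne = ⊥-elim (ne refl)
  other : ∀ {y} → y ∈ xs → assoc (x ∷ xs) (b ∷ bs) y ≡ assoc xs bs y
  other {y} m with y ≟ x
  ... | yes refl = ⊥-elim (Unique-head u m)
  ... | no _ = refl
  cong-∈ : ∀ ys {f g : Pos → Bool} → (∀ {y} → y ∈ ys → f y ≡ g y) → map f ys ≡ map g ys
  cong-∈ [] h = refl
  cong-∈ (y ∷ ys) h = cong₂ _∷_ (h (here refl)) (cong-∈ ys (h ∘ there))

lookup-map-∃ : ∀ {X : Set} (f : Pos → X) xs {ys : List Pos} (eq : length ys ≡ length (map f xs))
  (j : Fin (length ys)) →
               ∃[ i ] toℕ i ≡ toℕ j × lookup (map f xs) (subst Fin eq j) ≡ f (lookup xs i)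
lookup-map-∃ f xs eq j = subst Fin (trans eq (length-map f xs)) j , toℕ-subst (trans eq (length-map f xs)) j ,
  go f xs eq (length-map f xs) j
  where
  go : ∀ {X : Set} (f : Pos → X) xs {n} (eq : n ≡ length (map f xs)) (eq′ : length (map f xs) ≡ length xs)
    (j : Fin n) →
       lookup (map f xs) (subst Fin eq j) ≡ f (lookup xs (subst Fin (trans eq eq′) j))
  go f (x ∷ xs) refl eq′ zero = cong (f ∘ lookup (x ∷ xs)) (sym (zero′ eq′))
    where
    zero′ : ∀ {m n} (eq : suc m ≡ suc n) → subst Fin eq zero ≡ zero
    zero′ refl = refl
  go f (x ∷ xs) refl eq′ (suc j) = trans (go f xs refl (ℕ.suc-injective eq′) j)
    (cong (f ∘ lookup (x ∷ xs)) (sym (suc′ eq′ (ℕ.suc-injective eq′) j)))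
    where
    suc′ : ∀ {m n} (eq : suc m ≡ suc n) (eq′ : m ≡ n) j → subst Fin eq (suc j) ≡ suc (subst Fin eq′ j)
    suc′ refl refl j = refl

lookup-map-index : ∀ {X : Set} (f : Pos → X) xs j → ∃[ i ] toℕ i ≡ toℕ j × lookup (map f xs) i ≡ f (lookup xs j)
lookup-map-index f (x ∷ xs) zero = zero , refl , refl
lookup-map-index f (x ∷ xs) (suc j) with i , eq , eq′ ← lookup-map-index f xs j = suc i , cong suc eq , eq′

lookup-index : ∀ {A : Set} {x : A} {xs} → x ∈ xs → ∃[ i ] lookup xs i ≡ x
lookup-index (here refl) = zero , refl
lookup-index (there m) with i , eq ← lookup-index m = suc i , eq

concatMap-index-unique : ∀ {A : Set} (h : A → List Pos) xs {y} i j → Unique (concatMap h xs) →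
                         y ∈ h (lookup xs i) → y ∈ h (lookup xs j) → i ≡ j
concatMap-index-unique h (x ∷ xs) zero zero u m m′ = refl
concatMap-index-unique h (x ∷ xs) zero (suc j) u m m′ = ⊥-elim (proj₂ (proj₂ (Unique-++⁻ (h x) u))
  (m , within xs j m′))
  where
  within : ∀ xs j {y} → y ∈ h (lookup xs j) → y ∈ concatMap h xs
  within (x ∷ xs) zero m = ∈-++⁺ˡ m
  within (x ∷ xs) (suc j) m = ∈-++⁺ʳ (h x) (within xs j m)
concatMap-index-unique h (x ∷ xs) (suc i) zero u m m′ = sym (concatMap-index-unique h (x ∷ xs) zero
  (suc i) u m′ m)
concatMap-index-unique h (x ∷ xs) (suc i) (suc j) u m m′ =
  cong suc (concatMap-index-unique h xs i j (proj₁ (proj₂ (Unique-++⁻ (h x) u))) m m′)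

dual-link : ∀ t k {a b c} → connective k a b c ∈ treeLinks (dualTree t) → connective
  (dualᵏ k) a b c ∈ treeLinks t
dual-link (node tensor p t u) parr (here refl) = here (cong₂ (λ a b → ten a b p) (root-dual t) (root-dual u))
dual-link (node parr p t u) tensor (here refl) = here (cong₂ (λ a b → par a b p) (root-dual t) (root-dual u))
dual-link (node tensor p t u) tensor (here ())
dual-link (node parr p t u) parr (here ())
dual-link (node k p t u) l (there m) with ∈-++⁻ (treeLinks (dualTree t)) m
... | inj₁ m′ = there (∈-++⁺ˡ (dual-link t l m′))
... | inj₂ m′ = there (∈-++⁺ʳ (treeLinks t) (dual-link u l m′))

-- What is used of a test, or of a juxtaposition of tests: its blocks are at least
-- as many as the conclusions of a switching, and each colouring of its blocks
-- comes from a switching.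
record TestLike (ss : List Shape) (T : Net) : Set where
  field
    trees      : List Tree
    blocks     : List (List Pos)
    isForest   : IsForest (body T) trees blocks
    shapes     : map shape trees ≡ map dualᵖ ss
    nonempty   : All (_≢ []) blocks
    many       : length trees + forestTensors trees ≤ length blocks
    switchable : ∀ Q → (∀ {b} → b ∈ blocks → Monochrome Q b) → ∀ {u} → u ∈ trees → ∃[ b ] Switchable
      (dualᵖ (paint Q u)) b

emptyNet-isForest : IsForest (body emptyNet) [] []
emptyNet-isForest = record { links-↭ = ↭-refl ; leaves-↭ = ↭-refl ; concl-≡ = refl }

tensors-rename : ∀ f t → tensors (renameTree f t) ≡ tensors t
tensors-rename f (leaf _) = refl
tensors-rename f (node tensor _ t u) = cong suc (cong₂ _+_ (tensors-rename f t) (tensors-rename f u))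
tensors-rename f (node parr _ t u) = cong₂ _+_ (tensors-rename f t) (tensors-rename f u)

forestTensors-rename : ∀ f ts → forestTensors (map (renameTree f) ts) ≡ forestTensors ts
forestTensors-rename f [] = refl
forestTensors-rename f (t ∷ ts) = cong₂ _+_ (tensors-rename f t) (forestTensors-rename f ts)

shape-rename : ∀ f ts → map shape (map (renameTree f) ts) ≡ map shape ts
shape-rename f ts = trans (sym (map-∘ ts)) (map-cong (paint-rename (λ _ → tt) f) ts)

monochrome-rename : ∀ {Q f b} → Monochrome Q (map f b) → Monochrome (Q ∘ f) b
monochrome-rename (c , m) = c , λ p∈ → m (∈-map⁺ _ p∈)

map-nonempty : ∀ {f : Pos → Pos} {b} → b ≢ [] → map f b ≢ []
map-nonempty {b = []} ne _ = ne refl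

∥-testLike : ∀ {s ss T U} → TestLike (s ∷ []) T → TestLike ss U → TestLike (s ∷ ss) (T ∥ₙ U)
∥-testLike {s} {ss} P R = record
  { trees      = map (renameTree evenly) P.trees ++ map (renameTree oddly) R.trees
  ; blocks     = map (map evenly) P.blocks ++ map (map oddly) R.blocks
  ; isForest   = ∥-isForest P.isForest R.isForest
  ; shapes     = trans (map-++ shape (map (renameTree evenly) P.trees) _)
      (cong₂ _++_ (trans (shape-rename evenly P.trees) P.shapes) (trans (shape-rename oddly R.trees) R.shapes))
  ; nonempty   = All.++⁺ (All.map⁺ (All.map map-nonempty P.nonempty))
      (All.map⁺ (All.map map-nonempty R.nonempty))
  ; many       = subst₂ _≤_ (sym left-≡)
      (sym (trans (length-++ (map (map evenly) P.blocks)) (cong₂ _+_ (length-map _ P.blocks)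
        (length-map _ R.blocks))))
      (ℕ.+-mono-≤ P.many R.many)
  ; switchable = sw
  }
  where
  module P = TestLike P
  module R = TestLike R
  left-≡ : length (map (renameTree evenly) P.trees ++ map (renameTree oddly) R.trees)
           + forestTensors (map (renameTree evenly) P.trees ++ map (renameTree oddly) R.trees)
         ≡ (length P.trees + forestTensors P.trees) + (length R.trees + forestTensors R.trees)
  left-≡ = trans (cong₂ _+_
      (trans (length-++ (map (renameTree evenly) P.trees)) (cong₂ _+_ (length-map _ P.trees)
        (length-map _ R.trees)))
      (trans (forestTensors-++ (map (renameTree evenly) P.trees) _)
        (cong₂ _+_ (forestTensors-rename evenly P.trees) (forestTensors-rename oddly R.trees))))
    (+-interchange (length P.trees) (length R.trees) (forestTensors P.trees) (forestTensors R.trees))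
  sw : ∀ Q → (∀ {b} → b ∈ map (map evenly) P.blocks ++ map (map oddly) R.blocks → Monochrome Q b) →
       ∀ {u} → u ∈ map (renameTree evenly) P.trees ++ map (renameTree oddly) R.trees → ∃[ b ] Switchable
         (dualᵖ (paint Q u)) b
  sw Q m u∈ with ∈-++⁻ (map (renameTree evenly) P.trees) u∈
  ... | inj₁ u∈′ with v , v∈ , refl ← ∈-map⁻ (renameTree evenly) u∈′
                 with b , x ← P.switchable (Q ∘ evenly) (λ b∈ → monochrome-rename {Q}
                   (m (∈-++⁺ˡ (∈-map⁺ _ b∈)))) v∈ =
    b , subst (λ z → Switchable (dualᵖ z) b) (sym (paint-rename Q evenly v)) x
  ... | inj₂ u∈′ with v , v∈ , refl ← ∈-map⁻ (renameTree oddly) u∈′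
                 with b , x ← R.switchable (Q ∘ oddly) (λ b∈ → monochrome-rename {Q}
                   (m (∈-++⁺ʳ (map (map evenly) P.blocks) (∈-map⁺ _ b∈)))) v∈ =
    b , subst (λ z → Switchable (dualᵖ z) b) (sym (paint-rename Q oddly v)) x

-- Here `T` is a test and `S`, switched to `H`, is the net that justifies it. Their positions are
-- unrelated: everything passes through ranks, the k-th leaf of `t` corresponding to the k-th leaf
-- of `t′`.
module Analysis {E t bs} {N : IsNet (graph E (root t ∷ []))} (F : IsForest (graph E (root t ∷ [])) (t ∷ []) bs)
                {E′ t′ bs′} {N′ : IsNet (graph E′ (root t′ ∷ []))} (F′ : IsForest (graph E′ (root t′ ∷ []))
                  (t′ ∷ []) bs′)
                {ι H} (W : Switched (graph E′ (root t′ ∷ [])) ι H (t′ ∷ []) bs′)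
                  (dual : shape t′ ≡ dualᵖ (shape t)) where

  private
    T S : Net
    T = net (graph E (root t ∷ [])) N
    S = net (graph E′ (root t′ ∷ [])) N′

    module T = Ranks {N = N} F
    module S = Ranks {N = N′} F′

    P = Nat T (daimonPartition T)
    Q = Nat S (switchingPartition S ι H)

  open Switched W

  private
    leaves-trees : map ι (leaves t′) ↭ forestLeaves trees
    leaves-trees = ↭-trans (map⁺ ι (↭-trans (↭-reflexive (sym (++-identityʳ (leaves t′))))
      (↭-sym (IsForest.leaves-↭ F′))))
      (↭-trans (↭-reflexive (sym (concat-rename ι bs′))) (IsForest.leaves-↭ isForest))

    unique-ι : Unique (map ι (leaves t′))
    unique-ι = Unique-resp-↭ (↭-sym leaves-trees) (unique-forestLeaves trees unique)

    lengths : length (map ι (leaves t′)) ≡ length (leaves t)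
    lengths = trans (length-map ι (leaves t′)) (length-leaves t′ t dual)

    initial-S : ∀ {x} → x ∈ leaves t′ → x ∈ initials S
    initial-S m = ∈-resp-↭ (↭-sym (initials-↭ {S} F′)) (subst (_ ∈_) (sym (++-identityʳ (leaves t′))) m)

    initial-S⁻ : ∀ {x} → x ∈ initials S → x ∈ leaves t′
    initial-S⁻ m = subst (_ ∈_) (++-identityʳ (leaves t′)) (∈-resp-↭ (initials-↭ {S} F′) m)

    root∈H : ∀ {u} → u ∈ trees → root u ∈ concl H
    root∈H u∈ = subst (_ ∈_) (sym (IsForest.concl-≡ isForest)) (∈-map⁺ root u∈)

    ranked : ∀ {u y} (u∈ : u ∈ trees) → y ∈ leaves u →
             ∃[ j ] y ≡ ι (lookup (leaves t′) j) × class Q (root u , root∈H u∈) (suc (toℕ j))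
    ranked {u} {y} u∈ m with x , x∈ , refl ← ∈-map⁻ ι (∈-resp-↭ (↭-sym leaves-trees) (forestLeaves-⊆ u∈ m))
      with j , refl ← lookup-index x∈ =
      j , refl , lookup (leaves t′) j , (initial-S x∈ , (let w , a = ∈⇒at u m in w , at⇒path
        (forest-tree-⊆ isForest u∈) a)) , S.rank⁺ j

    class-leaf : ∀ {u k} (u∈ : u ∈ trees) → class Q (root u , root∈H u∈) k →
                 ∃[ x ] x ∈ leaves t′ × ι x ∈ leaves u × Rank S x k
    class-leaf u∈ (x , (m , w , π) , r) = x , initial-S⁻ m ,
      path-leaf isForest unique u∈ (∈-resp-↭ leaves-trees (∈-map⁺ ι (initial-S⁻ m))) π , r

  module _ (parts : P ≋ Q) where

    private
      BlockOf : ∀ {u} → u ∈ trees → Set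
      BlockOf {u} u∈ = ∃[ b ] b ∈ bs × Σ[ d ∈ dai b ∈ E ] class P (b , d) ≐ class Q (root u , root∈H u∈)

      block-of : ∀ {u} (u∈ : u ∈ trees) → BlockOf u∈
      block-of u∈ with (b , d) , eq ← proj₂ parts (_ , root∈H u∈) = b , dai∈⇒block {body T} F d , d , eq

    -- A class of a switching consists of what lies above a conclusion, and the tree above a
    -- conclusion has a leaf. A block with the same ranks is therefore inhabited.
    analysis-nonempty : All (_≢ []) bs
    analysis-nonempty = All.tabulate λ {b} b∈ → nonempty b b∈ {block b∈} (proj₁ parts (b , block b∈))
      where
      block : ∀ {b} → b ∈ bs → dai b ∈ E
      block b∈ = ∈-resp-↭ (↭-sym (IsForest.links-↭ F)) (∈-++⁺ˡ (∈-map⁺ dai b∈))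
      nonempty : ∀ b → b ∈ bs → ∀ {d} → ∃[ j ] class P (b , d) ≐ class Q j → b ≢ []
      nonempty b b∈ ((q , q∈) , eq) refl
        with u , u∈ , refl ← ∈-map⁻ root (subst (q ∈_) (IsForest.concl-≡ isForest) q∈)
        with y , m ← some-leaf u
        with j , _ , x , (i , π) , r ← ranked u∈ m
        with _ , () , _ ← proj₂ eq (x , (i , π) , r)

    -- Equality of partitions compares sets of classes, so the count goes through an injection from
    -- the components of the switching to the blocks: two components with the same block would share
    -- a leaf.
    analysis-many : suc (tensors t) ≤ length bs
    analysis-many = subst (_≤ length bs) (trans length-≡ (cong suc (trans (ℕ.+-identityʳ (pars t′))
      (pars≡tensors t′ t dual))))
      (Fin.injective⇒≤ {f = f} λ {i} {i′} eq → collide {i} {i′} {∈-lookup i} {∈-lookup i′}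
        (block-of (∈-lookup i)) (block-of (∈-lookup i′))
        (trans (sym (f-≡ i)) (trans (cong (lookup bs) eq) (f-≡ i′))))
      where
      f : Fin (length trees) → Fin (length bs)
      f i = proj₁ (lookup-index (proj₁ (proj₂ (block-of (∈-lookup i)))))
      f-≡ : ∀ i → lookup bs (f i) ≡ proj₁ (block-of (∈-lookup i))
      f-≡ i = proj₂ (lookup-index (proj₁ (proj₂ (block-of (∈-lookup i)))))
      collide : ∀ {i i′} {u∈ : lookup trees i ∈ trees} {u∈′ : lookup trees i′ ∈ trees}
                (B : BlockOf u∈) (B′ : BlockOf u∈′) → proj₁ B ≡ proj₁ B′ → i ≡ i′
      collide {i} {i′} {u∈} {u∈′} (b , _ , d , e) (_ , _ , d′ , e′) refl
        with y , m ← some-leaf (lookup trees i)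
        with j , refl , c ← ranked u∈ m
        with p , p∈ , r ← proj₂ e c
        with x , x∈ , m′ , r′ ← class-leaf u∈′ (proj₁ e′ (p , p∈ , r))
        with refl ← S.rank-unique r′ (S.rank⁺ j) = concatMap-index-unique leaves trees i i′
          (unique-forestLeaves trees unique) m m′

    -- The colours of the leaves of `t` are moved by rank to the leaves of the switched net. Each
    -- component has the ranks of some block, so it becomes monochrome, and the switching supplies
    -- the choices at the pars.
    analysis-switchable : ∀ R → (∀ {b} → b ∈ bs → Monochrome R b) → ∃[ b ] Switchable (dualᵖ (paint R t)) b
    analysis-switchable R mono =
      let b , x = switchable R′ mono′ (here refl) in b , subst (λ z → Switchable z b) paint-≡ x
      where
      colours = map R (leaves t)
      lengths′ : length (map ι (leaves t′)) ≡ length colours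
      lengths′ = trans lengths (sym (length-map R (leaves t)))
      R′ : Pos → Bool
      R′ = assoc (map ι (leaves t′)) colours

      paint-≡ : paint (R′ ∘ ι) t′ ≡ dualᵖ (paint R t)
      paint-≡ = paint-match t′ t dual (trans (map-∘ (leaves t′)) (map-assoc
        (map ι (leaves t′)) colours unique-ι lengths′))

      leaf-colour : ∀ j → ∃[ i ] toℕ i ≡ toℕ j × R′ (ι (lookup (leaves t′) j)) ≡ R (lookup (leaves t) i)
      leaf-colour j with i , eq , eq′ ← lookup-map-index ι (leaves t′) j
        with i′ , eq″ , eq‴ ← lookup-map-∃ R (leaves t) {map ι (leaves t′)} lengths′ i =
        i′ , trans eq″ eq , trans (cong R′ (sym eq′)) (trans (assoc-lookup
          (map ι (leaves t′)) colours unique-ι lengths′ i) eq‴)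

      mono′ : ∀ {u} → u ∈ trees → Monochrome R′ (leaves u)
      mono′ {u} u∈ with b , b∈ , d , eq ← block-of u∈ with c , h ← mono b∈ = c , colour
        where
        colour : ∀ {y} → y ∈ leaves u → R′ y ≡ c
        colour m with j , refl , cl ← ranked u∈ m with p , p∈ , r ← proj₂ eq cl
          with i , i≡ , eq′ ← leaf-colour j
          with refl ← T.rank-unique r (subst (λ n → Rank T (lookup (leaves t) i) (suc n)) i≡
            (T.rank⁺ i)) = trans eq′ (h p∈)

sameColour : List Tree → (Pos → Bool) → List Tree → (Pos → Bool) → Set
sameColour ts e us e′ = Pointwise (λ t u → paint e t ≡ dualᵖ (paint e′ u)) ts us

join-monochrome : ∀ {e e′ bs cs} → (∀ {b} → b ∈ bs → Monochrome e b) → (∀ {c} → c ∈ cs → Monochrome e′ c) →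
                  ∀ {b} → b ∈ map (map evenly) bs ++ map (map oddly) cs → Monochrome (join e e′) b
join-monochrome {e} {e′} {bs} h h′ b∈ with ∈-++⁻ (map (map evenly) bs) b∈
... | inj₁ m with b , b∈′ , refl ← ∈-map⁻ (map evenly) m with c , k ← h b∈′ =
  c , λ p∈ → let q , q∈ , eq = ∈-map⁻ evenly p∈ in trans (cong (join e e′) eq) (trans (join-even e e′ q) (k q∈))
... | inj₂ m with b , b∈′ , refl ← ∈-map⁻ (map oddly) m with c , k ← h′ b∈′ =
  c , λ p∈ → let q , q∈ , eq = ∈-map⁻ oddly p∈ in trans (cong (join e e′) eq) (trans (join-odd e e′ q) (k q∈))

-- Tests of formulas and juxtapositions of tests.

module Tests (𝒱 : PropositionalVariables) where

  open MLL 𝒱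
  open PropositionalVariables 𝒱
  open Decomposition 𝒱

  module _ {S : Net} {τ : Pos → Formula} (lab : IsAtomicLabelling S τ)
           {ts bs} (F : IsForest (body S) ts bs) {t} (t∈ : t ∈ ts) {e} (u : Unique (occurrences t))
             (v : Valid e t) where

    open IsAtomicLabelling lab

    private
      module X = SwitchingTest e t u v

      leaf-atomic : ∀ {p} → p ∈ leaves t → ∃[ X ] τ p ≡ var X
      leaf-atomic m with _ , d , m′ ← leaf-initial F (forestLeaves-⊆ t∈ m) = atomic d m′

      t⊆ : treeLinks t ⊆ linksₙ S
      t⊆ = forest-tree-⊆ F t∈

      labelling-S : IsAtomicLabelling X.S τ
      labelling-S = record
        { label-⅋ = λ { (there m) → label-⅋ (t⊆ m) }
        ; label-⊗ = λ { (there m) → label-⊗ (t⊆ m) }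
        ; atomic  = λ { (here refl) m → leaf-atomic m
                      ; (there d) _ → ⊥-elim (dai∉forest (t ∷ []) (subst (_ ∈_)
                          (sym (++-identityʳ (treeLinks t))) d)) }
        }

      not-daimon : ∀ k {a b c} → connective k a b c ∈ linksₙ X.T → connective k a b c ∈ treeLinks (dualTree t)
      not-daimon k m with ∈-++⁻ (map dai X.blocks) m
      ... | inj₂ m′ = m′
      ... | inj₁ m′ with _ , _ , eq ← ∈-map⁻ dai m′ = ⊥-elim (connective≢dai k eq)

      labelling-T : IsAtomicLabelling X.T (λ p → τ p ^⊥)
      labelling-T = record
        { label-⅋ = λ m → cong _^⊥ (label-⊗ (t⊆ (dual-link t parr (not-daimon parr m))))
        ; label-⊗ = λ m → cong _^⊥ (label-⅋ (t⊆ (dual-link t tensor (not-daimon tensor m))))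
        ; atomic  = λ d m → let X , eq = leaf-atomic (∈-resp-↭ X.blocks-↭ (∈-concat⁺′ m (dai∈⇒block {body X.T} X.test-isForest d)))
                            in dual X , cong _^⊥ eq
        }

    switchingTest : IsTest (τ (root t)) X.T
    switchingTest = record
      { testable   = record
          { cutFree     = no-cuts {X.T} X.test-isForest
          ; τ           = λ p → τ p ^⊥
          ; isLabelling = labelling-T
          ; labels      = cong (λ p → τ p ^⊥ ∷ []) (root-dual t)
          }
      ; S          = X.S
      ; S-testable = record
          { cutFree     = no-cuts {X.S} (proj₂ X.reference)
          ; τ           = τ
          ; isLabelling = labelling-S
          ; labels      = refl
          }
      ; ι          = X.ι
      ; σS         = X.H
      ; switching  = X.switching
      ; partitions = X.partitions
      }

  -- A juxtaposition of tests to which the colouring `e` of the trees `ts` extends: facing leaves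
  -- agree and every daimon of `T` is monochrome. Against such a `T`, an experiment on the
  -- interaction sees exactly the colouring `e`.
  record ColouredTest (Γ : Sequent) (ts : List Tree) (e : Pos → Bool) : Set where
    field
      T          : Net
      T∈         : juxtapositions (map tests Γ) T
      trees      : List Tree
      blocks     : List (List Pos)
      colour     : Pos → Bool
      isForest   : IsForest (body T) trees blocks
      matched    : sameColour ts e trees colour
      monochrome : ∀ {b} → b ∈ blocks → Monochrome colour b
      count      : length blocks ≡ length ts + forestPars ts

  module _ {S : Net} {τ : Pos → Formula} (lab : IsAtomicLabelling S τ)
           {ts bs} (F : IsForest (body S) ts bs) {e : Pos → Bool} where

    coloured-singleton : ∀ {t} → t ∈ ts → Valid e t → ColouredTest (τ (root t) ∷ []) (t ∷ []) e
    coloured-singleton {t} t∈ v = record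
      { T          = X.T
      ; T∈         = switchingTest {S} lab F t∈ u v
      ; trees      = dualTree t ∷ []
      ; blocks     = X.blocks
      ; colour     = e
      ; isForest   = X.test-isForest
      ; matched    = sym (trans (cong dualᵖ (paint-dual e t)) (dualᵖ-involutive (paint e t))) ∷ []
      ; monochrome = X.blocks-monochrome
      ; count      = trans X.length-blocks (cong suc (sym (ℕ.+-identityʳ (pars t))))
      }
      where
      u = unique-tree t∈ (unique-occurrences {S} F)
      module X = SwitchingTest e t u v

    coloured-∥ : ∀ {A Γ t t′ ts} → ColouredTest (A ∷ []) (t ∷ []) e → ColouredTest Γ (t′ ∷ ts) e →
                 (∀ {T U} → tests A T → juxtapositions (map tests Γ) U → juxtapositions (map tests (A ∷ Γ))
                   (T ∥ₙ U)) →
                 ColouredTest (A ∷ Γ) (t ∷ t′ ∷ ts) e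
    coloured-∥ {t = t} {t′} {ts} C D j = record
      { T          = C.T ∥ₙ D.T
      ; T∈         = j C.T∈ D.T∈
      ; trees      = map (renameTree evenly) C.trees ++ map (renameTree oddly) D.trees
      ; blocks     = map (map evenly) C.blocks ++ map (map oddly) D.blocks
      ; colour     = join C.colour D.colour
      ; isForest   = ∥-isForest C.isForest D.isForest
      ; matched    = Pointwise-++⁺ {xs = t ∷ []} (renamed evenly (join-even C.colour D.colour) C.matched)
                       (renamed oddly (join-odd C.colour D.colour) D.matched)
      ; monochrome = join-monochrome C.monochrome D.monochrome
      ; count      = trans (length-++ (map (map evenly) C.blocks)) (trans
          (cong₂ _+_ (trans (length-map _ C.blocks) C.count) (trans (length-map _ D.blocks) D.count))
          (arith (pars t) (length ts) (forestPars (t′ ∷ ts))))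
      }
      where
      module C = ColouredTest C
      module D = ColouredTest D
      arith : ∀ a b c → (1 + (a + 0)) + (suc b + c) ≡ suc (suc b) + (a + c)
      arith = +-*-Solver.solve 3 (λ a b c → (con 1 :+ (a :+ con 0)) :+ ((con 1 :+ b) :+ c) := (con 2 :+ b) :+
        (a :+ c)) refl
        where open +-*-Solver using (_:+_; _:=_; con)
      renamed : ∀ {ts us e e′ e″} f → (∀ p → e″ (f p) ≡ e′ p) → sameColour ts e us e′ → sameColour ts e
        (map (renameTree f) us) e″
      renamed f h [] = []
      renamed {us = u ∷ _} {e″ = e″} f h (eq ∷ eqs) =
        trans eq (cong dualᵖ (sym (trans (paint-rename e″ f u) (paint-cong h u)))) ∷ renamed f h eqs

    coloured-test : ∀ us → us ⊆ ts → All (Valid e) us → ColouredTest (map (τ ∘ root) us) us e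
    coloured-test [] _ _ = record
      { T = emptyNet ; T∈ = refl ; trees = [] ; blocks = [] ; colour = λ _ → true ; isForest = emptyNet-isForest
      ; matched = [] ; monochrome = λ () ; count = refl }
    coloured-test (u ∷ []) us⊆ (v ∷ []) = coloured-singleton (us⊆ (here refl)) v
    coloured-test (u ∷ u′ ∷ us) us⊆ (v ∷ vs) =
      coloured-∥ (coloured-singleton (us⊆ (here refl)) v) (coloured-test (u′ ∷ us) (us⊆ ∘ there) vs) juxtapose

  single-shape : ∀ ts {s} → map shape ts ≡ s ∷ [] → ∃[ t ] ts ≡ t ∷ [] × shape t ≡ s
  single-shape (t ∷ []) eq = t , refl , ∷-injectiveˡ eq

  single-tree : ∀ {T A} → AtomicallyTestable T (A ∷ []) → ∃[ t ] ∃[ bs ] Σ[ eq ∈ conclₙ T ≡ root t ∷ [] ]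
                IsForest (body T) (t ∷ []) bs × shape t ≡ formulaShape A
  single-tree {T} {A} at with ts , bs , F , s ← decompose {T} (AtomicallyTestable.cutFree at)
    (AtomicallyTestable.isLabelling at)
    with t , refl , eq ← single-shape ts (trans s (trans (map-∘ (conclₙ T))
      (cong (map formulaShape) (AtomicallyTestable.labels at)))) =
    t , bs , IsForest.concl-≡ F , F , eq

  test-singleton : ∀ {A T} → IsTest A T → Singleton T
  test-singleton {T = T} i with t , _ , eq , _ ← single-tree {T} (IsTest.testable i) = root t , eq

  test-like : ∀ {A T} → IsTest A T → TestLike (formulaShape A ∷ []) T
  test-like {A} {T@(net (graph E _) N)} i
    with t , bs , refl , F , s ← single-tree {T} (IsTest.testable i)
    with IsTest.S i | IsTest.S-testable i | IsTest.switching i | IsTest.partitions i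
  ... | S@(net (graph E′ _) N′) | at | sw | parts
    with t′ , bs′ , refl , F′ , s′ ← single-tree {S} at = record
      { trees      = t ∷ []
      ; blocks     = bs
      ; isForest   = F
      ; shapes     = cong (_∷ []) (trans s (formulaShape-dual A))
      ; nonempty   = X.analysis-nonempty parts
      ; many       = subst (_≤ length bs) (cong suc (sym (ℕ.+-identityʳ (tensors t)))) (X.analysis-many parts)
      ; switchable = λ { Q m (here refl) → X.analysis-switchable parts Q m }
      }
    where
    dual-≡ : shape t′ ≡ dualᵖ (shape t)
    dual-≡ = trans s′ (sym (trans (cong dualᵖ (trans s (formulaShape-dual A)))
      (dualᵖ-involutive (formulaShape A))))
    module X = Analysis {N = N} F {N′ = N′} F′ (switched sw F′ (unique-occurrences {S} F′)) dual-≡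

  tests-like : ∀ Γ {T} → juxtapositions (map tests Γ) T → TestLike (map formulaShape Γ) T
  tests-like [] refl = record
    { trees = [] ; blocks = [] ; isForest = emptyNet-isForest ; shapes = refl ; nonempty = [] ; many = z≤n ;
        switchable = λ _ _ () }
  tests-like (A ∷ []) i = test-like i
  tests-like (A ∷ B ∷ Γ) (juxtapose i j) = ∥-testLike (test-like i) (tests-like (B ∷ Γ) j)

  tests-singleton : ∀ Γ → AllSingleton (map tests Γ)
  tests-singleton [] = []
  tests-singleton (A ∷ Γ) = test-singleton ∷ tests-singleton Γ

-- The correctness criterion

-- e colours the positions so that the edges of some switching join positions of
-- the same colour.
Respects : (Pos → Bool) → Link → Set
Respects e (ten p₁ p₂ p) = e p₁ ≡ e p × e p₂ ≡ e p
Respects e (par p₁ p₂ p) = e p₁ ≡ e p ⊎ e p₂ ≡ e p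
Respects e (cut p q)     = ⊤
Respects e (dai ps)      = Monochrome e ps

-- The Danos–Regnier criterion, with connectedness expressed by colourings and
-- acyclicity by counting.
record Correct (S : Net) : Set where
  field
    connected : ∀ e → All (Respects e) (linksₙ S) → ∀ {p q} → p ∈ targets (linksₙ S) → q ∈ targets (linksₙ S) →
      e p ≡ e q
    count     : total isDai (linksₙ S) ≡ suc (total isJoin (linksₙ S))
    nonempty  : conclₙ S ≢ [] → dai [] ∉ linksₙ S

conclusion∈ : ∀ S {p} → p ∈ conclₙ S → p ∈ targets (linksₙ S)
conclusion∈ S m = proj₁ (Equivalence.to (IsNet.concl-spec (isNet S) _) m)

++∷≢[] : ∀ (ps : List Pos) {q qs} → ps ++ q ∷ qs ≢ []
++∷≢[] [] ()
++∷≢[] (_ ∷ _) ()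

module Soundness (𝒱 : PropositionalVariables) where

  open MLL 𝒱

  -- A colouring restricts to the premises, where it is constant by induction, and the new link ties
  -- its output to them. The two ones contributed by the counts of the premises of a tensor are
  -- compensated by the tensor itself. Every premise of a rule has a conclusion, so an empty daimon
  -- can only be a whole proof of the empty sequent.
  sound : ∀ {S Γ} {π : Proof Γ} → Represents S π → CutFree S → Correct S
  sound {S} (✠-rep {ps = ps} eq c _) cf = record
    { connected = λ e rs p∈ q∈ → let b , m = All.head (subst (All (Respects e)) eq rs) in
        trans (m (in-ps p∈)) (sym (m (in-ps q∈)))
    ; count     = trans (cong (total isDai) eq) (cong suc (sym (cong (total isJoin) eq)))
    ; nonempty  = λ ne m → case subst (dai [] ∈_) eq m of λ { (here refl) → ne c }
    }
    where
    in-ps : ∀ {p} → p ∈ targets (linksₙ S) → p ∈ ps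
    in-ps m = subst (_ ∈_) (trans (cong targets eq) (++-identityʳ ps)) m
  sound {S} (⅋-rep {S₀ = S₀} {ps} {p₁} {p₂} {p} r c₀ σ c) cf = record
    { connected = λ e rs → conn e (All-resp-↭ σ rs)
    ; count     = trans (total-↭ isDai σ) (trans C.count (cong suc (sym (total-↭ isJoin σ))))
    ; nonempty  = λ _ m → case ∈-resp-↭ σ m of λ { (there m′) → C.nonempty ne m′ }
    }
    where
    module C = Correct (sound r (λ a b m → cf a b (∈-resp-↭ (↭-sym σ) (there m))))
    ne : conclₙ S₀ ≢ []
    ne eq = ++∷≢[] ps (trans (sym c₀) eq)
    conn : ∀ e → All (Respects e) (par p₁ p₂ p ∷ linksₙ S₀) → ∀ {x y} → x ∈ targets (linksₙ S) → y ∈ targets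
      (linksₙ S) → e x ≡ e y
    conn e (h ∷ rs) x∈ y∈ = trans (all x∈) (sym (all y∈))
      where
      p₁∈ : p₁ ∈ targets (linksₙ S₀)
      p₁∈ = conclusion∈ S₀ (subst (p₁ ∈_) (sym c₀) (∈-++⁺ʳ ps (here refl)))
      p₂∈ : p₂ ∈ targets (linksₙ S₀)
      p₂∈ = conclusion∈ S₀ (subst (p₂ ∈_) (sym c₀) (∈-++⁺ʳ ps (there (here refl))))
      p≡ : e p ≡ e p₁
      p≡ = [ sym , (λ eq → trans (sym eq) (C.connected e rs p₂∈ p₁∈)) ]′ h
      all : ∀ {x} → x ∈ targets (linksₙ S) → e x ≡ e p₁
      all m with ∈-resp-↭ (targets-↭ σ) m
      ... | here refl = p≡
      ... | there m′ = C.connected e rs m′ p₁∈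
  sound {S} (⊗-rep {S₁ = S₁} {S₂} {ps₁} {ps₂} {p₁} {p₂} {p} r₁ r₂ c₁ c₂ σ c) cf = record
    { connected = λ e rs → conn e (All-resp-↭ σ rs)
    ; count     = trans (total-↭ isDai σ) (trans (total-++ isDai (linksₙ S₁) (linksₙ S₂))
        (trans (cong₂ _+_ C₁.count C₂.count)
        (cong suc (trans (ℕ.+-suc _ _) (trans (cong suc (sym (total-++ isJoin (linksₙ S₁) (linksₙ S₂))))
          (sym (total-↭ isJoin σ)))))))
    ; nonempty  = λ _ m → case ∈-resp-↭ σ m of λ { (there m′) → [ C₁.nonempty (ne c₁) , C₂.nonempty (ne c₂) ]′
        (∈-++⁻ (linksₙ S₁) m′) }
    }
    where
    module C₁ = Correct (sound r₁ (λ a b m → cf a b (∈-resp-↭ (↭-sym σ) (there (∈-++⁺ˡ m)))))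
    module C₂ = Correct (sound r₂ (λ a b m → cf a b (∈-resp-↭ (↭-sym σ) (there (∈-++⁺ʳ (linksₙ S₁) m)))))
    ne : ∀ {xs : List Pos} {ps q} → xs ≡ ps ++ q ∷ [] → xs ≢ []
    ne {ps = ps} c eq = ++∷≢[] ps (trans (sym c) eq)
    conn : ∀ e → All (Respects e) (ten p₁ p₂ p ∷ linksₙ S₁ ++ linksₙ S₂) → ∀ {x y} → x ∈ targets (linksₙ S) →
      y ∈ targets (linksₙ S) → e x ≡ e y
    conn e ((h₁ , h₂) ∷ rs) x∈ y∈ = trans (all x∈) (sym (all y∈))
      where
      p₁∈ : p₁ ∈ targets (linksₙ S₁)
      p₁∈ = conclusion∈ S₁ (subst (p₁ ∈_) (sym c₁) (∈-++⁺ʳ ps₁ (here refl)))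
      p₂∈ : p₂ ∈ targets (linksₙ S₂)
      p₂∈ = conclusion∈ S₂ (subst (p₂ ∈_) (sym c₂) (∈-++⁺ʳ ps₂ (here refl)))
      all : ∀ {x} → x ∈ targets (linksₙ S) → e x ≡ e p
      all {x} m with ∈-resp-↭ (targets-↭ σ) m
      ... | here refl = refl
      ... | there m′ with ∈-++⁻ (targets (linksₙ S₁)) (subst (x ∈_)
          (concatMap-++ target (linksₙ S₁) (linksₙ S₂)) m′)
      ...   | inj₁ m″ = trans (C₁.connected e (All.++⁻ˡ (linksₙ S₁) rs) m″ p₁∈) h₁
      ...   | inj₂ m″ = trans (C₂.connected e (All.++⁻ʳ (linksₙ S₁) rs) m″ p₂∈) h₂
  sound (cut-rep {p₁ = p₁} {p₂} _ _ _ _ σ _) cf = ⊥-elim (cf p₁ p₂ (∈-resp-↭ (↭-sym σ) (here refl)))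
  sound {S} (ex-rep {S₀ = S₀} {ps} {p} {q} {qs} r c₀ _ σ c) cf = record
    { connected = λ e rs x∈ y∈ → C.connected e (All-resp-↭ σ rs) (∈-resp-↭ (targets-↭ σ) x∈)
        (∈-resp-↭ (targets-↭ σ) y∈)
    ; count     = trans (total-↭ isDai σ) (trans C.count (cong suc (sym (total-↭ isJoin σ))))
    ; nonempty  = λ _ m → C.nonempty ne (∈-resp-↭ σ m)
    }
    where
    module C = Correct (sound r (λ a b m → cf a b (∈-resp-↭ (↭-sym σ) m)))
    ne : conclₙ S₀ ≢ []
    ne eq = ++∷≢[] ps (trans (sym c₀) eq)

valid-links : ∀ {e t} → Valid e t → All (Respects e) (treeLinks t)
valid-links leaf = []
valid-links (ten a b x y) = (a , b) ∷ All.++⁺ (valid-links x) (valid-links y)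
valid-links (parˡ a x y) = inj₁ a ∷ All.++⁺ (valid-links x) (valid-links y)
valid-links (parʳ b x y) = inj₂ b ∷ All.++⁺ (valid-links x) (valid-links y)

links-valid : ∀ {e} t → All (Respects e) (treeLinks t) → Valid e t
links-valid (leaf _) _ = leaf
links-valid (node tensor p t u) ((a , b) ∷ rs) = ten a b (links-valid t (All.++⁻ˡ (treeLinks t) rs))
  (links-valid u (All.++⁻ʳ (treeLinks t) rs))
links-valid (node parr p t u) (inj₁ a ∷ rs) = parˡ a (links-valid t (All.++⁻ˡ (treeLinks t) rs))
  (links-valid u (All.++⁻ʳ (treeLinks t) rs))
links-valid (node parr p t u) (inj₂ b ∷ rs) = parʳ b (links-valid t (All.++⁻ˡ (treeLinks t) rs))
  (links-valid u (All.++⁻ʳ (treeLinks t) rs))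

valid-cong : ∀ {e e′ t} → (∀ {x} → x ∈ occurrences t → e′ x ≡ e x) → Valid e t → Valid e′ t
valid-cong h leaf = leaf
valid-cong {t = node _ p t u} h (ten a b x y) = ten
  (trans (h (there (∈-++⁺ˡ (root∈ t)))) (trans a (sym (h (here refl)))))
  (trans (h (there (∈-++⁺ʳ (occurrences t) (root∈ u)))) (trans b (sym (h (here refl)))))
  (valid-cong (h ∘ there ∘ ∈-++⁺ˡ) x) (valid-cong (h ∘ there ∘ ∈-++⁺ʳ (occurrences t)) y)
valid-cong {t = node _ p t u} h (parˡ a x y) = parˡ
  (trans (h (there (∈-++⁺ˡ (root∈ t)))) (trans a (sym (h (here refl)))))
  (valid-cong (h ∘ there ∘ ∈-++⁺ˡ) x) (valid-cong (h ∘ there ∘ ∈-++⁺ʳ (occurrences t)) y)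
valid-cong {t = node _ p t u} h (parʳ b x y) = parʳ
  (trans (h (there (∈-++⁺ʳ (occurrences t) (root∈ u)))) (trans b (sym (h (here refl)))))
  (valid-cong (h ∘ there ∘ ∈-++⁺ˡ) x) (valid-cong (h ∘ there ∘ ∈-++⁺ʳ (occurrences t)) y)

-- Every inner position has the colour of one of its premises, so the common colour of the leaves
-- descends to the root.
valid-constant : ∀ {e t c} → Valid e t → (∀ {x} → x ∈ leaves t → e x ≡ c) → ∀ {x} → x ∈ occurrences t → e x ≡ c
valid-constant {t = leaf _} leaf h m = h m
valid-constant {e} {node k p t u} {c} v h m = go v m
  where
  left-≡ : Valid e t → ∀ {x} → x ∈ occurrences t → e x ≡ c
  left-≡ v = valid-constant v (h ∘ ∈-++⁺ˡ)
  right-≡ : Valid e u → ∀ {x} → x ∈ occurrences u → e x ≡ c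
  right-≡ v = valid-constant v (h ∘ ∈-++⁺ʳ (leaves t))
  rest : Valid e t → Valid e u → ∀ {x} → x ∈ occurrences t ++ occurrences u → e x ≡ c
  rest x y m with ∈-++⁻ (occurrences t) m
  ... | inj₁ m′ = left-≡ x m′
  ... | inj₂ m′ = right-≡ y m′
  go : Valid e (node k p t u) → ∀ {x} → x ∈ p ∷ occurrences t ++ occurrences u → e x ≡ c
  go (ten a b x y) (here refl) = trans (sym a) (left-≡ x (root∈ t))
  go (parˡ a x y) (here refl) = trans (sym a) (left-≡ x (root∈ t))
  go (parʳ b x y) (here refl) = trans (sym b) (right-≡ y (root∈ u))
  go (ten a b x y) (there m) = rest x y m
  go (parˡ a x y) (there m) = rest x y m
  go (parʳ b x y) (there m) = rest x y m

update : (Pos → Bool) → Pos → Bool → Pos → Bool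
update e p b x with x ≟ p
... | yes _ = b
... | no _  = e x

update-≡ : ∀ e p b → update e p b p ≡ b
update-≡ e p b with p ≟ p
... | yes _ = refl
... | no ne = ⊥-elim (ne refl)

update-≢ : ∀ e {p b x} → x ≢ p → update e p b x ≡ e x
update-≢ e {p} {b} {x} ne with x ≟ p
... | yes eq = ⊥-elim (ne eq)
... | no _ = refl

paint-leaves : ∀ {X : Set} {e e′ : Pos → X} t → (∀ {x} → x ∈ leaves t → e x ≡ e′ x) → paint e t ≡ paint e′ t
paint-leaves (leaf p) h = cong leaf (h (here refl))
paint-leaves (node k _ t u) h = cong₂ (node k) (paint-leaves t (h ∘ ∈-++⁺ˡ))
  (paint-leaves u (h ∘ ∈-++⁺ʳ (leaves t)))

monochrome-cong : ∀ {e e′ ps} → (∀ {x} → x ∈ ps → e′ x ≡ e x) → Monochrome e ps → Monochrome e′ ps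
monochrome-cong h (c , m) = c , λ x∈ → trans (h x∈) (m x∈)

record Extension (e : Pos → Bool) (occ ls : List Pos) : Set where
  field
    e⁺      : Pos → Bool
    outside : ∀ {x} → x ∉ occ → e⁺ x ≡ e x
    onLeaf  : ∀ {x} → x ∈ ls → e⁺ x ≡ e x

-- A derivation of `Switchable` records a choice at each par and thus the colours of the inner
-- positions. The two subtrees share no position, so they are coloured in turn, and the output is
-- coloured last.
extend : ∀ {e} t {b} → Unique (occurrences t) → Switchable (paint e t) b →
         Σ[ X ∈ Extension e (occurrences t) (leaves t) ] Extension.e⁺ X (root t) ≡ b × Valid (Extension.e⁺ X) t
extend {e} (leaf p) _ leaf = record { e⁺ = e ; outside = λ _ → refl ; onLeaf = λ _ → refl } , refl , leaf
extend {e} (node k p t u) {b} w s = go k s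
  where
  wt = proj₁ (unique-children {k} {p} {t} {u} w)
  wu = proj₂ (unique-children {k} {p} {t} {u} w)
  disjoint : Disjoint (occurrences t) (occurrences u)
  disjoint (m , m′) = unique-sibling {t} {u} w m m′

  module _ {c d} (x : Switchable (paint e t) c) (y : Switchable (paint e u) d) where
    X = extend t wt x
    e₁ = Extension.e⁺ (proj₁ X)
    Y = extend {e₁} u wu (subst (λ z → Switchable z d)
      (paint-leaves u (λ m → sym (Extension.outside (proj₁ X) λ m′ → disjoint
        (m′ , leaves⊆occurrences u m)))) y)
    e₂ = Extension.e⁺ (proj₁ Y)
    e₃ = update e₂ p b

    on-t : ∀ {x} → x ∈ occurrences t → e₃ x ≡ e₁ x
    on-t {x} m = trans (update-≢ e₂ λ { refl → Unique-head w (∈-++⁺ˡ m) })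
      (Extension.outside (proj₁ Y) λ m′ → disjoint (m , m′))

    on-u : ∀ {x} → x ∈ occurrences u → e₃ x ≡ e₂ x
    on-u m = update-≢ e₂ λ { refl → Unique-head w (∈-++⁺ʳ (occurrences t) m) }

    extension : Extension e (occurrences (node k p t u)) (leaves (node k p t u))
    extension = record
      { e⁺      = e₃
      ; outside = λ n → trans (update-≢ e₂ (λ eq → n (here eq))) (trans
          (Extension.outside (proj₁ Y) (n ∘ there ∘ ∈-++⁺ʳ (occurrences t)))
          (Extension.outside (proj₁ X) (n ∘ there ∘ ∈-++⁺ˡ)))
      ; onLeaf  = λ m → case ∈-++⁻ (leaves t) m of λ
          { (inj₁ m′) → trans (on-t (leaves⊆occurrences t m′)) (Extension.onLeaf (proj₁ X) m′)
          ; (inj₂ m′) → trans (on-u (leaves⊆occurrences u m′)) (trans (Extension.onLeaf (proj₁ Y) m′)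
              (Extension.outside (proj₁ X) λ m″ → disjoint (m″ , leaves⊆occurrences u m′))) }
      }

    root-t : e₃ (root t) ≡ c
    root-t = trans (on-t (root∈ t)) (proj₁ (proj₂ X))
    root-u : e₃ (root u) ≡ d
    root-u = trans (on-u (root∈ u)) (proj₁ (proj₂ Y))
    root-p : e₃ p ≡ b
    root-p = update-≡ e₂ p b
    valid-t : Valid e₃ t
    valid-t = valid-cong on-t (proj₂ (proj₂ X))
    valid-u : Valid e₃ u
    valid-u = valid-cong on-u (proj₂ (proj₂ Y))

  go : ∀ k → Switchable (node k (paint e t) (paint e u)) b →
       Σ[ X ∈ Extension e (occurrences (node k p t u)) (leaves (node k p t u)) ] Extension.e⁺ X p ≡ b × Valid
         (Extension.e⁺ X) (node k p t u)
  go tensor (ten x y) = extension x y , root-p x y ,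
    ten (trans (root-t x y) (sym (root-p x y))) (trans (root-u x y) (sym (root-p x y))) (valid-t x y)
      (valid-u x y)
  go parr (parˡ x y) = extension x y , root-p x y , parˡ (trans (root-t x y) (sym (root-p x y))) (valid-t x y)
    (valid-u x y)
  go parr (parʳ x y) = extension x y , root-p x y , parʳ (trans (root-u x y) (sym (root-p x y))) (valid-t x y)
    (valid-u x y)

extend-forest : ∀ {e} ts → Unique (forestOccurrences ts) → (∀ {t} → t ∈ ts → ∃[ b ] Switchable (paint e t) b) →
                Σ[ X ∈ Extension e (forestOccurrences ts) (forestLeaves ts) ] All (Valid (Extension.e⁺ X)) ts
extend-forest {e} [] _ _ = record { e⁺ = e ; outside = λ _ → refl ; onLeaf = λ _ → refl } , []
extend-forest {e} (t ∷ ts) w s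
  with wt , wts , disjoint ← Unique-++⁻ (occurrences t) w
  with X , _ , v ← extend t wt (proj₂ (s (here refl)))
  with Y , vs ← extend-forest {Extension.e⁺ X} ts wts (λ {u} u∈ → let b , y = s (there u∈) in
         b , subst (λ z → Switchable z b) (paint-leaves u λ m → sym (Extension.outside X λ m′ →
           disjoint (m′ , occurrences-⊆ u∈ (leaves⊆occurrences u m)))) y) = record
    { e⁺      = Extension.e⁺ Y
    ; outside = λ n → trans (Extension.outside Y (n ∘ ∈-++⁺ʳ (occurrences t)))
        (Extension.outside X (n ∘ ∈-++⁺ˡ))
    ; onLeaf  = λ m → case ∈-++⁻ (leaves t) m of λ
        { (inj₁ m′) → trans (Extension.outside Y λ m″ → disjoint (leaves⊆occurrences t m′ , m″))
            (Extension.onLeaf X m′)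
        ; (inj₂ m′) → trans (Extension.onLeaf Y m′) (Extension.outside X λ m″ → disjoint
            (m″ , forestLeaves⊆ ts m′)) }
    } , valid-cong (λ m → Extension.outside Y λ m″ → disjoint (m , m″)) v ∷ vs
  where
  forestLeaves⊆ : ∀ ts → forestLeaves ts ⊆ forestOccurrences ts
  forestLeaves⊆ (t ∷ ts) m with ∈-++⁻ (leaves t) m
  ... | inj₁ m′ = ∈-++⁺ˡ (leaves⊆occurrences t m′)
  ... | inj₂ m′ = ∈-++⁺ʳ (occurrences t) (forestLeaves⊆ ts m′)

leaf-injective : ∀ {X} {x y : X} → Painted.leaf x ≡ leaf y → x ≡ y
leaf-injective refl = refl

paint-leaves⁻ : ∀ {e e′ : Pos → Bool} t u → paint e t ≡ dualᵖ (paint e′ u) → map e (leaves t) ≡ map e′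
  (leaves u)
paint-leaves⁻ (leaf p) (leaf q) eq = cong (_∷ []) (leaf-injective eq)
paint-leaves⁻ {e} {e′} (node k _ t t′) (node l _ u u′) eq with _ , eq₁ , eq₂ ← node-injective eq =
  trans (map-++ e (leaves t) (leaves t′)) (trans (cong₂ _++_ (paint-leaves⁻ t u eq₁) (paint-leaves⁻ t′ u′ eq₂))
    (sym (map-++ e′ (leaves u) (leaves u′))))

matching-leaves : ∀ {e ts us} → Matching e ts us → map e (forestLeaves ts) ≡ map e (forestLeaves us)
matching-leaves [] = refl
matching-leaves {e} {t ∷ ts} {u ∷ us} (eq ∷ eqs) = trans (map-++ e (leaves t) (forestLeaves ts))
  (trans (cong₂ _++_ (paint-leaves⁻ t u eq) (matching-leaves eqs)) (sym
    (map-++ e (leaves u) (forestLeaves us))))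

length-leaves-count : ∀ t → length (leaves t) ≡ suc (tensors t + pars t)
length-leaves-count (leaf _) = refl
length-leaves-count (node k p t u) = trans (length-++ (leaves t)) (trans
  (cong₂ _+_ (length-leaves-count t) (length-leaves-count u)) (go k))
  where
  go : ∀ k → suc (tensors t + pars t) + suc (tensors u + pars u) ≡ suc
    (tensors (node k p t u) + pars (node k p t u))
  go tensor = +-*-Solver.solve 4 (λ a b c d → con 1 :+ (a :+ b) :+ (con 1 :+ (c :+ d)) := con 1 :+
    ((con 1 :+ (a :+ c)) :+ (b :+ d))) refl
    (tensors t) (pars t) (tensors u) (pars u)
    where open +-*-Solver using (_:+_; _:=_; con)
  go parr = +-*-Solver.solve 4 (λ a b c d → con 1 :+ (a :+ b) :+ (con 1 :+ (c :+ d)) := con 1 :+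
    ((a :+ c) :+ (con 1 :+ (b :+ d)))) refl
    (tensors t) (pars t) (tensors u) (pars u)
    where open +-*-Solver using (_:+_; _:=_; con)

length-forestLeaves-count : ∀ ts → length (forestLeaves ts) ≡ length ts + (forestTensors ts + forestPars ts)
length-forestLeaves-count [] = refl
length-forestLeaves-count (t ∷ ts) = trans (length-++ (leaves t)) (trans
  (cong₂ _+_ (length-leaves-count t) (length-forestLeaves-count ts))
  (+-*-Solver.solve 5 (λ a b l c d → (con 1 :+ (a :+ b)) :+ (l :+ (c :+ d)) := (con 1 :+ l) :+
    ((a :+ c) :+ (b :+ d))) refl
    (tensors t) (pars t) (length ts) (forestTensors ts) (forestPars ts)))
  where open +-*-Solver using (_:+_; _:=_; con)

forest-daimons : ∀ {G ts bs} → IsForest G ts bs → total isDai (links G) ≡ length bs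
forest-daimons {ts = ts} {bs} F = trans (total-↭ isDai (IsForest.links-↭ F))
  (trans (total-++ isDai (map dai bs) (forestLinks ts))
  (trans (cong₂ _+_ (daimons-dai bs) (daimons-forestLinks ts)) (ℕ.+-identityʳ _)))

forest-joins : ∀ {G ts bs} → IsForest G ts bs → total isJoin (links G) ≡ forestTensors ts
forest-joins {ts = ts} {bs} F = trans (total-↭ isJoin (IsForest.links-↭ F))
  (trans (total-++ isJoin (map dai bs) (forestLinks ts))
  (cong₂ _+_ (joins-dai bs) (joins-forestLinks ts)))

map-root-[] : ∀ {ts} → map root ts ≡ [] → ts ≡ []
map-root-[] {[]} _ = refl

dual-shapes : ∀ ts us {ss} → map shape ts ≡ ss → map shape us ≡ map dualᵖ ss → Dual ts us
dual-shapes [] [] refl _ = []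
dual-shapes (t ∷ ts) (u ∷ us) refl eq =
  sym (trans (cong dualᵖ (∷-injectiveˡ eq)) (dualᵖ-involutive (shape t))) ∷ dual-shapes ts us refl
    (∷-injectiveʳ eq)

dual-pars : ∀ {ts us} → Dual ts us → forestPars ts ≡ forestTensors us
dual-pars [] = refl
dual-pars {t ∷ _} {u ∷ _} (eq ∷ eqs) = cong₂ _+_ (pars≡tensors t u eq) (dual-pars eqs)

dual-rename : ∀ f g {ts us} → Dual ts us → Dual (map (renameTree f) ts) (map (renameTree g) us)
dual-rename f g [] = []
dual-rename f g {t ∷ _} {u ∷ _} (eq ∷ eqs) =
  trans (paint-rename _ f t) (trans eq (cong dualᵖ (sym (paint-rename _ g u)))) ∷ dual-rename f g eqs

-- From correctness to orthogonality.

module _ {S T : Net} {ts bs ss} (F : IsForest (body S) ts bs) (s : map shape ts ≡ ss) (C : Correct S)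
  (L : TestLike ss T) where

  private
    module C = Correct C
    module L = TestLike L
    us = L.trees
    cs = L.blocks
    ts′ = map (renameTree evenly) ts
    us′ = map (renameTree oddly) us
    bs′ = map (map evenly) bs
    cs′ = map (map oddly) cs

    d : Dual ts us
    d = dual-shapes ts us s L.shapes

    d′ : Dual ts′ us′
    d′ = dual-rename evenly oddly d

    blocks-count : length bs ≡ suc (forestTensors ts)
    blocks-count = trans (sym (forest-daimons F)) (trans C.count (cong suc (forest-joins F)))

    length-blocks : length (bs′ ++ cs′) ≡ length bs + length cs
    length-blocks = trans (length-++ bs′) (cong₂ _+_ (length-map _ bs) (length-map _ cs))

    -- There is one cut per leaf, that is, one per tree, per tensor and per par of `S`. Correctness
    -- gives one daimon more than the tensors of `S`; `T` has at least one per tree and one per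
    -- tensor of its own, and these tensors face the pars of `S`.
    enough : suc (length (forestLeaves ts′)) ≤ length (bs′ ++ cs′)
    enough = ℕ.≤-trans (ℕ.≤-reflexive (cong suc (trans (cong length (forestLeaves-rename evenly ts))
        (trans (length-map evenly (forestLeaves ts)) (trans (length-forestLeaves-count ts)
        (+-*-Solver.solve 3 (λ l a b → l :+ (a :+ b) := a :+ (l :+ b)) refl (length ts) (forestTensors ts)
          (forestPars ts)))))))
      (ℕ.≤-trans (ℕ.+-mono-≤ (ℕ.≤-reflexive (sym blocks-count))
        (ℕ.≤-trans (ℕ.≤-reflexive (cong₂ _+_ (pointwise-length d) (dual-pars d))) L.many))
        (ℕ.≤-reflexive (sym length-blocks)))
      where open +-*-Solver using (_:+_; _:=_)

    F′ = ∥-isForest F L.isForest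

    unique : Unique (forestOccurrences (ts′ ++ us′))
    unique = unique-occurrences {S ∥ₙ T} F′

    nonempty-S : ts ≢ [] → All (_≢ []) bs
    nonempty-S ne = All.tabulate λ { b∈ refl → C.nonempty (λ eq → ne
      (map-root-[] (trans (sym (IsForest.concl-≡ F)) eq)))
        (∈-resp-↭ (↭-sym (IsForest.links-↭ F)) (∈-++⁺ˡ (∈-map⁺ dai b∈))) }

    -- Monochromy on the blocks of `T` makes its trees dually switchable, hence the trees of `S`
    -- switchable. The colouring then extends to the inner positions of `S`, where correctness
    -- applies; a leaf of `T` has the colour of the leaf of `S` that faces it.
    connected : Connected (bs′ ++ cs′) ts′ us′
    connected e mono match {b} {c} {p} {q} b∈ c∈ p∈ q∈ = trans (proj₂ (constant b∈ p∈)) (trans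
        (C.connected e⁺ respects (proj₁ (proj₂ (proj₁ (constant b∈ p∈))))
          (proj₁ (proj₂ (proj₁ (constant c∈ q∈)))))
        (sym (proj₂ (constant c∈ q∈))))
      where
      eS = e ∘ evenly
      switchable-S : ∀ {ts us} → Matching e (map (renameTree evenly) ts) (map (renameTree oddly) us) →
        (∀ {u} → u ∈ us → ∃[ b ] Switchable (dualᵖ (paint (e ∘ oddly) u)) b) →
        ∀ {t} → t ∈ ts → ∃[ b ] Switchable (paint eS t) b
      switchable-S {t ∷ _} {u ∷ _} (eq ∷ eqs) h (here refl) with b , x ← h (here refl) =
        b , subst (λ z → Switchable z b) (sym (trans (sym (paint-rename e evenly t))
          (trans eq (cong dualᵖ (paint-rename e oddly u))))) x
      switchable-S {_ ∷ _} {_ ∷ _} (eq ∷ eqs) h (there m) = switchable-S eqs (h ∘ there) m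

      E = extend-forest {eS} ts (unique-occurrences {S} F) (switchable-S {ts} {us} match
        (L.switchable (e ∘ oddly) λ b∈ → monochrome-rename {e} (mono (∈-++⁺ʳ bs′ (∈-map⁺ _ b∈)))))
      e⁺ = Extension.e⁺ (proj₁ E)

      leaf∈ : ∀ {b x} → b ∈ bs → x ∈ b → x ∈ forestLeaves ts
      leaf∈ b∈ m = ∈-resp-↭ (IsForest.leaves-↭ F) (∈-concat⁺′ m b∈)

      respects : All (Respects e⁺) (linksₙ S)
      respects = All-resp-↭ (↭-sym (IsForest.links-↭ F)) (All.++⁺
        (All.map⁺ (All.tabulate λ {b} b∈ → monochrome-cong {eS} (λ m → Extension.onLeaf (proj₁ E) (leaf∈ b∈ m))
          (monochrome-rename {e} (mono (∈-++⁺ˡ (∈-map⁺ _ b∈))))))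
        (All.concat⁺ (All.map⁺ (All.map valid-links (proj₂ E)))))

      from-leaf : ∀ {x} → x ∈ forestLeaves ts′ → ∃[ y ] (y ∈ targets (linksₙ S) × e x ≡ e⁺ y)
      from-leaf m with y , y∈ , refl ← ∈-map⁻ evenly (subst (_ ∈_) (forestLeaves-rename evenly ts) m) =
        y , (let b , d , m′ = leaf-initial F y∈ in ∈-targets d m′) , sym (Extension.onLeaf (proj₁ E) y∈)

      constant : ∀ {b x} → b ∈ bs′ ++ cs′ → x ∈ b → Σ[ Y ∈ ∃[ y ] (y ∈ targets
        (linksₙ S) × e x ≡ e⁺ y) ] e x ≡ e⁺ (proj₁ Y)
      constant {x = x} b∈ m with ∈-++⁻ (forestLeaves ts′) (subst (x ∈_) (concatMap-++ leaves ts′ us′)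
             (∈-resp-↭ (IsForest.leaves-↭ F′) (∈-concat⁺′ m b∈)))
      ... | inj₁ m′ = from-leaf m′ , proj₂ (proj₂ (from-leaf m′))
      ... | inj₂ m′ with z , z∈ , eq ← ∈-map⁻ e (subst (e x ∈_) (sym (matching-leaves match)) (∈-map⁺ e m′))
        with y , y∈ , eq′ ← from-leaf z∈ = (y , y∈ , trans eq eq′) , trans eq eq′

    -- Without conclusions, `T` has no block and the count leaves a single block in `S`. Otherwise
    -- no block is empty and colours decide.
    closing : length (bs′ ++ cs′) ≡ 1 ⊎ (All (_≢ []) (bs′ ++ cs′) × Connected (bs′ ++ cs′) ts′ us′)
    closing = go ts refl
      where
      go : ∀ xs → ts ≡ xs → length (bs′ ++ cs′) ≡ 1 ⊎ (All (_≢ []) (bs′ ++ cs′) × Connected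
        (bs′ ++ cs′) ts′ us′)
      go (x ∷ xs) eq = inj₂ (All.++⁺ (All.map⁺ (All.map map-nonempty
        (nonempty-S λ eq′ → case trans (sym eq) eq′ of λ ())))
        (All.map⁺ (All.map map-nonempty L.nonempty)) , connected)
      go [] eq = inj₁ (trans length-blocks (trans (cong₂ _+_ (trans blocks-count
        (cong (suc ∘ forestTensors) eq)) (cong length no-blocks)) refl))
        where
        us≡[] : us ≡ []
        us≡[] with us | pointwise-length d
        ... | [] | _ = refl
        ... | _ ∷ _ | eq′ = case trans (sym eq′) (cong length eq) of λ ()
        no-blocks : cs ≡ []
        no-blocks with cs in eqc | L.nonempty | ↭-empty-inv (↭-trans (IsForest.leaves-↭ L.isForest)
          (↭-reflexive (cong forestLeaves us≡[])))
        ... | [] | _ | _ = refl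
        ... | [] ∷ _ | ne ∷ _ | _ = ⊥-elim (ne refl)
        ... | (_ ∷ _) ∷ _ | _ | ()

  correct⇒⟂ : S ⟂ T
  correct⇒⟂ = ⟂-intro S T
    (trans (cong length (IsForest.concl-≡ F)) (trans (length-map root ts) (trans (pointwise-length d)
      (trans (sym (length-map root us)) (sym (cong length (IsForest.concl-≡ L.isForest)))))))
    (wins-resp-↭ (interaction-links {S} {T} F L.isForest)
      (wins-closed (IsForest.leaves-↭ F′) unique d′ enough closing))

-- From orthogonality to correctness.

module Completeness (𝒱 : PropositionalVariables) where

  open MLL 𝒱
  open Tests 𝒱

  module _ {S : Net} {τ : Pos → Formula} (lab : IsAtomicLabelling S τ) {ts bs} (F : IsForest (body S) ts bs)
           (o : S ⟂ˢ juxtapositions (map tests (map (τ ∘ root) ts))) where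

    module _ {e : Pos → Bool} (vs : All (Valid e) ts) where

      private
        module X = ColouredTest (coloured-test {S} lab F ts id vs)
        us = X.trees
        cs = X.blocks
        ts′ = map (renameTree evenly) ts
        us′ = map (renameTree oddly) us
        e′ = join e X.colour
        F′ = ∥-isForest F X.isForest

        link-≡ : links (interaction S X.T) ↭ closedLinks (map (map evenly) bs ++ map (map oddly) cs) ts′ us′
        link-≡ = interaction-links {S} {X.T} F X.isForest

        lengths : length ts′ ≡ length us′
        lengths = trans (length-map _ ts) (trans (pointwise-length X.matched) (sym (length-map _ us)))

        match : ∀ {ts us} → sameColour ts e us X.colour → Matching e′ (map (renameTree evenly) ts)
          (map (renameTree oddly) us)
        match [] = []
        match {t ∷ _} {u ∷ _} (eq ∷ eqs) =
          trans (trans (paint-rename e′ evenly t) (paint-cong (join-even e X.colour) t))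
            (trans eq (cong dualᵖ (sym (trans (paint-rename e′ oddly u)
              (paint-cong (join-odd e X.colour) u))))) ∷ match eqs

        ⟂-tensors : ∀ {ts us} → sameColour ts e us X.colour → forestTensors us ≡ forestPars ts
        ⟂-tensors [] = refl
        ⟂-tensors {t ∷ _} {u ∷ _} (eq ∷ eqs) = cong₂ _+_ (sym (painted-tensors t u eq)) (⟂-tensors eqs)
          where
          painted-tensors : ∀ t u → paint e t ≡ dualᵖ (paint X.colour u) → pars t ≡ tensors u
          painted-tensors (leaf _) (leaf _) _ = refl
          painted-tensors (node k _ t t′) (node l _ u u′) eq with refl , eq₁ , eq₂ ← node-injective eq with l
          ... | tensor = cong suc (cong₂ _+_ (painted-tensors t u eq₁) (painted-tensors t′ u′ eq₂))
          ... | parr   = cong₂ _+_ (painted-tensors t u eq₁) (painted-tensors t′ u′ eq₂)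

      -- The test built from the colouring `e` continues it across the cuts without spoiling
      -- monochromy. The joint colouring is an experiment on the interaction, and the reduction to
      -- one daimon makes it constant.
      blocks-constant : (∀ {b} → b ∈ bs → Monochrome e b) → ∀ {b c p q} → b ∈ bs → c ∈ bs → p ∈ b → q ∈ c →
        e p ≡ e q
      blocks-constant mono {p = p} {q} b∈ c∈ p∈ q∈ = trans (sym (join-even e X.colour p)) (trans
        (⟶*-monochrome e′ (IsForest.leaves-↭ F′) (unique-occurrences {S ∥ₙ X.T} F′)
          (join-monochrome mono X.monochrome) (match X.matched) (o X.T X.T∈) link-≡
          (∈-++⁺ˡ (∈-map⁺ (map evenly) b∈)) (∈-++⁺ˡ (∈-map⁺ (map evenly) c∈)) (∈-map⁺ evenly p∈)
            (∈-map⁺ evenly q∈))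
        (join-even e X.colour q))

      -- By the weight invariant, the daimons of both nets number one more than their tensors and
      -- the cuts. The test has one daimon per tree and per par of `ts`, its tensors face those
      -- pars, and there is one cut per tree; these contributions cancel.
      blocks-count : length bs ≡ suc (forestTensors ts)
      blocks-count = ℕ.+-cancelʳ-≡ (length ts + forestPars ts) _ _ (trans
        (trans (trans (cong (length bs +_) (sym X.count)) (sym (trans (length-++ (map (map evenly) bs))
          (cong₂ _+_ (length-map (map evenly) bs) (length-map (map oddly) cs)))))
          (trans (sym (closed-daimons (map (map evenly) bs ++ map (map oddly) cs) ts′ us′))
            (trans (sym (total-↭ isDai link-≡)) (trans (⟶*-weight (o X.T X.T∈))
            (cong suc (trans (total-↭ isJoin link-≡) (closed-joins (map (map evenly) bs ++ map
              (map oddly) cs) ts′ us′ lengths)))))))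
        (cong suc (trans (cong₂ _+_ (trans (forestTensors-++ ts′ us′)
            (cong₂ _+_ (forestTensors-rename evenly ts) (trans (forestTensors-rename oddly us)
              (⟂-tensors X.matched)))) (length-map _ ts))
          (+-*-Solver.solve 3 (λ a b c → (a :+ b) :+ c := a :+ (c :+ b)) refl (forestTensors ts)
            (forestPars ts) (length ts)))))
        where open +-*-Solver using (_:+_; _:=_)

      -- An empty daimon in the interaction would have to be alone from the start, whereas each tree
      -- contributes a cut.
      no-empty : ts ≢ [] → [] ∉ bs
      no-empty ne m = contradiction (⟶*-empty (o X.T X.T∈) link∈) (other ts us ne lengths-≡)
        where
        lengths-≡ : length ts ≡ length us
        lengths-≡ = pointwise-length X.matched
        rest = proj₁ (∈⇒↭ (∈-map⁺ (map evenly) m))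
        ρ = proj₂ (∈⇒↭ (∈-map⁺ (map evenly) m))
        cuts = map dai (rest ++ map (map oddly) cs) ++ forestLinks (ts′ ++ us′) ++ cutRoots ts′ us′
        link∈ : links (interaction S X.T) ↭ dai [] ∷ cuts
        link∈ = ↭-trans link-≡ (++⁺ʳ _ (map⁺ dai (++⁺ʳ (map (map oddly) cs) ρ)))
        other : ∀ xs ys → xs ≢ [] → length xs ≡ length ys →
                map dai (rest ++ map (map oddly) cs) ++ forestLinks (ts′ ++ us′) ++
                cutRoots (map (renameTree evenly) xs) (map (renameTree oddly) ys) ≢ []
        other [] _ ne _ = ⊥-elim (ne refl)
        other (x ∷ xs) (y ∷ ys) _ _ eq =
          case ++-conicalʳ (forestLinks (ts′ ++ us′)) _ (++-conicalʳ
            (map dai (rest ++ map (map oddly) cs)) _ eq) of λ ()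

    ⟂⇒correct : Correct S
    ⟂⇒correct = record
      { connected = conn
      -- The count does not depend on the colouring. The constant one is valid on every tree and
      -- provides a test to count with.
      ; count     = trans (forest-daimons F) (trans (blocks-count {λ _ → true} trivial)
          (cong suc (sym (forest-joins F))))
      ; nonempty  = λ ne m → no-empty {λ _ → true} trivial (λ eq → ne
          (trans (IsForest.concl-≡ F) (cong (map root) eq))) (dai∈⇒block F m)
      }
      where
      trivial-tree : ∀ t → Valid (λ _ → true) t
      trivial-tree (leaf _) = leaf
      trivial-tree (node tensor _ t u) = ten refl refl (trivial-tree t) (trivial-tree u)
      trivial-tree (node parr _ t u) = parˡ refl (trivial-tree t) (trivial-tree u)
      trivial : All (Valid (λ _ → true)) ts
      trivial = All.tabulate λ {t} _ → trivial-tree t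

      conn : ∀ e → All (Respects e) (linksₙ S) → ∀ {p q} → p ∈ targets (linksₙ S) → q ∈ targets (linksₙ S) →
        e p ≡ e q
      conn e rs p∈ q∈ = trans (colour p∈′) (sym (trans (colour q∈′) (same (leaf-of p∈′) (leaf-of q∈′))))
        where
        p∈′ = ∈-resp-↭ (targets-forest F) p∈
        q∈′ = ∈-resp-↭ (targets-forest F) q∈
        rs′ = All-resp-↭ (IsForest.links-↭ F) rs
        mono : ∀ {b} → b ∈ bs → Monochrome e b
        mono b∈ = All.lookup (All.++⁻ˡ (map dai bs) rs′) (∈-map⁺ dai b∈)
        vs : All (Valid e) ts
        vs = All.tabulate λ {t} t∈ → links-valid t (All.tabulate λ m → All.lookup (All.++⁻ʳ (map dai bs) rs′)
          (forest-⊆ t∈ m))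
        Leaf = ∃[ x ] x ∈ forestLeaves ts
        same : (x y : Leaf) → e (proj₁ y) ≡ e (proj₁ x)
        same (x , x∈) (y , y∈)
          with b , m , b∈ ← ∈-concat⁻′ bs (∈-resp-↭ (↭-sym (IsForest.leaves-↭ F)) x∈)
          with c , m′ , c∈ ← ∈-concat⁻′ bs (∈-resp-↭ (↭-sym (IsForest.leaves-↭ F)) y∈) = blocks-constant vs
            mono c∈ b∈ m′ m
        tree-of : ∀ ts {x} → x ∈ forestOccurrences ts → ∃[ t ] t ∈ ts × x ∈ occurrences t
        tree-of (t ∷ ts) m with ∈-++⁻ (occurrences t) m
        ... | inj₁ m′ = t , here refl , m′
        ... | inj₂ m′ with u , u∈ , m″ ← tree-of ts m′ = u , there u∈ , m″
        leaf-of : ∀ {x} → x ∈ forestOccurrences ts → Leaf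
        leaf-of m with t , t∈ , _ ← tree-of ts m with y , m′ ← some-leaf t = y , forestLeaves-⊆ t∈ m′
        colour : ∀ {x} (m : x ∈ forestOccurrences ts) → e x ≡ e (proj₁ (leaf-of m))
        colour m with t , t∈ , m′ ← tree-of ts m with y , y∈ ← some-leaf t =
          valid-constant (All.lookup vs t∈) (λ z∈ → same (y , forestLeaves-⊆ t∈ y∈)
            (_ , forestLeaves-⊆ t∈ z∈)) m′

-- Contractible links

¬true⇒false : ∀ {b} → b ≢ true → b ≡ false
¬true⇒false {false} _ = refl
¬true⇒false {true} n = ⊥-elim (n refl)

true≢false : ∀ {b} → b ≡ true → b ≡ false → ⊥
true≢false refl ()

filter-length : ∀ {V : List Pos} b → Unique V → length V ≤ suc (length (filter (λ v → ¬? (v ≟ b)) V))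
filter-length {[]} b _ = z≤n
filter-length {v ∷ V} b (v∉ ∷ u) with v ≟ b
... | no ne rewrite filter-accept (λ v → ¬? (v ≟ b)) {x = v} {xs = V} ne = s≤s (filter-length b u)
... | yes refl rewrite filter-reject (λ v → ¬? (v ≟ b)) {x = v} {xs = V} (λ ne → ne refl)
                     | filter-all (λ v → ¬? (v ≟ b)) (All.map (λ ne eq → ne (sym eq)) v∉) = ℕ.≤-refl

Separation : List Pos → List Edge → Set
Separation V es = Σ[ e ∈ (Pos → Bool) ] (∀ {a b} → (a , b) ∈ es → e a ≡ e b) × ∃[ x ] ∃[ y ] x ∈ V × y ∈ V × e
  x ≢ e y

-- A graph with at least two more vertices than edges is disconnected. An edge between distinct ends
-- is contracted by renaming `b` to `a` and deleting `b`, which loses at most one vertex, and the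
-- colouring is pulled back along the renaming. The number `n` makes the recursion structural, since
-- the edges are renamed.
separate : ∀ n V es → length es ≡ n → Unique V → suc (suc (length es)) ≤ length V → Separation V es
separate n (x ∷ y ∷ V) [] _ (x∉ ∷ _) _ = e , (λ ()) , x , y , here refl , there (here refl) , distinct
  where
  e : Pos → Bool
  e v = does (v ≟ x)
  distinct : e x ≢ e y
  distinct eq = true≢false (dec-true (x ≟ x) refl) (trans eq (dec-false (y ≟ x) λ eq′ → All.lookup x∉
    (here refl) (sym eq′)))
separate n (x ∷ []) [] _ _ (s≤s ())
separate (suc n) V ((a , b) ∷ es) l u le with a ≟ b
... | yes refl with e , h , rest ← separate n V es (ℕ.suc-injective l) u (ℕ.≤-trans (ℕ.n≤1+n _) le) =
  e , (λ { (here refl) → refl ; (there m) → h m }) , rest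
... | no ne
  with e , h , x , y , x∈ , y∈ , d ← separate n (filter (λ v → ¬? (v ≟ b)) V)
    (map (λ (c , d) → replace b a c , replace b a d) es)
         (trans (length-map _ es) (ℕ.suc-injective l)) (Unique.filter⁺ (λ v → ¬? (v ≟ b)) u)
         (ℕ.≤-pred (subst (λ n → suc (suc (suc n)) ≤ suc (length (filter (λ v → ¬? (v ≟ b)) V)))
           (sym (length-map _ es))
           (ℕ.≤-trans le (filter-length b u)))) =
  e ∘ replace b a ,
  (λ { (here refl) → trans (cong e (replace-≢ ne)) (sym (cong e (replace-≡ b a)))
     ; (there m) → h (∈-map⁺ _ m) }) ,
  x , y , proj₁ (∈-filter⁻ (λ v → ¬? (v ≟ b)) x∈) , proj₁ (∈-filter⁻ (λ v → ¬? (v ≟ b)) y∈) ,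
  λ eq → d (trans (sym (cong e (replace-≢ (proj₂ (∈-filter⁻ (λ v → ¬? (v ≟ b)) {xs = V} x∈)))))
    (trans eq (cong e (replace-≢ (proj₂ (∈-filter⁻ (λ v → ¬? (v ≟ b)) {xs = V} y∈))))))

pick : {A : Set} → Side → A → A → A
pick left  a b = a
pick right a b = b

opposite : Side → Side
opposite left  = right
opposite right = left

-- An edge `(s , c)` goes from the output `s` of a connective to a premise `c`, and its far end is
-- the node `rep c`. Keeping `c` itself distinguishes edges that end in the same block.
linkEdges : (Pos → Side) → Link → List Edge
linkEdges σ (ten a b p) = (p , a) ∷ (p , b) ∷ []
linkEdges σ (par a b p) = (p , pick (σ p) a b) ∷ []
linkEdges σ _           = []

graphEdges : (Pos → Side) → List Link → List Edge
graphEdges σ = concatMap (linkEdges σ)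

∈-graphEdges⁺ : ∀ σ {L l g} → l ∈ L → g ∈ linkEdges σ l → g ∈ graphEdges σ L
∈-graphEdges⁺ σ (here refl) m = ∈-++⁺ˡ m
∈-graphEdges⁺ σ {l′ ∷ L} (there l∈) m = ∈-++⁺ʳ (linkEdges σ l′) (∈-graphEdges⁺ σ l∈ m)

∈-graphEdges⁻ : ∀ σ L {g} → g ∈ graphEdges σ L → ∃[ l ] l ∈ L × g ∈ linkEdges σ l
∈-graphEdges⁻ σ (l ∷ L) m with ∈-++⁻ (linkEdges σ l) m
... | inj₁ m′ = l , here refl , m′
... | inj₂ m′ with l′ , l∈ , m″ ← ∈-graphEdges⁻ σ L m′ = l′ , there l∈ , m″

trues : (Pos → Bool) → List Pos → ℕ
trues e V = sum (map (λ v → if e v then 1 else 0) V)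

trues-≤ : ∀ {e f : Pos → Bool} V → (∀ v → e v ≡ true → f v ≡ true) → trues e V ≤ trues f V
trues-≤ [] _ = z≤n
trues-≤ {e} {f} (v ∷ V) h with e v in eq
... | false = ℕ.≤-trans (trues-≤ V h) (ℕ.m≤n+m _ _)
... | true rewrite h v eq = s≤s (trues-≤ V h)

trues-< : ∀ {e f : Pos → Bool} {V v} → (∀ v → e v ≡ true → f v ≡ true) → v ∈ V → e v ≡ false → f v ≡ true →
  trues e V < trues f V
trues-< {e} {f} {v ∷ V} h (here refl) eq eq′ rewrite eq | eq′ = s≤s (trues-≤ V h)
trues-< {e} {f} {w ∷ V} h (there m) eq eq′ with e w in eqw
... | false = ℕ.≤-trans (trues-< h m eq eq′) (ℕ.m≤n+m _ _)
... | true rewrite h w eqw = s≤s (trues-< h m eq eq′)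

-- Between two leaves a tensor can always be contracted, and so can a par inside one block; what
-- blocks contraction is a par between different blocks.
data Stuck (rep : Pos → Pos) : Tree → Set where
  leaf : ∀ {p} → Stuck rep (leaf p)
  node : ∀ {k p t u} → Stuck rep t → Stuck rep u →
         (∀ {x y} → t ≡ leaf x → u ≡ leaf y → k ≡ parr × rep x ≢ rep y) → Stuck rep (node k p t u)

data _⊑_ (s : Tree) : Tree → Set where
  here : s ⊑ s
  inˡ  : ∀ {k p t u} → s ⊑ t → s ⊑ node k p t u
  inʳ  : ∀ {k p t u} → s ⊑ u → s ⊑ node k p t u

⊑-left : ∀ {k p t u v} → node k p t u ⊑ v → t ⊑ v
⊑-left here = inˡ here
⊑-left (inˡ m) = inˡ (⊑-left m)
⊑-left (inʳ m) = inʳ (⊑-left m)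

⊑-right : ∀ {k p t u v} → node k p t u ⊑ v → u ⊑ v
⊑-right here = inʳ here
⊑-right (inˡ m) = inˡ (⊑-right m)
⊑-right (inʳ m) = inʳ (⊑-right m)

⊑-link : ∀ {k p t u v} → node k p t u ⊑ v → connective k (root t) (root u) p ∈ treeLinks v
⊑-link here = here refl
⊑-link (inˡ m) = there (∈-++⁺ˡ (⊑-link m))
⊑-link (inʳ {t = t} m) = there (∈-++⁺ʳ (treeLinks t) (⊑-link m))

link-⊑ : ∀ v {l} → l ∈ treeLinks v → ∃[ k ] ∃[ p ] ∃[ t ] ∃[ u ] node k p t u ⊑ v × l ≡ connective k (root t)
  (root u) p
link-⊑ (node k p t u) (here refl) = k , p , t , u , here , refl
link-⊑ (node k p t u) (there m) with ∈-++⁻ (treeLinks t) m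
... | inj₁ m′ with _ , _ , _ , _ , s , eq ← link-⊑ t m′ = _ , _ , _ , _ , inˡ s , eq
... | inj₂ m′ with _ , _ , _ , _ , s , eq ← link-⊑ u m′ = _ , _ , _ , _ , inʳ s , eq

⊑-unique : ∀ {s v} → s ⊑ v → Unique (occurrences v) → Unique (occurrences s)
⊑-unique here u = u
⊑-unique (inˡ {k} {p} {t} {u} m) w = ⊑-unique m (proj₁ (unique-children {k} {p} {t} {u} w))
⊑-unique (inʳ {k} {p} {t} {u} m) w = ⊑-unique m (proj₂ (unique-children {k} {p} {t} {u} w))

⊑-stuck : ∀ {rep s v} → s ⊑ v → Stuck rep v → Stuck rep s
⊑-stuck here x = x
⊑-stuck (inˡ m) (node x _ _) = ⊑-stuck m x
⊑-stuck (inʳ m) (node _ y _) = ⊑-stuck m y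

-- Blocks of positions already joined together are represented by the points
-- rep x; the nodes V of the graphs below are these points and the outputs of the
-- connective links.
record Situation : Set₁ where
  field
    ts        : List Tree
    unique    : Unique (forestOccurrences ts)
    rep       : Pos → Pos
    V         : List Pos
    V-unique  : Unique V
    rep-fixed : ∀ {k a b p} → connective k a b p ∈ forestLinks ts → rep p ≡ p
    rep-leaf  : ∀ {k a b p x} → connective k a b p ∈ forestLinks ts → x ∈ forestLeaves ts → p ≢ rep x
    output∈V  : ∀ {k a b p} → connective k a b p ∈ forestLinks ts → p ∈ V
    rep∈V     : ∀ {x} → x ∈ forestLeaves ts → rep x ∈ V
    connected : ∀ σ (e : Pos → Bool) → (∀ {s c} → (s , c) ∈ graphEdges σ (forestLinks ts) → e s ≡ e (rep c)) →
                ∀ {x y} → x ∈ V → y ∈ V → e x ≡ e y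
    count     : ∀ σ → length V ≡ suc (length (graphEdges σ (forestLinks ts)))

-- A stuck forest has no connective.

module Progress (𝒮 : Situation) where

  open Situation 𝒮

  L : List Link
  L = forestLinks ts

  E : (Pos → Side) → List Edge
  E σ = graphEdges σ L

  Within : Tree → Set
  Within s = ∃[ v ] v ∈ ts × s ⊑ v

  within-left : ∀ {k p t u} → Within (node k p t u) → Within t
  within-left (v , v∈ , m) = v , v∈ , ⊑-left m

  within-right : ∀ {k p t u} → Within (node k p t u) → Within u
  within-right (v , v∈ , m) = v , v∈ , ⊑-right m

  within-link : ∀ {k p t u} → Within (node k p t u) → connective k (root t) (root u) p ∈ L
  within-link (v , v∈ , m) = forest-⊆ v∈ (⊑-link m)

  link-within : ∀ {l} → l ∈ L → ∃[ k ] ∃[ p ] ∃[ t ] ∃[ u ] Within (node k p t u) × l ≡ connective k (root t)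
    (root u) p
  link-within m with as , v , cs , eq , m′ ← locate-forest ts m with k , p , t , u , s , eq′ ← link-⊑ v m′ =
    k , p , t , u , (v , subst (v ∈_) (sym eq) (∈-++⁺ʳ as (here refl)) , s) , eq′

  within-leaf : ∀ {x} → Within (leaf x) → x ∈ forestLeaves ts
  within-leaf (v , v∈ , m) = forestLeaves-⊆ v∈ (go m)
    where
    go : ∀ {x v} → leaf x ⊑ v → x ∈ leaves v
    go here = here refl
    go (inˡ m) = ∈-++⁺ˡ (go m)
    go (inʳ {t = t} m) = ∈-++⁺ʳ (leaves t) (go m)

  within-rep∈V : ∀ {t} → Within t → rep (root t) ∈ V
  within-rep∈V {leaf x} w = rep∈V (within-leaf w)
  within-rep∈V {node k p t u} w = subst (_∈ V) (sym (rep-fixed (within-link w))) (output∈V (within-link w))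

  children-distinct : ∀ {k p t u} → Within (node k p t u) → root t ≢ root u
  children-distinct {k} {p} {t} {u} (v , v∈ , m) eq =
    unique-sibling {t} {u} (⊑-unique m (unique-tree v∈ unique)) (root∈ t)
      (subst (_∈ occurrences u) (sym eq) (root∈ u))

  targets-unique : Unique (targets L)
  targets-unique = proj₁ (Unique-++⁻ (targets L) (Unique-resp-↭ (↭-sym (forestOccurrences-↭ ts)) unique))

  same-link : ∀ k k′ {a b a′ b′ p} → connective k a b p ∈ L → connective k′ a′ b′ p ∈ L →
    k ≡ k′ × a ≡ a′ × b ≡ b′
  same-link tensor tensor m m′ with refl ← target-injective targets-unique m m′ (here refl)
    (here refl) = refl , refl , refl
  same-link parr parr m m′ with refl ← target-injective targets-unique m m′ (here refl) (here refl) = refl ,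
    refl , refl
  same-link tensor parr m m′ = case target-injective targets-unique m m′ (here refl) (here refl) of λ ()
  same-link parr tensor m m′ = case target-injective targets-unique m m′ (here refl) (here refl) of λ ()

  data EdgeOf (σ : Pos → Side) (s c : Pos) : Set where
    tenˡ : ∀ {t u} → Within (node tensor s t u) → c ≡ root t → EdgeOf σ s c
    tenʳ : ∀ {t u} → Within (node tensor s t u) → c ≡ root u → EdgeOf σ s c
    par  : ∀ {t u} → Within (node parr s t u) → c ≡ pick (σ s) (root t) (root u) → EdgeOf σ s c

  edge-of : ∀ σ {s c} → (s , c) ∈ E σ → EdgeOf σ s c
  edge-of σ m with l , l∈ , g∈ ← ∈-graphEdges⁻ σ L m = go l∈ g∈
    where
    go : ∀ {l s c} → l ∈ L → (s , c) ∈ linkEdges σ l → EdgeOf σ s c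
    go l∈ g∈ with link-within l∈
    go l∈ (here refl) | tensor , _ , _ , _ , w , refl = tenˡ w refl
    go l∈ (there (here refl)) | tensor , _ , _ , _ , w , refl = tenʳ w refl
    go l∈ (here refl) | parr , _ , _ , _ , w , refl = par w refl

  edge-tenˡ : ∀ σ {p t u} → Within (node tensor p t u) → (p , root t) ∈ E σ
  edge-tenˡ σ w = ∈-graphEdges⁺ σ (within-link w) (here refl)

  edge-tenʳ : ∀ σ {p t u} → Within (node tensor p t u) → (p , root u) ∈ E σ
  edge-tenʳ σ w = ∈-graphEdges⁺ σ (within-link w) (there (here refl))

  edge-par : ∀ σ {p t u} → Within (node parr p t u) → (p , pick (σ p) (root t) (root u)) ∈ E σ
  edge-par σ w = ∈-graphEdges⁺ σ (within-link w) (here refl)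

  par-edge-unique : ∀ σ {p t u c} → Within (node parr p t u) → (p , c) ∈ E σ → c ≡ pick (σ p) (root t) (root u)
  par-edge-unique σ w m with edge-of σ m
  ... | tenˡ w′ _ with () , _ ← same-link parr tensor (within-link w) (within-link w′)
  ... | tenʳ w′ _ with () , _ ← same-link parr tensor (within-link w) (within-link w′)
  ... | par w′ refl with _ , e₁ , e₂ ← same-link parr parr (within-link w) (within-link w′) =
    sym (cong₂ (pick (σ _)) e₁ e₂)

  base∈V : ∀ σ {s c} → (s , c) ∈ E σ → s ∈ V
  base∈V σ m with edge-of σ m
  ... | tenˡ w _ = output∈V (within-link w)
  ... | tenʳ w _ = output∈V (within-link w)
  ... | par w _ = output∈V (within-link w)

  end∈V : ∀ σ {s c} → (s , c) ∈ E σ → rep c ∈ V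
  end∈V σ {s} m with edge-of σ m
  ... | tenˡ w refl = within-rep∈V (within-left w)
  ... | tenʳ w refl = within-rep∈V (within-right w)
  ... | par w refl with σ s
  ...   | left  = within-rep∈V (within-left w)
  ...   | right = within-rep∈V (within-right w)

  RespectsBut : (Pos → Side) → Edge → (Pos → Bool) → Set
  RespectsBut σ g e = ∀ {s c} → (s , c) ∈ E σ → (s , c) ≢ g → e s ≡ e (rep c)

  -- Each switching gives a tree. Without the edge there are two vertices more than edges, so some
  -- non-constant colouring respects all the others; by connectedness it must change along the
  -- removed edge.
  edge-cut : ∀ σ {s c} → (s , c) ∈ E σ → Σ[ e ∈ (Pos → Bool) ] RespectsBut σ (s , c) e × e s ≢ e (rep c)
  edge-cut σ {s} {c} m
    with es , ρ ← ∈⇒↭ m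
    with e , h , x , y , x∈ , y∈ , d ← separate _ V (map (λ (s , c) → s , rep c) es) refl V-unique
           (ℕ.≤-reflexive (trans (cong (2 +_) (length-map _ es)) (trans (cong (1 +_) (sym (↭-length ρ)))
             (sym (count σ))))) =
    e , respects , λ eq → d (connected σ e (λ {s′} {c′} → all eq) x∈ y∈)
    where
    respects : RespectsBut σ (s , c) e
    respects m′ ne with ∈-resp-↭ ρ m′
    ... | here eq = ⊥-elim (ne eq)
    ... | there m″ = h (∈-map⁺ _ m″)
    all : e s ≡ e (rep c) → ∀ {s′ c′} → (s′ , c′) ∈ E σ → e s′ ≡ e (rep c′)
    all eq m′ with ∈-resp-↭ ρ m′
    ... | here refl = eq
    ... | there m″ = h (∈-map⁺ _ m″)

  -- Two premises in one block would close a cycle of length two with the edges of the tensor: after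
  -- removing one edge, the other still joins its ends.
  tensor-distinct : ∀ {a b p} → ten a b p ∈ L → a ≢ b → rep a ≢ rep b
  tensor-distinct {a} {b} {p} m ne eq with e , h , d ← edge-cut (λ _ → left)
    (∈-graphEdges⁺ (λ _ → left) m (here refl)) =
    d (trans (h (∈-graphEdges⁺ (λ _ → left) m (there (here refl))) (λ { refl → ne refl })) (cong e (sym eq)))

  -- e isolates the component of the chosen premise of the par link p from p.
  record ParCut (σ : Pos → Side) (p : Pos) (e : Pos → Bool) : Set where
    field
      {left-premise right-premise} : Tree
      within   : Within (node parr p left-premise right-premise)
      respects : ∀ {s c} → (s , c) ∈ E σ → s ≢ p → e s ≡ e (rep c)
      output   : e p ≡ false
      premise  : e (rep (pick (σ p) (root left-premise) (root right-premise))) ≡ true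

  module _ (stuck : ∀ {t} → t ∈ ts → Stuck rep t) where

    stuck-within : ∀ {t} → Within t → Stuck rep t
    stuck-within (v , v∈ , m) = ⊑-stuck m (stuck v∈)

    no-top-tensor : ∀ {p t u} → Within (node tensor p t u) → ∃[ x ] t ≡ leaf x → ∃[ y ] u ≡ leaf y → ⊥
    no-top-tensor w (_ , refl) (_ , refl) with node _ _ h ← stuck-within w with () , _ ← h refl refl

    -- A component C cut off at p, seen from its point r next to p, and such that
    -- no smaller component avoiding r is cut off at a par link.
    module Rooted (σ : Pos → Side) (p : Pos) (C : Pos → Bool) (r : Pos)
                  (r∈V : r ∈ V)
                  (C-respects : ∀ {s c} → (s , c) ∈ E σ → s ≢ p → C s ≡ C (rep c))
                  (C-p : C p ≡ false) (C-r : C r ≡ true)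
                  (r-edge : ∀ {c} → (p , c) ∈ E σ → rep c ≡ r)
                  (minimal : ∀ {q R} → ParCut σ q R → (∀ v → R v ≡ true → C v ≡ true) → R r ≡ false → ⊥) where

      -- `R` is the part of `C` separated from `r` by the edge `(s , c)`, the only edge on its
      -- border. If `R s` holds, the edge leads from `s` towards `r`; otherwise it leads away from
      -- `r`.
      record CutAt (s c : Pos) : Set where
        field
          R       : Pos → Bool
          but     : RespectsBut σ (s , c) R
          differ  : R s ≢ R (rep c)
          inside  : ∀ v → R v ≡ true → C v ≡ true
          root-∉  : R r ≡ false

      open CutAt

      cut-at : ∀ {s c} → (s , c) ∈ E σ → C s ≡ true → CutAt s c
      cut-at {s} {c} m Cs with e , h , d ← edge-cut σ m = record
        { R      = R′
        ; but    = but′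
        ; differ = λ eq → d (xor-injective (trans (sym (on s Cs)) (trans eq
            (on (rep c) (trans (sym (C-respects m s≢p)) Cs)))))
        ; inside = λ v eq → ∧-true (C v) eq
        ; root-∉ = root-false
        }
        where
        -- The exclusive or with `e r` selects the side of the removed edge that does not contain
        -- `r`, and the conjunction keeps it inside `C`. An edge at `p` does not reach it, since
        -- such an edge ends at `r`.
        R′ : Pos → Bool
        R′ v = C v ∧ (e v xor e r)
        s≢p : s ≢ p
        s≢p refl = true≢false Cs C-p
        on : ∀ v → C v ≡ true → R′ v ≡ e v xor e r
        on v eq rewrite eq = refl
        ∧-true : ∀ b {c} → b ∧ c ≡ true → b ≡ true
        ∧-true true _ = refl
        xor-injective : ∀ {b c d} → b xor d ≡ c xor d → b ≡ c
        xor-injective {true} {true} _ = refl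
        xor-injective {false} {false} _ = refl
        xor-injective {true} {false} {true} ()
        xor-injective {true} {false} {false} ()
        xor-injective {false} {true} {true} ()
        xor-injective {false} {true} {false} ()
        root-false : R′ r ≡ false
        root-false = trans (on r C-r) (Bool.xor-same (e r))
        but′ : RespectsBut σ (s , c) R′
        but′ {s′} {c′} m′ ne with s′ ≟ p
        ... | no ne′ = cong₂ (λ a b → a ∧ (b xor e r)) (C-respects m′ ne′) (h m′ ne)
        ... | yes refl = trans (cong (_∧ (e p xor e r)) C-p) (sym (trans (cong R′ (r-edge m′)) root-false))

      -- Two edges at a node cannot both lead from it towards r.
      one-way : ∀ {s c s′ c′ w} (G : CutAt s c) (K : CutAt s′ c′) → (s , c) ∈ E σ → (s′ , c′) ∈ E σ → (s , c) ≢
        (s′ , c′) →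
                w ≡ s ⊎ w ≡ rep c → w ≡ s′ ⊎ w ≡ rep c′ → R G w ≡ true → R K w ≡ true → ⊥
      one-way {s} {c} {s′} {c′} {w} G K m m′ ne on on′ Gw Kw =
        true≢false (trans (sym (connected σ U U-respects w∈V r∈V)) (cong₂ _∨_ Gw Kw))
          (cong₂ _∨_ (root-∉ G) (root-∉ K))
        where
        -- The union of the two sides has no border: each of the two border edges passes through
        -- `w`, lies inside the other side, and so has both ends in the union. But `w` is in it and
        -- `r` is not.
        U : Pos → Bool
        U v = R G v ∨ R K v
        w∈V : w ∈ V
        w∈V = [ (λ { refl → base∈V σ m }) , (λ { refl → end∈V σ m }) ]′ on
        both-ends : ∀ {s c} (X : Pos → Bool) → X s ≡ X (rep c) → w ≡ s ⊎ w ≡ rep c → X w ≡ true →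
          X s ≡ true × X (rep c) ≡ true
        both-ends X eq (inj₁ refl) t = t , trans (sym eq) t
        both-ends X eq (inj₂ refl) t = trans eq t , t
        U-respects : ∀ {a b} → (a , b) ∈ E σ → U a ≡ U (rep b)
        U-respects {a} {b} m″ with ≡-dec _≟_ _≟_ (a , b) (s , c) | ≡-dec _≟_ _≟_ (a , b) (s′ , c′)
        ... | no n | no n′ = cong₂ _∨_ (but G m″ n) (but K m″ n′)
        ... | yes refl | _ with x , y ← both-ends (R K) (but K m ne) on Kw =
          trans (cong (R G s ∨_) x) (trans (Bool.∨-zeroʳ (R G s)) (sym
            (trans (cong (R G (rep c) ∨_) y) (Bool.∨-zeroʳ _))))
        ... | no _ | yes refl with x , y ← both-ends (R G) (but G m′ (ne ∘ sym)) on′ Gw =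
          trans (cong (_∨ R K s′) x) (sym (cong (_∨ R K (rep c′)) y))

      -- Otherwise the premise selected at `q` would have its component cut off at `q`, inside `C`
      -- and avoiding `r`, against minimality. Hence the selected edge of a par in `C` leads towards
      -- `r`.
      par-rootward : ∀ {q t u c} → Within (node parr q t u) → (q , c) ∈ E σ → (G : CutAt q c) → R G q ≡ true
      par-rootward {q} {t} {u} {c} w m G with R G q in eq
      ... | true = refl
      ... | false = ⊥-elim (minimal {R = R G} record
        { within   = w
        ; respects = λ m ne → but G m (ne ∘ cong proj₁)
        ; output   = eq
        ; premise  = trans (cong (R G ∘ rep) (sym (par-edge-unique σ w m))) (other (differ G) eq)
        } (inside G) (root-∉ G))
        where
        other : ∀ {a b} → a ≢ b → a ≡ false → b ≡ true
        other {false} {true} _ _ = refl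
        other {false} {false} ne _ = ⊥-elim (ne refl)

      other-true : ∀ {s c} (G : CutAt s c) → R G s ≡ false → R G (rep c) ≡ true
      other-true {s} {c} G eq with R G (rep c) in eq′
      ... | true = refl
      ... | false = ⊥-elim (differ G (trans eq (sym eq′)))

      -- Suppose an edge leads away from `r` to a connective `q`, so that it leads from `q` towards
      -- `r`. If `q` is a par, its own selected edge does so too, and there cannot be two. If `q` is
      -- a tensor, both its edges lead further away, so by induction both premises are leaves and
      -- the tensor would be contractible.
      away-leaf : ∀ t {s} → Within t → (s , root t) ∈ E σ → (G : CutAt s (root t)) → R G
        (rep (root t)) ≡ true → ∃[ x ] t ≡ leaf x
      away-leaf (leaf x) _ _ _ _ = x , refl
      away-leaf (node parr q t u) {s} w m G eq = ⊥-elim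
        (one-way G K m mK (λ e → differ G (cong (R G) (trans (cong proj₁ e) (sym fixed)))) (inj₂ (sym fixed))
          (inj₁ refl) Gq (par-rootward w mK K))
        where
        fixed : rep q ≡ q
        fixed = rep-fixed (within-link w)
        Gq : R G q ≡ true
        Gq = trans (cong (R G) (sym fixed)) eq
        mK = edge-par σ w
        K = cut-at mK (inside G q Gq)
      away-leaf (node tensor q t u) {s} w m G eq = ⊥-elim (no-top-tensor w
        (away-leaf t (within-left w) (edge-tenˡ σ w) (cut-at (edge-tenˡ σ w) (inside G q Gq))
          (away (edge-tenˡ σ w)))
        (away-leaf u (within-right w) (edge-tenʳ σ w) (cut-at (edge-tenʳ σ w) (inside G q Gq))
          (away (edge-tenʳ σ w))))
        where
        fixed : rep q ≡ q
        fixed = rep-fixed (within-link w)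
        Gq : R G q ≡ true
        Gq = trans (cong (R G) (sym fixed)) eq
        away : ∀ {c} (mK : (q , c) ∈ E σ) → R (cut-at mK (inside G q Gq)) (rep c) ≡ true
        away mK = other-true K (¬true⇒false λ Kq →
            one-way G K m mK (λ e → differ G (cong (R G) (trans (cong proj₁ e) (sym fixed))))
              (inj₂ (sym fixed)) (inj₁ refl) Gq Kq)
          where K = cut-at mK (inside G q Gq)

      -- The same dichotomy at `r` itself: no edge leads from `r` towards `r`, which excludes a par,
      -- and both edges of a tensor would lead away.
      root-leaf : ∀ t → Within t → rep (root t) ≡ r → ∃[ x ] t ≡ leaf x
      root-leaf (leaf x) _ _ = x , refl
      root-leaf (node parr q t u) w eq = ⊥-elim (true≢false (par-rootward w (edge-par σ w) K)
        (trans (cong (R K) q≡r) (root-∉ K)))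
        where
        q≡r : q ≡ r
        q≡r = trans (sym (rep-fixed (within-link w))) eq
        K = cut-at (edge-par σ w) (trans (cong C q≡r) C-r)
      root-leaf (node tensor q t u) w eq = ⊥-elim (no-top-tensor w
          (away-leaf t (within-left w) (edge-tenˡ σ w) (cut-at (edge-tenˡ σ w) Cq) (away (edge-tenˡ σ w)))
          (away-leaf u (within-right w) (edge-tenʳ σ w) (cut-at (edge-tenʳ σ w) Cq) (away (edge-tenʳ σ w))))
        where
        q≡r : q ≡ r
        q≡r = trans (sym (rep-fixed (within-link w))) eq
        Cq : C q ≡ true
        Cq = trans (cong C q≡r) C-r
        away : ∀ {c} (mK : (q , c) ∈ E σ) → R (cut-at mK Cq) (rep c) ≡ true
        away mK = other-true (cut-at mK Cq) (trans (cong (R (cut-at mK Cq)) q≡r) (root-∉ (cut-at mK Cq)))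

      -- Only one edge at `s` can lead towards `r`, and `m` already does. The edge to the other
      -- premise leads away, so that premise is a leaf.
      sibling-leaf : ∀ {s t u c} → Within (node tensor s t u) → (m : (s , c) ∈ E σ) (G : CutAt s c) →
        R G s ≡ true →
                     ∀ v → Within v → (s , root v) ∈ E σ → root v ≢ c → ∃[ x ] v ≡ leaf x
      sibling-leaf {s} w m G Gs v wv mK ne = away-leaf v wv mK K (other-true K (¬true⇒false λ Ks →
          one-way G K m mK (λ e → ne (sym (cong proj₂ e))) (inj₁ refl) (inj₁ refl) Gs Ks))
        where K = cut-at mK (inside G s Gs)

    flip : (Pos → Side) → Pos → Pos → Side
    flip σ p s = if does (s ≟ p) then opposite (σ s) else σ s

    flip-≡ : ∀ σ p → flip σ p p ≡ opposite (σ p)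
    flip-≡ σ p rewrite dec-true (p ≟ p) refl = refl

    flip-≢ : ∀ σ {p s} → s ≢ p → flip σ p s ≡ σ s
    flip-≢ σ {p} {s} ne rewrite dec-false (s ≟ p) ne = refl

    transfer : ∀ {σ σ′ s c} → σ s ≡ σ′ s → (s , c) ∈ E σ → (s , c) ∈ E σ′
    transfer {σ} {σ′} eq m with l , l∈ , g∈ ← ∈-graphEdges⁻ σ L m = ∈-graphEdges⁺ σ′ l∈ (go l g∈)
      where
      go : ∀ l → _ ∈ linkEdges σ l → _ ∈ linkEdges σ′ l
      go (ten _ _ _) g∈ = g∈
      go (par a b _) (here refl) = here (cong (λ z → _ , pick z a b) eq)

    pick-root : ∀ s t u → pick s (root t) (root u) ≡ root (pick s t u)
    pick-root left t u  = refl
    pick-root right t u = refl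

    within-pick : ∀ s {k p t u} → Within (node k p t u) → Within (pick s t u)
    within-pick left  w = within-left w
    within-pick right w = within-right w

    -- A component C cut off at a par link p contains the points above both premises
    -- of p, for every switching of p.  Comparing the two gives a smaller component,
    -- or a path in C from one premise to the other that no edge can start.
    no-cut : ∀ n σ p C → ParCut σ p C → trues C V < n → ⊥
    no-cut (suc n) σ p C κ lt = A-leaf (A.root-leaf tx (within-pick (σ p) within) refl)
      (B.root-leaf ty (within-pick (opposite (σ p)) within) refl)
      where
      open ParCut κ renaming (left-premise to ta; right-premise to tb)
      σ′ = flip σ p
      tx = pick (σ p) ta tb
      ty = pick (opposite (σ p)) ta tb
      r  = rep (root tx)
      r′ = rep (root ty)

      p∈V : p ∈ V
      p∈V = output∈V (within-link within)
      r∈V : r ∈ V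
      r∈V = within-rep∈V (within-pick (σ p) within)
      r′∈V : r′ ∈ V
      r′∈V = within-rep∈V (within-pick (opposite (σ p)) within)

      C-r : C r ≡ true
      C-r = trans (cong (C ∘ rep) (sym (pick-root (σ p) ta tb))) premise

      back : ∀ {s c} → s ≢ p → (s , c) ∈ E σ′ → (s , c) ∈ E σ
      back ne = transfer (flip-≢ σ ne)
      forth : ∀ {s c} → s ≢ p → (s , c) ∈ E σ → (s , c) ∈ E σ′
      forth ne = transfer (sym (flip-≢ σ ne))

      r-edge : ∀ {c} → (p , c) ∈ E σ → rep c ≡ r
      r-edge m = cong rep (trans (par-edge-unique σ within m) (pick-root (σ p) ta tb))
      r′-edge : ∀ {c} → (p , c) ∈ E σ′ → rep c ≡ r′
      r′-edge m = cong rep (trans (par-edge-unique σ′ within m) (trans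
        (cong (λ z → pick z (root ta) (root tb)) (flip-≡ σ p)) (pick-root (opposite (σ p)) ta tb)))

      -- If `r′` were outside `C`, the border of `C` would carry no edge of the flipped switching,
      -- although `r` is in `C` and `p` is not.
      C-r′ : C r′ ≡ true
      C-r′ with C r′ in eq
      ... | true = refl
      ... | false = ⊥-elim (true≢false C-r (trans (connected σ′ C respects′ r∈V p∈V) output))
        where
        respects′ : ∀ {s c} → (s , c) ∈ E σ′ → C s ≡ C (rep c)
        respects′ {s} m with s ≟ p
        ... | no ne = respects (back ne m) ne
        ... | yes refl = trans output (sym (trans (cong C (r′-edge m)) eq))

      -- Minimality is the induction hypothesis: a component inside `C` that avoids the root has
      -- strictly fewer nodes. The same `C` is used with root `r` for the given switching and with
      -- root `r′` for the flipped one.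
      module A = Rooted σ p C r r∈V respects output C-r r-edge
        (λ {q} {R} k inside root → no-cut n σ q R k (ℕ.≤-trans (trues-< inside r∈V root C-r) (ℕ.≤-pred lt)))
      module B = Rooted σ′ p C r′ r′∈V (λ m ne → respects (back ne m) ne) output C-r′ r′-edge
        (λ {q} {R} k inside root → no-cut n σ′ q R k (ℕ.≤-trans (trues-< inside r′∈V root C-r′) (ℕ.≤-pred lt)))

      -- The edge would begin a path in `C` from `r` to `r′`. Seen from `r′` it must lead away from
      -- `r′`, otherwise its two sides can be subtracted to disconnect the graph. A par at `s` is
      -- impossible, since its selected edge leads towards `r′`. A tensor would have two leaves as
      -- premises: `c` because the edge leads away from `r′`, the other because this edge already
      -- leads from `s` towards `r`.
      incident : ∀ {s c} → (s , c) ∈ E σ → s ≢ p → rep c ≡ r → (G : A.CutAt s c) → A.CutAt.R G r′ ≡ true → ⊥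
      incident {s} {c} m ne c≡r G Gr′ = go H refl
        where
        open A.CutAt G
        Rc : R (rep c) ≡ false
        Rc = trans (cong R c≡r) root-∉
        Rs : R s ≡ true
        Rs with R s in eq
        ... | true = refl
        ... | false = ⊥-elim (differ (trans eq (sym Rc)))
        Cs : C s ≡ true
        Cs = inside s Rs
        m′ = forth ne m
        H : B.CutAt s c
        H = B.cut-at m′ Cs

        go : (H : B.CutAt s c) → ∀ {b} → B.CutAt.R H s ≡ b → ⊥
        go H {true} eq = true≢false D-r′ (trans (connected σ D D-respects r′∈V r∈V)
          (cong (_∧ not (H.R r)) root-∉))
          where
          module H = B.CutAt H
          -- What lies beyond the edge from `r` but not beyond it from `r′`. The common border edge
          -- has both ends outside `D`, so `D` has no border, yet it contains `r′` and not `r`.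
          D : Pos → Bool
          D v = R v ∧ not (H.R v)
          D-r′ : D r′ ≡ true
          D-r′ = cong₂ (λ a b → a ∧ not b) Gr′ H.root-∉
          R-p : R p ≡ false
          R-p = ¬true⇒false λ t → true≢false (inside p t) output
          D-respects : ∀ {a b} → (a , b) ∈ E σ → D a ≡ D (rep b)
          D-respects {a} {b} k with a ≟ p
          ... | yes refl = trans (cong (_∧ not (H.R p)) R-p)
            (sym (trans (cong D (r-edge k)) (cong (_∧ not (H.R r)) root-∉)))
          ... | no ne′ with ≡-dec _≟_ _≟_ (a , b) (s , c)
          ...   | no d = cong₂ (λ x y → x ∧ not y) (but k d) (H.but (forth ne′ k) d)
          ...   | yes refl = trans (cong (λ z → R s ∧ not z) eq) (trans (Bool.∧-zeroʳ (R s))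
            (sym (cong (_∧ not (H.R (rep c))) Rc)))
        go H {false} eq with edge-of σ m
        ... | par w refl = true≢false (B.par-rootward w m′ H) eq
        ... | tenˡ {t} {u} w refl = no-top-tensor w (B.away-leaf t (within-left w) m′ H (B.other-true H eq))
              (A.sibling-leaf w m G Rs u (within-right w) (edge-tenʳ σ w) (children-distinct w ∘ sym))
        ... | tenʳ {t} {u} w refl = no-top-tensor w (A.sibling-leaf w m G Rs t (within-left w) (edge-tenˡ σ w)
            (children-distinct w))
              (B.away-leaf u (within-right w) m′ H (B.other-true H eq))

      A-leaf : ∃[ x ] tx ≡ leaf x → ∃[ y ] ty ≡ leaf y → ⊥
      A-leaf (x , ex) (y , ey) = true≢false D-r′ (trans (connected σ D D-respects r′∈V r∈V) D-r)
        where
        r≡ : r ≡ rep x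
        r≡ = cong (rep ∘ root) ex
        r′≡ : r′ ≡ rep y
        r′≡ = cong (rep ∘ root) ey

        distinct : ∀ s → pick s ta tb ≡ leaf x → pick (opposite s) ta tb ≡ leaf y → rep x ≢ rep y
        distinct s e₁ e₂ with node _ _ h ← stuck-within within with s
        ... | left  = proj₂ (h e₁ e₂)
        ... | right = proj₂ (h e₂ e₁) ∘ sym

        r′≢r : r′ ≢ r
        r′≢r eq = distinct (σ p) ex ey (trans (sym r≡) (trans (sym eq) r′≡))

        -- The point `r` represents a block and is not the output of a connective, so an edge can
        -- only meet `r` at its far end.
        base≢r : ∀ {s c} → (s , c) ∈ E σ → s ≢ r
        base≢r m eq with l , l∈ , g∈ ← ∈-graphEdges⁻ σ L m with link-within l∈ | edge-of σ m
        ... | _ | tenˡ w _ = rep-leaf {tensor} (within-link w) x∈ (trans eq r≡)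
          where x∈ = within-leaf (subst Within ex (within-pick (σ p) within))
        ... | _ | tenʳ w _ = rep-leaf {tensor} (within-link w) x∈ (trans eq r≡)
          where x∈ = within-leaf (subst Within ex (within-pick (σ p) within))
        ... | _ | par w _ = rep-leaf {parr} (within-link w) x∈ (trans eq r≡)
          where x∈ = within-leaf (subst Within ex (within-pick (σ p) within))

        -- The union of {r} and of the components hanging from r inside C.
        record Hanging (es : List Edge) : Set where
          field
            Z      : Pos → Bool
            Z-r    : Z r ≡ true
            Z-r′   : Z r′ ≡ false
            beside : ∀ {s c} → (s , c) ∈ E σ → s ≢ p → rep c ≢ r → Z s ≡ Z (rep c)
            at-r   : ∀ {s c} → (s , c) ∈ es → s ≢ p → rep c ≡ r → Z s ≡ true

        hanging : ∀ es → (∀ {g} → g ∈ es → g ∈ E σ) → Hanging es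
        hanging [] _ = record
          { Z      = λ v → does (v ≟ r)
          ; Z-r    = dec-true (r ≟ r) refl
          ; Z-r′   = dec-false (r′ ≟ r) r′≢r
          ; beside = λ {s} {c} m _ ne → trans (dec-false (s ≟ r) (base≢r m)) (sym (dec-false (rep c ≟ r) ne))
          ; at-r   = λ ()
          }
        hanging ((s , c) ∷ es) sub with hanging es (sub ∘ there) | s ≟ p | rep c ≟ r
        ... | Y | yes eq | _ = record
          { Z = Y.Z ; Z-r = Y.Z-r ; Z-r′ = Y.Z-r′ ; beside = Y.beside
          ; at-r = λ { (here refl) ne _ → ⊥-elim (ne eq) ; (there m) → Y.at-r m } }
          where module Y = Hanging Y
        ... | Y | no _ | no ne = record
          { Z = Y.Z ; Z-r = Y.Z-r ; Z-r′ = Y.Z-r′ ; beside = Y.beside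
          ; at-r = λ { (here refl) _ eq → ⊥-elim (ne eq) ; (there m) → Y.at-r m } }
          where module Y = Hanging Y
        ... | Y | no s≢p | yes c≡r = record
          { Z      = λ v → Y.Z v ∨ R v
          ; Z-r    = cong (_∨ R r) Y.Z-r
          ; Z-r′   = cong₂ _∨_ Y.Z-r′ (¬true⇒false (incident m s≢p c≡r G))
          ; beside = λ k ne ne′ → cong₂ _∨_ (Y.beside k ne ne′) (but k λ { refl → ne′ c≡r })
          ; at-r   = λ { (here refl) _ _ → trans (cong (Y.Z s ∨_) Rs) (Bool.∨-zeroʳ _)
                       ; (there k) ne eq → cong (_∨ R _) (Y.at-r k ne eq) }
          }
          where
          module Y = Hanging Y
          m = sub (here refl)
          G = A.cut-at m (trans (respects m s≢p) (trans (cong C c≡r) C-r))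
          open A.CutAt G
          Rs : R s ≡ true
          Rs with R s in eq
          ... | true = refl
          ... | false = ⊥-elim (differ (trans eq (sym (trans (cong R c≡r) root-∉))))

        open Hanging (hanging (E σ) id)

        -- What remains of `C` after removing `r` and everything hanging from it. No edge is on the
        -- border of `D`, yet it contains `r′` and not `r`.
        D : Pos → Bool
        D v = C v ∧ not (Z v)
        D-r′ : D r′ ≡ true
        D-r′ = cong₂ (λ a b → a ∧ not b) C-r′ Z-r′
        D-r : D r ≡ false
        D-r = cong₂ (λ a b → a ∧ not b) C-r Z-r
        D-respects : ∀ {s c} → (s , c) ∈ E σ → D s ≡ D (rep c)
        D-respects {s} {c} m with s ≟ p | rep c ≟ r
        ... | yes refl | _ = trans (cong (_∧ not (Z p)) output) (sym (trans (cong D (r-edge m)) D-r))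
        ... | no ne | yes eq = trans (trans (cong (λ z → C s ∧ not z) (at-r m ne eq)) (Bool.∧-zeroʳ (C s)))
            (sym (trans (cong D eq) D-r))
        ... | no ne | no ne′ = cong₂ (λ a b → a ∧ not b) (respects m ne) (beside m ne ne′)

    top-par : ∀ {k p t u} → Stuck rep (node k p t u) → ∃[ q ] ∃[ x ] ∃[ y ] node parr q (leaf x)
      (leaf y) ⊑ node k p t u
    top-par {t = node _ _ _ _} (node x _ _) with q , a , b , m ← top-par x = q , a , b , inˡ m
    top-par {t = leaf _} {node _ _ _ _} (node _ y _) with q , a , b , m ← top-par y = q , a , b , inʳ m
    top-par {t = leaf x} {leaf y} (node _ _ h) with refl , _ ← h refl refl = _ , x , y , here

    -- A connective would lie below some topmost one, which is a par. Removing its selected edge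
    -- cuts off a first component, and `no-cut` refutes every such component.
    stuck⇒no-links : ∀ {l} → l ∉ L
    stuck⇒no-links l∈
      with k , p , t , u , w@(v , v∈ , s) , _ ← link-within l∈
      with q , x , y , m ← top-par (stuck-within w) =
      no-cut _ σ q C (record
        { within   = w′
        ; respects = λ k ne → cong (_xor e q) (h k (ne ∘ cong proj₁))
        ; output   = Bool.xor-same (e q)
        ; premise  = differ d }) ℕ.≤-refl
      where
      -- Any switching serves as a starting point.
      σ : Pos → Side
      σ _ = left
      ⊑-trans : ∀ {a b c} → a ⊑ b → b ⊑ c → a ⊑ c
      ⊑-trans m here = m
      ⊑-trans m (inˡ n) = inˡ (⊑-trans m n)
      ⊑-trans m (inʳ n) = inʳ (⊑-trans m n)
      w′ : Within (node parr q (leaf x) (leaf y))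
      w′ = v , v∈ , ⊑-trans m s
      c = edge-cut σ (edge-par σ w′)
      e = proj₁ c
      h = proj₁ (proj₂ c)
      d = proj₂ (proj₂ c)
      C : Pos → Bool
      C v = e v xor e q
      differ : ∀ {a b} → a ≢ b → b xor a ≡ true
      differ {true} {true} ne = ⊥-elim (ne refl)
      differ {true} {false} _ = refl
      differ {false} {true} _ = refl
      differ {false} {false} ne = ⊥-elim (ne refl)

-- Sequentialization

data Contract : Kind → Pos → Pos → Pos → Tree → Tree → Set where
  here : ∀ {k p x y} → Contract k p x y (node k p (leaf x) (leaf y)) (leaf p)
  inˡ  : ∀ {k p x y l q t t′ u} → Contract k p x y t t′ → Contract k p x y (node l q t u) (node l q t′ u)
  inʳ  : ∀ {k p x y l q t u u′} → Contract k p x y u u′ → Contract k p x y (node l q t u) (node l q t u′)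

contract-root : ∀ {k p x y t t′} → Contract k p x y t t′ → root t′ ≡ root t
contract-root here    = refl
contract-root (inˡ _) = refl
contract-root (inʳ _) = refl

contract-links : ∀ {k p x y t t′} → Contract k p x y t t′ → treeLinks t ↭ connective k x y p ∷ treeLinks t′
contract-links here = ↭-refl
contract-links (inˡ {l = l} {q} {u = u} c) rewrite contract-root c =
  ↭-trans (prep _ (++⁺ʳ (treeLinks u) (contract-links c))) (swap _ _ ↭-refl)
contract-links (inʳ {l = l} {q} {t} c) rewrite contract-root c =
  ↭-trans (prep _ (↭-trans (++⁺ˡ (treeLinks t) (contract-links c)) (shift _ (treeLinks t) _))) (swap _ _ ↭-refl)

contract-leaves : ∀ {k p x y t t′} → Contract k p x y t t′ → ∃[ ls ] leaves t ↭ x ∷ y ∷ ls × leaves t′ ↭ p ∷ ls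
contract-leaves here = [] , ↭-refl , ↭-refl
contract-leaves (inˡ {u = u} c) with ls , σ , τ ← contract-leaves c = ls ++ leaves u , ++⁺ʳ (leaves u) σ , ++⁺ʳ
  (leaves u) τ
contract-leaves {p = p} {x} {y} (inʳ {t = t} c) with ls , σ , τ ← contract-leaves c = leaves t ++ ls ,
  ↭-trans (++⁺ˡ (leaves t) σ) (shifts (leaves t) (x ∷ y ∷ [])) , ↭-trans (++⁺ˡ (leaves t) τ)
    (shift p (leaves t) ls)

contract-tensors : ∀ {k p x y t t′} → Contract k p x y t t′ → tensors t ≡ tensors
  (node k p (leaf x) (leaf y)) + tensors t′
contract-tensors {k} here = sym (ℕ.+-identityʳ _)
contract-tensors {k} {p} {x} {y} (inˡ {l = tensor} {u = u} c) =
  trans (cong (λ n → suc (n + tensors u)) (contract-tensors c)) (trans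
    (cong suc (ℕ.+-assoc (tensors (node k p (leaf x) (leaf y))) _ _)) (sym (ℕ.+-suc _ _)))
contract-tensors {k} {p} {x} {y} (inˡ {l = parr} {u = u} c) =
  trans (cong (_+ tensors u) (contract-tensors c)) (ℕ.+-assoc (tensors (node k p (leaf x) (leaf y))) _ _)
contract-tensors {k} {p} {x} {y} (inʳ {l = tensor} {t = t} {u′ = u′} c) = trans
  (cong (λ n → suc (tensors t + n)) (contract-tensors c))
  (+-*-Solver.solve 3 (λ a b d → con 1 :+ (a :+ (b :+ d)) := b :+ (con 1 :+ (a :+ d))) refl (tensors t)
    (tensors (node k p (leaf x) (leaf y))) (tensors u′))
  where open +-*-Solver using (_:+_; _:=_; con)
contract-tensors {k} {p} {x} {y} (inʳ {l = parr} {t = t} {u′ = u′} c) = trans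
  (cong (tensors t +_) (contract-tensors c))
  (+-*-Solver.solve 3 (λ a b d → a :+ (b :+ d) := b :+ (a :+ d)) refl (tensors t)
    (tensors (node k p (leaf x) (leaf y))) (tensors u′))
  where open +-*-Solver using (_:+_; _:=_)

Contractible : (Pos → Pos) → Tree → Set
Contractible rep t = ∃[ k ] ∃[ p ] ∃[ x ] ∃[ y ] ∃[ t′ ] Contract k p x y t t′ × (k ≡ parr → rep x ≡ rep y)

contractible-or-stuck : ∀ rep t → Contractible rep t ⊎ Stuck rep t
contractible-or-stuck rep (leaf _) = inj₂ leaf
contractible-or-stuck rep (node k p t u) with contractible-or-stuck rep t | contractible-or-stuck rep u
... | inj₁ (_ , _ , _ , _ , _ , c , h) | _ = inj₁ (_ , _ , _ , _ , _ , inˡ c , h)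
... | inj₂ _ | inj₁ (_ , _ , _ , _ , _ , c , h) = inj₁ (_ , _ , _ , _ , _ , inʳ c , h)
contractible-or-stuck rep (node tensor p (leaf x) (leaf y)) | inj₂ _ | inj₂ _ = inj₁
  (_ , _ , _ , _ , _ , here , λ ())
contractible-or-stuck rep (node parr p (leaf x) (leaf y)) | inj₂ a | inj₂ b with rep x ≟ rep y
... | yes eq = inj₁ (_ , _ , _ , _ , _ , here , λ _ → eq)
... | no ne  = inj₂ (node a b λ { refl refl → refl , ne })
contractible-or-stuck rep (node k p (node _ _ _ _) u) | inj₂ a | inj₂ b = inj₂ (node a b λ ())
contractible-or-stuck rep (node k p (leaf _) (node _ _ _ _)) | inj₂ a | inj₂ b = inj₂ (node a b λ _ ())

forest-contractible-or-stuck : ∀ rep ts →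
  (∃[ as ] ∃[ t ] ∃[ cs ] ts ≡ as ++ t ∷ cs × Contractible rep t) ⊎ (∀ {t} → t ∈ ts → Stuck rep t)
forest-contractible-or-stuck rep [] = inj₂ λ ()
forest-contractible-or-stuck rep (t ∷ ts) with contractible-or-stuck rep t | forest-contractible-or-stuck rep ts
... | inj₁ c | _ = inj₁ ([] , t , ts , refl , c)
... | inj₂ _ | inj₁ (as , u , cs , refl , c) = inj₁ (t ∷ as , u , cs , refl , c)
... | inj₂ s | inj₂ ss = inj₂ λ { (here refl) → s ; (there m) → ss m }

-- Junk value 0 on the empty list.
headPos : List Pos → Pos
headPos []      = 0
headPos (x ∷ _) = x

headPos∈ : ∀ {b} → b ≢ [] → headPos b ∈ b
headPos∈ {[]} ne = ⊥-elim (ne refl)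
headPos∈ {x ∷ _} _ = here refl

-- A block is represented by its first position; a position outside all blocks represents itself.
representative : List (List Pos) → Pos → Pos
representative []       x = x
representative (b ∷ bs) x with x ∈? b
... | yes _ = headPos b
... | no _  = representative bs x

representative-∈ : ∀ {bs b x} → Unique (concat bs) → b ∈ bs → x ∈ b → representative bs x ≡ headPos b
representative-∈ {b ∷ bs} {x = x} u (here refl) m with x ∈? b
... | yes _ = refl
... | no n = ⊥-elim (n m)
representative-∈ {b ∷ bs} {x = x} u (there b∈) m with x ∈? b
... | yes m′ = ⊥-elim (proj₂ (proj₂ (Unique-++⁻ b u)) (m′ , ∈-concat⁺′ m b∈))
... | no _ = representative-∈ (proj₁ (proj₂ (Unique-++⁻ b u))) b∈ m

representative-∉ : ∀ bs {x} → x ∉ concat bs → representative bs x ≡ x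
representative-∉ [] _ = refl
representative-∉ (b ∷ bs) {x} n with x ∈? b
... | yes m = ⊥-elim (n (∈-++⁺ˡ m))
... | no _ = representative-∉ bs (n ∘ ∈-++⁺ʳ b)

unique-heads : ∀ bs → Unique (concat bs) → (∀ {b} → b ∈ bs → b ≢ []) → Unique (map headPos bs)
unique-heads [] _ _ = []
unique-heads (b ∷ bs) u ne with _ , u′ , d ← Unique-++⁻ b u =
  All.tabulate (λ m eq → let c , c∈ , eq′ = ∈-map⁻ headPos m in
    d (headPos∈ (ne (here refl)) , subst (_∈ concat bs) (sym (trans eq eq′))
      (∈-concat⁺′ (headPos∈ (ne (there c∈))) c∈)))
  ∷ unique-heads bs u′ (ne ∘ there)

-- Every connective selects one edge for its output, and a tensor has one more. The number is
-- therefore the same for all switchings.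
edges-count : ∀ σ t → length (graphEdges σ (treeLinks t)) ≡ tensors t + length (targets (treeLinks t))
edges-count σ (leaf _) = refl
edges-count σ (node k p t u) = go k
  where
  open +-*-Solver using (_:+_; _:=_; con)
  edges-++ : length (graphEdges σ (treeLinks t ++ treeLinks u)) ≡
             (tensors t + length (targets (treeLinks t))) + (tensors u + length (targets (treeLinks u)))
  edges-++ = trans (cong length (concatMap-++ (linkEdges σ) (treeLinks t) (treeLinks u)))
    (trans (length-++ (graphEdges σ (treeLinks t)))
    (cong₂ _+_ (edges-count σ t) (edges-count σ u)))
  targets-++ : length (targets (treeLinks t ++ treeLinks u)) ≡ length (targets (treeLinks t)) + length
    (targets (treeLinks u))
  targets-++ = trans (cong length (concatMap-++ target (treeLinks t) (treeLinks u)))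
    (length-++ (targets (treeLinks t)))
  go : ∀ k → length (graphEdges σ (treeLinks (node k p t u))) ≡ tensors (node k p t u) + length
    (targets (treeLinks (node k p t u)))
  go tensor = trans (cong (2 +_) edges-++) (trans
    (+-*-Solver.solve 4 (λ a b c d → con 2 :+ ((a :+ b) :+ (c :+ d)) := (con 1 :+ (a :+ c)) :+
      (con 1 :+ (b :+ d))) refl
      (tensors t) (length (targets (treeLinks t))) (tensors u) (length (targets (treeLinks u))))
    (cong (λ n → suc (tensors t + tensors u) + suc n) (sym targets-++)))
  go parr = trans (cong (1 +_) edges-++) (trans
    (+-*-Solver.solve 4 (λ a b c d → con 1 :+ ((a :+ b) :+ (c :+ d)) := (a :+ c) :+ (con 1 :+ (b :+ d))) refl
      (tensors t) (length (targets (treeLinks t))) (tensors u) (length (targets (treeLinks u))))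
    (cong (λ n → (tensors t + tensors u) + suc n) (sym targets-++)))

forest-edges-count : ∀ σ ts → length (graphEdges σ (forestLinks ts)) ≡ forestTensors ts + length
  (targets (forestLinks ts))
forest-edges-count σ [] = refl
forest-edges-count σ (t ∷ ts) = trans (cong length (concatMap-++ (linkEdges σ) (treeLinks t) (forestLinks ts)))
  (trans (length-++ (graphEdges σ (treeLinks t))) (trans (cong₂ _+_ (edges-count σ t) (forest-edges-count σ ts))
    (trans (+-interchange (tensors t) (length (targets (treeLinks t))) (forestTensors ts)
      (length (targets (forestLinks ts))))
      (cong (tensors t + forestTensors ts +_) (sym (trans (cong length
        (concatMap-++ target (treeLinks t) (forestLinks ts)))
        (length-++ (targets (treeLinks t)))))))))

constant-respects : ∀ {e c} l → (∀ {x} → x ∈ ends l → e x ≡ c) → Respects e l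
constant-respects (ten _ _ _) h = trans (h (here refl)) (sym (h (there (there (here refl))))) ,
                                  trans (h (there (here refl))) (sym (h (there (there (here refl)))))
constant-respects (par _ _ _) h = inj₁ (trans (h (here refl)) (sym (h (there (there (here refl))))))
constant-respects (cut _ _) h = tt
constant-respects {c = c} (dai ps) h = c , h

∈-sources : ∀ {l E p} → l ∈ E → p ∈ source l → p ∈ sources E
∈-sources (here refl) m = ∈-++⁺ˡ m
∈-sources {E = l′ ∷ _} (there l∈) m = ∈-++⁺ʳ (source l′) (∈-sources l∈ m)

-- A part of the net that has already been sequentialized.
Box : Set
Box = List Link × List Pos

boxLinks : Box → List Link
boxLinks = proj₁

boxConcl : Box → List Pos
boxConcl = proj₂

box-conclusion : ∀ bs {x} → x ∈ concatMap boxConcl bs → ∃[ b ] b ∈ bs × x ∈ boxConcl b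
box-conclusion (b ∷ bs) m with ∈-++⁻ (boxConcl b) m
... | inj₁ m′ = b , here refl , m′
... | inj₂ m′ with c , c∈ , m″ ← box-conclusion bs m′ = c , there c∈ , m″

boxTargets : List Box → List (List Pos)
boxTargets = map (targets ∘ boxLinks)

-- A stage of the sequentialization. Shrinking each box of `S` to a point turns the remaining
-- connectives into a `Situation`, and correctness of `S` is inherited by the quotient.
module Parts {S : Net} (C : Correct S) {boxes : List Box} {ts : List Tree}
  (links-↭  : linksₙ S ↭ concatMap boxLinks boxes ++ forestLinks ts)
  (leaves-↭ : concatMap boxConcl boxes ↭ forestLeaves ts)
  (balanced : ∀ {b} → b ∈ boxes → targets (boxLinks b) ↭ sources (boxLinks b) ++ boxConcl b)
  (nonempty : ∀ {b} → b ∈ boxes → targets (boxLinks b) ≢ [])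
  (count    : length boxes ≡ suc (forestTensors ts)) where

  private
    bts = boxTargets boxes
    outs = targets (forestLinks ts)

    targets-boxes : ∀ bs → targets (concatMap boxLinks bs) ≡ concat (boxTargets bs)
    targets-boxes [] = refl
    targets-boxes (b ∷ bs) = trans (concatMap-++ target (boxLinks b) (concatMap boxLinks bs))
      (cong (targets (boxLinks b) ++_) (targets-boxes bs))

  targets-parts : targets (linksₙ S) ↭ concat bts ++ outs
  targets-parts = ↭-trans (targets-↭ links-↭) (↭-reflexive (trans (concatMap-++ target
    (concatMap boxLinks boxes) (forestLinks ts))
    (cong (_++ outs) (targets-boxes boxes))))

  private
    unique-parts : Unique (concat bts ++ outs)
    unique-parts = Unique-resp-↭ targets-parts (IsNet.targets-unique (isNet S))

    unique-bts : Unique (concat bts)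
    unique-bts = proj₁ (Unique-++⁻ (concat bts) unique-parts)

    apart : Disjoint (concat bts) outs
    apart = proj₂ (proj₂ (Unique-++⁻ (concat bts) unique-parts))

    conclusions-⊆ : ∀ bs → (∀ {b} → b ∈ bs → targets (boxLinks b) ↭ sources (boxLinks b) ++ boxConcl b) →
                    concat (boxTargets bs) ↭ concatMap (sources ∘ boxLinks) bs ++ concatMap boxConcl bs
    conclusions-⊆ [] _ = ↭-refl
    conclusions-⊆ (b ∷ bs) h = ↭-trans (++⁺ (h (here refl)) (conclusions-⊆ bs (h ∘ there)))
      (solve 4 (λ a b c d → (a ⊕ b) ⊕ (c ⊕ d) ⊜ (a ⊕ c) ⊕ (b ⊕ d)) ↭-refl (sources (boxLinks b))
        (boxConcl b) _ _)

    unique-ts : Unique (forestOccurrences ts)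
    unique-ts = Unique-resp-↭ (↭-trans (++-comm (forestLeaves ts) outs) (forestOccurrences-↭ ts))
      (Unique-resp-↭ (++⁺ʳ outs leaves-↭) (proj₁ (proj₂ (Unique-++⁻ (concatMap (sources ∘ boxLinks) boxes)
        (Unique-resp-↭ (↭-trans (++⁺ʳ outs (conclusions-⊆ boxes balanced))
          (↭-reflexive (++-assoc (concatMap (sources ∘ boxLinks) boxes) _ outs))) unique-parts)))))

  rep : Pos → Pos
  rep = representative bts

  box-of : ∀ {x} → x ∈ forestLeaves ts → ∃[ b ] b ∈ boxes × x ∈ boxConcl b
  box-of m = box-conclusion boxes (∈-resp-↭ (↭-sym leaves-↭) m)

  conclusion-target : ∀ {b x} → b ∈ boxes → x ∈ boxConcl b → x ∈ targets (boxLinks b)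
  conclusion-target {b} b∈ m = ∈-resp-↭ (↭-sym (balanced b∈)) (∈-++⁺ʳ (sources (boxLinks b)) m)

  rep-box : ∀ {b x} → b ∈ boxes → x ∈ targets (boxLinks b) → rep x ≡ headPos (targets (boxLinks b))
  rep-box b∈ m = representative-∈ unique-bts (∈-map⁺ (targets ∘ boxLinks) b∈) m

  rep-outside : ∀ {x} → x ∈ outs → rep x ≡ x
  rep-outside m = representative-∉ bts (λ m′ → apart (m′ , m))

  private
    output∈ : ∀ {k a b p} → connective k a b p ∈ forestLinks ts → p ∈ outs
    output∈ {k} l∈ = ∈-targets l∈ (subst (_ ∈_) (sym (target-connective k)) (here refl))

    head∈ : ∀ {b} → b ∈ bts → headPos b ∈ b
    head∈ b∈ with c , c∈ , refl ← ∈-map⁻ (targets ∘ boxLinks) b∈ = headPos∈ (nonempty c∈)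

    V = map headPos bts ++ outs

    V-fixed : ∀ {x} → x ∈ V → rep x ≡ x
    V-fixed m with ∈-++⁻ (map headPos bts) m
    ... | inj₂ m′ = rep-outside m′
    ... | inj₁ m′ with b , b∈ , refl ← ∈-map⁻ headPos m′ = representative-∈ unique-bts b∈ (head∈ b∈)

    V-target : ∀ {x} → x ∈ V → x ∈ targets (linksₙ S)
    V-target m with ∈-++⁻ (map headPos bts) m
    ... | inj₂ m′ = ∈-resp-↭ (↭-sym targets-parts) (∈-++⁺ʳ (concat bts) m′)
    ... | inj₁ m′ with b , b∈ , refl ← ∈-map⁻ headPos m′ = ∈-resp-↭ (↭-sym targets-parts)
        (∈-++⁺ˡ (∈-concat⁺′ (head∈ b∈) b∈))

    box-link : ∀ bs {l} → l ∈ concatMap boxLinks bs → ∃[ b ] b ∈ bs × l ∈ boxLinks b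
    box-link (b ∷ bs) m with ∈-++⁻ (boxLinks b) m
    ... | inj₁ m′ = b , here refl , m′
    ... | inj₂ m′ with c , c∈ , m″ ← box-link bs m′ = c , there c∈ , m″

    -- A colouring of the quotient is composed with `rep`. It is then constant on each box, so it
    -- respects the links inside, and on the remaining connectives it respects the selected edges.
    connected : ∀ σ (e : Pos → Bool) → (∀ {s c} → (s , c) ∈ graphEdges σ (forestLinks ts) → e s ≡ e (rep c)) →
                ∀ {x y} → x ∈ V → y ∈ V → e x ≡ e y
    connected σ e h x∈ y∈ = trans (cong e (sym (V-fixed x∈))) (trans
        (Correct.connected C (e ∘ rep) respects (V-target x∈) (V-target y∈)) (cong e (V-fixed y∈)))
      where
      connective-respects : ∀ k {a b p} → connective k a b p ∈ forestLinks ts → Respects (e ∘ rep)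
        (connective k a b p)
      connective-respects tensor {a} {b} {p} l∈ =
        trans (sym (h (∈-graphEdges⁺ σ l∈ (here refl)))) (cong e (sym (rep-outside (output∈ {tensor} l∈)))) ,
        trans (sym (h (∈-graphEdges⁺ σ l∈ (there (here refl))))) (cong e
          (sym (rep-outside (output∈ {tensor} l∈))))
      connective-respects parr {a} {b} {p} l∈ with σ p | h (∈-graphEdges⁺ σ l∈ (here refl))
      ... | left  | eq = inj₁ (trans (sym eq) (cong e (sym (rep-outside (output∈ {parr} l∈)))))
      ... | right | eq = inj₂ (trans (sym eq) (cong e (sym (rep-outside (output∈ {parr} l∈)))))

      respects : All (Respects (e ∘ rep)) (linksₙ S)
      respects = All-resp-↭ (↭-sym links-↭) (All.++⁺
        (All.tabulate λ {l} m → let b , b∈ , l∈ = box-link boxes m in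
          constant-respects l λ x∈ → cong e (rep-box b∈ (end b∈ l∈ x∈)))
        (All.tabulate λ {l} m → let k , p₁ , p₂ , p , eq = forest-connective ts m in
          subst (Respects (e ∘ rep)) (sym eq) (connective-respects k (subst (_∈ forestLinks ts) eq m))))
        where
        end : ∀ {b l x} → b ∈ boxes → l ∈ boxLinks b → x ∈ ends l → x ∈ targets (boxLinks b)
        end {b} {l} b∈ l∈ m with ∈-++⁻ (source l) m
        ... | inj₁ s = ∈-resp-↭ (↭-sym (balanced b∈)) (∈-++⁺ˡ (∈-sources l∈ s))
        ... | inj₂ t = ∈-targets l∈ t

  situation : Situation
  situation = record
    { ts        = ts
    ; unique    = unique-ts
    ; rep       = rep
    ; V         = V
    ; V-unique  = Unique.++⁺ (unique-heads bts unique-bts (λ { b∈ refl → case head∈ b∈ of λ () }))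
        (proj₁ (proj₂ (Unique-++⁻ (concat bts) unique-parts)))
        (λ (m , m′) → let b , b∈ , eq = ∈-map⁻ headPos m in apart (subst (_∈ concat bts) (sym eq) (∈-concat⁺′ (head∈ b∈) b∈) , m′))
    ; rep-fixed = λ {k} l∈ → rep-outside (output∈ {k} l∈)
    ; rep-leaf  = λ {k} l∈ x∈ eq → let b , b∈ , m = box-of x∈ in
        apart (subst (_∈ concat bts) (sym (trans eq (rep-box b∈ (conclusion-target b∈ m))))
          (∈-concat⁺′ (headPos∈ (nonempty b∈)) (∈-map⁺ (targets ∘ boxLinks) b∈)) , output∈ {k} l∈)
    ; output∈V  = λ {k} l∈ → ∈-++⁺ʳ (map headPos bts) (output∈ {k} l∈)
    ; rep∈V     = λ x∈ → let b , b∈ , m = box-of x∈ in ∈-++⁺ˡ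
        (subst (_∈ map headPos bts) (sym (rep-box b∈ (conclusion-target b∈ m)))
          (∈-map⁺ headPos (∈-map⁺ (targets ∘ boxLinks) b∈)))
    ; connected = connected
    -- The nodes are the boxes and the remaining outputs, and the edges are counted by the remaining
    -- tensors and outputs; there is one box more than there are remaining tensors.
    ; count     = λ σ → trans (length-++ (map headPos bts)) (trans
        (cong (_+ length outs) (trans (length-map headPos bts) (trans
          (length-map (targets ∘ boxLinks) boxes) count)))
        (cong suc (sym (forest-edges-count σ ts))))
    }

  same-box : ∀ {b rest x y} → boxes ↭ b ∷ rest → x ∈ boxConcl b → y ∈ concatMap boxConcl boxes →
    rep x ≡ rep y → y ∈ boxConcl b
  same-box {b} {rest} {x} {y} ρ x∈ y∈ eq with ∈-++⁻ (boxConcl b) (∈-resp-↭ (concatMap⁺ proj₂ ρ) y∈)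
  ... | inj₁ m = m
  ... | inj₂ m = ⊥-elim (proj₂ (proj₂ (Unique-++⁻ (targets (boxLinks b)) unique-ρ)) (hx , hy))
    where
    b∈ : b ∈ boxes
    b∈ = ∈-resp-↭ (↭-sym ρ) (here refl)
    unique-ρ : Unique (targets (boxLinks b) ++ concat (boxTargets rest))
    unique-ρ = Unique-resp-↭ (concat-↭ (map⁺ (targets ∘ boxLinks) ρ)) unique-bts
    c = proj₁ (box-conclusion rest m)
    c∈rest = proj₁ (proj₂ (box-conclusion rest m))
    c∈ : c ∈ boxes
    c∈ = ∈-resp-↭ (↭-sym ρ) (there c∈rest)
    y∈c = proj₂ (proj₂ (box-conclusion rest m))
    hx : headPos (targets (boxLinks b)) ∈ targets (boxLinks b)
    hx = headPos∈ (nonempty b∈)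
    hy : headPos (targets (boxLinks b)) ∈ concat (boxTargets rest)
    hy = subst (_∈ concat (boxTargets rest))
      (sym (trans (sym (rep-box b∈ (conclusion-target b∈ x∈))) (trans eq
        (rep-box c∈ (conclusion-target c∈ y∈c)))))
      (∈-concat⁺′ (headPos∈ (nonempty c∈)) (∈-map⁺ (targets ∘ boxLinks) c∈rest))

concatMap-nonempty : ∀ {A B : Set} {h : A → List B} {xs : List A} → concatMap h xs ≢ [] → xs ≢ []
concatMap-nonempty ne refl = ne refl

reorder : (N : Net) (ps : List Pos) → conclₙ N ↭ ps → Net
reorder N ps σ = net (graph (linksₙ N) ps)
  (balance⇒isNet source#target targets-unique (↭-trans (balance (isNet N)) (++⁺ˡ (sources (linksₙ N)) σ)))
  where open IsNet (isNet N)

subnet : ∀ {N E F ps} → linksₙ N ↭ E ++ F → targets E ↭ sources E ++ ps → IsNet (graph E ps)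
subnet {N} {E} {F} σ β = balance⇒isNet (All.++⁻ˡ E (All-resp-↭ σ source#target))
  (proj₁ (Unique-++⁻ (targets E) (Unique-resp-↭ (↭-trans (targets-↭ σ)
    (↭-reflexive (concatMap-++ target E F))) targets-unique))) β
  where open IsNet (isNet N)

module Sequentialization (𝒱 : PropositionalVariables) where

  open MLL 𝒱

  represents-resp : ∀ {M N Γ} {π : Proof Γ} → linksₙ N ↭ linksₙ M → conclₙ N ≡ conclₙ M → Represents M π →
    Represents N π
  represents-resp σ c (✠-rep l c′ n) = ✠-rep (↭-singleton-inv (↭-trans σ (↭-reflexive l))) (trans c c′) n
  represents-resp σ c (⅋-rep r c₀ ρ c′) = ⅋-rep r c₀ (↭-trans σ ρ) (trans c c′)
  represents-resp σ c (⊗-rep r₁ r₂ c₁ c₂ ρ c′) = ⊗-rep r₁ r₂ c₁ c₂ (↭-trans σ ρ) (trans c c′)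
  represents-resp σ c (cut-rep r₁ r₂ c₁ c₂ ρ c′) = cut-rep r₁ r₂ c₁ c₂ (↭-trans σ ρ) (trans c c′)
  represents-resp σ c (ex-rep r c₀ n ρ c′) = ex-rep r c₀ n (↭-trans σ ρ) (trans c c′)

  module _ (τ : Pos → Formula) where

    -- A permutation is realized by exchange rules. Since the rule acts inside a sequent, the
    -- untouched prefix is accumulated in `ps`, and each swap passes through an intermediate net
    -- with reordered conclusions.
    exchange : ∀ {xs ys} → xs ↭ ys → ∀ ps {M N} → conclₙ M ≡ ps ++ xs → conclₙ N ≡ ps ++ ys →
      linksₙ N ↭ linksₙ M →
               M ⊢ map τ (ps ++ xs) → N ⊢ map τ (ps ++ ys)
    exchange _↭_.refl ps m n ρ (π , r) = π , represents-resp ρ (trans n (sym m)) r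
    exchange {x ∷ xs} {_ ∷ ys} (prep x σ) ps {M} {N} m n ρ d =
      subst (λ zs → N ⊢ map τ zs) (++-assoc ps (x ∷ []) ys)
        (exchange σ (ps ++ x ∷ []) {M} {N} (trans m (sym (++-assoc ps (x ∷ []) xs)))
          (trans n (sym (++-assoc ps (x ∷ []) ys))) ρ
          (subst (λ zs → M ⊢ map τ zs) (sym (++-assoc ps (x ∷ []) xs)) d))
    exchange {x ∷ y ∷ xs} {_ ∷ _ ∷ ys} (swap x y σ) ps {M} {N} m n ρ d =
      subst (λ zs → N ⊢ map τ zs) (++-assoc ps (y ∷ x ∷ []) ys)
        (exchange σ (ps ++ y ∷ x ∷ []) {K} {N} (sym (++-assoc ps (y ∷ x ∷ []) xs))
          (trans n (sym (++-assoc ps (y ∷ x ∷ []) ys))) ρ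
          (subst (λ zs → K ⊢ map τ zs) (sym (++-assoc ps (y ∷ x ∷ []) xs))
            (swapped-⊢ (subst (M ⊢_) (map-++ τ ps (x ∷ y ∷ xs)) d))))
      where
      K : Net
      K = reorder M (ps ++ y ∷ x ∷ xs) (↭-trans (↭-reflexive m) (++⁺ˡ ps (swap x y ↭-refl)))
      swapped-⊢ : M ⊢ (map τ ps ++ τ x ∷ τ y ∷ map τ xs) → K ⊢ map τ (ps ++ y ∷ x ∷ xs)
      swapped-⊢ (π , r) = subst (K ⊢_) (sym (map-++ τ ps (y ∷ x ∷ xs)))
        (ex-rule (map τ ps) (map τ xs) (τ x) (τ y) π , ex-rep r m (sym (length-map τ ps)) ↭-refl refl)
    exchange (_↭_.trans {ys = zs} σ σ′) ps {M} {N} m n ρ d =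
      exchange σ′ ps {K} {N} refl n ρ (exchange σ ps {M} {K} m refl ↭-refl d)
      where
      K : Net
      K = reorder M (ps ++ zs) (↭-trans (↭-reflexive m) (++⁺ˡ ps σ))

    exchange-⊢ : ∀ {M N} → conclₙ M ↭ conclₙ N → linksₙ N ↭ linksₙ M → M ⊢ map τ (conclₙ M) → N ⊢ map τ
      (conclₙ N)
    exchange-⊢ {M} {N} σ ρ = exchange σ [] {M} {N} refl refl ρ

    -- A box fixes neither an order of its links nor one of its conclusions, hence the
    -- quantification over nets in `proved`. Balance is what allows a net to be rebuilt from a
    -- sublist of the links of a larger one.
    record Sequential (b : Box) : Set where
      field
        balanced : targets (boxLinks b) ↭ sources (boxLinks b) ++ boxConcl b
        proved   : ∀ N → linksₙ N ↭ boxLinks b → conclₙ N ↭ boxConcl b → N ⊢ map τ (conclₙ N)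

    open Sequential

    daimon-sequential : ∀ ps → Sequential (dai ps ∷ [] , ps)
    daimon-sequential ps = record
      { balanced = ↭-reflexive (++-identityʳ ps)
      ; proved   = λ N ρ σ → exchange-⊢ {reorder N ps σ} {N} (↭-sym σ) ↭-refl
          (✠-rule (map τ ps) , ✠-rep (↭-singleton-inv ρ) refl (sym (length-map τ ps)))
      }

    sequential-↭ : ∀ {E cs ds} → cs ↭ ds → Sequential (E , cs) → Sequential (E , ds)
    sequential-↭ {E} σ s = record
      { balanced = ↭-trans (balanced s) (++⁺ˡ (sources E) σ)
      ; proved   = λ N ρ σ′ → proved s N ρ (↭-trans σ′ (↭-sym σ))
      }

    par-sequential : ∀ {E x y p c} → τ p ≡ τ x ⅋ τ y → Sequential (E , c ++ x ∷ y ∷ []) → Sequential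
      (par x y p ∷ E , c ++ p ∷ [])
    par-sequential {E} {x} {y} {p} {c} eq s = record
      { balanced = ↭-trans (prep p (balanced s))
          (solve 5 (λ p e c x y → p ⊕ (e ⊕ (c ⊕ (x ⊕ y))) ⊜ (x ⊕ (y ⊕ e)) ⊕ (c ⊕ p)) ↭-refl (p ∷ [])
            (sources E) c (x ∷ []) (y ∷ []))
      ; proved   = λ N ρ σ → prove N ρ σ (proved s (N₀ N ρ) ↭-refl ↭-refl)
      }
      where
      N₀ : ∀ N → linksₙ N ↭ par x y p ∷ E → Net
      N₀ N ρ = net (graph E (c ++ x ∷ y ∷ [])) (subnet {N} (↭-trans ρ (++-comm (par x y p ∷ []) E))
        (balanced s))
      prove : ∀ N (ρ : linksₙ N ↭ par x y p ∷ E) → conclₙ N ↭ c ++ p ∷ [] → N₀ N ρ ⊢ map τ (c ++ x ∷ y ∷ []) →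
        N ⊢ map τ (conclₙ N)
      prove N ρ σ d with π , r ← subst (N₀ N ρ ⊢_) (map-++ τ c (x ∷ y ∷ [])) d =
        exchange-⊢ {K} {N} (↭-sym σ) ↭-refl
          (subst (K ⊢_) (trans (cong (λ A → map τ c ++ A ∷ []) (sym eq)) (sym (map-++ τ c (p ∷ []))))
            (⅋-rule (map τ c) (τ x) (τ y) π , ⅋-rep r refl ρ refl))
        where
        K : Net
        K = reorder N (c ++ p ∷ []) σ

    tensor-sequential : ∀ {E F x y p c d} → τ p ≡ τ x ⊗ τ y → Sequential (E , c ++ x ∷ []) → Sequential
      (F , d ++ y ∷ []) →
                        Sequential (ten x y p ∷ E ++ F , c ++ d ++ p ∷ [])
    tensor-sequential {E} {F} {x} {y} {p} {c} {d} eq s t = record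
      { balanced = ↭-trans (prep p (↭-trans (↭-reflexive (concatMap-++ target E F))
          (++⁺ (balanced s) (balanced t))))
          (↭-trans (solve 7 (λ p e c x f d y → p ⊕ ((e ⊕ (c ⊕ x)) ⊕ (f ⊕ (d ⊕ y))) ⊜ (x ⊕ (y ⊕ (e ⊕ f))) ⊕
            (c ⊕ (d ⊕ p))) ↭-refl
            (p ∷ []) (sources E) c (x ∷ []) (sources F) d (y ∷ []))
          (++⁺ʳ (c ++ d ++ p ∷ []) (prep x (prep y (↭-reflexive (sym (concatMap-++ source E F)))))))
      ; proved   = λ N ρ σ → prove N ρ σ (proved s (N₁ N ρ) ↭-refl ↭-refl) (proved t (N₂ N ρ) ↭-refl ↭-refl)
      }
      where
      N₁ N₂ : ∀ N → linksₙ N ↭ ten x y p ∷ E ++ F → Net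
      N₁ N ρ = net (graph E (c ++ x ∷ [])) (subnet {N} {F = ten x y p ∷ F}
        (↭-trans ρ (↭-sym (shift (ten x y p) E F))) (balanced s))
      N₂ N ρ = net (graph F (d ++ y ∷ [])) (subnet {N} {F = ten x y p ∷ E}
        (↭-trans ρ (++-comm (ten x y p ∷ E) F)) (balanced t))
      prove : ∀ N (ρ : linksₙ N ↭ ten x y p ∷ E ++ F) → conclₙ N ↭ c ++ d ++ p ∷ [] →
              N₁ N ρ ⊢ map τ (c ++ x ∷ []) → N₂ N ρ ⊢ map τ (d ++ y ∷ []) → N ⊢ map τ (conclₙ N)
      prove N ρ σ d₁ d₂ with π₁ , r₁ ← subst (N₁ N ρ ⊢_) (map-++ τ c (x ∷ [])) d₁
                           | π₂ , r₂ ← subst (N₂ N ρ ⊢_) (map-++ τ d (y ∷ [])) d₂ =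
        exchange-⊢ {K} {N} (↭-sym σ) ↭-refl
          (subst (K ⊢_) (sym (trans (map-++ τ c (d ++ p ∷ [])) (cong (map τ c ++_)
            (trans (map-++ τ d (p ∷ [])) (cong (λ A → map τ d ++ A ∷ []) eq)))))
            (⊗-rule (map τ c) (map τ d) (τ x) (τ y) π₁ π₂ , ⊗-rep r₁ r₂ refl refl ρ refl))
        where
        K : Net
        K = reorder N (c ++ d ++ p ∷ []) σ

    module _ {S : Net} (lab : IsAtomicLabelling S τ) (C : Correct S) where

      open IsAtomicLabelling lab

      -- Contractions shorten the trees until only leaves remain; a tensor merges two boxes, so
      -- their number stays one above that of the tensors left. Nonemptiness is conditional because
      -- `S` itself may be a single empty daimon.
      record State : Set where
        field
          boxes      : List Box
          ts         : List Tree
          links-↭    : linksₙ S ↭ concatMap boxLinks boxes ++ forestLinks ts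
          leaves-↭   : concatMap boxConcl boxes ↭ forestLeaves ts
          concl-≡    : conclₙ S ≡ map root ts
          sequential : ∀ {b} → b ∈ boxes → Sequential b
          nonempty   : forestLinks ts ≢ [] → ∀ {b} → b ∈ boxes → targets (boxLinks b) ≢ []
          count      : length boxes ≡ suc (forestTensors ts)

      no-links : ∀ ts → forestLinks ts ≡ [] → map root ts ≡ forestLeaves ts × forestTensors ts ≡ 0
      no-links [] _ = refl , refl
      no-links (leaf x ∷ ts) eq with a , b ← no-links ts eq = cong (x ∷_) a , b
      no-links (node _ _ _ _ ∷ ts) ()

      -- With no tensor left the count leaves one box. It contains all links of `S`, and as the
      -- trees are leaves, its conclusions are those of `S` up to order.
      finish : (X : State) → forestLinks (State.ts X) ≡ [] → S ⊢ map τ (conclₙ S)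
      finish X eq with State.boxes X in eqb | trans (State.count X)
        (cong suc (proj₂ (no-links (State.ts X) eq)))
      ... | b ∷ [] | _ = proved (sequential (subst (b ∈_) (sym eqb) (here refl))) S
          (↭-trans links-↭ (↭-reflexive (trans (cong₂ (λ bs E → concatMap boxLinks bs ++ E) eqb eq)
            (trans (++-identityʳ _) (++-identityʳ (boxLinks b))))))
          (↭-trans (↭-reflexive (trans concl-≡ (proj₁ (no-links ts eq)))) (↭-trans (↭-sym leaves-↭)
            (↭-reflexive (trans (cong (concatMap boxConcl) eqb) (++-identityʳ (boxConcl b))))))
        where open State X

      module Step (X : State) (ne : forestLinks (State.ts X) ≢ []) where

        open State X
        open Parts {S} C {boxes} {ts} links-↭ leaves-↭ (balanced ∘ sequential) (nonempty ne) count

        module _ {k p x y t t′} (as cs : List Tree) (ts≡ : ts ≡ as ++ t ∷ cs) (κ : Contract k p x y t t′) where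

          after : List Tree
          after = as ++ t′ ∷ cs

          private
            ls = proj₁ (contract-leaves κ)
            rest = forestLeaves as ++ ls ++ forestLeaves cs

          forest-links-↭ : forestLinks ts ↭ connective k x y p ∷ forestLinks after
          forest-links-↭ = ↭-trans (↭-reflexive (trans (cong forestLinks ts≡)
            (concatMap-++ treeLinks as (t ∷ cs))))
            (↭-trans (++⁺ˡ (forestLinks as) (++⁺ʳ (forestLinks cs) (contract-links κ)))
            (↭-trans (shift _ (forestLinks as) _) (prep _ (↭-reflexive
              (sym (concatMap-++ treeLinks as (t′ ∷ cs)))))))

          link∈ : connective k x y p ∈ forestLinks ts
          link∈ = ∈-resp-↭ (↭-sym forest-links-↭) (here refl)

          link∈S : connective k x y p ∈ linksₙ S
          link∈S = ∈-resp-↭ (↭-sym links-↭) (∈-++⁺ʳ (concatMap boxLinks boxes) link∈)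

          forest-leaves-↭ : forestLeaves ts ↭ x ∷ y ∷ rest
          forest-leaves-↭ = ↭-trans (↭-reflexive (trans (cong forestLeaves ts≡)
            (concatMap-++ leaves as (t ∷ cs))))
            (↭-trans (++⁺ˡ (forestLeaves as) (++⁺ʳ (forestLeaves cs) (proj₁ (proj₂ (contract-leaves κ)))))
              (shifts (forestLeaves as) (x ∷ y ∷ [])))

          after-leaves-↭ : forestLeaves after ↭ p ∷ rest
          after-leaves-↭ = ↭-trans (↭-reflexive (concatMap-++ leaves as (t′ ∷ cs)))
            (↭-trans (++⁺ˡ (forestLeaves as) (++⁺ʳ (forestLeaves cs) (proj₂ (proj₂ (contract-leaves κ)))))
              (shift p (forestLeaves as) _))

          after-concl : conclₙ S ≡ map root after
          after-concl = trans concl-≡ (trans (cong (map root) ts≡) (trans (map-++ root as (t ∷ cs))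
            (trans (cong (λ r → map root as ++ r ∷ map root cs) (sym (contract-root κ)))
              (sym (map-++ root as (t′ ∷ cs))))))

          after-tensors : forestTensors ts ≡ tensors (node k p (leaf x) (leaf y)) + forestTensors after
          after-tensors = trans (cong forestTensors ts≡) (trans (forestTensors-++ as (t ∷ cs)) (trans
            (cong (λ n → forestTensors as + (n + forestTensors cs)) (contract-tensors κ))
            (trans (+-*-Solver.solve 4 (λ a m n c → a :+ ((m :+ n) :+ c) := m :+ (a :+ (n :+ c))) refl
              (forestTensors as) (tensors (node k p (leaf x) (leaf y))) (tensors t′) (forestTensors cs))
            (cong (tensors (node k p (leaf x) (leaf y)) +_) (sym (forestTensors-++ as (t′ ∷ cs)))))))
            where open +-*-Solver using (_:+_; _:=_)

          premises-distinct : x ≢ y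
          premises-distinct refl = Unique-head (Unique-resp-↭ forest-leaves-↭
            (unique-forestLeaves ts (Situation.unique situation))) (here refl)

          x∈ : x ∈ concatMap boxConcl boxes
          x∈ = ∈-resp-↭ (↭-sym leaves-↭) (∈-resp-↭ (↭-sym forest-leaves-↭) (here refl))

          y∈ : y ∈ concatMap boxConcl boxes
          y∈ = ∈-resp-↭ (↭-sym leaves-↭) (∈-resp-↭ (↭-sym forest-leaves-↭) (there (here refl)))

          Next : Set
          Next = Σ[ X′ ∈ State ] State.ts X′ ≡ after

        par-step : ∀ {p x y t t′} as cs (ts≡ : ts ≡ as ++ t ∷ cs) (κ : Contract parr p x y t t′) →
          rep x ≡ rep y → Next as cs ts≡ κ
        par-step {p} {x} {y} as cs ts≡ κ eq
          with b , b∈ , xb ← box-conclusion boxes (x∈ as cs ts≡ κ)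
          with others , ρ ← ∈⇒↭ b∈
          with c₁ , σ₁ ← ∈⇒↭ xb
          -- Equal representatives put both premises in one box, as the par rule demands of its
          -- premise.
          with yb ← same-box ρ xb (y∈ as cs ts≡ κ) eq
          with ∈-resp-↭ σ₁ yb
        ... | here y≡x = ⊥-elim (premises-distinct as cs ts≡ κ (sym y≡x))
        ... | there yc with c , σ₂ ← ∈⇒↭ yc = record
          { boxes      = (par x y p ∷ boxLinks b , c ++ p ∷ []) ∷ others
          ; ts         = after as cs ts≡ κ
          ; links-↭    = ↭-trans links-↭ (↭-trans (++⁺ (concatMap⁺ boxLinks ρ) (forest-links-↭ as cs ts≡ κ))
              (shift _ (boxLinks b ++ concatMap boxLinks others) _))
          ; leaves-↭   = ↭-trans (solve 3 (λ c p o → (c ⊕ p) ⊕ o ⊜ p ⊕ (c ⊕ o)) ↭-refl c (p ∷ [])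
              (concatMap boxConcl others))
              (↭-trans (prep p (drop-∷ (drop-∷ (↭-trans (↭-sym (↭-trans (concatMap⁺ boxConcl ρ)
                (++⁺ʳ _ (↭-trans σ₁ (prep x σ₂)))))
                (↭-trans leaves-↭ (forest-leaves-↭ as cs ts≡ κ)))))) (↭-sym (after-leaves-↭ as cs ts≡ κ)))
          ; concl-≡    = after-concl as cs ts≡ κ
          ; sequential = λ { (here refl) → par-sequential (label-⅋ (link∈S as cs ts≡ κ))
                               (sequential-↭ (↭-trans σ₁ (↭-trans (prep x σ₂) (++-comm (x ∷ y ∷ []) c)))
                                 (sequential b∈))
                           ; (there m) → sequential (∈-resp-↭ (↭-sym ρ) (there m)) }
          ; nonempty   = λ _ → λ { (here refl) () ; (there m) → nonempty ne (∈-resp-↭ (↭-sym ρ) (there m)) }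
          ; count      = trans (sym (↭-length ρ)) (trans count (cong suc (after-tensors as cs ts≡ κ)))
          } , refl

        tensor-step : ∀ {p x y t t′} as cs (ts≡ : ts ≡ as ++ t ∷ cs) (κ : Contract tensor p x y t t′) →
          Next as cs ts≡ κ
        tensor-step {p} {x} {y} as cs ts≡ κ
          with b , b∈ , xb ← box-conclusion boxes (x∈ as cs ts≡ κ)
          with others , ρ ← ∈⇒↭ b∈
          with c , σ₁ ← ∈⇒↭ xb
          with ∈-++⁻ (boxConcl b) (∈-resp-↭ (concatMap⁺ boxConcl ρ) (y∈ as cs ts≡ κ))
        -- Both premises in one box would close a cycle through the tensor.
        ... | inj₁ yb = ⊥-elim (Progress.tensor-distinct situation (link∈ as cs ts≡ κ)
            (premises-distinct as cs ts≡ κ)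
            (trans (rep-box b∈ (conclusion-target b∈ xb)) (sym (rep-box b∈ (conclusion-target b∈ yb)))))
        ... | inj₂ y∈′
          with b′ , b′∈ , yb ← box-conclusion others y∈′
          with others′ , ρ′ ← ∈⇒↭ b′∈
          with d , σ₂ ← ∈⇒↭ yb = record
          { boxes      = (ten x y p ∷ boxLinks b ++ boxLinks b′ , c ++ d ++ p ∷ []) ∷ others′
          ; ts         = after as cs ts≡ κ
          ; links-↭    = ↭-trans links-↭ (↭-trans (++⁺ (↭-trans (concatMap⁺ boxLinks ρ)
              (++⁺ˡ (boxLinks b) (concatMap⁺ boxLinks ρ′))) (forest-links-↭ as cs ts≡ κ))
              (solve 5 (λ a b o l f → (a ⊕ (b ⊕ o)) ⊕ (l ⊕ f) ⊜ (l ⊕ ((a ⊕ b) ⊕ o)) ⊕ f) ↭-refl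
                (boxLinks b) (boxLinks b′) (concatMap boxLinks others′) (ten x y p ∷ [])
                  (forestLinks (after as cs ts≡ κ))))
          ; leaves-↭   = ↭-trans (solve 4 (λ c d p o → (c ⊕ (d ⊕ p)) ⊕ o ⊜ p ⊕ (c ⊕ (d ⊕ o))) ↭-refl c d
              (p ∷ []) (concatMap boxConcl others′))
              (↭-trans (prep p (drop-∷ (drop-∷ (↭-trans (solve 5 (λ x y c d o → x ⊕ (y ⊕ (c ⊕ (d ⊕ o))) ⊜
                (x ⊕ c) ⊕ ((y ⊕ d) ⊕ o)) ↭-refl
                  (x ∷ []) (y ∷ []) c d (concatMap boxConcl others′))
                (↭-trans (↭-sym (↭-trans (concatMap⁺ boxConcl ρ) (++⁺ σ₁
                  (↭-trans (concatMap⁺ boxConcl ρ′) (++⁺ʳ _ σ₂)))))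
                (↭-trans leaves-↭ (forest-leaves-↭ as cs ts≡ κ))))))) (↭-sym (after-leaves-↭ as cs ts≡ κ)))
          ; concl-≡    = after-concl as cs ts≡ κ
          ; sequential = λ { (here refl) → tensor-sequential (label-⊗ (link∈S as cs ts≡ κ))
                               (sequential-↭ (↭-trans σ₁ (++-comm (x ∷ []) c)) (sequential b∈))
                               (sequential-↭ (↭-trans σ₂ (++-comm (y ∷ []) d))
                                 (sequential (∈-resp-↭ (↭-sym ρ) (there b′∈))))
                           ; (there m) → sequential (old m) }
          ; nonempty   = λ _ → λ { (here refl) () ; (there m) → nonempty ne (old m) }
          ; count      = ℕ.suc-injective (trans (cong suc (sym (↭-length ρ′)))
              (trans (sym (↭-length ρ)) (trans count (cong suc (after-tensors as cs ts≡ κ)))))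
          } , refl
          where
          old : ∀ {z} → z ∈ others′ → z ∈ boxes
          old m = ∈-resp-↭ (↭-sym ρ) (there (∈-resp-↭ (↭-sym ρ′) (there m)))

        step-state : Σ[ X′ ∈ State ] length (forestLinks ts) ≡ suc (length (forestLinks (State.ts X′)))
        step-state with forest-contractible-or-stuck rep ts
        ... | inj₂ stuck = let l , l∈ = nonempty-member ne in ⊥-elim (Progress.stuck⇒no-links situation stuck l∈)
        ... | inj₁ (as , t , cs , ts≡ , parr , p , x , y , t′ , κ , h) with X′ , eq ← par-step as cs ts≡ κ
            (h refl) =
          X′ , trans (↭-length (forest-links-↭ as cs ts≡ κ)) (cong (λ us → suc (length (forestLinks us)))
            (sym eq))
        ... | inj₁ (as , t , cs , ts≡ , tensor , p , x , y , t′ , κ , h) with X′ ,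
            eq ← tensor-step as cs ts≡ κ =
          X′ , trans (↭-length (forest-links-↭ as cs ts≡ κ)) (cong (λ us → suc (length (forestLinks us)))
            (sym eq))

      run : ∀ n (X : State) → length (forestLinks (State.ts X)) ≡ n → S ⊢ map τ (conclₙ S)
      run n X eq with forestLinks (State.ts X) in eqL
      run n X eq | [] = finish X eqL
      run (suc n) X eq | _ ∷ _ with X′ , eq′ ← Step.step-state X (λ e → case trans (sym eqL) e of λ ()) =
        run n X′ (ℕ.suc-injective (trans (sym eq′) (trans (cong length eqL) eq)))

      sequentialize : ∀ {ts bs} → IsForest (body S) ts bs → S ⊢ map τ (conclₙ S)
      sequentialize {ts} {bs} F = run _ record
        { boxes      = map box bs
        ; ts         = ts
        ; links-↭    = ↭-trans F.links-↭ (++⁺ʳ (forestLinks ts) (↭-reflexive (sym (box-links bs))))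
        ; leaves-↭   = ↭-trans (↭-reflexive (box-concls bs)) F.leaves-↭
        ; concl-≡    = F.concl-≡
        ; sequential = λ b∈ → let ps , _ , eq = ∈-map⁻ box b∈ in subst Sequential (sym eq) (daimon-sequential ps)
        ; nonempty   = λ ne b∈ → let ps , ps∈ , eq = ∈-map⁻ box b∈ in λ e → block-nonempty ne ps∈
            (trans (sym (++-identityʳ ps)) (subst (λ b → targets (boxLinks b) ≡ []) eq e))
        ; count      = trans (length-map box bs) (trans (sym (forest-daimons F))
            (trans (Correct.count C) (cong suc (forest-joins F))))
        } refl
        where
        module F = IsForest F
        box : List Pos → Box
        box ps = dai ps ∷ [] , ps
        box-links : ∀ bs → concatMap boxLinks (map box bs) ≡ map dai bs
        box-links [] = refl
        box-links (b ∷ bs) = cong (dai b ∷_) (box-links bs)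
        box-concls : ∀ bs → concatMap boxConcl (map box bs) ≡ concat bs
        box-concls [] = refl
        box-concls (b ∷ bs) = cong (b ++_) (box-concls bs)
        block-nonempty : forestLinks ts ≢ [] → ∀ {ps} → ps ∈ bs → ps ≢ []
        block-nonempty ne ps∈ refl = Correct.nonempty C
          (λ e → concatMap-nonempty ne (map-root-[] (trans (sym F.concl-≡) e)))
          (∈-resp-↭ (↭-sym F.links-↭) (∈-++⁺ˡ (∈-map⁺ dai ps∈)))

theorem76 : (𝒱 : PropositionalVariables) → let open MLL 𝒱 in
    (S : Net) (Γ : Sequent) → AtomicallyTestable S Γ →
    (S ⊢ Γ) ⇔ (S ⟂ˢ parallel (map tests Γ))
theorem76 𝒱 S Γ at = mk⇔ to from
  where
  open MLL 𝒱
  open AtomicallyTestable at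
  open Decomposition 𝒱
  open Tests 𝒱

  D = decompose {S} cutFree isLabelling
  ts = proj₁ D
  F = proj₁ (proj₂ (proj₂ D))
  shapes : map shape ts ≡ map formulaShape Γ
  shapes = trans (proj₂ (proj₂ (proj₂ D))) (trans (map-∘ (conclₙ S)) (cong (map formulaShape) labels))

  to : S ⊢ Γ → S ⟂ˢ parallel (map tests Γ)
  to (_ , r) = ⟂-parallel (map tests Γ) (tests-singleton Γ) S
    (trans (sym (length-map τ (conclₙ S))) (trans (cong length labels) (sym (length-map tests Γ))))
    λ T T∈ → correct⇒⟂ {S} {T} F shapes (Soundness.sound 𝒱 r cutFree) (tests-like Γ T∈)

  roots : map (τ ∘ root) ts ≡ Γ
  roots = trans (map-∘ ts) (trans (cong (map τ) (sym (IsForest.concl-≡ F))) labels)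

  from : S ⟂ˢ parallel (map tests Γ) → S ⊢ Γ
  from o = subst (S ⊢_) labels (Sequentialization.sequentialize 𝒱 τ {S} isLabelling
    (Completeness.⟂⇒correct 𝒱 {S} isLabelling F
      (subst (λ Γ → S ⟂ˢ juxtapositions (map tests Γ)) (sym roots) λ T T∈ → o T
        (juxtapositions⊆parallel (map tests Γ) T∈))) F)
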